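{- Let $q$ be an odd prime power, $d\ge 2$, $t\in\mathbb{F}_q^*$, and let $E\subseteq\mathbb{F}_q^d$ with $|E|\ge Cq^{\frac{d+1}{2}}$, where $C>4$. Then for any $\lambda>\frac{2C}{C-4}$ there exists a subset $E^*\subseteq E$ with \[ |E^*|\ge \frac{1-2\lambda^{ -1}}{2\lambda}|E| \] such that for every $x\in E^*$, \[ \lambda^{ -1}\frac{|E|}{q}\le E*S(x)\le \lambda\frac{|E|}{q}. \]
   Context: For $x\in\mathbb{F}_q^d$, $\lVert x\rVert=x_1^2+\dots+x_d^2$. $S(x)=1$ if $\lVert x\rVert=t$ and $S(x)=0$ otherwise; identifying $E$ with its indicator function, $E*S(x)=\sum_{y\in\mathbb{F}_q^d}E(y)S(x-y)=\#\{y\in E:\lVert x-y\rVert=t\}$.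
   Formalization: The constants C and λ are taken to be rational numbers instead of real numbers; the condition |E| ≥ C q^{(d+1)/2} is stated in the equivalent squared form C² q^{d+1} ≤ |E|². -}

module Defs where

open import Level using (0ℓ)
open import Algebra.Bundles using (CommutativeRing)
open import Data.Nat as ℕ using (ℕ)
open import Data.Integer as ℤ using (ℤ)
open import Data.List using (List; length; filter; foldr)
open import Data.List.Relation.Unary.Unique.Propositional using (Unique)
open import Data.List.Membership.Propositional using (_∈_)
open import Data.List.Relation.Unary.Any using (here; there)
open import Data.Vec using (Vec; zipWith)
open import Data.Product using (∃)
open import Data.Rational as ℚ using (ℚ; Positive; _<_; 0ℚ; _-_; _÷_)
open import Data.Rational.Properties as ℚP using (pos⇒nonZero; +-monoˡ-<; +-inverseʳ)
open import Relation.Nullary using (¬_)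
open import Relation.Binary.PropositionalEquality using (_≡_; subst)
open import Relation.Binary.Definitions using (DecidableEquality)

record FiniteField : Set₁ where
  field
    commRing : CommutativeRing 0ℓ 0ℓ
  open CommutativeRing commRing public
  field
    ≈⇒≡       : ∀ {x y} → x ≈ y → x ≡ y
    1≢0       : ¬ (1# ≡ 0#)
    inverse   : ∀ x → ¬ (x ≡ 0#) → ∃ λ y → x * y ≡ 1#
    _≟_       : DecidableEquality Carrier
    elems     : List Carrier
    elems-unique   : Unique elems
    elems-complete : ∀ x → x ∈ elems

  order : ℕ
  order = length elems

  order-nonZero : ℕ.NonZero order
  order-nonZero = nz (elems-complete 0#)
    where
    nz : ∀ {x : Carrier} {xs : List Carrier} → x ∈ xs → ℕ.NonZero (length xs)
    nz (here _)  = _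
    nz (there _) = _

  _/q : ℕ → ℚ
  n /q = ℚ._/_ (ℤ.+ n) order {{order-nonZero}}

  Point : ℕ → Set
  Point d = Vec Carrier d

  ‖_‖ : ∀ {d} → Point d → Carrier
  ‖ x ‖ = foldr _+_ 0# (Data.Vec.toList (zipWith _*_ x x))

  _⊖_ : ∀ {d} → Point d → Point d → Point d
  x ⊖ y = zipWith (λ a b → a + (- b)) x y

  -- E * S (x) = #{ y ∈ E : ‖x - y‖ = t }, E given as a duplicate-free list
  sphereCount : ∀ {d} → Carrier → List (Point d) → Point d → ℕ
  sphereCount t E x = length (filter (λ y → ‖ x ⊖ y ‖ ≟ t) E)

toℚ : ℕ → ℚ
toℚ n = ℤ.+ n ℚ./ 1

sub-pos : ∀ {a C : ℚ} → a < C → Positive (C - a)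
sub-pos {a} {C} a<C = ℚ.positive (subst (_< C - a) (+-inverseʳ a) (+-monoˡ-< (ℚ.- a) a<C))

inv : (p : ℚ) → Positive p → ℚ
inv p pos = ℚ.1/_ p {{pos⇒nonZero p {{pos}}}}

lamBound : (C : ℚ) → toℚ 4 < C → ℚ
lamBound C h = (toℚ 2 ℚ.* C) ℚ.* inv (C - toℚ 4) (sub-pos h)

{-# OPTIONS --safe #-}
-- The deviation of E * S from its mean is controlled by the eigenvalues of the operator f ↦ f * S on functions of
-- mean zero.  Instead of complex characters everything takes place in the rational group algebra of F_q^d × F_q:
-- u is the sum of the translations τ_r by the second factor, γ = ∑ η(z) τ_z is the Gauss sum, and the operator is
-- the sum over c ≠ 0 of the Gaussian kernels p_c = ∑_y [y , c ‖y‖], twisted by τ_{-ct}.  On elements annihilated by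
-- u, completing the square makes suitably normalised p_c into a representation g of the additive group of F_q; on
-- its isotypic components X_a the operator acts as a power of γ times the Kloosterman sum ∑ τ(c + a/c) (d even) or
-- the Salié sum ∑ η(c) τ(c + a/c) (d odd).  A Salié sum equals γ (τ_{2b} + τ_{-2b}) or 0 for a ≠ 0, according to
-- whether a = b² or not.  For Kloosterman sums κ_j over the tower of quadratic extensions K_j of F_q, comparing
-- split and non-split pairs of given trace and norm gives κ_j² + κ_{j+1} = 2 |K_j|, so a bound |κ_j|² ≤ s² |K_j|
-- high up in the tower descends to a bound |κ_0|² ≤ 6 q.  The bound at the top, where s may depend linearly on the
-- level, is a point count on s + a/s = y^q - y + c by Stepanov's method.  Thus the second moment of E * S - μ over E
-- is at most 6 q^{d-1} |E| with |μ - |E|/q| ≤ |E|/(3q), and Chebyshev's inequality leaves at least 5/32 of E.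
module Submission where

-- The obstacle in even dimension is Weil's bound for Kloosterman sums; a contraction stands in for
-- it. Relative to the square root of |K_j|, a bound s one level up gives √(2 + s) below, and the
-- fixed point 2 of this map is Weil's constant. Hence a tower of height 4q + 4 tolerates the
-- constant 4q + 7 at its top. There an upper estimate for point counts is enough: their average is
-- known exactly and the additive character sums to zero, so the shortfalls from the estimate are
-- nonnegative weights of small total. Polynomials are represented by their functions, which
-- determine them only in degrees below the order of the field; Stepanov's argument for K compares
-- polynomials with degree bounds beyond |K|, and is therefore carried out over the quadratic
-- extension of K. The constant 6, where Weil's theorem would give 4, is affordable: (1 - 2/λ)/(2λ)
-- never exceeds 1/16, so up to 15/16 of E may be discarded, and 6 discards at most 27/32.

open import Defs
open import Algebra.Bundles using (CommutativeRing)
open import Data.Nat as ℕ using (ℕ; zero; suc)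
open import Relation.Binary.PropositionalEquality as ≡ using (_≡_; _≢_)

-- Ring solver with integer coefficients over any commutative ring

module IntegerSolver {c ℓ} (CR : CommutativeRing c ℓ) where
  open import Data.Nat.Properties using (+-suc)
  open import Data.Integer as ℤ using (ℤ; +_; -[1+_]; _⊖_; _◃_)
  open import Data.Integer.Properties using ([1+m]⊖[1+n]≡m⊖n)
  open import Data.Sign as Sign using ()
  open import Data.Maybe using (Maybe; just; nothing)
  open import Relation.Nullary using (yes; no)
  open import Algebra.Solver.Ring.AlmostCommutativeRing using (fromCommutativeRing; _-Raw-AlmostCommutative⟶_)
  open CommutativeRing CR
  open import Algebra.Properties.Ring ring
  open import Algebra.Properties.AbelianGroup +-abelianGroup using (⁻¹-∙-comm)
  open import Algebra.Properties.Semiring.Mult semiring using (_×_; ×-homo-+; ×1-homo-*)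
  open import Relation.Binary.Reasoning.Setoid setoid

  ⟦_⟧ℤ : ℤ → Carrier
  ⟦ + n ⟧ℤ      = n × 1#
  ⟦ -[1+ n ] ⟧ℤ = - (suc n × 1#)

  ⊖-homo : ∀ m n → ⟦ m ⊖ n ⟧ℤ ≈ m × 1# + - (n × 1#)
  ⊖-homo m zero = sym (trans (+-congˡ -0#≈0#) (+-identityʳ _))
  ⊖-homo zero (suc n) = sym (+-identityˡ _)
  ⊖-homo (suc m) (suc n) rewrite [1+m]⊖[1+n]≡m⊖n m n = begin
    ⟦ m ⊖ n ⟧ℤ                          ≈⟨ ⊖-homo m n ⟩
    a + - b                             ≈⟨ +-congʳ (+-identityʳ a) ⟨
    (a + 0#) + - b                      ≈⟨ +-congʳ (+-congˡ (-‿inverseʳ 1#)) ⟨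
    (a + (1# + - 1#)) + - b             ≈⟨ +-congʳ (+-assoc a 1# (- 1#)) ⟨
    ((a + 1#) + - 1#) + - b             ≈⟨ +-assoc _ _ _ ⟩
    (a + 1#) + (- 1# + - b)             ≈⟨ +-cong (+-comm a 1#) (⁻¹-∙-comm 1# b) ⟩
    (1# + a) + - (1# + b)               ∎
    where a = m × 1#
          b = n × 1#

  ◃-homo+ : ∀ n → ⟦ Sign.+ ◃ n ⟧ℤ ≈ n × 1#
  ◃-homo+ zero    = refl
  ◃-homo+ (suc n) = refl

  ◃-homo- : ∀ n → ⟦ Sign.- ◃ n ⟧ℤ ≈ - (n × 1#)
  ◃-homo- zero    = sym -0#≈0#
  ◃-homo- (suc n) = refl

  +-homoℤ : ∀ i j → ⟦ i ℤ.+ j ⟧ℤ ≈ ⟦ i ⟧ℤ + ⟦ j ⟧ℤ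
  +-homoℤ (+ m) (+ n)           = ×-homo-+ 1# m n
  +-homoℤ (+ m) (-[1+ n ])      = ⊖-homo m (suc n)
  +-homoℤ (-[1+ m ]) (+ n)      = trans (⊖-homo n (suc m)) (+-comm _ _)
  +-homoℤ (-[1+ m ]) (-[1+ n ]) = trans
    (-‿cong (trans (reflexive (≡.cong (λ k → suc k × 1#) (≡.sym (+-suc m n)))) (×-homo-+ 1# (suc m) (suc n))))
    (sym (⁻¹-∙-comm _ _))

  *-homoℤ : ∀ i j → ⟦ i ℤ.* j ⟧ℤ ≈ ⟦ i ⟧ℤ * ⟦ j ⟧ℤ
  *-homoℤ (+ m) (+ n)           = trans (◃-homo+ (m ℕ.* n)) (×1-homo-* m n)
  *-homoℤ (+ m) (-[1+ n ])      = trans (◃-homo- (m ℕ.* suc n)) (trans (-‿cong (×1-homo-* m (suc n))) (-‿distribʳ-* _ _))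
  *-homoℤ (-[1+ m ]) (+ n)      = trans (◃-homo- (suc m ℕ.* n)) (trans (-‿cong (×1-homo-* (suc m) n)) (-‿distribˡ-* _ _))
  *-homoℤ (-[1+ m ]) (-[1+ n ]) = trans (◃-homo+ (suc m ℕ.* suc n)) (trans (×1-homo-* (suc m) (suc n))
    (trans (sym (-‿involutive _)) (trans (-‿cong (-‿distribˡ-* _ _)) (-‿distribʳ-* _ _))))

  -‿homoℤ : ∀ i → ⟦ ℤ.- i ⟧ℤ ≈ - ⟦ i ⟧ℤ
  -‿homoℤ (+ zero)    = sym -0#≈0#
  -‿homoℤ (+ (suc n)) = refl
  -‿homoℤ (-[1+ n ])  = sym (-‿involutive _)

  num : ℕ → Carrier
  num zero          = 0#
  num (suc zero)    = 1#
  num (suc (suc n)) = 1# + num (suc n)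

  num≈× : ∀ n → num n ≈ n × 1#
  num≈× zero          = refl
  num≈× (suc zero)    = sym (+-identityʳ 1#)
  num≈× (suc (suc n)) = +-congˡ (num≈× (suc n))

  -- Unlike ⟦_⟧ℤ, this sends 1 to 1# on the nose, so that numerals in solver goals need no conversion.
  ⟦_⟧ : ℤ → Carrier
  ⟦ + n ⟧      = num n
  ⟦ -[1+ n ] ⟧ = - num (suc n)

  ⟦⟧≈ : ∀ i → ⟦ i ⟧ ≈ ⟦ i ⟧ℤ
  ⟦⟧≈ (+ n)      = num≈× n
  ⟦⟧≈ (-[1+ n ]) = -‿cong (num≈× (suc n))

  ℤ-morphism : ℤ.+-*-rawRing -Raw-AlmostCommutative⟶ fromCommutativeRing CR
  ℤ-morphism = record
    { ⟦_⟧    = ⟦_⟧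
    ; +-homo = λ i j → trans (⟦⟧≈ (i ℤ.+ j)) (trans (+-homoℤ i j) (sym (+-cong (⟦⟧≈ i) (⟦⟧≈ j))))
    ; *-homo = λ i j → trans (⟦⟧≈ (i ℤ.* j)) (trans (*-homoℤ i j) (sym (*-cong (⟦⟧≈ i) (⟦⟧≈ j))))
    ; -‿homo = λ i → trans (⟦⟧≈ (ℤ.- i)) (trans (-‿homoℤ i) (sym (-‿cong (⟦⟧≈ i))))
    ; 0-homo = refl
    ; 1-homo = refl
    }

  coeff≟ : ∀ i j → Maybe (⟦ i ⟧ ≈ ⟦ j ⟧)
  coeff≟ i j with i ℤ.≟ j
  ... | yes ≡.refl = just refl
  ... | no  _      = nothing

  open import Algebra.Solver.Ring ℤ.+-*-rawRing (fromCommutativeRing CR) ℤ-morphism coeff≟ public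
    using (solve; _:+_; _:*_; :-_; _:-_; _:=_; con; Polynomial)

  :# : ∀ {n} → ℕ → Polynomial n
  :# k = con (+ k)

-- Finite enumerations and sums over them

module Sums where
  open import Level using (0ℓ)
  open import Algebra.Bundles using (CommutativeMonoid; CommutativeRing)
  open import Data.List using (List; []; _∷_; _++_; map; length; cartesianProductWith; cartesianProduct)
  open import Data.List.Properties using (length-map; length-++)
  open import Data.List.Relation.Unary.Unique.Propositional using (Unique; []; _∷_)
  open import Data.List.Relation.Unary.Unique.Propositional.Properties using (map⁺; cartesianProductWith⁺)
  open import Data.List.Relation.Unary.All using ([]; _∷_)
  import Data.List.Relation.Unary.All as All
  open import Data.List.Relation.Unary.Any using (here; there)
  open import Data.List.Membership.Propositional using (_∈_)
  open import Data.List.Membership.Propositional.Properties using (∈-map⁺; ∈-cartesianProductWith⁺)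
  open import Data.List.Membership.Propositional.Properties.WithK using (unique∧set⇒bag)
  open import Data.List.Relation.Binary.BagAndSetEquality using (∼bag⇒↭)
  open import Data.List.Relation.Binary.Permutation.Propositional using (_↭_; refl; prep; swap; trans)
  open import Data.Product using (_×_; _,_)
  open import Data.Product.Properties using (,-injective; ≡-dec)
  open import Data.Vec using (Vec; []; _∷_)
  open import Data.Vec.Properties using (∷-injective) renaming (≡-dec to Vec-≡-dec)
  open import Function.Bundles using (mk⇔)
  open import Function.Base using (_∘_)
  open import Relation.Nullary using (yes)
  open import Relation.Binary.Definitions using (DecidableEquality)
  open import Relation.Binary.PropositionalEquality as ≡ using (_≡_; _≢_)

  record Enum (A : Set) : Set where
    field
      elems    : List A
      unique   : Unique elems
      complete : ∀ x → x ∈ elems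
      _≟_      : DecidableEquality A

    card : ℕ
    card = length elems

  open Enum using (elems; card)

  _⊗_ : ∀ {A B} → Enum A → Enum B → Enum (A × B)
  e ⊗ e′ = record
    { elems    = cartesianProduct (elems e) (elems e′)
    ; unique   = cartesianProductWith⁺ _,_ ,-injective (Enum.unique e) (Enum.unique e′)
    ; complete = λ (a , b) → ∈-cartesianProductWith⁺ _,_ (Enum.complete e a) (Enum.complete e′ b)
    ; _≟_      = ≡-dec (Enum._≟_ e) (Enum._≟_ e′)
    }

  vecEnum : ∀ {A} → Enum A → ∀ n → Enum (Vec A n)
  vecEnum e zero = record
    { elems = [] ∷ [] ; unique = [] ∷ [] ; complete = λ { [] → here ≡.refl } ; _≟_ = λ { [] [] → yes ≡.refl } }
  vecEnum e (suc n) = record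
    { elems    = cartesianProductWith _∷_ (elems e) (elems (vecEnum e n))
    ; unique   = cartesianProductWith⁺ _∷_ ∷-injective (Enum.unique e) (Enum.unique (vecEnum e n))
    ; complete = λ { (a ∷ v) → ∈-cartesianProductWith⁺ _∷_ (Enum.complete e a) (Enum.complete (vecEnum e n) v) }
    ; _≟_      = Vec-≡-dec (Enum._≟_ e)
    }

  length-cartesianProductWith : ∀ {A B C : Set} (f : A → B → C) xs ys →
    length (cartesianProductWith f xs ys) ≡ length xs ℕ.* length ys
  length-cartesianProductWith f []       ys = ≡.refl
  length-cartesianProductWith f (x ∷ xs) ys = ≡.trans (length-++ (map (f x) ys))
    (≡.cong₂ ℕ._+_ (length-map (f x) ys) (length-cartesianProductWith f xs ys))

  card-⊗ : ∀ {A B} (e : Enum A) (e′ : Enum B) → card (e ⊗ e′) ≡ card e ℕ.* card e′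
  card-⊗ e e′ = length-cartesianProductWith _,_ (elems e) (elems e′)

  card-vecEnum : ∀ {A} (e : Enum A) n → card (vecEnum e n) ≡ card e ℕ.^ n
  card-vecEnum e zero    = ≡.refl
  card-vecEnum e (suc n) = ≡.trans (length-cartesianProductWith _∷_ (elems e) _)
    (≡.cong (card e ℕ.*_) (card-vecEnum e n))

  module _ {A B : Set} (e : Enum A) (e′ : Enum B) (φ : A → B) (ψ : B → A)
           (ψφ : ∀ a → ψ (φ a) ≡ a) (φψ : ∀ b → φ (ψ b) ≡ b) where

    -- Both lists are free of duplicates and have the same members, hence are equal as bags, and
    -- equality of bags is permutation.
    map-elems-↭ : map φ (elems e) ↭ elems e′
    map-elems-↭ = ∼bag⇒↭ (unique∧set⇒bag
      (map⁺ (λ {x} {y} p → ≡.trans (≡.sym (ψφ x)) (≡.trans (≡.cong ψ p) (ψφ y))) (Enum.unique e))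
      (Enum.unique e′)
      (λ {b} → mk⇔ (λ _ → Enum.complete e′ b)
        (λ _ → ≡.subst (_∈ map φ (elems e)) (φψ b) (∈-map⁺ φ (Enum.complete e (ψ b))))))

  -- Over a commutative monoid, so that one set of lemmas covers sums in a ring and the product over
  -- all field elements in `fermat`.
  module MonoidSum (M : CommutativeMonoid 0ℓ 0ℓ) where
    open CommutativeMonoid M renaming (refl to ≈-refl; trans to ≈-trans; sym to ≈-sym; Carrier to C)
    open import Algebra.Properties.Monoid.Mult monoid using () renaming (_×_ to _·_)
    open import Algebra.Properties.CommutativeSemigroup commutativeSemigroup using (interchange; x∙yz≈y∙xz)

    sumL : {A : Set} → List A → (A → C) → C
    sumL []       f = ε
    sumL (x ∷ xs) f = f x ∙ sumL xs f

    ∑ : {A : Set} → Enum A → (A → C) → C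
    ∑ e f = sumL (elems e) f

    module _ {A : Set} where

      sumL-cong∈ : ∀ (xs : List A) {f g : A → C} → (∀ {x} → x ∈ xs → f x ≈ g x) → sumL xs f ≈ sumL xs g
      sumL-cong∈ []       h = ≈-refl
      sumL-cong∈ (x ∷ xs) h = ∙-cong (h (here ≡.refl)) (sumL-cong∈ xs (h ∘ there))

      sumL-cong : ∀ (xs : List A) {f g : A → C} → (∀ x → f x ≈ g x) → sumL xs f ≈ sumL xs g
      sumL-cong xs h = sumL-cong∈ xs (λ {x} _ → h x)

      sumL-ε : ∀ (xs : List A) → sumL xs (λ _ → ε) ≈ ε
      sumL-ε []       = ≈-refl
      sumL-ε (x ∷ xs) = ≈-trans (identityˡ _) (sumL-ε xs)

      sumL-∙ : ∀ (xs : List A) (f g : A → C) → sumL xs (λ x → f x ∙ g x) ≈ sumL xs f ∙ sumL xs g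
      sumL-∙ []       f g = ≈-sym (identityˡ _)
      sumL-∙ (x ∷ xs) f g = ≈-trans (∙-congˡ (sumL-∙ xs f g)) (interchange _ _ _ _)

      sumL-const : ∀ (xs : List A) c → sumL xs (λ _ → c) ≈ length xs · c
      sumL-const []       c = ≈-refl
      sumL-const (x ∷ xs) c = ∙-congˡ (sumL-const xs c)

      sumL-↭ : ∀ {xs ys : List A} (f : A → C) → xs ↭ ys → sumL xs f ≈ sumL ys f
      sumL-↭ f refl         = ≈-refl
      sumL-↭ f (prep x p)   = ∙-congˡ (sumL-↭ f p)
      sumL-↭ f (swap x y p) = ≈-trans (∙-congˡ (∙-congˡ (sumL-↭ f p))) (x∙yz≈y∙xz _ _ _)
      sumL-↭ f (trans p q)  = ≈-trans (sumL-↭ f p) (sumL-↭ f q)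

      sumL-++ : ∀ (xs ys : List A) (f : A → C) → sumL (xs ++ ys) f ≈ sumL xs f ∙ sumL ys f
      sumL-++ []       ys f = ≈-sym (identityˡ _)
      sumL-++ (x ∷ xs) ys f = ≈-trans (∙-congˡ (sumL-++ xs ys f)) (≈-sym (assoc _ _ _))

      sumL-only : ∀ {xs : List A} {a} (f : A → C) → Unique xs → a ∈ xs → (∀ x → x ≢ a → f x ≈ ε) → sumL xs f ≈ f a
      sumL-only {x ∷ xs} f (x∉ ∷ u) (here ≡.refl) z =
        ≈-trans (∙-congˡ (≈-trans (sumL-cong∈ xs (λ m → z _ (λ p → All.lookup x∉ m (≡.sym p)))) (sumL-ε xs))) (identityʳ _)
      sumL-only {x ∷ xs} f (x∉ ∷ u) (there m) z =
        ≈-trans (∙-cong (z x (All.lookup x∉ m)) (sumL-only f u m z)) (identityˡ _)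

    sumL-map : ∀ {A B : Set} (g : A → B) (f : B → C) xs → sumL (map g xs) f ≈ sumL xs (f ∘ g)
    sumL-map g f []       = ≈-refl
    sumL-map g f (x ∷ xs) = ∙-congˡ (sumL-map g f xs)

    sumL-swap : ∀ {A B : Set} (xs : List A) (ys : List B) (f : A → B → C) →
      sumL xs (λ x → sumL ys (f x)) ≈ sumL ys (λ y → sumL xs (λ x → f x y))
    sumL-swap []       ys f = ≈-sym (sumL-ε ys)
    sumL-swap (x ∷ xs) ys f = ≈-trans (∙-congˡ (sumL-swap xs ys f)) (≈-sym (sumL-∙ ys (f x) _))

    sumL-cartesian : ∀ {A B D : Set} (g : A → B → D) (f : D → C) xs ys →
      sumL (cartesianProductWith g xs ys) f ≈ sumL xs (λ x → sumL ys (λ y → f (g x y)))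
    sumL-cartesian g f []       ys = ≈-refl
    sumL-cartesian g f (x ∷ xs) ys = ≈-trans (sumL-++ (map (g x) ys) _ f)
      (∙-cong (sumL-map (g x) f ys) (sumL-cartesian g f xs ys))

    module _ {A : Set} (e : Enum A) where

      ∑-cong : ∀ {f g : A → C} → (∀ x → f x ≈ g x) → ∑ e f ≈ ∑ e g
      ∑-cong = sumL-cong (elems e)

      ∑-ε : ∀ {f : A → C} → (∀ x → f x ≈ ε) → ∑ e f ≈ ε
      ∑-ε h = ≈-trans (∑-cong h) (sumL-ε (elems e))

      ∑-∙ : ∀ (f g : A → C) → ∑ e (λ x → f x ∙ g x) ≈ ∑ e f ∙ ∑ e g
      ∑-∙ = sumL-∙ (elems e)

      ∑-const : ∀ c → ∑ e (λ _ → c) ≈ card e · c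
      ∑-const = sumL-const (elems e)

      ∑-only : ∀ a (f : A → C) → (∀ x → x ≢ a → f x ≈ ε) → ∑ e f ≈ f a
      ∑-only a f = sumL-only f (Enum.unique e) (Enum.complete e a)

    ∑-swap : ∀ {A B} (e : Enum A) (e′ : Enum B) (f : A → B → C) →
      ∑ e (λ x → ∑ e′ (f x)) ≈ ∑ e′ (λ y → ∑ e (λ x → f x y))
    ∑-swap e e′ = sumL-swap (elems e) (elems e′)

    ∑-⊗ : ∀ {A B} (e : Enum A) (e′ : Enum B) (f : A × B → C) →
      ∑ (e ⊗ e′) f ≈ ∑ e (λ x → ∑ e′ (λ y → f (x , y)))
    ∑-⊗ e e′ f = sumL-cartesian _,_ f (elems e) (elems e′)

    ∑-vec : ∀ {A} (e : Enum A) n (f : Vec A (suc n) → C) →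
      ∑ (vecEnum e (suc n)) f ≈ ∑ e (λ x → ∑ (vecEnum e n) (λ v → f (x ∷ v)))
    ∑-vec e n f = sumL-cartesian _∷_ f (elems e) (elems (vecEnum e n))

    ∑-reindex : ∀ {A B} (e : Enum A) (e′ : Enum B) (φ : A → B) (ψ : B → A) →
      (∀ a → ψ (φ a) ≡ a) → (∀ b → φ (ψ b) ≡ b) → ∀ (f : B → C) → ∑ e (f ∘ φ) ≈ ∑ e′ f
    ∑-reindex e e′ φ ψ ψφ φψ f = ≈-trans (≈-sym (sumL-map φ f (elems e))) (sumL-↭ f (map-elems-↭ e e′ φ ψ ψφ φψ))

  module RingSum (R : CommutativeRing 0ℓ 0ℓ) where
    open CommutativeRing R renaming (refl to ≈-refl; trans to ≈-trans; sym to ≈-sym; Carrier to C)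
    open import Algebra.Properties.Ring ring using (-0#≈0#)
    open import Algebra.Properties.AbelianGroup +-abelianGroup using (⁻¹-∙-comm)
    open MonoidSum +-commutativeMonoid public

    sumL-*ˡ : ∀ {A : Set} (xs : List A) c (f : A → C) → c * sumL xs f ≈ sumL xs (λ x → c * f x)
    sumL-*ˡ []       c f = zeroʳ c
    sumL-*ˡ (x ∷ xs) c f = ≈-trans (distribˡ _ _ _) (+-congˡ (sumL-*ˡ xs c f))

    sumL-neg : ∀ {A : Set} (xs : List A) (f : A → C) → - sumL xs f ≈ sumL xs (λ x → - f x)
    sumL-neg []       f = -0#≈0#
    sumL-neg (x ∷ xs) f = ≈-trans (≈-sym (⁻¹-∙-comm _ _)) (+-congˡ (sumL-neg xs f))

    module _ {A : Set} (e : Enum A) where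

      ∑-*ˡ : ∀ c (f : A → C) → c * ∑ e f ≈ ∑ e (λ x → c * f x)
      ∑-*ˡ = sumL-*ˡ (elems e)

      ∑-*ʳ : ∀ c (f : A → C) → ∑ e f * c ≈ ∑ e (λ x → f x * c)
      ∑-*ʳ c f = ≈-trans (*-comm _ _) (≈-trans (∑-*ˡ c f) (∑-cong e (λ x → *-comm _ _)))

      ∑-neg : ∀ (f : A → C) → - ∑ e f ≈ ∑ e (λ x → - f x)
      ∑-neg = sumL-neg (elems e)

    ∑-*∑ : ∀ {A B} (e : Enum A) (e′ : Enum B) (f : A → C) (g : B → C) →
      ∑ e f * ∑ e′ g ≈ ∑ e (λ x → ∑ e′ (λ y → f x * g y))
    ∑-*∑ e e′ f g = ≈-trans (∑-*ʳ e (∑ e′ g) f) (∑-cong e (λ x → ∑-*ˡ e′ (f x) g))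

-- Rational arithmetic, inequalities and counting

module Q where
  import Data.Nat.Properties as ℕP
  open import Data.Integer as ℤ using (+_)
  import Data.Integer.Properties as ℤP
  open import Data.Rational as ℚ using (ℚ; 0ℚ; 1ℚ; _+_; _*_; -_; _-_; _≤_; _<_; toℚᵘ)
  open import Data.Rational.Properties as ℚP hiding (_≟_)
  open import Data.Rational.Unnormalised as ℚᵘ using (mkℚᵘ; *≡*)
  import Data.Rational.Unnormalised.Properties as ℚᵘP
  open import Data.List using (List; []; _∷_; length; filter)
  open import Data.List.Relation.Unary.Any using (here; there)
  open import Data.List.Membership.Propositional using (_∈_)
  open import Data.Sum using (inj₁; inj₂)
  open import Relation.Nullary using (¬_; Dec; yes; no; contradiction)
  open import Relation.Unary using (Decidable)
  open import Relation.Binary.PropositionalEquality using (_≡_; _≢_; refl; sym; trans; cong; cong₂; subst; subst₂)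
  open import Function.Base using (_∘_)
  open IntegerSolver +-*-commutativeRing public
  open Sums
  open import Algebra.Properties.Monoid.Mult +-0-monoid using () renaming (_×_ to _·_)
  open RingSum +-*-commutativeRing public

  toℚ-+ : ∀ m n → toℚ (m ℕ.+ n) ≡ toℚ m + toℚ n
  toℚ-+ m n = toℚᵘ-injective (begin
    toℚᵘ (toℚ (m ℕ.+ n))                 ≈⟨ toℚᵘ-fromℚᵘ (mkℚᵘ (+ (m ℕ.+ n)) 0) ⟩
    mkℚᵘ (+ (m ℕ.+ n)) 0                 ≈⟨ *≡* (cong (ℤ._* + 1) (sym (cong₂ ℤ._+_ (ℤP.*-identityʳ (+ m)) (ℤP.*-identityʳ (+ n))))) ⟩
    mkℚᵘ (+ m) 0 ℚᵘ.+ mkℚᵘ (+ n) 0       ≈⟨ ℚᵘP.+-cong (toℚᵘ-fromℚᵘ (mkℚᵘ (+ m) 0)) (toℚᵘ-fromℚᵘ (mkℚᵘ (+ n) 0)) ⟨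
    toℚᵘ (toℚ m) ℚᵘ.+ toℚᵘ (toℚ n)       ≈⟨ toℚᵘ-homo-+ (toℚ m) (toℚ n) ⟨
    toℚᵘ (toℚ m + toℚ n)                 ∎)
    where open import Relation.Binary.Reasoning.Setoid ℚᵘP.≃-setoid

  toℚ-* : ∀ m n → toℚ (m ℕ.* n) ≡ toℚ m * toℚ n
  toℚ-* zero    n = sym (*-zeroˡ (toℚ n))
  toℚ-* (suc m) n = trans (toℚ-+ n (m ℕ.* n)) (trans (cong (toℚ n ℚ.+_) (toℚ-* m n))
    (trans (solve 2 (λ m n → n :+ m :* n := (:# 1 :+ m) :* n) refl (toℚ m) (toℚ n))
           (cong (_* toℚ n) (sym (toℚ-+ 1 m)))))

  infixr 8 _^_
  _^_ : ℚ → ℕ → ℚ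
  x ^ zero  = 1ℚ
  x ^ suc n = x * x ^ n

  toℚ-^ : ∀ m n → toℚ (m ℕ.^ n) ≡ toℚ m ^ n
  toℚ-^ m zero    = refl
  toℚ-^ m (suc n) = trans (toℚ-* m (m ℕ.^ n)) (cong (toℚ m *_) (toℚ-^ m n))

  ^-*-dist : ∀ x y n → (x * y) ^ n ≡ x ^ n * y ^ n
  ^-*-dist x y zero    = refl
  ^-*-dist x y (suc n) = trans (cong (x * y *_) (^-*-dist x y n))
    (solve 4 (λ x y a b → x :* y :* (a :* b) := x :* a :* (y :* b)) refl x y (x ^ n) (y ^ n))

  ^-+ : ∀ x m n → x ^ (m ℕ.+ n) ≡ x ^ m * x ^ n
  ^-+ x zero    n = sym (*-identityˡ _)
  ^-+ x (suc m) n = trans (cong (x *_) (^-+ x m n)) (sym (*-assoc x (x ^ m) (x ^ n)))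

  1^ : ∀ n → 1ℚ ^ n ≡ 1ℚ
  1^ zero    = refl
  1^ (suc n) = trans (*-identityˡ _) (1^ n)

  0≤toℚ : ∀ n → 0ℚ ≤ toℚ n
  0≤toℚ zero    = ≤-refl
  0≤toℚ (suc n) = subst (0ℚ ≤_) (sym (toℚ-+ 1 n)) (+-mono-≤ (ℚP.nonNegative⁻¹ 1ℚ) (0≤toℚ n))

  toℚ-mono : ∀ {m n} → m ℕ.≤ n → toℚ m ≤ toℚ n
  toℚ-mono {m} {n} m≤n = subst₂ _≤_ (+-identityʳ (toℚ m))
    (trans (sym (toℚ-+ m (n ℕ.∸ m))) (cong toℚ (ℕP.m+[n∸m]≡n m≤n))) (+-monoʳ-≤ (toℚ m) (0≤toℚ (n ℕ.∸ m)))

  0≤* : ∀ {x y} → 0ℚ ≤ x → 0ℚ ≤ y → 0ℚ ≤ x * y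
  0≤* {x} {y} p q = subst (_≤ x * y) (*-zeroʳ x) (*-monoˡ-≤-nonNeg x {{ℚ.nonNegative p}} q)

  0≤+ : ∀ {x y} → 0ℚ ≤ x → 0ℚ ≤ y → 0ℚ ≤ x + y
  0≤+ = +-mono-≤

  *-monoˡ : ∀ {x y} z → 0ℚ ≤ z → x ≤ y → z * x ≤ z * y
  *-monoˡ z p = *-monoˡ-≤-nonNeg z {{ℚ.nonNegative p}}

  *-mono : ∀ {x y z w} → 0ℚ ≤ x → 0ℚ ≤ w → x ≤ y → z ≤ w → x * z ≤ y * w
  *-mono {x} {y} {z} {w} p q x≤y z≤w =
    ≤-trans (*-monoˡ x p z≤w) (*-monoʳ-≤-nonNeg w {{ℚ.nonNegative q}} x≤y)

  0≤^ : ∀ {x} n → 0ℚ ≤ x → 0ℚ ≤ x ^ n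
  0≤^ zero    p = ℚP.nonNegative⁻¹ 1ℚ
  0≤^ (suc n) p = 0≤* p (0≤^ n p)

  0<* : ∀ {x y} → 0ℚ < x → 0ℚ < y → 0ℚ < x * y
  0<* {x} {y} p q = ℚP.positive⁻¹ _ {{pos*pos⇒pos x {{ℚ.positive p}} y {{ℚ.positive q}}}}

  0<^ : ∀ {x} n → 0ℚ < x → 0ℚ < x ^ n
  0<^ zero    p = ℚP.positive⁻¹ 1ℚ
  0<^ (suc n) p = 0<* p (0<^ n p)

  0≤-⇒≤ : ∀ {x y} → 0ℚ ≤ y - x → x ≤ y
  0≤-⇒≤ {x} {y} p = subst₂ _≤_ (+-identityˡ x) (solve 2 (λ x y → (y :- x) :+ x := y) refl x y) (+-monoˡ-≤ x p)

  ≤⇒0≤- : ∀ {x y} → x ≤ y → 0ℚ ≤ y - x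
  ≤⇒0≤- {x} {y} p = subst (_≤ y - x) (+-inverseʳ x) (+-monoˡ-≤ (- x) p)

  -- The form in which polynomial inequalities are proved: the difference y - x is exhibited as a nonnegative expression.
  ≤-by : ∀ {x y} r → 0ℚ ≤ r → y - x ≡ r → x ≤ y
  ≤-by r p q = 0≤-⇒≤ (subst (0ℚ ≤_) (sym q) p)

  square-nonneg : ∀ x → 0ℚ ≤ x * x
  square-nonneg x with ≤-total 0ℚ x
  ... | inj₁ p = 0≤* p p
  ... | inj₂ p = subst (0ℚ ≤_) (solve 1 (λ x → (:- x) :* (:- x) := x :* x) refl x) (0≤* (neg-antimono-≤ p) (neg-antimono-≤ p))

  *-cancelˡ-≤ : ∀ {x y z} → 0ℚ < z → z * x ≤ z * y → x ≤ y
  *-cancelˡ-≤ {z = z} p = *-cancelˡ-≤-pos z {{ℚ.positive p}}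

  -- The factor `x + y` of the difference of squares is cancelled when it is positive; otherwise the
  -- claim follows from the sign of `y`.
  square-≤⇒≤ : ∀ {x y} → 0ℚ ≤ y → x * x ≤ y * y → x ≤ y
  square-≤⇒≤ {x} {y} 0≤y p with ≤-total x y
  ... | inj₁ q = q
  ... | inj₂ q with ≤-total (x + y) 0ℚ
  ...   | inj₁ r = ≤-trans (≤-by (- (x + y)) (neg-antimono-≤ r) (solve 2 (λ x y → :# 0 :- y :- x := :- (x :+ y)) refl x y) ) (≤-refl′ 0≤y)
    where
    ≤-refl′ : 0ℚ ≤ y → 0ℚ - y ≤ y
    ≤-refl′ h = ≤-by (y + y) (0≤+ h h) (solve 1 (λ y → y :- (:# 0 :- y) := y :+ y) refl y)
  ...   | inj₂ r with ℚP._≟_ (x + y) 0ℚ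
  ...     | yes s = ≤-trans (≤-by y 0≤y (trans (solve 2 (λ x y → :# 0 :- x := y :- (x :+ y)) refl x y) (trans (cong (λ z → y - z) s) (solve 1 (λ y → y :- :# 0 := y) refl y)))) 0≤y
  ...     | no s  = *-cancelˡ-≤ {z = x + y} (≤∧≢⇒< r (s ∘ sym))
                     (≤-by (y * y - x * x) (≤⇒0≤- p) (solve 2 (λ x y → (x :+ y) :* y :- (x :+ y) :* x := y :* y :- x :* x) refl x y))
    where
    ≤∧≢⇒< : ∀ {x y} → x ≤ y → x ≢ y → x < y
    ≤∧≢⇒< {x} {y} p q with ℚP._<?_ x y
    ... | yes r = r
    ... | no r  = contradiction (≤-antisym p (≮⇒≥ r)) q

  -- The Iverson bracket. It takes the decision as its argument, so that matching on a `Dec`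
  -- computes the value and counting becomes rational summation.
  ⟨_⟩ : ∀ {P : Set} → Dec P → ℚ
  ⟨ yes _ ⟩ = 1ℚ
  ⟨ no _ ⟩  = 0ℚ

  ⟨yes⟩ : ∀ {P : Set} (d : Dec P) → P → ⟨ d ⟩ ≡ 1ℚ
  ⟨yes⟩ (yes _) p = refl
  ⟨yes⟩ (no q)  p = contradiction p q

  ⟨no⟩ : ∀ {P : Set} (d : Dec P) → ¬ P → ⟨ d ⟩ ≡ 0ℚ
  ⟨no⟩ (yes p) q = contradiction p q
  ⟨no⟩ (no _)  q = refl

  ⟨⟩-cong : ∀ {P Q : Set} (d : Dec P) (d′ : Dec Q) → (P → Q) → (Q → P) → ⟨ d ⟩ ≡ ⟨ d′ ⟩
  ⟨⟩-cong (yes p) d′ f g = sym (⟨yes⟩ d′ (f p))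
  ⟨⟩-cong (no p)  d′ f g = sym (⟨no⟩ d′ (p ∘ g))

  0≤⟨⟩ : ∀ {P : Set} (d : Dec P) → 0ℚ ≤ ⟨ d ⟩
  0≤⟨⟩ (yes _) = ℚP.nonNegative⁻¹ 1ℚ
  0≤⟨⟩ (no _)  = ≤-refl

  ·≡* : ∀ n x → n · x ≡ toℚ n * x
  ·≡* zero    x = sym (*-zeroˡ x)
  ·≡* (suc n) x = trans (cong (x ℚ.+_) (·≡* n x)) (trans (solve 2 (λ x n → x :+ n :* x := (:# 1 :+ n) :* x) refl x (toℚ n))
    (cong (_* x) (sym (toℚ-+ 1 n))))


  module _ {A : Set} where

    sumL-mono : ∀ (xs : List A) {f g : A → ℚ} → (∀ {x} → x ∈ xs → f x ≤ g x) → sumL xs f ≤ sumL xs g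
    sumL-mono []       h = ≤-refl
    sumL-mono (x ∷ xs) h = +-mono-≤ (h (here refl)) (sumL-mono xs (h ∘ there))

    sumL-nonneg : ∀ (xs : List A) {f : A → ℚ} → (∀ x → 0ℚ ≤ f x) → 0ℚ ≤ sumL xs f
    sumL-nonneg xs h = subst (_≤ sumL xs _) (sumL-ε xs) (sumL-mono xs (λ {x} _ → h x))

    sumL-count : ∀ {P : A → Set} (P? : Decidable P) xs → sumL xs (λ x → ⟨ P? x ⟩) ≡ toℚ (length (filter P? xs))
    sumL-count P? [] = refl
    sumL-count P? (x ∷ xs) with P? x
    ... | yes _ = trans (cong (1ℚ ℚ.+_) (sumL-count P? xs)) (sym (toℚ-+ 1 (length (filter P? xs))))
    ... | no _  = trans (+-identityˡ _) (sumL-count P? xs)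

    sumL-const-ℚ : ∀ (xs : List A) c → sumL xs (λ _ → c) ≡ toℚ (length xs) * c
    sumL-const-ℚ xs c = trans (sumL-const xs c) (·≡* (length xs) c)

    sumL-zero⇒zero : ∀ (xs : List A) {f : A → ℚ} → (∀ x → f x ≤ 0ℚ) → sumL xs f ≡ 0ℚ → ∀ {x} → x ∈ xs → f x ≡ 0ℚ
    sumL-zero⇒zero (y ∷ xs) {f} h s m = go m
      where
      S≤0 : sumL xs f ≤ 0ℚ
      S≤0 = ≤-trans (sumL-mono xs (λ {x} _ → h x)) (≤-reflexive (sumL-ε xs))
      fy≡0 : f y ≡ 0ℚ
      fy≡0 = ≤-antisym (h y) (subst₂ _≤_ s (+-identityʳ (f y)) (+-monoʳ-≤ (f y) S≤0))
      go : ∀ {x} → x ∈ y ∷ xs → f x ≡ 0ℚ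
      go (here refl) = fy≡0
      go (there m)   = sumL-zero⇒zero xs h (trans (sym (+-identityˡ _)) (trans (cong (_+ sumL xs f) (sym fy≡0)) s)) m

  ∑-δ : ∀ {A} (e : Enum A) (f : A → ℚ) a → ∑ e (λ x → ⟨ Enum._≟_ e x a ⟩ * f x) ≡ f a
  ∑-δ e f a = trans
    (∑-only e a _ (λ x p → trans (cong (_* f x) (⟨no⟩ (Enum._≟_ e x a) p)) (*-zeroˡ (f x))))
    (trans (cong (_* f a) (⟨yes⟩ (Enum._≟_ e a a) refl)) (*-identityˡ (f a)))

  ∑-1 : ∀ {A} (e : Enum A) a → ∑ e (λ x → ⟨ Enum._≟_ e x a ⟩) ≡ 1ℚ
  ∑-1 e a = trans (∑-cong e (λ x → sym (*-identityʳ _))) (∑-δ e (λ _ → 1ℚ) a)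

-- Finite fields: inverses, the element 2, Fermat's theorem

module Field (F : FiniteField) where
  open import Level using (0ℓ)
  open import Algebra.Bundles using (CommutativeRing)
  open import Data.List using (List)
  open import Data.Product using (_,_; proj₁; proj₂)
  open import Data.Sum using (_⊎_; inj₁; inj₂)
  open import Relation.Nullary using (yes; no; contradiction)
  open import Relation.Binary.PropositionalEquality using (_≡_; _≢_; refl; sym; trans; cong; cong₂; isEquivalence; module ≡-Reasoning)
  open import Relation.Binary.Definitions using (DecidableEquality)
  open Sums
  open ≡-Reasoning

  private module F = FiniteField F

  ring≡ : CommutativeRing 0ℓ 0ℓ
  ring≡ = record
    { Carrier = F.Carrier ; _≈_ = _≡_ ; _+_ = F._+_ ; _*_ = F._*_ ; -_ = λ x → F.- x ; 0# = F.0# ; 1# = F.1#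
    ; isCommutativeRing = record
      { isRing = record
        { +-isAbelianGroup = record
          { isGroup = record
            { isMonoid = record
              { isSemigroup = record
                { isMagma = record { isEquivalence = isEquivalence ; ∙-cong = cong₂ F._+_ }
                ; assoc = λ x y z → F.≈⇒≡ (F.+-assoc x y z) }
              ; identity = (λ x → F.≈⇒≡ (F.+-identityˡ x)) , (λ x → F.≈⇒≡ (F.+-identityʳ x)) }
            ; inverse = (λ x → F.≈⇒≡ (F.-‿inverseˡ x)) , (λ x → F.≈⇒≡ (F.-‿inverseʳ x))
            ; ⁻¹-cong = λ p → cong (λ x → F.- x) p }
          ; comm = λ x y → F.≈⇒≡ (F.+-comm x y) }
        ; *-cong = cong₂ F._*_
        ; *-assoc = λ x y z → F.≈⇒≡ (F.*-assoc x y z)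
        ; *-identity = (λ x → F.≈⇒≡ (F.*-identityˡ x)) , (λ x → F.≈⇒≡ (F.*-identityʳ x))
        ; distrib = (λ x y z → F.≈⇒≡ (F.distribˡ x y z)) , (λ x y z → F.≈⇒≡ (F.distribʳ x y z)) }
      ; *-comm = λ x y → F.≈⇒≡ (F.*-comm x y) } }

  open CommutativeRing ring≡ public
    using (Carrier; _+_; _*_; -_; _-_; 0#; 1#; +-assoc; +-comm; +-identityˡ; +-identityʳ; -‿inverseˡ; -‿inverseʳ;
           *-assoc; *-comm; *-identityˡ; *-identityʳ; distribˡ; distribʳ; zeroˡ; zeroʳ; ring; semiring;
           commutativeSemiring; *-commutativeMonoid; +-commutativeMonoid; +-abelianGroup)
  open IntegerSolver ring≡ public using (solve; _:+_; _:*_; :-_; _:-_; _:=_; :#)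
  open import Algebra.Properties.Ring ring public using (-0#≈0#; -‿involutive)
  open import Algebra.Properties.CommutativeSemiring.Exp commutativeSemiring public
  open F public using (1≢0; order)

  infix 4 _≟_
  _≟_ : DecidableEquality Carrier
  _≟_ = F._≟_

  open RingSum ring≡ public using () renaming (∑ to ∑ᶠ)
  private module Σ = RingSum ring≡
  private module Π = MonoidSum *-commutativeMonoid

  enum : Enum Carrier
  enum = record { elems = F.elems ; unique = F.elems-unique ; complete = F.elems-complete ; _≟_ = _≟_ }

  2# : Carrier
  2# = 1# + 1#

  -- junk value: 0# ⁻¹ = 0#
  _⁻¹ : Carrier → Carrier
  x ⁻¹ with x ≟ 0#
  ... | yes _ = 0#
  ... | no p  = proj₁ (F.inverse x p)

  infix 9 _⁻¹

  inverseʳ : ∀ {x} → x ≢ 0# → x * x ⁻¹ ≡ 1#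
  inverseʳ {x} x≢0 with x ≟ 0#
  ... | yes p = contradiction p x≢0
  ... | no p  = proj₂ (F.inverse x p)

  inverseˡ : ∀ {x} → x ≢ 0# → x ⁻¹ * x ≡ 1#
  inverseˡ x≢0 = trans (*-comm _ _) (inverseʳ x≢0)

  0⁻¹ : 0# ⁻¹ ≡ 0#
  0⁻¹ with 0# ≟ 0#
  ... | yes _ = refl
  ... | no p  = contradiction refl p

  *-cancelˡ : ∀ {x y z} → x ≢ 0# → x * y ≡ x * z → y ≡ z
  *-cancelˡ {x} {y} {z} x≢0 p = begin
    y                ≡⟨ *-identityˡ y ⟨
    1# * y           ≡⟨ cong (_* y) (inverseˡ x≢0) ⟨
    x ⁻¹ * x * y     ≡⟨ *-assoc _ _ _ ⟩
    x ⁻¹ * (x * y)   ≡⟨ cong (x ⁻¹ *_) p ⟩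
    x ⁻¹ * (x * z)   ≡⟨ *-assoc _ _ _ ⟨
    x ⁻¹ * x * z     ≡⟨ cong (_* z) (inverseˡ x≢0) ⟩
    1# * z           ≡⟨ *-identityˡ z ⟩
    z                ∎

  *-zero-split : ∀ {x y} → x * y ≡ 0# → x ≡ 0# ⊎ y ≡ 0#
  *-zero-split {x} {y} p with x ≟ 0#
  ... | yes q = inj₁ q
  ... | no q  = inj₂ (*-cancelˡ q (trans p (sym (zeroʳ x))))

  *-nonzero : ∀ {x y} → x ≢ 0# → y ≢ 0# → x * y ≢ 0#
  *-nonzero x≢0 y≢0 p with *-zero-split p
  ... | inj₁ q = x≢0 q
  ... | inj₂ q = y≢0 q

  ⁻¹-nonzero : ∀ {x} → x ≢ 0# → x ⁻¹ ≢ 0#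
  ⁻¹-nonzero {x} x≢0 p = 1≢0 (trans (sym (inverseʳ x≢0)) (trans (cong (x *_) p) (zeroʳ x)))

  ⁻¹-unique : ∀ {x y} → x * y ≡ 1# → y ≡ x ⁻¹
  ⁻¹-unique {x} {y} p = *-cancelˡ x≢0 (trans p (sym (inverseʳ x≢0)))
    where
    x≢0 : x ≢ 0#
    x≢0 q = 1≢0 (trans (sym p) (trans (cong (_* y) q) (zeroˡ y)))

  ⁻¹-involutive : ∀ {x} → x ≢ 0# → x ⁻¹ ⁻¹ ≡ x
  ⁻¹-involutive x≢0 = sym (⁻¹-unique (inverseˡ x≢0))

  ⁻¹-* : ∀ {x y} → x ≢ 0# → y ≢ 0# → (x * y) ⁻¹ ≡ x ⁻¹ * y ⁻¹
  ⁻¹-* {x} {y} x≢0 y≢0 = sym (⁻¹-unique (begin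
    x * y * (x ⁻¹ * y ⁻¹)   ≡⟨ solve 4 (λ x y u v → x :* y :* (u :* v) := (x :* u) :* (y :* v)) refl x y (x ⁻¹) (y ⁻¹) ⟩
    x * x ⁻¹ * (y * y ⁻¹)   ≡⟨ cong₂ _*_ (inverseʳ x≢0) (inverseʳ y≢0) ⟩
    1# * 1#                 ≡⟨ *-identityˡ 1# ⟩
    1#                      ∎))

  ⁻¹-neg : ∀ {x} → x ≢ 0# → (- x) ⁻¹ ≡ - (x ⁻¹)
  ⁻¹-neg {x} x≢0 = sym (⁻¹-unique (trans (solve 2 (λ x u → (:- x) :* (:- u) := x :* u) refl x (x ⁻¹)) (inverseʳ x≢0)))

  -≡0⇒≡ : ∀ {x y} → x - y ≡ 0# → x ≡ y
  -≡0⇒≡ {x} {y} p = trans (solve 2 (λ x y → x := (x :- y) :+ y) refl x y) (trans (cong (_+ y) p) (+-identityˡ y))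

  ≡⇒-≡0 : ∀ {x y} → x ≡ y → x - y ≡ 0#
  ≡⇒-≡0 {x} refl = -‿inverseʳ x

  neg-nonzero : ∀ {x} → x ≢ 0# → - x ≢ 0#
  neg-nonzero {x} x≢0 p = x≢0 (trans (sym (-‿involutive x)) (trans (cong (λ z → - z) p) -0#≈0#))

  ^-nonzero : ∀ {x} n → x ≢ 0# → x ^ n ≢ 0#
  ^-nonzero zero    x≢0 = 1≢0
  ^-nonzero (suc n) x≢0 = *-nonzero x≢0 (^-nonzero n x≢0)

  1^ : ∀ n → 1# ^ n ≡ 1#
  1^ zero    = refl
  1^ (suc n) = trans (*-identityˡ _) (1^ n)

  0^ : ∀ n → 0# ^ suc n ≡ 0#
  0^ n = zeroˡ _

  open import Algebra.Properties.Semiring.Mult semiring using () renaming (_×_ to _·_; ×-homo-+ to ·-homo-+)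

  -- Translation by 1 permutes the field, so adding `order · 1#` does not change the sum of all
  -- elements.
  order·1≡0 : order · 1# ≡ 0#
  order·1≡0 = begin
    order · 1#                        ≡⟨ Σ.∑-const enum 1# ⟨
    ∑ᶠ enum (λ _ → 1#)                ≡⟨ solve 2 (λ s t → s := (t :+ s) :- t) refl (∑ᶠ enum (λ _ → 1#)) S ⟩
    (S + ∑ᶠ enum (λ _ → 1#)) - S      ≡⟨ cong (_- S) (Σ.∑-∙ enum (λ x → x) (λ _ → 1#)) ⟨
    ∑ᶠ enum (λ x → x + 1#) - S        ≡⟨ cong (_- S) (Σ.∑-reindex enum enum (_+ 1#) (_- 1#)
                                          (λ x → solve 2 (λ x y → (x :+ y) :- y := x) refl x 1#)
                                          (λ x → solve 2 (λ x y → (x :- y) :+ y := x) refl x 1#) (λ x → x)) ⟩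
    S - S                             ≡⟨ -‿inverseʳ S ⟩
    0#                                ∎
    where S = ∑ᶠ enum (λ x → x)

  -- An odd number of ones adds up to 0 here; with 2 = 0 it would add up to 1.
  odd⇒2≢0 : ∀ {k} → order ≡ suc (k ℕ.+ k) → 2# ≢ 0#
  odd⇒2≢0 {k} p 2≡0 = 1≢0 (begin
    1#                               ≡⟨ +-identityʳ 1# ⟨
    1# + 0#                          ≡⟨ cong (1# +_) (even k) ⟨
    suc (k ℕ.+ k) · 1#               ≡⟨ cong (_· 1#) p ⟨
    order · 1#                       ≡⟨ order·1≡0 ⟩
    0#                               ∎)
    where
    even : ∀ k → (k ℕ.+ k) · 1# ≡ 0#
    even k = begin
      (k ℕ.+ k) · 1#        ≡⟨ ·-homo-+ 1# k k ⟩
      k · 1# + k · 1#       ≡⟨ solve 1 (λ x → x :+ x := (:# 1 :+ :# 1) :* x) refl (k · 1#) ⟩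
      2# * (k · 1#)         ≡⟨ cong (_* (k · 1#)) 2≡0 ⟩
      0# * (k · 1#)         ≡⟨ zeroˡ _ ⟩
      0#                    ∎
      where open import Data.Integer as ℤ using ()

  private
    nz : Carrier → Carrier
    nz y with y ≟ 0#
    ... | yes _ = 1#
    ... | no _  = y

    nz-nonzero : ∀ y → nz y ≢ 0#
    nz-nonzero y with y ≟ 0#
    ... | yes _ = 1≢0
    ... | no p  = p

    at0 : Carrier → Carrier → Carrier
    at0 x y with y ≟ 0#
    ... | yes _ = x
    ... | no _  = 1#

    at0-0 : ∀ x → at0 x 0# ≡ x
    at0-0 x with 0# ≟ 0#
    ... | yes _ = refl
    ... | no p  = contradiction refl p

    at0-≢ : ∀ x y → y ≢ 0# → at0 x y ≡ 1#
    at0-≢ x y p with y ≟ 0#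
    ... | yes q = contradiction q p
    ... | no _  = refl

    nz-* : ∀ {x} → x ≢ 0# → ∀ y → x * nz y ≡ nz (x * y) * at0 x y
    nz-* {x} x≢0 y with y ≟ 0# | (x * y) ≟ 0#
    ... | yes p | yes q = *-comm _ _
    ... | yes p | no q  = contradiction (trans (cong (x *_) p) (zeroʳ x)) q
    ... | no p  | yes q = contradiction q (*-nonzero x≢0 p)
    ... | no p  | no q  = sym (*-identityʳ _)

    prod-nonzero : ∀ (xs : List Carrier) → Π.sumL xs nz ≢ 0#
    prod-nonzero List.[]       = 1≢0
    prod-nonzero (x List.∷ xs) = *-nonzero (nz-nonzero x) (prod-nonzero xs)

  -- Multiplication by x ≠ 0 permutes the field. To take the product over the whole enumeration,
  -- `nz` replaces the factor 0 by 1; at y = 0 this leaves one surplus factor x, which `at0 x`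
  -- collects. So P x^order = P x with P ≠ 0.
  fermat : ∀ x → x ^ order ≡ x
  fermat x with x ≟ 0#
  ... | yes refl = zero^ (F.order-nonZero)
    where
    zero^ : ∀ {n} → ℕ.NonZero n → 0# ^ n ≡ 0#
    zero^ {suc n} _ = 0^ n
  ... | no x≢0 = *-cancelˡ (prod-nonzero F.elems) (begin
    P * x ^ order                                      ≡⟨ *-comm _ _ ⟩
    x ^ order * P                                      ≡⟨ cong (_* P) (Π.∑-const enum x) ⟨
    Π.∑ enum (λ _ → x) * P                             ≡⟨ Π.∑-∙ enum (λ _ → x) nz ⟨
    Π.∑ enum (λ y → x * nz y)                          ≡⟨ Π.∑-cong enum (nz-* x≢0) ⟩
    Π.∑ enum (λ y → nz (x * y) * at0 x y)              ≡⟨ Π.∑-∙ enum (λ y → nz (x * y)) (at0 x) ⟩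
    Π.∑ enum (λ y → nz (x * y)) * Π.∑ enum (at0 x)     ≡⟨ cong₂ _*_
                                                            (Π.∑-reindex enum enum (x *_) (x ⁻¹ *_)
                                                              (λ y → trans (sym (*-assoc _ _ _)) (trans (cong (_* y) (inverseˡ x≢0)) (*-identityˡ y)))
                                                              (λ y → trans (sym (*-assoc _ _ _)) (trans (cong (_* y) (inverseʳ x≢0)) (*-identityˡ y))) nz)
                                                            (trans (Π.∑-only enum 0# (at0 x) (at0-≢ x)) (at0-0 x)) ⟩
    P * x                                              ∎)
    where P = Π.∑ enum nz

-- Polynomials as functions: degree, leading coefficient, roots, linear dependence

module Polynomials (F : FiniteField) where
  open import Data.Nat as ℕ using (ℕ; zero; suc; z≤n; s≤s)
  import Data.Nat.Properties as ℕP
  open import Data.Fin as Fin using (Fin; punchIn)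
  import Data.Fin.Properties as FinP
  open import Data.List using ([]; _∷_; length; filter)
  open import Data.List.Properties using (filter-all)
  open import Data.List.Relation.Unary.Unique.Propositional using (Unique; []; _∷_)
  open import Data.List.Relation.Unary.Unique.Propositional.Properties using (filter⁺)
  open import Data.List.Relation.Unary.All as All using (All; []; _∷_; all?)
  open import Data.List.Relation.Unary.All.Properties using (all-filter)
  open import Data.Product using (∃; ∃₂; _×_; _,_; proj₁; proj₂)
  open import Data.Sum using (_⊎_; inj₁; inj₂)
  open import Data.Vec.Functional using (insertAt)
  open import Data.Vec.Functional.Properties using (insertAt-lookup; insertAt-punchIn)
  open import Relation.Nullary using (¬_; Dec; yes; no; ¬?; contradiction)
  open import Relation.Nullary.Decidable using (map′)
  open import Relation.Binary.Definitions using (tri<; tri≈; tri>)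
  open import Relation.Binary.PropositionalEquality using (_≡_; _≢_; refl; sym; trans; cong; cong₂; subst; module ≡-Reasoning)
  open Field F
  open Sums using (Enum)
  open import Algebra.Properties.CommutativeMonoid.Sum +-commutativeMonoid using (sum; sum-remove; sum-cong-≋; ∑-distrib-+)
  open import Algebra.Properties.Semiring.Sum semiring using (*-distribˡ-sum)
  open ≡-Reasoning

  Fun : Set
  Fun = Carrier → Carrier

  _≗0 : Fun → Set
  f ≗0 = ∀ y → f y ≡ 0#

  _≗0? : ∀ f → Dec (f ≗0)
  f ≗0? = map′ (λ a y → All.lookup a (Enum.complete enum y)) (λ h → All.universal h _) (all? (λ y → f y ≟ 0#) (Enum.elems enum))

  -- Blk C Y P f: the function f is a sum of blocks c₀ + c₁ Y + … + c_{P-1} Y^{P-1} with coefficient functions in C.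
  data Blk (C : Fun → Set) (Y : Fun) : ℕ → Fun → Set where
    nil  : ∀ {f} → f ≗0 → Blk C Y 0 f
    cons : ∀ {P f c g} → C c → Blk C Y P g → (∀ y → f y ≡ c y + Y y * g y) → Blk C Y (suc P) f

  -- Coefficient spaces enter only through these linear operations. Constants give ordinary
  -- polynomials; polynomials of degree below r give expansions in powers of y^r.
  record Closed (C : Fun → Set) : Set where
    field
      zeroᶜ : C (λ _ → 0#)
      ext   : ∀ {f g} → (∀ y → g y ≡ f y) → C f → C g
      addᶜ  : ∀ {f g} → C f → C g → C (λ y → f y + g y)
      scale : ∀ {f} a → C f → C (λ y → a * f y)

    negᶜ : ∀ {f} → C f → C (λ y → - f y)
    negᶜ {f} p = ext (λ y → solve 2 (λ x o → :- x := (:- o) :* x :+ (o :* x :- x)) refl (f y) 1# ∙ cong ((- 1#) * f y +_)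
                   (trans (cong (_- f y) (*-identityˡ (f y))) (-‿inverseʳ (f y))) ∙ +-identityʳ _) (scale (- 1#) p)
      where
      infixr 5 _∙_
      _∙_ : ∀ {x y z : Carrier} → x ≡ y → y ≡ z → x ≡ z
      _∙_ = trans

    subᶜ : ∀ {f g} → C f → C g → C (λ y → f y - g y)
    subᶜ p q = addᶜ p (negᶜ q)

  module _ {C : Fun → Set} {Y : Fun} where

    Blk-ext : ∀ {P f g} → (∀ y → g y ≡ f y) → Blk C Y P f → Blk C Y P g
    Blk-ext h (nil p)      = nil (λ y → trans (h y) (p y))
    Blk-ext h (cons c b p) = cons c b (λ y → trans (h y) (p y))

    Blk-cast : ∀ {P P′ f} → P ≡ P′ → Blk C Y P f → Blk C Y P′ f
    Blk-cast refl b = b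

    module _ (cl : Closed C) where
      open Closed cl

      Blk-zero : ∀ P → Blk C Y P (λ _ → 0#)
      Blk-zero zero    = nil (λ _ → refl)
      Blk-zero (suc P) = cons zeroᶜ (Blk-zero P) (λ y → sym (trans (+-identityˡ _) (zeroʳ _)))

      Blk-weaken : ∀ {P P′ f} → P ℕ.≤ P′ → Blk C Y P f → Blk C Y P′ f
      Blk-weaken z≤n     (nil p)      = Blk-ext p (Blk-zero _)
      Blk-weaken (s≤s l) (cons c b p) = cons c (Blk-weaken l b) p

      Blk-+ : ∀ {P f g} → Blk C Y P f → Blk C Y P g → Blk C Y P (λ y → f y + g y)
      Blk-+ (nil p) (nil q) = nil (λ y → trans (cong₂ _+_ (p y) (q y)) (+-identityˡ 0#))
      Blk-+ (cons {c = c} {g} a b p) (cons {c = c′} {g′} a′ b′ p′) = cons (addᶜ a a′) (Blk-+ b b′) (λ y →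
        trans (cong₂ _+_ (p y) (p′ y))
          (solve 5 (λ c c′ Y g g′ → (c :+ Y :* g) :+ (c′ :+ Y :* g′) := (c :+ c′) :+ Y :* (g :+ g′)) refl (c y) (c′ y) (Y y) (g y) (g′ y)))

      Blk-scale : ∀ {P f} a → Blk C Y P f → Blk C Y P (λ y → a * f y)
      Blk-scale a (nil p) = nil (λ y → trans (cong (a *_) (p y)) (zeroʳ a))
      Blk-scale a (cons {c = c} {g} x b p) = cons (scale a x) (Blk-scale a b) (λ y →
        trans (cong (a *_) (p y)) (solve 4 (λ a c Y g → a :* (c :+ Y :* g) := a :* c :+ Y :* (a :* g)) refl a (c y) (Y y) (g y)))

      Blk-closed : ∀ P → Closed (Blk C Y P)
      Blk-closed P = record { zeroᶜ = Blk-zero P ; ext = Blk-ext ; addᶜ = Blk-+ ; scale = Blk-scale }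

      Blk-shift : ∀ {P f} n → Blk C Y P f → Blk C Y (n ℕ.+ P) (λ y → Y y ^ n * f y)
      Blk-shift zero    b = Blk-ext (λ y → *-identityˡ _) b
      Blk-shift (suc n) b = cons zeroᶜ (Blk-shift n b) (λ y → trans (*-assoc _ _ _) (sym (+-identityˡ _)))

      Blk-C : ∀ {c} → C c → Blk C Y 1 c
      Blk-C {c} p = cons p (nil (λ _ → refl)) (λ y → sym (trans (cong (c y +_) (zeroʳ _)) (+-identityʳ _)))

  module _ {C₁ C₂ C₃ : Fun → Set} {Y : Fun} (cl : Closed C₃)
           (mul : ∀ {c d} → C₁ c → C₂ d → C₃ (λ y → c y * d y)) where
    open Closed cl

    Blk-mulC : ∀ {P c f} → C₁ c → Blk C₂ Y P f → Blk C₃ Y P (λ y → c y * f y)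
    Blk-mulC {c = c} p (nil q) = nil (λ y → trans (cong (c y *_) (q y)) (zeroʳ _))
    Blk-mulC {c = c} p (cons {c = d} {g} x b q) = cons (mul p x) (Blk-mulC p b) (λ y →
      trans (cong (c y *_) (q y)) (solve 4 (λ a c Y g → a :* (c :+ Y :* g) := a :* c :+ Y :* (a :* g)) refl (c y) (d y) (Y y) (g y)))

    Blk-mul : ∀ {P P′ f g} → Blk C₁ Y P f → Blk C₂ Y P′ g → Blk C₃ Y (P ℕ.+ P′) (λ y → f y * g y)
    Blk-mul {P′ = P′} {g = g} (nil p) b = Blk-ext (λ y → trans (cong (_* g y) (p y)) (zeroˡ _)) (Blk-zero cl P′)
    Blk-mul {P′ = P′} {g = g} (cons {P} {c = c} {f′} x a p) b = Blk-ext
      (λ y → trans (cong (_* g y) (p y)) (solve 4 (λ c Y f g → (c :+ Y :* f) :* g := c :* g :+ (:# 0 :+ Y :* (f :* g))) refl (c y) (Y y) (f′ y) (g y)))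
      (Blk-+ cl (Blk-weaken cl (ℕP.m≤n+m P′ (suc P)) (Blk-mulC x b))
        (cons zeroᶜ (Blk-mul a b) (λ y → refl)))
      where open import Data.Integer as ℤ using ()

  IsConst : Fun → Set
  IsConst f = ∃ λ a → ∀ y → f y ≡ a

  const-closed : Closed IsConst
  const-closed = record
    { zeroᶜ = 0# , (λ _ → refl)
    ; ext   = λ { h (a , p) → a , (λ y → trans (h y) (p y)) }
    ; addᶜ  = λ { (a , p) (b , q) → a + b , (λ y → cong₂ _+_ (p y) (q y)) }
    ; scale = λ { c (a , p) → c * a , (λ y → cong (c *_) (p y)) }
    }

  const-mul : ∀ {f g} → IsConst f → IsConst g → IsConst (λ y → f y * g y)
  const-mul (a , p) (b , q) = a * b , (λ y → cong₂ _*_ (p y) (q y))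

  -- The index counts coefficients: `IsPoly n` means degree at most n - 1, and `IsPoly 0` contains
  -- only the zero function.
  IsPoly : ℕ → Fun → Set
  IsPoly = Blk IsConst (λ y → y)

  poly-closed : ∀ n → Closed (IsPoly n)
  poly-closed = Blk-closed const-closed

  poly-mul : ∀ {n m f g} → IsPoly n f → IsPoly m g → IsPoly (n ℕ.+ m) (λ y → f y * g y)
  poly-mul = Blk-mul const-closed const-mul

  poly-weaken : ∀ {n m f} → n ℕ.≤ m → IsPoly n f → IsPoly m f
  poly-weaken = Blk-weaken const-closed

  poly-const : ∀ a → IsPoly 1 (λ _ → a)
  poly-const a = Blk-C const-closed (a , λ _ → refl)

  poly-^ : ∀ n → IsPoly (suc n) (_^ n)
  poly-^ n = subst (λ m → IsPoly m (_^ n)) (ℕP.+-comm n 1)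
    (Blk-ext (λ y → sym (*-identityʳ _)) (Blk-shift const-closed n (poly-const 1#)))

  poly-append : ∀ {n m c g} → IsPoly n c → IsPoly m g → IsPoly (n ℕ.+ m) (λ y → c y + y ^ n * g y)
  poly-append (nil p) b = Blk-ext (λ y → trans (cong₂ _+_ (p y) (*-identityˡ _)) (+-identityˡ _)) b
  poly-append {suc n} {g = g} (cons {c = c} {c′} a p q) b = cons a (poly-append p b) (λ y → trans (cong (_+ y * y ^ n * g y) (q y))
    (solve 5 (λ c y c′ yn g → (c :+ y :* c′) :+ y :* yn :* g := c :+ y :* (c′ :+ yn :* g)) refl (c y) y (c′ y) (y ^ n) (g y)))

  -- Blocks of r coefficients in powers of y^r do not overlap, so the expansion is read as an
  -- ordinary polynomial by concatenation.
  poly-blocks : ∀ {r P f} → Blk (IsPoly r) (_^ r) P f → IsPoly (P ℕ.* r) f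
  poly-blocks (nil p)      = nil p
  poly-blocks (cons c b p) = Blk-ext p (poly-append c (poly-blocks b))

  poly-divide : ∀ {n f} → IsPoly (suc n) f → ∀ z → ∃ λ b → IsPoly n b × (∀ y → f y ≡ (y - z) * b y + f z)
  poly-divide {zero} {f} (cons {c = c} {g} (a , h) (nil p) q) z =
    (λ _ → 0#) , nil (λ _ → refl) , λ y → trans (f≡a y) (sym (trans (cong (_+ f z) (zeroʳ _)) (trans (+-identityˡ _) (f≡a z))))
    where
    f≡a : ∀ y → f y ≡ a
    f≡a y = trans (q y) (trans (cong₂ _+_ (h y) (trans (cong (y *_) (p y)) (zeroʳ y))) (+-identityʳ a))
  poly-divide {suc n} {f} (cons {c = c} {g} (a , h) b q) z with poly-divide b z
  ... | b′ , p′ , q′ = (λ y → g z + y * b′ y) , cons (g z , λ _ → refl) p′ (λ _ → refl) , λ y → begin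
    f y                                       ≡⟨ q y ⟩
    c y + y * g y                             ≡⟨ cong₂ (λ u v → u + y * v) (h y) (q′ y) ⟩
    a + y * ((y - z) * b′ y + g z)            ≡⟨ solve 5 (λ a y z b g → a :+ y :* ((y :- z) :* b :+ g) := (y :- z) :* (g :+ y :* b) :+ (a :+ z :* g)) refl a y z (b′ y) (g z) ⟩
    (y - z) * (g z + y * b′ y) + (a + z * g z) ≡⟨ cong ((y - z) * (g z + y * b′ y) +_) (trans (q z) (cong (_+ z * g z) (h z))) ⟨
    (y - z) * (g z + y * b′ y) + f z          ∎

  poly-roots : ∀ {n f} → IsPoly n f → ∀ {Z} → Unique Z → All (λ z → f z ≡ 0#) Z → n ℕ.≤ length Z → f ≗0
  poly-roots {zero} (nil p) _ _ _ = p
  poly-roots {suc n} {f} P {z ∷ Z} (z∉ ∷ u) (fz ∷ fZ) (s≤s l) with poly-divide P z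
  ... | b , pb , q = λ y → trans (q y) (trans (cong₂ (λ u v → (y - z) * u + v) (b≗0 y) fz) (trans (+-identityʳ _) (zeroʳ _)))
    where
    b-root : ∀ {w} → z ≢ w → f w ≡ 0# → b w ≡ 0#
    b-root {w} z≢w fw with *-zero-split (trans (sym (+-identityʳ _)) (trans (cong ((w - z) * b w +_) (sym fz)) (trans (sym (q w)) fw)))
    ... | inj₁ p = contradiction (sym (-≡0⇒≡ p)) z≢w
    ... | inj₂ p = p
    b≗0 : b ≗0
    b≗0 = poly-roots pb u (All.zipWith (λ { (p , q) → b-root p q }) (z∉ , fZ)) l

  length-remove : ∀ (a : Carrier) {xs} → Unique xs → length xs ℕ.≤ suc (length (filter (λ x → ¬? (x ≟ a)) xs))
  length-remove a [] = z≤n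
  length-remove a {x ∷ xs} (x∉ ∷ u) with x ≟ a
  ... | yes refl = s≤s (ℕP.≤-reflexive (cong length (sym (filter-all (λ y → ¬? (y ≟ a)) (All.map (λ p q → p (sym q)) x∉)))))
  ... | no _     = s≤s (length-remove a u)

  poly-roots≢0 : ∀ {n f} → IsPoly n f → n ℕ.< order → (∀ y → y ≢ 0# → f y ≡ 0#) → f ≗0
  poly-roots≢0 {n} p l h = poly-roots p (filter⁺ nz? (Enum.unique enum))
    (All.map (λ {y} q → h y q) (all-filter nz? (Enum.elems enum)))
    (ℕP.≤-pred (ℕP.≤-trans l (length-remove 0# (Enum.unique enum))))
    where nz? = λ (x : Carrier) → ¬? (x ≟ 0#)

  -- Induction on the length of `low`. At y = 0 the identity kills the constant term of `low`;
  -- dividing by y leaves an identity for y ≠ 0, which extends to y = 0 because its degree is below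
  -- `order - 1`.
  poly-top-zero : ∀ {n r low w} → IsPoly n low → IsPoly r w → n ℕ.+ r ℕ.≤ order →
    (∀ y → w y * y ^ n + low y ≡ 0#) → w ≗0
  poly-top-zero {low = low} {w} (nil p) q l h y = begin
    w y              ≡⟨ *-identityʳ _ ⟨
    w y * 1#         ≡⟨ +-identityʳ _ ⟨
    w y * 1# + 0#    ≡⟨ cong (w y * 1# +_) (p y) ⟨
    w y * 1# + low y ≡⟨ h y ⟩
    0#               ∎
  poly-top-zero {suc n} {r} {low} {w} (cons {c = c} {low₁} (a , ca) p q) pw l h =
    poly-top-zero p pw (ℕP.<⇒≤ l) (λ y → trans (+-comm _ _) (trans (cong (low₁ y +_) (*-comm _ _))
      (poly-roots≢0 (poly-append p pw) l h′ y)))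
    where
    a≡0 : a ≡ 0#
    a≡0 = begin
      a                                   ≡⟨ solve 3 (λ a w l → a := w :* (:# 0) :+ (a :+ :# 0 :* l)) refl a (w 0#) (low₁ 0#) ⟩
      w 0# * 0# + (a + 0# * low₁ 0#)      ≡⟨ cong₂ (λ u v → w 0# * u + (v + 0# * low₁ 0#)) (zeroˡ (0# ^ n)) (ca 0#) ⟨
      w 0# * 0# ^ suc n + (c 0# + 0# * low₁ 0#) ≡⟨ cong (w 0# * 0# ^ suc n +_) (q 0#) ⟨
      w 0# * 0# ^ suc n + low 0#          ≡⟨ h 0# ⟩
      0#                                  ∎
      where open import Data.Integer as ℤ using ()
    h′ : ∀ y → y ≢ 0# → low₁ y + y ^ n * w y ≡ 0#
    h′ y y≢0 = *-cancelˡ y≢0 (begin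
      y * (low₁ y + y ^ n * w y)          ≡⟨ solve 4 (λ y l yn w → y :* (l :+ yn :* w) := w :* (y :* yn) :+ (:# 0 :+ y :* l)) refl y (low₁ y) (y ^ n) (w y) ⟩
      w y * y ^ suc n + (0# + y * low₁ y) ≡⟨ cong (λ u → w y * y ^ suc n + (u + y * low₁ y)) (trans (sym a≡0) (sym (ca y))) ⟩
      w y * y ^ suc n + (c y + y * low₁ y) ≡⟨ cong (w y * y ^ suc n +_) (q y) ⟨
      w y * y ^ suc n + low y             ≡⟨ h y ⟩
      0#                                  ≡⟨ zeroʳ y ⟨
      y * 0#                              ∎)
      where open import Data.Integer as ℤ using ()

  -- `t` is the coefficient of Y^P and `low` collects the smaller powers. That `t` does not vanish
  -- is demanded separately, so that tops multiply without case distinctions.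
  HasTop : (Fun → Set) → Fun → ℕ → Fun → Fun → Set
  HasTop C Y P f t = ∃ λ low → C t × Blk C Y P low × (∀ y → f y ≡ t y * Y y ^ P + low y)

  HasTop-ext : ∀ {C Y P f g t} → (∀ y → g y ≡ f y) → HasTop C Y P f t → HasTop C Y P g t
  HasTop-ext h (low , ct , bl , p) = low , ct , bl , λ y → trans (h y) (p y)

  HasTop-add-low : ∀ {C Y P f t h} → Closed C → HasTop C Y P f t → Blk C Y P h → HasTop C Y P (λ y → f y + h y) t
  HasTop-add-low {h = h} cl (low , ct , bl , p) b =
    (λ y → low y + h y) , ct , Blk-+ cl bl b , λ y → trans (cong (_+ h y) (p y)) (+-assoc _ _ _)

  module _ {C₁ C₂ C₃ : Fun → Set} {Y : Fun} (cl₂ : Closed C₂) (cl₃ : Closed C₃)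
           (mul : ∀ {c d} → C₁ c → C₂ d → C₃ (λ y → c y * d y)) where

    HasTop-mul : ∀ {P P′ f g t s} → HasTop C₁ Y P f t → HasTop C₂ Y P′ g s →
      HasTop C₃ Y (P ℕ.+ P′) (λ y → f y * g y) (λ y → t y * s y)
    HasTop-mul {P} {P′} {f} {g} {t} {s} (low , ct , bl , p) (low′ , cs , bl′ , p′) =
      (λ y → (Y y ^ P * (t y * low′ y)) + low y * g y) , mul ct cs ,
      Blk-+ cl₃ (Blk-shift cl₃ P (Blk-mulC cl₃ mul ct bl′))
        (Blk-ext (λ y → trans (cong (low y *_) (p′ y)) (solve 4 (λ l s YP l′ → l :* (s :* YP :+ l′) := YP :* (l :* s) :+ l :* l′) refl (low y) (s y) (Y y ^ P′) (low′ y)))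
          (Blk-+ cl₃ (Blk-cast (ℕP.+-comm P′ P) (Blk-shift cl₃ P′ (Blk-mulC′ bl cs)))
                     (Blk-mul cl₃ mul bl bl′))) ,
      λ y → begin
        f y * g y                                 ≡⟨ cong (_* g y) (p y) ⟩
        (t y * Y y ^ P + low y) * g y             ≡⟨ solve 4 (λ t YP l g → (t :* YP :+ l) :* g := t :* YP :* g :+ l :* g) refl (t y) (Y y ^ P) (low y) (g y) ⟩
        t y * Y y ^ P * g y + low y * g y         ≡⟨ cong (λ u → t y * Y y ^ P * u + low y * g y) (p′ y) ⟩
        t y * Y y ^ P * (s y * Y y ^ P′ + low′ y) + low y * g y
          ≡⟨ solve 6 (λ t YP s YP′ l lg → t :* YP :* (s :* YP′ :+ l) :+ lg := t :* s :* (YP :* YP′) :+ (YP :* (t :* l) :+ lg)) refl (t y) (Y y ^ P) (s y) (Y y ^ P′) (low′ y) (low y * g y) ⟩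
        t y * s y * (Y y ^ P * Y y ^ P′) + ((Y y ^ P * (t y * low′ y)) + low y * g y)
          ≡⟨ cong (λ u → t y * s y * u + ((Y y ^ P * (t y * low′ y)) + low y * g y)) (^-homo-* (Y y) P P′) ⟨
        t y * s y * Y y ^ (P ℕ.+ P′) + ((Y y ^ P * (t y * low′ y)) + low y * g y) ∎
      where
      Blk-mulC′ : ∀ {P d l} → Blk C₁ Y P l → C₂ d → Blk C₃ Y P (λ y → l y * d y)
      Blk-mulC′ {d = d} (nil q) c = nil (λ y → trans (cong (_* d y) (q y)) (zeroˡ _))
      Blk-mulC′ {d = d} (cons {c = e} {h} x b q) c = cons (mul x c) (Blk-mulC′ b c) (λ y →
        trans (cong (_* d y) (q y)) (solve 4 (λ c Y g d → (c :+ Y :* g) :* d := c :* d :+ Y :* (g :* d)) refl (e y) (Y y) (h y) (d y)))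

  module _ {C : Fun → Set} {Y : Fun} (cl : Closed C) where

    -- Passes over vanishing coefficients from above; vanishing is decidable because the field is
    -- finite.
    HasTop-exists : ∀ {P f} → Blk C Y P f → f ≗0 ⊎ (∃₂ λ P′ t → P′ ℕ.< P × HasTop C Y P′ f t × ¬ t ≗0)
    HasTop-exists (nil p) = inj₁ p
    HasTop-exists (cons {f = f} {c} {g} cc b p) with HasTop-exists b
    ... | inj₂ (P′ , t , l , (low , ct , bl , q) , t≢0) = inj₂ (suc P′ , t , s≤s l ,
          ((λ y → c y + Y y * low y) , ct , cons cc bl (λ _ → refl) , λ y →
            trans (p y) (trans (cong (λ u → c y + Y y * u) (q y))
              (solve 5 (λ c Y t YP l → c :+ Y :* (t :* YP :+ l) := t :* (Y :* YP) :+ (c :+ Y :* l)) refl (c y) (Y y) (t y) (Y y ^ P′) (low y)))) , t≢0)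
    ... | inj₁ g≗0 with c ≗0?
    ...   | yes c≗0 = inj₁ (λ y → trans (f≡c y) (c≗0 y))
      where
      f≡c : ∀ y → f y ≡ c y
      f≡c y = trans (p y) (trans (cong (λ u → c y + Y y * u) (g≗0 y)) (trans (cong (c y +_) (zeroʳ _)) (+-identityʳ _)))
    ...   | no c≢0  = inj₂ (0 , c , s≤s z≤n , ((λ _ → 0#) , cc , nil (λ _ → refl) ,
            λ y → trans (p y) (trans (cong (λ u → c y + Y y * u) (g≗0 y)) (cong₂ _+_ (sym (*-identityʳ _)) (zeroʳ _)))) , c≢0)

    HasTop⇒Blk : ∀ {P f t} → HasTop C Y P f t → Blk C Y (suc P) f
    HasTop⇒Blk {P} {f} {t} (low , ct , bl , p) = Blk-ext (λ y → trans (p y) (cong (_+ low y) (*-comm _ _)))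
      (Blk-+ cl (Blk-cast (ℕP.+-comm P 1) (Blk-shift cl P (Blk-C cl ct))) (Blk-weaken cl (ℕP.n≤1+n P) bl))

    -- `Bound P` expresses that P is small enough for a function to determine its term of index P.
    -- Given this, leading terms are well defined, for ordinary degrees and for expansions in powers
    -- of y^r alike.
    module Unique-top (Bound : ℕ → Set)
      (top-zero : ∀ {P low t} → Bound P → C t → Blk C Y P low → (∀ y → t y * Y y ^ P + low y ≡ 0#) → t ≗0) where

      HasTop-nonzero : ∀ {P f t} → Bound P → HasTop C Y P f t → ¬ t ≗0 → ¬ f ≗0
      HasTop-nonzero bd (low , ct , bl , p) t≢0 f≗0 = t≢0 (top-zero bd ct bl (λ y → trans (sym (p y)) (f≗0 y)))

      HasTop-¬Blk : ∀ {P f t} → Bound P → HasTop C Y P f t → ¬ t ≗0 → ¬ Blk C Y P f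
      HasTop-¬Blk {f = f} bd (low , ct , bl , p) t≢0 b = t≢0 (top-zero bd ct (Closed.subᶜ (Blk-closed cl _) bl b)
        (λ y → trans (sym (+-assoc _ _ _)) (≡⇒-≡0 (sym (p y)))))

      HasTop-unique : ∀ {P P′ f t s} → Bound P → Bound P′ → HasTop C Y P f t → HasTop C Y P′ f s → ¬ t ≗0 → ¬ s ≗0 →
        P ≡ P′ × (∀ y → t y ≡ s y)
      HasTop-unique {P} {P′} bd bd′ T S t≢0 s≢0 with ℕP.<-cmp P P′
      ... | tri< l _ _ = contradiction (Blk-weaken cl l (HasTop⇒Blk T)) (HasTop-¬Blk bd′ S s≢0)
      ... | tri> _ _ l = contradiction (Blk-weaken cl l (HasTop⇒Blk S)) (HasTop-¬Blk bd T t≢0)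
      HasTop-unique {P} {f = f} {t} {s} bd bd′ (low , ct , bl , p) (low′ , cs , bl′ , p′) t≢0 s≢0 | tri≈ _ refl _ =
        refl , λ y → -≡0⇒≡ (top-zero bd (Closed.subᶜ cl ct cs) (Closed.subᶜ (Blk-closed cl _) bl bl′) (λ y → begin
          (t y - s y) * Y y ^ P + (low y - low′ y)                    ≡⟨ solve 5 (λ t s YP l l′ → (t :- s) :* YP :+ (l :- l′) := (t :* YP :+ l) :- (s :* YP :+ l′)) refl (t y) (s y) (Y y ^ P) (low y) (low′ y) ⟩
          (t y * Y y ^ P + low y) - (s y * Y y ^ P + low′ y)          ≡⟨ ≡⇒-≡0 (trans (sym (p y)) (p′ y)) ⟩
          0#                                                          ∎) y)

  private
    X : Fun
    X y = y

    degree-top-zero : ∀ {P low t} → P ℕ.< order → IsConst t → IsPoly P low → (∀ y → t y * y ^ P + low y ≡ 0#) → t ≗0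
    degree-top-zero {P} bd ct bl = poly-top-zero bl (Blk-C const-closed ct) (subst (ℕ._≤ order) (ℕP.+-comm 1 P) bd)

    block-top-zero : ∀ r {P low t} → P ℕ.* r ℕ.+ r ℕ.≤ order → IsPoly r t → Blk (IsPoly r) (_^ r) P low →
      (∀ y → t y * (y ^ r) ^ P + low y ≡ 0#) → t ≗0
    block-top-zero r {P} {low} {t} bd ct bl h = poly-top-zero (poly-blocks bl) ct bd (λ y →
      trans (cong (λ u → t y * u + low y) (trans (cong (y ^_) (ℕP.*-comm P r)) (sym (^-assocʳ y r P)))) (h y))

    BlockBound : ℕ → ℕ → Set
    BlockBound r P = P ℕ.* r ℕ.+ r ℕ.≤ order

  module Degree = Unique-top {Y = X} const-closed (ℕ._< order) degree-top-zero

  module BlockDegree (r : ℕ) = Unique-top {Y = _^ r} (poly-closed r) (BlockBound r) (block-top-zero r)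

  poly-split : ∀ {N f} → IsPoly (suc N) f → ∃₂ λ a ψ → IsPoly N ψ × (∀ y → f y ≡ a + y * ψ y)
  poly-split (cons {c = c} {g} (a , h) b q) = a , g , b , λ y → trans (q y) (cong (_+ y * g y) (h y))

  -- Gaussian elimination on the constant coefficients: a nonzero one is the pivot, and after
  -- subtraction, or if all of them vanish, a factor y comes out. Length 0 means that all functions
  -- are zero, where any nonzero vector will do.
  poly-kernel : ∀ N {n} (φ : Fin n → Fun) → (∀ i → IsPoly N (φ i)) → N ℕ.< n →
    ∃ λ (v : Fin n → Carrier) → (∃ λ i → v i ≢ 0#) × (∀ y → sum (λ i → v i * φ i y) ≡ 0#)
  poly-kernel zero {suc n} φ p _ = (λ _ → 1#) , (Fin.zero , 1≢0) , λ y → zero-sum (λ i → trans (*-identityˡ _) (nil-zero (p i) y))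
    where
    nil-zero : ∀ {f} → IsPoly 0 f → f ≗0
    nil-zero (nil q) = q
    zero-sum : ∀ {m} {t : Fin m → Carrier} → (∀ i → t i ≡ 0#) → sum t ≡ 0#
    zero-sum {zero}  h = refl
    zero-sum {suc m} h = trans (cong₂ _+_ (h Fin.zero) (zero-sum (λ i → h (Fin.suc i)))) (+-identityˡ 0#)
  poly-kernel (suc N) {suc n} φ p (s≤s l) with FinP.any? (λ i → ¬? (proj₁ (poly-split (p i)) ≟ 0#))
  ... | no none = v , v≢0 , λ y → trans (sum-cong-≋ (λ i → trans (cong (v i *_) (φ≡ i y)) (solve 3 (λ v y ψ → v :* (y :* ψ) := y :* (v :* ψ)) refl (v i) y (ψ i y))))
      (trans (sym (*-distribˡ-sum y (λ i → v i * ψ i y))) (trans (cong (y *_) (hv y)) (zeroʳ y)))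
    where
    ψ : Fin (suc n) → Fun
    ψ i = proj₁ (proj₂ (poly-split (p i)))
    φ≡ : ∀ i y → φ i y ≡ y * ψ i y
    φ≡ i y with proj₁ (poly-split (p i)) ≟ 0#
    ... | yes r = trans (proj₂ (proj₂ (proj₂ (poly-split (p i)))) y) (trans (cong (_+ y * ψ i y) r) (+-identityˡ _))
    ... | no r  = contradiction (i , r) none
    IH = poly-kernel N ψ (λ i → proj₁ (proj₂ (proj₂ (poly-split (p i))))) (ℕP.m≤n⇒m≤1+n l)
    v = proj₁ IH
    v≢0 = proj₁ (proj₂ IH)
    hv = proj₂ (proj₂ IH)
  ... | yes (j , c≢0) = v , (punchIn j (proj₁ v′≢0) , λ q → proj₂ v′≢0 (trans (sym (insertAt-punchIn v′ j x (proj₁ v′≢0))) q)) , eq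
    where
    c : Fin (suc n) → Carrier
    c i = proj₁ (poly-split (p i))
    ψ : Fin (suc n) → Fun
    ψ i = proj₁ (proj₂ (poly-split (p i)))
    ψ-poly : ∀ i → IsPoly N (ψ i)
    ψ-poly i = proj₁ (proj₂ (proj₂ (poly-split (p i))))
    φ≡ : ∀ i y → φ i y ≡ c i + y * ψ i y
    φ≡ i = proj₂ (proj₂ (proj₂ (poly-split (p i))))
    m : Fin n → Carrier
    m i = c (punchIn j i) * c j ⁻¹
    ψ′ : Fin n → Fun
    ψ′ i y = ψ (punchIn j i) y - m i * ψ j y
    IH = poly-kernel N ψ′ (λ i → Closed.subᶜ (poly-closed N) (ψ-poly (punchIn j i)) (Closed.scale (poly-closed N) (m i) (ψ-poly j))) l
    v′ = proj₁ IH
    v′≢0 = proj₁ (proj₂ IH)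
    x : Carrier
    x = sum (λ i → v′ i * - m i)
    v : Fin (suc n) → Carrier
    v = insertAt v′ j x
    eq : ∀ y → sum (λ i → v i * φ i y) ≡ 0#
    eq y = begin
      sum (λ i → v i * φ i y)                                         ≡⟨ sum-remove {i = j} (λ i → v i * φ i y) ⟩
      v j * φ j y + sum (λ i → v (punchIn j i) * φ (punchIn j i) y)   ≡⟨ cong₂ _+_ (trans (cong (_* φ j y) (insertAt-lookup v′ j x)) (trans (*-comm x _) (*-distribˡ-sum (φ j y) (λ i → v′ i * - m i))))
                                                                           (sum-cong-≋ (λ i → cong (_* φ (punchIn j i) y) (insertAt-punchIn v′ j x i))) ⟩
      sum (λ i → φ j y * (v′ i * - m i)) + sum (λ i → v′ i * φ (punchIn j i) y) ≡⟨ ∑-distrib-+ (λ i → φ j y * (v′ i * - m i)) (λ i → v′ i * φ (punchIn j i) y) ⟨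
      sum (λ i → φ j y * (v′ i * - m i) + v′ i * φ (punchIn j i) y)   ≡⟨ sum-cong-≋ step ⟩
      sum (λ i → y * (v′ i * ψ′ i y))                                 ≡⟨ *-distribˡ-sum y (λ i → v′ i * ψ′ i y) ⟨
      y * sum (λ i → v′ i * ψ′ i y)                                   ≡⟨ cong (y *_) (proj₂ (proj₂ IH) y) ⟩
      y * 0#                                                          ≡⟨ zeroʳ y ⟩
      0#                                                              ∎
      where
      step : ∀ i → φ j y * (v′ i * - m i) + v′ i * φ (punchIn j i) y ≡ y * (v′ i * ψ′ i y)
      step i = begin
        φ j y * (v′ i * - m i) + v′ i * φ (punchIn j i) y
          ≡⟨ cong₂ (λ u w → u * (v′ i * - m i) + v′ i * w) (φ≡ j y) (φ≡ (punchIn j i) y) ⟩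
        (c j + y * ψ j y) * (v′ i * - (cᵢ * c j ⁻¹)) + v′ i * (cᵢ + y * ψ (punchIn j i) y)
          ≡⟨ solve 7 (λ cj y ψj v ci cj⁻ ψi → (cj :+ y :* ψj) :* (v :* :- (ci :* cj⁻)) :+ v :* (ci :+ y :* ψi)
               := (v :* ci) :* (:# 1 :- cj :* cj⁻) :+ y :* (v :* (ψi :- ci :* cj⁻ :* ψj))) refl (c j) y (ψ j y) (v′ i) cᵢ (c j ⁻¹) (ψ (punchIn j i) y) ⟩
        (v′ i * cᵢ) * (1# - c j * c j ⁻¹) + y * (v′ i * ψ′ i y)
          ≡⟨ cong (λ u → (v′ i * cᵢ) * u + y * (v′ i * ψ′ i y)) (≡⇒-≡0 (sym (inverseʳ c≢0))) ⟩
        (v′ i * cᵢ) * 0# + y * (v′ i * ψ′ i y)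
          ≡⟨ trans (cong (_+ y * (v′ i * ψ′ i y)) (zeroʳ _)) (+-identityˡ _) ⟩
        y * (v′ i * ψ′ i y) ∎
        where
        cᵢ = c (punchIn j i)

-- The polynomial L² - e is not a square

module NonSquare (F : FiniteField) where
  open import Data.Nat as ℕ using (ℕ; suc; z≤n; s≤s)
  import Data.Nat.Properties as ℕP
  open import Data.Empty using (⊥)
  open import Data.Product using (∃₂; _×_; _,_; proj₁; proj₂)
  open import Data.Sum using (_⊎_; inj₁; inj₂)
  open import Relation.Nullary using (¬_; contradiction)
  open import Relation.Binary.PropositionalEquality using (_≡_; _≢_; refl; sym; trans; cong; cong₂; subst; module ≡-Reasoning)
  open Field F
  open Polynomials F
  open ≡-Reasoning

  PolyTop : ℕ → Fun → Fun → Set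
  PolyTop = HasTop IsConst (λ y → y)

  polyTop-mul : ∀ {P P′ f g t s} → PolyTop P f t → PolyTop P′ g s → PolyTop (P ℕ.+ P′) (λ y → f y * g y) (λ y → t y * s y)
  polyTop-mul = HasTop-mul const-closed const-closed const-mul

  polyTop-scale : ∀ {P f t} c → PolyTop P f t → PolyTop P (λ y → c * f y) (λ y → c * t y)
  polyTop-scale c T = polyTop-mul ((λ _ → 0#) , (c , λ _ → refl) , nil (λ _ → refl) , λ y → sym (trans (+-identityʳ _) (*-identityʳ c))) T

  polyTop⇒poly : ∀ {P f t} → PolyTop P f t → IsPoly (suc P) f
  polyTop⇒poly = HasTop⇒Blk const-closed

  const-mul-nonzero : ∀ {t s} → IsConst t → IsConst s → ¬ t ≗0 → ¬ s ≗0 → ¬ (λ y → t y * s y) ≗0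
  const-mul-nonzero (a , p) (b , q) t≢0 s≢0 h with *-zero-split (trans (sym (cong₂ _*_ (p 0#) (q 0#))) (h 0#))
  ... | inj₁ r = t≢0 (λ y → trans (p y) r)
  ... | inj₂ r = s≢0 (λ y → trans (q y) r)

  top-const : ∀ {P f t} → PolyTop P f t → IsConst t
  top-const T = proj₁ (proj₂ T)

  poly-mul-nonzero : ∀ {n m f g} → IsPoly n f → IsPoly m g → n ℕ.+ m ℕ.≤ order → ¬ f ≗0 → ¬ g ≗0 → ¬ (λ y → f y * g y) ≗0
  poly-mul-nonzero p q l f≢0 g≢0 with HasTop-exists const-closed p | HasTop-exists const-closed q
  ... | inj₁ r | _ = contradiction r f≢0
  ... | inj₂ _ | inj₁ r = contradiction r g≢0
  ... | inj₂ (P , t , P<n , T , t≢0) | inj₂ (P′ , s , P′<m , S , s≢0) =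
    Degree.HasTop-nonzero (ℕP.<-≤-trans (ℕP.+-mono-< P<n P′<m) l) (polyTop-mul T S)
      (const-mul-nonzero (top-const T) (top-const S) t≢0 s≢0)

  -- For e = 4a, `D` is the discriminant of s² - L s + a, the quadratic equation behind s + a/s = L.
  module ArtinSchreier {q} (2≤q : 2 ℕ.≤ q) (c e : Carrier) where

    L D one : Fun
    L y = y ^ q - y + c
    D y = L y * L y - e
    one _ = 1#

    one≢0 : ¬ one ≗0
    one≢0 h = 1≢0 (h 0#)

    L-top : PolyTop q L one
    L-top = (λ y → c - y) , (1# , λ _ → refl) ,
      poly-weaken 2≤q (cons (c , λ _ → refl) (poly-const (- 1#)) (λ y → solve 2 (λ c y → c :- y := c :+ y :* (:- :# 1)) refl c y)) ,
      λ y → solve 3 (λ p y c → p :- y :+ c := :# 1 :* p :+ (c :- y)) refl (y ^ q) y c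

    D-top : PolyTop (q ℕ.+ q) D (λ _ → 1# * 1#)
    D-top = HasTop-add-low const-closed (polyTop-mul L-top L-top)
      (Closed.negᶜ (poly-closed _) (poly-weaken (ℕP.≤-trans (ℕP.≤-trans (s≤s z≤n) 2≤q) (ℕP.m≤m+n q q)) (poly-const e)))

    D-nonzero : q ℕ.+ q ℕ.< order → ¬ D ≗0
    D-nonzero l = Degree.HasTop-nonzero l D-top (λ h → 1≢0 (trans (sym (*-identityˡ 1#)) (h 0#)))

  -- If α² = β²(L² - e) with β ≠ 0, then (α - Lβ)(α + Lβ) = -eβ², while one of the factors has the degree of Lβ;
  -- the other factor then has smaller degree than β and is the denominator of another representation of √(L² - e).
  module Descent (2≢0 : 2# ≢ 0#) {q L tL} (1≤q : 1 ℕ.≤ q) (TL : PolyTop q L tL) (tL≢0 : ¬ tL ≗0) {e} (e≢0 : e ≢ 0#)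
           {W} (2W≤ : W ℕ.+ W ℕ.≤ order) where

    D : Fun
    D y = L y * L y - e

    D-poly : IsPoly (suc (q ℕ.+ q)) D
    D-poly = Closed.subᶜ (poly-closed _) (polyTop⇒poly (polyTop-mul TL TL)) (poly-weaken (s≤s z≤n) (poly-const e))

    descent : ∀ n {b α β s} → b ℕ.< n → suc (q ℕ.+ q) ℕ.+ suc b ℕ.≤ W → IsPoly W α → PolyTop b β s → ¬ s ≗0 →
      ¬ (∀ y → α y * α y ≡ β y * β y * D y)
    descent (suc n) {b} {α} {β} {s} (s≤s b≤n) bW pα Tβ s≢0 eq = go (HasTop-exists const-closed pβ₁) (HasTop-exists const-closed pβ₂)
      where
      β₁ β₂ : Fun
      β₁ y = α y - L y * β y
      β₂ y = α y + L y * β y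
      TLβ : PolyTop (q ℕ.+ b) (λ y → L y * β y) (λ y → tL y * s y)
      TLβ = polyTop-mul TL Tβ
      q+b<W : q ℕ.+ b ℕ.< W
      q+b<W = ℕP.≤-trans (ℕP.≤-trans (s≤s (ℕP.m≤n+m (q ℕ.+ b) (suc q))) (ℕP.≤-reflexive lem)) bW
        where
        lem : suc (suc q ℕ.+ (q ℕ.+ b)) ≡ suc (q ℕ.+ q) ℕ.+ suc b
        lem = cong suc (trans (cong suc (sym (ℕP.+-assoc q q b))) (sym (ℕP.+-suc (q ℕ.+ q) b)))
      b<W : b ℕ.< W
      b<W = ℕP.≤-<-trans (ℕP.m≤n+m b q) q+b<W
      W≤o : W ℕ.≤ order
      W≤o = ℕP.≤-trans (ℕP.m≤m+n W W) 2W≤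
      pLβ : IsPoly W (λ y → L y * β y)
      pLβ = poly-weaken q+b<W (polyTop⇒poly TLβ)
      pβ₁ = Closed.subᶜ (poly-closed W) pα pLβ
      pβ₂ = Closed.addᶜ (poly-closed W) pα pLβ
      prod : ∀ y → β₁ y * β₂ y ≡ (- e) * (β y * β y)
      prod y = begin
        β₁ y * β₂ y                                   ≡⟨ solve 2 (λ α x → (α :- x) :* (α :+ x) := α :* α :- x :* x) refl (α y) (L y * β y) ⟩
        α y * α y - L y * β y * (L y * β y)           ≡⟨ cong (_- L y * β y * (L y * β y)) (eq y) ⟩
        β y * β y * (L y * L y - e) - L y * β y * (L y * β y) ≡⟨ solve 3 (λ β L e → β :* β :* (L :* L :- e) :- L :* β :* (L :* β) := (:- e) :* (β :* β)) refl (β y) (L y) e ⟩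
        (- e) * (β y * β y)                           ∎
      Tββ : PolyTop (b ℕ.+ b) (λ y → β₁ y * β₂ y) (λ y → (- e) * (s y * s y))
      Tββ = HasTop-ext prod (polyTop-scale (- e) (polyTop-mul Tβ Tβ))
      tββ≢0 : ¬ (λ y → (- e) * (s y * s y)) ≗0
      tββ≢0 = const-mul-nonzero {λ _ → - e} (- e , λ _ → refl) (const-mul (top-const Tβ) (top-const Tβ))
        (λ h → neg-nonzero e≢0 (h 0#)) (const-mul-nonzero (top-const Tβ) (top-const Tβ) s≢0 s≢0)
      2b<o : b ℕ.+ b ℕ.< order
      2b<o = ℕP.<-≤-trans (ℕP.+-mono-< b<W b<W) 2W≤
      ββ≢0 : ¬ (λ y → β₁ y * β₂ y) ≗0
      ββ≢0 = Degree.HasTop-nonzero 2b<o Tββ tββ≢0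
      pα′ : ∀ c → IsPoly W (λ y → D y * β y + c * (L y * α y))
      pα′ c = Closed.addᶜ (poly-closed W) (poly-weaken bW (poly-mul D-poly (polyTop⇒poly Tβ)))
                (Closed.scale (poly-closed W) c (poly-weaken (ℕP.≤-trans (ℕP.≤-reflexive len) bW) (poly-mul (polyTop⇒poly TL) α-small)))
        where
        len : suc q ℕ.+ suc (q ℕ.+ b) ≡ suc (q ℕ.+ q) ℕ.+ suc b
        len = cong suc (trans (ℕP.+-suc q (q ℕ.+ b)) (trans (cong suc (sym (ℕP.+-assoc q q b))) (sym (ℕP.+-suc (q ℕ.+ q) b))))
        -- α² = β² D makes twice the degree of α equal to 2b + 2q, unless α vanishes.
        α-small : IsPoly (suc (q ℕ.+ b)) α
        α-small with HasTop-exists const-closed pα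
        ... | inj₁ α≗0 = Blk-ext α≗0 (Blk-zero const-closed _)
        ... | inj₂ (P , t , P<W , T , t≢0) = subst (λ n → IsPoly (suc n) α) (halve P≡) (polyTop⇒poly T)
          where
          TD : PolyTop (q ℕ.+ q) D (λ y → tL y * tL y)
          TD = HasTop-add-low const-closed (polyTop-mul TL TL)
            (Closed.negᶜ (poly-closed _) (poly-weaken (ℕP.≤-trans 1≤q (ℕP.m≤m+n q q)) (poly-const e)))
          TβD : PolyTop (b ℕ.+ b ℕ.+ (q ℕ.+ q)) (λ y → α y * α y) (λ y → s y * s y * (tL y * tL y))
          TβD = HasTop-ext eq (polyTop-mul (polyTop-mul Tβ Tβ) TD)
          shuffle : b ℕ.+ b ℕ.+ (q ℕ.+ q) ≡ (q ℕ.+ b) ℕ.+ (q ℕ.+ b)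
          shuffle = ℕS.solve 2 (λ b q → b ℕS.:+ b ℕS.:+ (q ℕS.:+ q) ℕS.:= (q ℕS.:+ b) ℕS.:+ (q ℕS.:+ b)) refl b q
            where
            open import Data.Nat.Solver using (module +-*-Solver)
            module ℕS = +-*-Solver
          P≡ : P ℕ.+ P ≡ (q ℕ.+ b) ℕ.+ (q ℕ.+ b)
          P≡ = trans (proj₁ (Degree.HasTop-unique (ℕP.<-≤-trans (ℕP.+-mono-< P<W P<W) 2W≤)
                 (subst (ℕ._< order) (sym shuffle) (ℕP.<-≤-trans (ℕP.+-mono-< q+b<W q+b<W) 2W≤))
                 (polyTop-mul T T) TβD (const-mul-nonzero (top-const T) (top-const T) t≢0 t≢0)
                 (const-mul-nonzero (const-mul (top-const Tβ) (top-const Tβ)) (const-mul (top-const TL) (top-const TL))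
                   (const-mul-nonzero (top-const Tβ) (top-const Tβ) s≢0 s≢0) (const-mul-nonzero (top-const TL) (top-const TL) tL≢0 tL≢0)))) shuffle
          halve : ∀ {x y} → x ℕ.+ x ≡ y ℕ.+ y → x ≡ y
          halve {x} {y} h = ℕP.*-cancelˡ-≡ x y 2 (trans (cong (x ℕ.+_) (ℕP.+-identityʳ x)) (trans h (cong (y ℕ.+_) (sym (ℕP.+-identityʳ y)))))
      -- Multiplying α + β √D by c L + √D gives (D β + c L α) + (α + c L β) √D. Norms multiply, so
      -- α² - β² D = 0 is inherited, and γ = α + c L β is the new coefficient of √D.
      recurse : ∀ {γ P t} c → c * c ≡ 1# → (∀ y → γ y ≡ α y + c * (L y * β y)) → P ℕ.< b → PolyTop P γ t → ¬ t ≗0 → ⊥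
      recurse {γ} {P} c c² γ≡ P<b T t≢0 = descent n (ℕP.<-≤-trans P<b b≤n)
        (ℕP.≤-trans (ℕP.+-monoʳ-≤ (suc (q ℕ.+ q)) (s≤s (ℕP.<⇒≤ P<b))) bW) (pα′ c) T t≢0 (λ y → begin
          (D y * β y + c * (L y * α y)) * (D y * β y + c * (L y * α y))
            ≡⟨ binomial (D y * β y) (L y * α y) ⟩
          D y * β y * (D y * β y) + (c + c) * (D y * β y * (L y * α y)) + c * c * (L y * α y * (L y * α y))
            ≡⟨ cong₂ (λ u v → u + (c + c) * (D y * β y * (L y * α y)) + c * c * v)
                 (solve 2 (λ D β → D :* β :* (D :* β) := D :* (β :* β :* D)) refl (D y) (β y))
                 (solve 2 (λ L α → L :* α :* (L :* α) := L :* L :* (α :* α)) refl (L y) (α y)) ⟩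
          D y * (β y * β y * D y) + (c + c) * (D y * β y * (L y * α y)) + c * c * (L y * L y * (α y * α y))
            ≡⟨ cong₂ (λ u v → D y * u + (c + c) * (D y * β y * (L y * α y)) + c * c * (L y * L y * v)) (sym (eq y)) (eq y) ⟩
          D y * (α y * α y) + (c + c) * (D y * β y * (L y * α y)) + c * c * (L y * L y * (β y * β y * D y))
            ≡⟨ cong₂ (λ u v → D y * (α y * α y) + (c + c) * u + c * c * v)
                 (solve 4 (λ D β L α → D :* β :* (L :* α) := D :* (α :* (L :* β))) refl (D y) (β y) (L y) (α y))
                 (solve 3 (λ L β D → L :* L :* (β :* β :* D) := D :* (L :* β :* (L :* β))) refl (L y) (β y) (D y)) ⟩
          D y * (α y * α y) + (c + c) * (D y * (α y * (L y * β y))) + c * c * (D y * (L y * β y * (L y * β y)))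
            ≡⟨ factor (D y) (α y * α y) (α y * (L y * β y)) (L y * β y * (L y * β y)) ⟩
          (α y * α y + (c + c) * (α y * (L y * β y)) + c * c * (L y * β y * (L y * β y))) * D y
            ≡⟨ cong (_* D y) (binomial (α y) (L y * β y)) ⟨
          (α y + c * (L y * β y)) * (α y + c * (L y * β y)) * D y
            ≡⟨ cong (λ u → u * u * D y) (γ≡ y) ⟨
          γ y * γ y * D y ∎)
        where
        binomial : ∀ x z → (x + c * z) * (x + c * z) ≡ x * x + (c + c) * (x * z) + c * c * (z * z)
        binomial x z = solve 3 (λ x c z → (x :+ c :* z) :* (x :+ c :* z) := x :* x :+ (c :+ c) :* (x :* z) :+ c :* c :* (z :* z)) refl x c z
        factor : ∀ d x z w → d * x + (c + c) * (d * z) + c * c * (d * w) ≡ (x + (c + c) * z + c * c * w) * d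
        factor d x z w = solve 6 (λ d x z w e f → d :* x :+ e :* (d :* z) :+ f :* (d :* w) := (x :+ e :* z :+ f :* w) :* d) refl d x z w (c + c) (c * c)
      NonzeroTop : Fun → Set
      NonzeroTop f = ∃₂ λ P t → P ℕ.< W × PolyTop P f t × ¬ t ≗0
      go : β₁ ≗0 ⊎ NonzeroTop β₁ → β₂ ≗0 ⊎ NonzeroTop β₂ → ⊥
      go (inj₁ h) _ = ββ≢0 (λ y → trans (cong (_* β₂ y) (h y)) (zeroˡ _))
      go (inj₂ _) (inj₁ h) = ββ≢0 (λ y → trans (cong (β₁ y *_) (h y)) (zeroʳ _))
      go (inj₂ (d₁ , t₁ , d₁<W , T₁ , t₁≢0)) (inj₂ (d₂ , t₂ , d₂<W , T₂ , t₂≢0)) = cases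
        where
        d₁+d₂ : d₁ ℕ.+ d₂ ≡ b ℕ.+ b
        d₁+d₂ = proj₁ (Degree.HasTop-unique (ℕP.<-≤-trans (ℕP.+-mono-< d₁<W d₂<W) 2W≤) 2b<o (polyTop-mul T₁ T₂) Tββ
          (const-mul-nonzero (top-const T₁) (top-const T₂) t₁≢0 t₂≢0) tββ≢0)
        other-small : ∀ {d d′} → d ℕ.+ d′ ≡ b ℕ.+ b → q ℕ.+ b ℕ.≤ d′ → d ℕ.< b
        other-small {d} {d′} h l = ℕP.+-cancelʳ-≤ b (suc d) b (ℕP.≤-trans
          (ℕP.≤-trans (ℕP.≤-reflexive (sym (ℕP.+-suc d b))) (ℕP.+-monoʳ-≤ d (ℕP.≤-trans (ℕP.+-monoˡ-≤ b 1≤q) l))) (ℕP.≤-reflexive h))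
        diff : ∀ y → 2# * (L y * β y) ≡ β₂ y - β₁ y
        diff y = solve 2 (λ α x → (:# 1 :+ :# 1) :* x := (α :+ x) :- (α :- x)) refl (α y) (L y * β y)
        -- 2 L β = β₂ - β₁ has degree q + b, so one factor has at least this degree. The degrees of
        -- the factors add up to 2b, which leaves less than b for the other one.
        cases : ⊥
        cases with ℕP.≤-<-connex (q ℕ.+ b) d₁ | ℕP.≤-<-connex (q ℕ.+ b) d₂
        ... | inj₁ h | _ = recurse 1# (*-identityˡ 1#) (λ y → cong (α y +_) (sym (*-identityˡ _))) (other-small (trans (ℕP.+-comm d₂ d₁) d₁+d₂) h) T₂ t₂≢0
        ... | inj₂ _ | inj₁ h = recurse (- 1#) (solve 0 ((:- :# 1) :* (:- :# 1) := :# 1) refl)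
                (λ y → solve 2 (λ α x → α :- x := α :+ (:- :# 1) :* x) refl (α y) (L y * β y)) (other-small d₁+d₂ h) T₁ t₁≢0
        ... | inj₂ h₁ | inj₂ h₂ = Degree.HasTop-¬Blk (ℕP.<-≤-trans q+b<W W≤o) (polyTop-scale 2# TLβ)
                (const-mul-nonzero {λ _ → 2#} (2# , λ _ → refl) (const-mul (top-const TL) (top-const Tβ)) (λ h → 2≢0 (h 0#))
                  (const-mul-nonzero (top-const TL) (top-const Tβ) tL≢0 s≢0))
                (Blk-ext diff (Closed.subᶜ (poly-closed _) (poly-weaken h₂ (polyTop⇒poly T₂)) (poly-weaken h₁ (polyTop⇒poly T₁))))

    not-square : ∀ {n α β} → suc (q ℕ.+ q) ℕ.+ n ℕ.≤ W → IsPoly n α → IsPoly n β → ¬ β ≗0 → ¬ (∀ y → α y * α y ≡ β y * β y * D y)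
    not-square {n} nW pα pβ β≢0 with HasTop-exists const-closed pβ
    ... | inj₁ h = contradiction h β≢0
    ... | inj₂ (b , s , b<n , T , s≢0) = descent n b<n (ℕP.≤-trans (ℕP.+-monoʳ-≤ (suc (q ℕ.+ q)) b<n) nW)
            (poly-weaken (ℕP.≤-trans (ℕP.m≤n+m n (suc (q ℕ.+ q))) nW) pα) T s≢0

-- Numerical inequalities for Stepanov's method

module StepanovParameters where
  open import Data.Nat
  open import Data.Nat.Properties
  open import Data.Nat.Solver using (module +-*-Solver)
  open +-*-Solver
  open import Relation.Nullary using (yes; no)
  open import Data.Empty using (⊥-elim)
  open import Data.Product using (∃; _,_)
  open import Relation.Binary.PropositionalEquality using (_≡_; refl; sym; trans; cong; cong₂; subst)

  -- R = 2l + 2q + 1 is the number of coefficients of β² D when β has l of them, so the product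
  -- fills exactly one block of length R. With m = l + 2q + 2 the 2 l m unknowns outnumber the
  -- equations as soon as l ≥ q² + q.
  module Parameters {q l : ℕ} (2≤q : 2 ≤ q) (q²≤l : q * q + q ≤ l) where

    M m R : ℕ
    M = l + q
    m = l + (q + q) + 2
    R = suc (M + M)

    1≤l : 1 ≤ l
    1≤l = ≤-trans (≤-trans (≤-trans (s≤s z≤n) 2≤q) (m≤n+m q (q * q))) q²≤l

    m≤R : m ≤ R
    m≤R = ≤-trans (+-monoʳ-≤ (l + (q + q)) (s≤s 1≤l))
      (≤-reflexive (solve 2 (λ l q → l :+ (q :+ q) :+ (con 1 :+ l) := con 1 :+ ((l :+ q) :+ (l :+ q))) refl l q))

    2l+D≡R : (l + l) + suc (q + q) ≡ R
    2l+D≡R = solve 2 (λ l q → (l :+ l) :+ (con 1 :+ (q :+ q)) := con 1 :+ ((l :+ q) :+ (l :+ q))) refl l q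

    1≤M : 1 ≤ M
    1≤M = ≤-trans 1≤l (m≤m+n l q)

    3≤R : 3 ≤ R
    3≤R = s≤s (+-mono-≤ 1≤M 1≤M)

    -- In powers of y^R the product B² D D^R has top index 2N + 2q. This keeps it within R³
    -- coefficients, a range in which functions over a field with R⁴ elements determine polynomials.
    blocks≤ : ∀ {N} → N < m → (N + N + (q + q)) * R + R ≤ R * R * R
    blocks≤ {N} N<m = ≤-trans (≤-reflexive (+-comm _ R)) (*-monoˡ-≤ R {suc (N + N + (q + q))} {R * R} (≤-trans step (*-monoˡ-≤ R 3≤R)))
      where
      step : suc (N + N + (q + q)) ≤ 3 * R
      step = ≤-trans (+-monoˡ-≤ (q + q) (≤-trans (+-monoʳ-≤ (suc N) (n≤1+n N)) (+-mono-≤ N<m N<m)))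
        (≤-trans (+-mono-≤ (+-mono-≤ m≤R m≤R) (≤-trans (+-mono-≤ (m≤n+m q l) (m≤n+m q l)) (n≤1+n (M + M))))
          (≤-reflexive (solve 1 (λ R → R :+ R :+ R := con 3 :* R) refl R)))

    mR≤ : m * R ≤ R * R * R
    mR≤ = *-monoˡ-≤ R {m} {R * R} (≤-trans m≤R (m≤m*n R R))

    2m≤ : m + m ≤ R * R * R
    2m≤ = ≤-trans (+-mono-≤ m≤R m≤R) (≤-trans (≤-trans (≤-reflexive (solve 1 (λ R → R :+ R := con 2 :* R) refl R))
      (*-monoˡ-≤ R {2} {R} (≤-trans (s≤s (s≤s z≤n)) 3≤R))) (m≤m*n (R * R) R))

    R≤R³ : R ≤ R * R * R
    R≤R³ = ≤-trans (m≤m*n R R) (m≤m*n (R * R) R)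

    -- Once the common terms are cancelled, what remains is 2 + 2 (q² + q) ≤ 3 l.
    unknowns> : l * R + suc (suc M * (q + q)) < l * m + l * m
    unknowns> = +-cancelʳ-≤ (2 * (q * q + q)) _ _ (≤-trans (≤-reflexive eq₁) (≤-trans small (≤-reflexive eq₂)))
      where
      T : ℕ
      T = 2 * l * l + 4 * l * q + l
      eq₁ : suc (l * R + suc (suc M * (q + q))) + 2 * (q * q + q) ≡ T + (2 + (2 * (q * q + q) + 2 * (q * q + q)))
      eq₁ = solve 2 (λ l q → con 1 :+ (l :* (con 1 :+ ((l :+ q) :+ (l :+ q))) :+ (con 1 :+ (con 1 :+ (l :+ q)) :* (q :+ q))) :+ con 2 :* (q :* q :+ q)
              := (con 2 :* l :* l :+ con 4 :* l :* q :+ l) :+ (con 2 :+ (con 2 :* (q :* q :+ q) :+ con 2 :* (q :* q :+ q)))) refl l q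
      eq₂ : T + (l + 2 * l + 2 * (q * q + q)) ≡ l * m + l * m + 2 * (q * q + q)
      eq₂ = solve 2 (λ l q → (con 2 :* l :* l :+ con 4 :* l :* q :+ l) :+ (l :+ con 2 :* l :+ con 2 :* (q :* q :+ q))
              := l :* (l :+ (q :+ q) :+ con 2) :+ l :* (l :+ (q :+ q) :+ con 2) :+ con 2 :* (q :* q :+ q)) refl l q
      2≤l : 2 ≤ l
      2≤l = ≤-trans (≤-trans 2≤q (m≤n+m q (q * q))) q²≤l
      small : T + (2 + (2 * (q * q + q) + 2 * (q * q + q))) ≤ T + (l + 2 * l + 2 * (q * q + q))
      small = +-monoʳ-≤ T (≤-trans (≤-reflexive (sym (+-assoc 2 (2 * (q * q + q)) (2 * (q * q + q)))))
        (+-monoˡ-≤ (2 * (q * q + q)) (+-mono-≤ 2≤l (*-monoʳ-≤ 2 q²≤l))))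

  odd-^ : ∀ {q k} → q ≡ suc (k + k) → ∀ n → ∃ λ M → q ^ n ≡ suc (M + M)
  odd-^ q≡ zero = 0 , refl
  odd-^ {q} {k} q≡ (suc n) with odd-^ {q} {k} q≡ n
  ... | M , p = M + k * suc (M + M) , trans (cong₂ _*_ q≡ p)
    (solve 2 (λ k M → (con 1 :+ (k :+ k)) :* (con 1 :+ (M :+ M)) := con 1 :+ ((M :+ k :* (con 1 :+ (M :+ M))) :+ (M :+ k :* (con 1 :+ (M :+ M))))) refl k M)

  -- Here the odd number R is given and l = (R - 1)/2 - q is computed from it; q⁴ ≤ R ensures l ≥ q²
  -- + q.
  module LargePower {q M R : ℕ} (3≤q : 3 ≤ q) (R≡ : R ≡ suc (M + M)) (q⁴≤R : q * q * (q * q) ≤ R) where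

    private
      2≤q : 2 ≤ q
      2≤q = ≤-trans (s≤s (s≤s z≤n)) 3≤q

      9≤q² : 9 ≤ q * q
      9≤q² = *-mono-≤ 3≤q 3≤q

      q≤q² : q ≤ q * q
      q≤q² = m≤m*n q q {{>-nonZero (≤-trans (s≤s z≤n) 3≤q)}}

      6q²≤R : 6 * (q * q) + suc q ≤ R
      6q²≤R = ≤-trans (+-monoʳ-≤ (6 * (q * q)) (≤-trans (+-mono-≤ (≤-trans (s≤s z≤n) 9≤q²) q≤q²) (m≤m+n (q * q + q * q) (q * q))))
        (≤-trans (≤-reflexive (solve 1 (λ x → con 6 :* x :+ (x :+ x :+ x) := con 9 :* x) refl (q * q))) (≤-trans (*-monoˡ-≤ (q * q) 9≤q²) q⁴≤R))

    4q≤3R : 4 * q ≤ 3 * R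
    4q≤3R = ≤-trans (≤-trans (*-monoʳ-≤ 4 q≤q²) (≤-trans (*-monoˡ-≤ (q * q) {4} {6} (s≤s (s≤s (s≤s (s≤s z≤n))))) (m≤m+n (6 * (q * q)) (suc q)))) (≤-trans 6q²≤R (m≤m+n R (2 * R)))

    2q<R : q + q < R
    2q<R = ≤-trans (s≤s (+-mono-≤ q≤q² q≤q²)) (≤-trans (≤-trans (s≤s (≤-trans (≤-reflexive (solve 1 (λ x → x :+ x := con 2 :* x) refl (q * q))) (*-monoˡ-≤ (q * q) {2} {6} (s≤s (s≤s z≤n)))))
      (≤-trans (≤-reflexive (+-comm 1 (6 * (q * q)))) (+-monoʳ-≤ (6 * (q * q)) (s≤s z≤n)))) 6q²≤R)

    private
      double : ∀ {a b} → a + a ≤ suc (b + b) → a ≤ b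
      double {a} {b} h with a ≤? b
      ... | yes p = p
      ... | no p = ⊥-elim (<-irrefl refl (≤-trans (≤-trans (≤-reflexive (cong suc (sym (+-suc b b)))) (+-mono-≤ (≰⇒> p) (≰⇒> p))) h))

    q²+2q≤M : q * q + q + q ≤ M
    q²+2q≤M = double (≤-trans (≤-trans (≤-reflexive (solve 2 (λ x q → (x :+ q :+ q) :+ (x :+ q :+ q) := (x :+ x) :+ (q :+ q :+ q :+ q)) refl (q * q) q))
        (≤-trans (+-monoʳ-≤ (q * q + q * q) (+-mono-≤ (+-mono-≤ (+-mono-≤ q≤q² q≤q²) q≤q²) q≤q²)) (≤-reflexive (solve 1 (λ x → x :+ x :+ (x :+ x :+ x :+ x) := con 6 :* x) refl (q * q)))))
      (≤-trans (m≤m+n (6 * (q * q)) (suc q)) (≤-trans 6q²≤R (≤-reflexive R≡))))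

    l : ℕ
    l = M ∸ q

    M≡ : M ≡ l + q
    M≡ = sym (m∸n+n≡m (≤-trans (m≤n+m q (q * q + q)) q²+2q≤M))

    q²≤l : q * q + q ≤ l
    q²≤l = ≤-trans (≤-reflexive (sym (m+n∸n≡m (q * q + q) q))) (∸-monoˡ-≤ q q²+2q≤M)

    private module P = Parameters 2≤q q²≤l

    m : ℕ
    m = P.m

    R≡′ : R ≡ suc ((l + q) + (l + q))
    R≡′ = trans R≡ (cong (λ M → suc (M + M)) M≡)

    m≤R : m ≤ R
    m≤R = subst (m ≤_) (sym R≡′) P.m≤R

    l≤R : l ≤ R
    l≤R = subst (l ≤_) (sym R≡′) (≤-trans (≤-trans (m≤m+n l q) (m≤m+n (l + q) (l + q))) (n≤1+n _))

    2l+D≡R : (l + l) + suc (q + q) ≡ R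
    2l+D≡R = trans P.2l+D≡R (sym R≡′)

    m≡ : suc (q + q) + suc l ≡ m
    m≡ = solve 2 (λ q l → con 1 :+ (q :+ q) :+ (con 1 :+ l) := l :+ (q :+ q) :+ con 2) refl q l

    2m≡ : m + m ≡ R + (q + q + 3)
    2m≡ = trans (solve 2 (λ q l → (l :+ (q :+ q) :+ con 2) :+ (l :+ (q :+ q) :+ con 2) := con 1 :+ ((l :+ q) :+ (l :+ q)) :+ (q :+ q :+ con 3)) refl q l)
      (cong (_+ (q + q + 3)) (sym R≡′))

    blocks≤ : ∀ {N} → N < m → (N + N + (q + q)) * R + R ≤ R * R * R
    blocks≤ {N} N<m = subst (λ R → (N + N + (q + q)) * R + R ≤ R * R * R) (sym R≡′) (P.blocks≤ N<m)

    mR≤ : m * R ≤ R * R * R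
    mR≤ = subst (λ R → m * R ≤ R * R * R) (sym R≡′) P.mR≤

    2m≤ : m + m ≤ R * R * R
    2m≤ = subst (λ R → m + m ≤ R * R * R) (sym R≡′) P.2m≤

    R≤R³ : R ≤ R * R * R
    R≤R³ = subst (λ R → R ≤ R * R * R) (sym R≡′) P.R≤R³

    unknowns> : l * R + suc (suc (l + q) * (q + q)) < l * m + l * m
    unknowns> = subst (λ R → l * R + suc (suc (l + q) * (q + q)) < l * m + l * m) (sym R≡′) P.unknowns>

    -- As 2m = R + 2q + 3 and 2 (M + 1) = R + 1, the left side is at most R² + (4q + 3) R + 4q, and
    -- 4q ≤ 3R.
    point-bound : ∀ {z z₀} → z < m * R + suc (suc (l + q) * (q + q)) → z₀ ≤ q + q → z + z + z₀ ≤ R * R + (4 * q + 6) * R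
    point-bound {z} {z₀} z< z₀≤ = ≤-trans (+-mono-≤ (+-mono-≤ z≤′ z≤′) z₀≤) (≤-trans (≤-reflexive eq) (≤-trans (+-monoʳ-≤ (R * R + (4 * q + 3) * R) 4q≤3R)
        (≤-reflexive (solve 2 (λ R q → R :* R :+ (con 4 :* q :+ con 3) :* R :+ con 3 :* R := R :* R :+ (con 4 :* q :+ con 6) :* R) refl R q))))
      where
      z≤′ : z ≤ m * R + suc (l + q) * (q + q)
      z≤′ = ≤-pred (≤-trans z< (≤-reflexive (+-suc (m * R) _)))
      eq : (m * R + suc (l + q) * (q + q)) + (m * R + suc (l + q) * (q + q)) + (q + q) ≡ R * R + (4 * q + 3) * R + 4 * q
      eq = trans (solve 4 (λ m R M q → (m :* R :+ M :* (q :+ q)) :+ (m :* R :+ M :* (q :+ q)) :+ (q :+ q) := (m :+ m) :* R :+ ((M :+ M) :* (q :+ q) :+ (q :+ q))) refl m R (suc (l + q)) q)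
        (trans (cong₂ (λ a b → a * R + (b * (q + q) + (q + q))) 2m≡ (trans (cong suc (+-suc (l + q) (l + q))) (cong suc (sym R≡′))))
          (solve 2 (λ R q → (R :+ (q :+ q :+ con 3)) :* R :+ ((con 1 :+ R) :* (q :+ q) :+ (q :+ q)) := R :* R :+ (con 4 :* q :+ con 3) :* R :+ con 4 :* q) refl R q))

-- Stepanov's auxiliary polynomial

module Stepanov (F : FiniteField) where
  open import Data.Nat as ℕ using (ℕ; zero; suc; z≤n; s≤s)
  import Data.Nat.Properties as ℕP
  open import Data.Empty using (⊥)
  open import Data.Fin as Fin using (Fin; toℕ; combine; remQuot; splitAt; _↑ˡ_; _↑ʳ_)
  import Data.Fin.Properties as FinP
  open import Data.List using (length)
  open import Data.List.Relation.Unary.Unique.Propositional using (Unique)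
  open import Data.List.Relation.Unary.All as All using (All)
  open import Data.Product using (∃₂; _×_; _,_; proj₁; proj₂; uncurry)
  open import Data.Sum using (_⊎_; inj₁; inj₂; [_,_]′)
  open import Relation.Nullary using (¬_; yes; no; contradiction)
  open import Relation.Binary.PropositionalEquality using (_≡_; _≢_; refl; sym; trans; cong; cong₂; module ≡-Reasoning)
  open Field F
  open Polynomials F
  open NonSquare F
  open import Algebra.Properties.CommutativeMonoid.Sum +-commutativeMonoid using (sum; sum-cong-≋; ∑-comm)
  open import Algebra.Properties.Semiring.Sum semiring using (*-distribˡ-sum)
  open ≡-Reasoning

  sum-↑ : ∀ m n (f : Fin (m ℕ.+ n) → Carrier) → sum f ≡ sum (λ i → f (i ↑ˡ n)) + sum (λ i → f (m ↑ʳ i))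
  sum-↑ zero    n f = sym (+-identityˡ _)
  sum-↑ (suc m) n f = trans (cong (f Fin.zero +_) (sum-↑ m n (λ i → f (Fin.suc i)))) (sym (+-assoc _ _ _))

  sum-combine : ∀ l m (f : Fin (l ℕ.* m) → Carrier) → sum f ≡ sum {l} (λ i → sum {m} (λ j → f (combine i j)))
  sum-combine zero    m f = refl
  sum-combine (suc l) m f = trans (sum-↑ m (l ℕ.* m) f) (cong (sum (λ j → f (j ↑ˡ (l ℕ.* m))) +_) (sum-combine l m (λ t → f (m ↑ʳ t))))

  sum-Blk : ∀ {C Y m} (c : Fin m → Fun) → (∀ i → C (c i)) → Blk C Y m (λ y → sum (λ i → c i y * Y y ^ toℕ i))
  sum-Blk {m = zero}  c p = nil (λ _ → refl)
  sum-Blk {Y = Y} {m = suc m} c p = cons (p Fin.zero) (sum-Blk (λ i → c (Fin.suc i)) (λ i → p (Fin.suc i))) (λ y →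
    cong₂ _+_ (*-identityʳ _) (trans
      (sum-cong-≋ {m} (λ i → solve 3 (λ c Y p → c :* (Y :* p) := Y :* (c :* p)) refl (c (Fin.suc i) y) (Y y) (Y y ^ toℕ i)))
      (sym (*-distribˡ-sum (Y y) (λ i → c (Fin.suc i) y * Y y ^ toℕ i)))))

  -- Uniqueness of expansions in powers of y^r: all blocks above the first form a polynomial times
  -- y^r, which `poly-top-zero` makes vanish. For r = 1 this is uniqueness of coefficients.
  sum-zero⇒blocks-zero : ∀ r {Y m} (c : Fin m → Fun) → (∀ y → Y y ≡ y ^ r) → (∀ i → IsPoly r (c i)) → m ℕ.* r ℕ.≤ order →
    (λ y → sum (λ i → c i y * Y y ^ toℕ i)) ≗0 → ∀ i → c i ≗0
  sum-zero⇒blocks-zero r {Y} {suc m} c hY p l h = λ { Fin.zero → c₀≗0 ; (Fin.suc i) → sum-zero⇒blocks-zero r (λ i → c (Fin.suc i)) hY (λ i → p (Fin.suc i))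
      (ℕP.≤-trans (ℕP.m≤n+m (m ℕ.* r) r) l) rest≗0 i }
    where
    rest : Fun
    rest y = sum (λ i → c (Fin.suc i) y * Y y ^ toℕ i)
    split : ∀ y → sum (λ i → c i y * Y y ^ toℕ i) ≡ rest y * y ^ r + c Fin.zero y
    split y = trans (+-comm _ _) (cong₂ _+_ (trans
      (sum-cong-≋ {m} (λ i → solve 3 (λ c Y p → c :* (Y :* p) := Y :* (c :* p)) refl (c (Fin.suc i) y) (Y y) (Y y ^ toℕ i)))
      (trans (sym (*-distribˡ-sum (Y y) (λ i → c (Fin.suc i) y * Y y ^ toℕ i))) (trans (*-comm _ _) (cong (rest y *_) (hY y)))))
      (*-identityʳ _))
    Blk-Y : ∀ {P f} → Blk (IsPoly r) Y P f → Blk (IsPoly r) (_^ r) P f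
    Blk-Y (nil q) = nil q
    Blk-Y (cons {c = d} {g} x b q) = cons x (Blk-Y b) (λ y → trans (q y) (cong (λ u → d y + u * g y) (hY y)))
    rest≗0 : rest ≗0
    rest≗0 = poly-top-zero (p Fin.zero) (poly-blocks (Blk-Y (sum-Blk (λ i → c (Fin.suc i)) (λ i → p (Fin.suc i))))) l (λ y → trans (sym (split y)) (h y))
    c₀≗0 : c Fin.zero ≗0
    c₀≗0 y = trans (trans (sym (+-identityˡ _)) (cong (_+ c Fin.zero y) (sym (trans (cong (_* y ^ r) (rest≗0 y)) (zeroˡ _))))) (trans (sym (split y)) (h y))

  Blk-map : ∀ {C C′ : Fun → Set} {Y P f} → (∀ {c} → C c → C′ c) → Blk C Y P f → Blk C′ Y P f
  Blk-map h (nil q)      = nil q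
  Blk-map h (cons c b q) = cons (h c) (Blk-map h b) q

  HasTop-map : ∀ {C C′ : Fun → Set} {Y P f t} → (∀ {c} → C c → C′ c) → HasTop C Y P f t → HasTop C′ Y P f t
  HasTop-map h (low , ct , bl , p) = low , h ct , Blk-map h bl , p

  poly-mul-const : ∀ {n f c} → IsPoly n f → IsConst c → IsPoly n (λ y → f y * c y)
  poly-mul-const {f = f} p (a , h) = Blk-ext (λ y → trans (cong (f y *_) (h y)) (*-comm _ _)) (Closed.scale (poly-closed _) a p)

  polyTop-^ : ∀ {P f t} n → PolyTop P f t → PolyTop (n ℕ.* P) (λ y → f y ^ n) (λ y → t y ^ n)
  polyTop-^ zero    T = (λ _ → 0#) , (1# , λ _ → refl) , nil (λ _ → refl) , λ y → sym (trans (+-identityʳ _) (*-identityʳ _))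
  polyTop-^ (suc n) T = polyTop-mul T (polyTop-^ n T)

  ^-comm-exp : ∀ x m n → (x ^ m) ^ n ≡ (x ^ n) ^ m
  ^-comm-exp x m n = trans (^-assocʳ x m n) (trans (cong (x ^_) (ℕP.*-comm m n)) (sym (^-assocʳ x n m)))

  -- M, m, R stand for l + q, l + 2q + 2 and 2M + 1; they are variables here so that powers with exponent R do not unfold.
  module _ (2≢0 : 2# ≢ 0#) (q l M m R : ℕ) (R≡ : R ≡ suc (M ℕ.+ M)) (2≤q : 2 ℕ.≤ q)
           (l≤R : l ℕ.≤ R) (m≤R : m ℕ.≤ R) (m≡ : suc (q ℕ.+ q) ℕ.+ suc l ≡ m) (2l+D≡R : (l ℕ.+ l) ℕ.+ suc (q ℕ.+ q) ≡ R)
           (mR≤ : m ℕ.* R ℕ.≤ order) (2m≤order : m ℕ.+ m ℕ.≤ order) (R≤order : R ℕ.≤ order)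
           (blocks≤ : ∀ {N} → N ℕ.< m → (N ℕ.+ N ℕ.+ (q ℕ.+ q)) ℕ.* R ℕ.+ R ℕ.≤ order)
           (unknowns> : l ℕ.* R ℕ.+ suc (suc M ℕ.* (q ℕ.+ q)) ℕ.< l ℕ.* m ℕ.+ l ℕ.* m) where

    module _ (frob : ∀ x y → (x + y) ^ R ≡ x ^ R + y ^ R)
             (S : ℕ) (root : ∀ x → (x ^ S) ^ R ≡ x)
             (c e : Carrier) (e≢0 : e ≢ 0#) where

      open ArtinSchreier 2≤q c e renaming (L-top to TL; D-top to TD)

      private
        0^R : 0# ^ R ≡ 0#
        0^R = trans (cong (0# ^_) R≡) (0^ (M ℕ.+ M))

        sum-frob : ∀ {n} (f : Fin n → Carrier) → sum f ^ R ≡ sum (λ i → f i ^ R)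
        sum-frob {zero}  f = 0^R
        sum-frob {suc n} f = trans (frob _ _) (cong (f Fin.zero ^ R +_) (sum-frob (λ i → f (Fin.suc i))))

        1≤q : 1 ℕ.≤ q
        1≤q = ℕP.≤-trans (s≤s z≤n) 2≤q

        pD^ : IsPoly (suc (suc M ℕ.* (q ℕ.+ q))) (λ y → D y ^ suc M)
        pD^ = polyTop⇒poly (polyTop-^ (suc M) TD)

        Ψ : Fin l → Fin m → Fun
        Ψ i j y = (y ^ toℕ i) ^ R * y ^ toℕ j

        -- Since j < m ≤ R, the exponent i R + j stays below l R.
        pΨ : ∀ i j → IsPoly (l ℕ.* R) (Ψ i j)
        pΨ i j = poly-weaken len (Blk-ext (λ y → trans (cong (_* y ^ toℕ j) (^-assocʳ y (toℕ i) R)) (sym (^-homo-* y (toℕ i ℕ.* R) (toℕ j)))) (poly-^ (toℕ i ℕ.* R ℕ.+ toℕ j)))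
          where
          len : suc (toℕ i ℕ.* R ℕ.+ toℕ j) ℕ.≤ l ℕ.* R
          len = ℕP.≤-trans (ℕP.≤-reflexive (sym (ℕP.+-suc (toℕ i ℕ.* R) (toℕ j))))
            (ℕP.≤-trans (ℕP.+-monoʳ-≤ (toℕ i ℕ.* R) (ℕP.≤-trans (FinP.toℕ<n j) m≤R))
              (ℕP.≤-trans (ℕP.≤-reflexive (ℕP.+-comm _ R)) (ℕP.*-monoˡ-≤ R (FinP.toℕ<n i))))

        φ : Fin (l ℕ.* m ℕ.+ l ℕ.* m) → Fun
        φ t = [ (λ t → uncurry Ψ (remQuot m t)) , (λ t y → uncurry Ψ (remQuot m t) y * D y ^ suc M) ]′ (splitAt (l ℕ.* m) t)

        pφ : ∀ t → IsPoly (l ℕ.* R ℕ.+ suc (suc M ℕ.* (q ℕ.+ q))) (φ t)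
        pφ t with splitAt (l ℕ.* m) t
        ... | inj₁ t′ = poly-weaken (ℕP.m≤m+n _ _) (uncurry pΨ (remQuot m t′))
        ... | inj₂ t′ = poly-mul (uncurry pΨ (remQuot m t′)) pD^

        -- A nontrivial relation between the monomials y^(iR + j) and their multiples by D^(M+1),
        -- obtained by counting unknowns against coefficients.
        kernel = poly-kernel (l ℕ.* R ℕ.+ suc (suc M ℕ.* (q ℕ.+ q))) φ pφ unknowns>

      private
        v : Fin (l ℕ.* m ℕ.+ l ℕ.* m) → Carrier
        v = proj₁ kernel

        a b : Fin l → Fin m → Carrier
        a i j = v (combine i j ↑ˡ (l ℕ.* m))
        b i j = v ((l ℕ.* m) ↑ʳ combine i j)

        S₁ : (Fin l → Fin m → Carrier) → Fun
        S₁ u y = sum {l} (λ i → sum {m} (λ j → u i j * Ψ i j y))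

        relation : ∀ y → S₁ a y + D y ^ suc M * S₁ b y ≡ 0#
        relation y = trans (cong₂ _+_ (sym part₁) (sym part₂)) (trans (sym (sum-↑ (l ℕ.* m) (l ℕ.* m) (λ t → v t * φ t y))) (proj₂ (proj₂ kernel) y))
          where
          part₁ : sum (λ t → v (t ↑ˡ (l ℕ.* m)) * φ (t ↑ˡ (l ℕ.* m)) y) ≡ S₁ a y
          part₁ = trans (sum-combine l m _) (sum-cong-≋ {l} (λ i → sum-cong-≋ {m} (λ j → cong (a i j *_)
            (trans (cong (λ s → [ (λ t → uncurry Ψ (remQuot m t)) , (λ t y → uncurry Ψ (remQuot m t) y * D y ^ suc M) ]′ s y) (FinP.splitAt-↑ˡ (l ℕ.* m) (combine i j) (l ℕ.* m)))
              (cong (λ p → uncurry Ψ p y) (FinP.remQuot-combine i j))))))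
          part₂ : sum (λ t → v ((l ℕ.* m) ↑ʳ t) * φ ((l ℕ.* m) ↑ʳ t) y) ≡ D y ^ suc M * S₁ b y
          part₂ = trans (sum-combine l m _) (trans (sum-cong-≋ {l} (λ i → trans (sum-cong-≋ {m} (λ j → trans (cong (b i j *_)
            (trans (cong (λ s → [ (λ t → uncurry Ψ (remQuot m t)) , (λ t y → uncurry Ψ (remQuot m t) y * D y ^ suc M) ]′ s y) (FinP.splitAt-↑ʳ (l ℕ.* m) (l ℕ.* m) (combine i j)))
              (cong (λ p → uncurry Ψ p y * D y ^ suc M) (FinP.remQuot-combine i j))))
            (solve 3 (λ b p d → b :* (p :* d) := d :* (b :* p)) refl (b i j) (Ψ i j y) (D y ^ suc M))))
            (sym (*-distribˡ-sum {m} (D y ^ suc M) (λ j → b i j * Ψ i j y)))))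
            (sym (*-distribˡ-sum {l} (D y ^ suc M) (λ i → sum {m} (λ j → b i j * Ψ i j y)))))

        -- The R-th root of a constant: by `root`, the S-th power inverts the R-th.
        hat : Carrier → Carrier
        hat x = x ^ S

        hat-zero : ∀ {x} → hat x ≡ 0# → x ≡ 0#
        hat-zero {x} h = trans (sym (root x)) (trans (cong (_^ R) h) (0^R))

        coeff : (Fin l → Fin m → Carrier) → Fin m → Fun
        coeff u j y = sum {l} (λ i → hat (u i j) * y ^ toℕ i)

        S₂ : (Fin l → Fin m → Carrier) → Fun
        S₂ u y = sum {m} (λ j → coeff u j y * (y ^ R) ^ toℕ j)

        -- The R-th power turns `hat (u i j)` into `u i j` and y^i into y^(iR), while (y^R)^j
        -- becomes y^j because y is fixed by the R²-th power. On such points `S₂` is therefore an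
        -- R-th root of `S₁`, and the relation between the `S₁` turns into zeros of `G`.
        S₂-frob : ∀ u {y} → (y ^ R) ^ R ≡ y → S₂ u y ^ R ≡ S₁ u y
        S₂-frob u {y} h = trans (sum-frob {m} (λ j → coeff u j y * (y ^ R) ^ toℕ j)) (trans (sum-cong-≋ {m} (λ j → begin
          (coeff u j y * (y ^ R) ^ toℕ j) ^ R                                ≡⟨ ^-distrib-* _ _ R ⟩
          coeff u j y ^ R * ((y ^ R) ^ toℕ j) ^ R                            ≡⟨ cong₂ _*_ (sum-frob (λ i → hat (u i j) * y ^ toℕ i)) (trans (^-comm-exp (y ^ R) (toℕ j) R) (cong (_^ toℕ j) h)) ⟩
          sum {l} (λ i → (hat (u i j) * y ^ toℕ i) ^ R) * y ^ toℕ j          ≡⟨ *-comm _ _ ⟩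
          y ^ toℕ j * sum {l} (λ i → (hat (u i j) * y ^ toℕ i) ^ R)          ≡⟨ *-distribˡ-sum {l} (y ^ toℕ j) (λ i → (hat (u i j) * y ^ toℕ i) ^ R) ⟩
          sum {l} (λ i → y ^ toℕ j * (hat (u i j) * y ^ toℕ i) ^ R)          ≡⟨ sum-cong-≋ {l} (λ i → trans (cong (y ^ toℕ j *_) (trans (^-distrib-* _ _ R) (cong (_* (y ^ toℕ i) ^ R) (root (u i j)))))
                                                                                  (solve 3 (λ p u r → p :* (u :* r) := u :* (r :* p)) refl (y ^ toℕ j) (u i j) ((y ^ toℕ i) ^ R))) ⟩
          sum {l} (λ i → u i j * Ψ i j y)                                    ∎)) (∑-comm {m} {l} (λ j i → u i j * Ψ i j y)))

        pcoeff : ∀ u j → IsPoly l (coeff u j)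
        pcoeff u j = sum-Blk (λ i _ → hat (u i j)) (λ i → hat (u i j) , λ _ → refl)

        S₂-blk : ∀ u → Blk (IsPoly l) (_^ R) m (S₂ u)
        S₂-blk u = sum-Blk (coeff u) (pcoeff u)

        S₂-zero : ∀ u → S₂ u ≗0 → ∀ i j → u i j ≡ 0#
        S₂-zero u h i j = hat-zero (sum-zero⇒blocks-zero 1 (λ i _ → hat (u i j)) (λ y → sym (*-identityʳ y)) (λ i → poly-const _)
          (ℕP.≤-trans (ℕP.≤-reflexive (ℕP.*-identityʳ l)) (ℕP.≤-trans l≤R R≤order))
          (sum-zero⇒blocks-zero R (coeff u) (λ _ → refl) (λ j → poly-weaken l≤R (pcoeff u j)) mR≤ h j) i 0#)

        A B G : Fun
        A = S₂ a
        B = S₂ b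
        G y = A y + D y ^ suc M * B y

        bound : ℕ
        bound = m ℕ.* R ℕ.+ suc (suc M ℕ.* (q ℕ.+ q))

        pG : IsPoly bound G
        pG = Closed.addᶜ (poly-closed bound) (poly-weaken (ℕP.m≤m+n _ _) (poly-blocks (Blk-map (poly-weaken l≤R) (S₂-blk a))))
               (Blk-ext (λ y → *-comm _ _) (poly-mul (poly-blocks (Blk-map (poly-weaken l≤R) (S₂-blk b))) pD^))

        -- In the application the first condition cuts out a subfield with R² elements. The second
        -- holds where D z is a nonzero square of this subfield, since (M + 1) R exceeds M + 1 by
        -- (R² - 1)/2.
        Good : Carrier → Set
        Good z = (z ^ R) ^ R ≡ z × (D z ^ suc M) ^ R ≡ D z ^ suc M

        G-vanishes : ∀ {z} → Good z → G z ≡ 0#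
        G-vanishes {z} (h , h′) with G z ≟ 0#
        ... | yes p = p
        ... | no p  = contradiction (begin
          G z ^ R                                      ≡⟨ frob _ _ ⟩
          A z ^ R + (D z ^ suc M * B z) ^ R            ≡⟨ cong (A z ^ R +_) (^-distrib-* _ _ R) ⟩
          A z ^ R + (D z ^ suc M) ^ R * B z ^ R        ≡⟨ cong₂ _+_ (S₂-frob a h) (cong₂ _*_ h′ (S₂-frob b h)) ⟩
          S₁ a z + D z ^ suc M * S₁ b z                ≡⟨ relation z ⟩
          0#                                           ∎) (^-nonzero R p)

        v-zero : (∀ i j → a i j ≡ 0#) → (∀ i j → b i j ≡ 0#) → ∀ t → v t ≡ 0#
        v-zero ha hb t = trans (cong v (sym (FinP.join-splitAt (l ℕ.* m) (l ℕ.* m) t))) (go (splitAt (l ℕ.* m) t))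
          where
          go : ∀ s → v (Fin.join (l ℕ.* m) (l ℕ.* m) s) ≡ 0#
          go (inj₁ s) = trans (cong (λ s → v (s ↑ˡ (l ℕ.* m))) (sym (FinP.combine-remQuot {l} m s))) (ha _ _)
          go (inj₂ s) = trans (cong (λ s → v ((l ℕ.* m) ↑ʳ s)) (sym (FinP.combine-remQuot {l} m s))) (hb _ _)

        frob-Blk : ∀ {P f} → IsPoly P f → Blk IsConst (_^ R) P (λ y → f y ^ R)
        frob-Blk (nil q) = nil (λ y → trans (cong (_^ R) (q y)) (0^R))
        frob-Blk (cons {c = c} {g} (x , h) b q) = cons (x ^ R , λ y → cong (_^ R) (h y)) (frob-Blk b)
          (λ y → trans (cong (_^ R) (q y)) (trans (frob _ _) (cong (c y ^ R +_) (^-distrib-* y (g y) R))))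

        frob-Top : ∀ {P f t} → PolyTop P f t → HasTop IsConst (_^ R) P (λ y → f y ^ R) (λ y → t y ^ R)
        frob-Top {P} {t = t} (low , (x , h) , bl , p) = (λ y → low y ^ R) , (x ^ R , λ y → cong (_^ R) (h y)) , frob-Blk bl ,
          λ y → trans (cong (_^ R) (p y)) (trans (frob _ _) (cong (_+ low y ^ R) (trans (^-distrib-* _ _ R) (cong (t y ^ R *_) (^-comm-exp y P R)))))

        tDR : Fun
        tDR _ = (1# * 1#) ^ R

        tDR≡1 : ∀ y → tDR y ≡ 1#
        tDR≡1 y = trans (cong (_^ R) (*-identityˡ 1#)) (1^ R)

        -- D^R is a polynomial in y^R with constant coefficients and leading coefficient 1. So the
        -- top coefficient of D D^R in powers of y^R is D itself.
        TDDR : HasTop (IsPoly (suc (q ℕ.+ q))) (_^ R) (q ℕ.+ q) (λ y → D y * D y ^ R) (λ y → D y * tDR y)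
        TDDR = HasTop-mul const-closed (poly-closed _) poly-mul-const
          ((λ _ → 0#) , polyTop⇒poly TD , nil (λ _ → refl) , λ y → sym (trans (+-identityʳ _) (*-identityʳ _))) (frob-Top TD)

        square-top : ∀ {P f t} → HasTop (IsPoly l) (_^ R) P f t → HasTop (IsPoly (l ℕ.+ l)) (_^ R) (P ℕ.+ P) (λ y → f y * f y) (λ y → t y * t y)
        square-top T = HasTop-mul (poly-closed _) (poly-closed _) poly-mul T T

        2l≤R : l ℕ.+ l ℕ.≤ R
        2l≤R = ℕP.≤-trans (ℕP.m≤m+n _ _) (ℕP.≤-reflexive 2l+D≡R)

        module BD = BlockDegree R

      -- With that many zeros `G` would vanish identically, giving A² = B² D^(2M+2) = B² D D^R. The
      -- top coefficients α and β of A and B in powers of y^R have degree below l, and 2l + 2q + 1 =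
      -- R allows them to be compared: α² = β² D, which `not-square` excludes.
      stepanov : ∀ {Z} → Unique Z → All (λ z → (z ^ R) ^ R ≡ z × (D z ^ suc M) ^ R ≡ D z ^ suc M) Z →
        length Z ℕ.< m ℕ.* R ℕ.+ suc (suc M ℕ.* (q ℕ.+ q))
      stepanov {Z} uZ good = ℕP.≰⇒> contra
        where
        contra : ¬ bound ℕ.≤ length Z
        contra len = go (HasTop-exists (poly-closed l) (S₂-blk b))
          where
          G≗0 : G ≗0
          G≗0 = poly-roots pG uZ (All.map G-vanishes good) len
          A≡ : ∀ y → A y ≡ - (D y ^ suc M * B y)
          A≡ y = trans (solve 2 (λ a x → a := (a :+ x) :+ (:- x)) refl (A y) (D y ^ suc M * B y)) (trans (cong (_+ - (D y ^ suc M * B y)) (G≗0 y)) (+-identityˡ _))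
          squares : ∀ y → A y * A y ≡ B y * B y * (D y * D y ^ R)
          squares y = begin
            A y * A y                                                  ≡⟨ cong₂ _*_ (A≡ y) (A≡ y) ⟩
            (- (D y ^ suc M * B y)) * (- (D y ^ suc M * B y))          ≡⟨ solve 2 (λ d b → (:- (d :* b)) :* (:- (d :* b)) := b :* b :* (d :* d)) refl (D y ^ suc M) (B y) ⟩
            B y * B y * (D y ^ suc M * D y ^ suc M)                    ≡⟨ cong (B y * B y *_) (trans (sym (^-homo-* (D y) (suc M) (suc M))) (trans (cong (D y ^_) (cong suc (ℕP.+-suc M M))) (cong (λ n → D y * D y ^ n) (sym R≡)))) ⟩
            B y * B y * (D y * D y ^ R)                                ∎
          go : B ≗0 ⊎ (∃₂ λ N β → N ℕ.< m × HasTop (IsPoly l) (_^ R) N B β × ¬ β ≗0) → ⊥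
          -- If B vanishes, so does A, and uniqueness of expansions kills every coefficient of a
          -- relation that was chosen nontrivial.
          go (inj₁ B≗0) = proj₂ (proj₁ (proj₂ kernel)) (v-zero (S₂-zero a A≗0) (S₂-zero b B≗0) (proj₁ (proj₁ (proj₂ kernel))))
            where
            A≗0 : A ≗0
            A≗0 y = trans (A≡ y) (trans (cong (λ u → - (D y ^ suc M * u)) (B≗0 y)) (trans (cong (λ u → - u) (zeroʳ _)) -0#≈0#))
          go (inj₂ (N , β , N<m , TB , β≢0)) = go′ (HasTop-exists (poly-closed l) (S₂-blk a))
            where
            pβ : IsPoly l β
            pβ = proj₁ (proj₂ TB)
            TR : HasTop (IsPoly R) (_^ R) (N ℕ.+ N ℕ.+ (q ℕ.+ q)) (λ y → A y * A y) (λ y → β y * β y * (D y * tDR y))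
            TR = HasTop-ext squares (HasTop-map (poly-weaken (ℕP.≤-reflexive 2l+D≡R)) (HasTop-mul (poly-closed _) (poly-closed _) poly-mul (square-top TB) TDDR))
            bdR : (N ℕ.+ N ℕ.+ (q ℕ.+ q)) ℕ.* R ℕ.+ R ℕ.≤ order
            bdR = blocks≤ N<m
            D≢0 : ¬ D ≗0
            D≢0 = D-nonzero (ℕP.≤-trans (ℕP.≤-trans (ℕP.m≤n+m (suc (q ℕ.+ q)) (l ℕ.+ l)) (ℕP.≤-reflexive 2l+D≡R)) R≤order)
            ββ≢0 : ¬ (λ y → β y * β y) ≗0
            ββ≢0 = poly-mul-nonzero pβ pβ (ℕP.≤-trans 2l≤R R≤order) β≢0 β≢0
            D*1 : ∀ y → D y * tDR y ≡ D y
            D*1 y = trans (cong (D y *_) (tDR≡1 y)) (*-identityʳ _)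
            topR≢0 : ¬ (λ y → β y * β y * (D y * tDR y)) ≗0
            topR≢0 h = poly-mul-nonzero (poly-mul pβ pβ) (polyTop⇒poly TD) (ℕP.≤-trans (ℕP.≤-reflexive 2l+D≡R) R≤order) ββ≢0 D≢0
              (λ y → trans (cong (β y * β y *_) (sym (D*1 y))) (h y))
            go′ : A ≗0 ⊎ (∃₂ λ P α → P ℕ.< m × HasTop (IsPoly l) (_^ R) P A α × ¬ α ≗0) → ⊥
            go′ (inj₁ A≗0) = BD.HasTop-nonzero bdR TR topR≢0 (λ y → trans (cong (_* A y) (A≗0 y)) (zeroˡ _))
            go′ (inj₂ (P , α , P<m , TA , α≢0)) = Descent.not-square 2≢0 1≤q TL one≢0 e≢0 {W = m} 2m≤order
                (ℕP.≤-reflexive m≡)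
                (poly-weaken (ℕP.n≤1+n l) pα) (poly-weaken (ℕP.n≤1+n l) pβ) β≢0
                (λ y → trans (proj₂ same y) (cong (β y * β y *_) (D*1 y)))
              where
              pα : IsPoly l α
              pα = proj₁ (proj₂ TA)
              bdP : (P ℕ.+ P) ℕ.* R ℕ.+ R ℕ.≤ order
              bdP = ℕP.≤-trans (ℕP.+-monoˡ-≤ R (ℕP.*-monoˡ-≤ R (ℕP.m≤m+n (P ℕ.+ P) (q ℕ.+ q)))) (blocks≤ P<m)
              same = BD.HasTop-unique bdP bdR (HasTop-map (poly-weaken 2l≤R) (square-top TA)) TR
                (poly-mul-nonzero pα pα (ℕP.≤-trans 2l≤R R≤order) α≢0 α≢0) topR≢0

-- The quadratic character

module QuadraticCharacter (F : FiniteField) (2≢0 : Field.2# F ≢ Field.0# F) where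
  open import Data.List.Relation.Unary.Any using (any?)
  open import Data.List.Membership.Propositional using (find; lose)
  open import Data.Rational as ℚ using (ℚ; 0ℚ; 1ℚ)
  import Data.Rational.Properties as ℚP
  open import Data.Product using (∃; _,_)
  open import Data.Sum using (_⊎_; inj₁; inj₂)
  open import Relation.Nullary using (¬_; Dec; yes; no; contradiction)
  open import Relation.Binary.PropositionalEquality using (refl; sym; trans; cong; cong₂; module ≡-Reasoning)
  open Field F
  open Sums using (Enum)
  open Q using (⟨_⟩; ⟨yes⟩; ⟨no⟩; ⟨⟩-cong; ∑; ∑-cong)
  open ≡-Reasoning

  -1ℚ : ℚ
  -1ℚ = ℚ.- 1ℚ

  roots : Carrier → ℚ
  roots r = ∑ enum (λ h → ⟨ h * h ≟ r ⟩)

  -- Defined by counting square roots; the values 0, 1, -1 and multiplicativity are derived from the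
  -- count.
  η : Carrier → ℚ
  η r = roots r ℚ.- 1ℚ

  roots≡1+η : ∀ r → roots r ≡ 1ℚ ℚ.+ η r
  roots≡1+η r = Q.solve 1 (λ x → x Q.:= Q.:# 1 Q.:+ (x Q.:- Q.:# 1)) refl (roots r)

  square-zero : ∀ {h} → h * h ≡ 0# → h ≡ 0#
  square-zero p with *-zero-split p
  ... | inj₁ q = q
  ... | inj₂ q = q

  square-≡ : ∀ {x y} → x * x ≡ y * y → x ≡ y ⊎ x ≡ - y
  square-≡ {x} {y} p with *-zero-split {x - y} {x + y} (trans (solve 2 (λ x y → (x :- y) :* (x :+ y) := x :* x :- y :* y) refl x y) (≡⇒-≡0 p))
  ... | inj₁ q = inj₁ (-≡0⇒≡ q)
  ... | inj₂ q = inj₂ (-≡0⇒≡ (trans (cong (x +_) (-‿involutive y)) q))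

  2*-zero : ∀ {x} → x + x ≡ 0# → x ≡ 0#
  2*-zero {x} p with *-zero-split {2#} {x} (trans (solve 1 (λ x → (:# 1 :+ :# 1) :* x := x :+ x) refl x) p)
  ... | inj₁ q = contradiction q 2≢0
  ... | inj₂ q = q

  ≢-neg : ∀ {h} → h ≢ 0# → h ≢ - h
  ≢-neg {h} h≢0 p = h≢0 (2*-zero (trans (cong (h +_) p) (-‿inverseʳ h)))

  η-0 : η 0# ≡ 0ℚ
  η-0 = cong (ℚ._- 1ℚ) (trans (∑-cong enum (λ h → ⟨⟩-cong (h * h ≟ 0#) (h ≟ 0#) square-zero (λ { refl → zeroˡ 0# }))) (Q.∑-1 enum 0#))

  η-square : ∀ {h} → h ≢ 0# → η (h * h) ≡ 1ℚ
  η-square {h} h≢0 = cong (ℚ._- 1ℚ) (trans (∑-cong enum pointwise)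
    (trans (Q.∑-∙ enum (λ x → ⟨ x ≟ h ⟩) (λ x → ⟨ x ≟ - h ⟩)) (cong₂ ℚ._+_ (Q.∑-1 enum h) (Q.∑-1 enum (- h)))))
    where
    pointwise : ∀ x → ⟨ x * x ≟ h * h ⟩ ≡ ⟨ x ≟ h ⟩ ℚ.+ ⟨ x ≟ - h ⟩
    pointwise x with x ≟ h | x ≟ - h
    ... | yes p | yes q = contradiction (trans (sym p) q) (≢-neg h≢0)
    ... | yes p | no q  = ⟨yes⟩ (x * x ≟ h * h) (cong₂ _*_ p p)
    ... | no p  | yes q = ⟨yes⟩ (x * x ≟ h * h) (trans (cong₂ _*_ q q) (solve 1 (λ h → (:- h) :* (:- h) := h :* h) refl h))
    ... | no p  | no q  = ⟨no⟩ (x * x ≟ h * h) (λ r → case (square-≡ r))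
      where
      case : ¬ (x ≡ h ⊎ x ≡ - h)
      case (inj₁ r) = p r
      case (inj₂ r) = q r

  η-nonsquare : ∀ {r} → (∀ h → h * h ≢ r) → η r ≡ -1ℚ
  η-nonsquare {r} no-root = cong (ℚ._- 1ℚ) (Q.∑-ε enum (λ h → ⟨no⟩ (h * h ≟ r) (no-root h)))

  data SquareView (r : Carrier) : Set where
    zeroˢ     : r ≡ 0# → SquareView r
    square    : ∀ {h} → h ≢ 0# → h * h ≡ r → SquareView r
    nonsquare : (∀ h → h * h ≢ r) → SquareView r

  squareView : ∀ r → SquareView r
  squareView r with r ≟ 0# | any? (λ h → h * h ≟ r) (Enum.elems enum)
  ... | yes p | _     = zeroˢ p
  ... | no p  | no q  = nonsquare (λ h s → q (lose (Enum.complete enum h) s))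
  ... | no p  | yes q with find q
  ...   | h , _ , s = square (λ { refl → p (trans (sym s) (zeroˡ 0#)) }) s

  ∑η≡0 : ∑ enum η ≡ 0ℚ
  ∑η≡0 = begin
    ∑ enum η                                                  ≡⟨ Q.∑-∙ enum roots (λ _ → -1ℚ) ⟩
    ∑ enum roots ℚ.+ ∑ enum (λ _ → -1ℚ)                       ≡⟨ cong₂ ℚ._+_ total (sym (Q.∑-neg enum (λ _ → 1ℚ))) ⟩
    ∑ enum (λ _ → 1ℚ) ℚ.- ∑ enum (λ _ → 1ℚ)                   ≡⟨ ℚP.+-inverseʳ (∑ enum (λ _ → 1ℚ)) ⟩
    0ℚ                                                        ∎
    where
    total : ∑ enum roots ≡ ∑ enum (λ _ → 1ℚ)
    total = trans (Q.∑-swap enum enum (λ r h → ⟨ h * h ≟ r ⟩))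
      (∑-cong enum (λ h → trans (∑-cong enum (λ r → ⟨⟩-cong (h * h ≟ r) (r ≟ h * h) sym sym)) (Q.∑-1 enum (h * h))))

  ∑η-scale : ∀ {δ} → δ ≢ 0# → ∑ enum (λ x → η (δ * x)) ≡ 0ℚ
  ∑η-scale {δ} δ≢0 = trans (Q.∑-reindex enum enum (δ *_) (δ ⁻¹ *_)
    (λ y → trans (sym (*-assoc _ _ _)) (trans (cong (_* y) (inverseˡ δ≢0)) (*-identityˡ y)))
    (λ y → trans (sym (*-assoc _ _ _)) (trans (cong (_* y) (inverseʳ δ≢0)) (*-identityˡ y))) η) ∑η≡0

  η-*-square : ∀ {a} x → a ≢ 0# → η (a * a * x) ≡ η x
  η-*-square {a} x a≢0 with squareView x
  ... | zeroˢ refl = cong η (zeroʳ _)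
  ... | square {h} h≢0 refl = trans (cong η (solve 2 (λ a h → a :* a :* (h :* h) := (a :* h) :* (a :* h)) refl a h))
          (trans (η-square (*-nonzero a≢0 h≢0)) (sym (η-square h≢0)))
  ... | nonsquare no-root = trans (η-nonsquare (λ h p → no-root (a ⁻¹ * h) (begin
          a ⁻¹ * h * (a ⁻¹ * h)      ≡⟨ solve 2 (λ a h → a :* h :* (a :* h) := a :* a :* (h :* h)) refl (a ⁻¹) h ⟩
          a ⁻¹ * a ⁻¹ * (h * h)      ≡⟨ cong (a ⁻¹ * a ⁻¹ *_) p ⟩
          a ⁻¹ * a ⁻¹ * (a * a * x)  ≡⟨ solve 3 (λ u a x → u :* u :* (a :* a :* x) := (u :* a) :* (u :* a) :* x) refl (a ⁻¹) a x ⟩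
          a ⁻¹ * a * (a ⁻¹ * a) * x  ≡⟨ cong (λ u → u * u * x) (inverseˡ a≢0) ⟩
          1# * 1# * x                ≡⟨ trans (cong (_* x) (*-identityˡ 1#)) (*-identityˡ x) ⟩
          x                          ∎))) (sym (η-nonsquare no-root))

  -1≤1 : -1ℚ ℚ.≤ 1ℚ
  -1≤1 = ℚP.≤-trans (ℚP.neg-antimono-≤ (ℚP.nonNegative⁻¹ 1ℚ)) (ℚP.nonNegative⁻¹ 1ℚ)

  η≤1 : ∀ x → η x ℚ.≤ 1ℚ
  η≤1 x with squareView x
  ... | zeroˢ refl          = ℚP.≤-trans (ℚP.≤-reflexive η-0) (ℚP.nonNegative⁻¹ 1ℚ)
  ... | square h≢0 refl     = ℚP.≤-reflexive (η-square h≢0)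
  ... | nonsquare no-root   = ℚP.≤-trans (ℚP.≤-reflexive (η-nonsquare no-root)) -1≤1

  -- Each summand of ∑ₓ (η x + η (δ x)) = 0 is nonpositive, so all vanish.
  η-*-nonsquare : ∀ {δ} → (∀ h → h * h ≢ δ) → ∀ x → η (δ * x) ≡ ℚ.- η x
  η-*-nonsquare {δ} no-root x = trans (Q.solve 2 (λ a b → b Q.:= (a Q.:+ b) Q.:- a) refl (η x) (η (δ * x)))
    (trans (cong (ℚ._- η x) (Q.sumL-zero⇒zero (Enum.elems enum) nonpos sum-zero (Enum.complete enum x))) (ℚP.+-identityˡ _))
    where
    δ≢0 : δ ≢ 0#
    δ≢0 p = no-root 0# (trans (zeroˡ 0#) (sym p))
    sum-zero : ∑ enum (λ x → η x ℚ.+ η (δ * x)) ≡ 0ℚ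
    sum-zero = trans (Q.∑-∙ enum η (λ x → η (δ * x))) (cong₂ ℚ._+_ ∑η≡0 (∑η-scale δ≢0))
    nonpos : ∀ x → η x ℚ.+ η (δ * x) ℚ.≤ 0ℚ
    nonpos x with squareView x
    ... | zeroˢ refl = ℚP.≤-reflexive (cong₂ ℚ._+_ η-0 (trans (cong η (zeroʳ δ)) η-0))
    ... | square {h} h≢0 refl = ℚP.≤-reflexive (cong₂ ℚ._+_ (η-square h≢0)
            (trans (cong η (*-comm δ (h * h))) (trans (η-*-square δ h≢0) (η-nonsquare no-root))))
    ... | nonsquare no-root′ = ℚP.+-mono-≤ (ℚP.≤-reflexive (η-nonsquare no-root′)) (η≤1 (δ * x))

  η-* : ∀ x y → η (x * y) ≡ η x ℚ.* η y
  η-* x y with squareView x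
  ... | zeroˢ refl = trans (cong η (zeroˡ y)) (trans η-0 (sym (trans (cong (ℚ._* η y) η-0) (ℚP.*-zeroˡ (η y)))))
  ... | square {h} h≢0 refl = trans (η-*-square y h≢0) (sym (trans (cong (ℚ._* η y) (η-square h≢0)) (ℚP.*-identityˡ (η y))))
  ... | nonsquare no-root = trans (η-*-nonsquare no-root y) (sym (trans (cong (ℚ._* η y) (η-nonsquare no-root))
          (Q.solve 1 (λ x → (Q.:- Q.:# 1) Q.:* x Q.:= Q.:- x) refl (η y))))

  η²≡1 : ∀ {x} → x ≢ 0# → η x ℚ.* η x ≡ 1ℚ
  η²≡1 {x} x≢0 = trans (sym (η-* x x)) (η-square x≢0)

  η-1 : η 1# ≡ 1ℚ
  η-1 = trans (cong η (sym (*-identityˡ 1#))) (η-square 1≢0)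

  η-⁻¹ : ∀ {x} → x ≢ 0# → η (x ⁻¹) ≡ η x
  η-⁻¹ {x} x≢0 = trans (sym (η-*-square (x ⁻¹) x≢0)) (cong η (trans (*-assoc x x (x ⁻¹)) (trans (cong (x *_) (inverseʳ x≢0)) (*-identityʳ x))))

  -- Otherwise η would be nonnegative with sum 0, against η(1) = 1.
  nonsquare-exists : ∃ λ δ → ∀ h → h * h ≢ δ
  nonsquare-exists with any? (λ δ → η δ ℚP.≟ -1ℚ) (Enum.elems enum)
  ... | yes p with find p
  ...   | δ , _ , q = δ , λ h s → absurd h s (squareView δ)
    where
    absurd : ∀ h → h * h ≡ δ → ¬ SquareView δ
    absurd h s (zeroˢ refl) = contradiction (trans (sym q) η-0) (λ ())
    absurd h s (square h≢0 refl) = contradiction (trans (sym q) (η-square h≢0)) (λ ())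
    absurd h s (nonsquare n) = n h s
  nonsquare-exists | no p = contradiction (trans (sym η-1) (neg-zero (Q.sumL-zero⇒zero (Enum.elems enum) {λ x → ℚ.- η x} nonpos
      (trans (sym (Q.∑-neg enum η)) (cong ℚ.-_ ∑η≡0)) (Enum.complete enum 1#)))) (λ ())
    where
    nonpos : ∀ x → ℚ.- η x ℚ.≤ 0ℚ
    nonpos x with squareView x
    ... | zeroˢ refl      = ℚP.≤-reflexive (cong ℚ.-_ η-0)
    ... | square h≢0 refl = ℚP.≤-trans (ℚP.≤-reflexive (cong ℚ.-_ (η-square h≢0))) (ℚP.neg-antimono-≤ (ℚP.nonNegative⁻¹ 1ℚ))
    ... | nonsquare n     = contradiction (lose (Enum.complete enum x) (η-nonsquare n)) p
    neg-zero : ∀ {x} → ℚ.- x ≡ 0ℚ → x ≡ 0ℚ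
    neg-zero {x} h = trans (Q.solve 1 (λ x → x Q.:= Q.:- (Q.:- x)) refl x) (cong ℚ.-_ h)

  -- For z ≠ 0 one has z (r - z) = z² (r/z - 1), so the summand is η (r/z - 1). If r ≠ 0, then z ↦
  -- r/z - 1 permutes the field and sends 0 to -1; the value η(-1), absent from the original sum, is
  -- subtracted from ∑ η = 0.
  η-⋆-η : ∀ r → ∑ enum (λ z → η z ℚ.* η (r - z)) ≡ η (- 1#) ℚ.* (toℚ order ℚ.* ⟨ r ≟ 0# ⟩ ℚ.- 1ℚ)
  η-⋆-η r with r ≟ 0#
  ... | yes refl = begin
    ∑ enum (λ z → η z ℚ.* η (0# - z))                          ≡⟨ ∑-cong enum pointwise ⟩
    ∑ enum (λ z → η (- 1#) ℚ.* (1ℚ ℚ.+ ℚ.- ⟨ z ≟ 0# ⟩))         ≡⟨ Q.∑-*ˡ enum (η (- 1#)) (λ z → 1ℚ ℚ.+ ℚ.- ⟨ z ≟ 0# ⟩) ⟨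
    η (- 1#) ℚ.* ∑ enum (λ z → 1ℚ ℚ.+ ℚ.- ⟨ z ≟ 0# ⟩)           ≡⟨ cong (η (- 1#) ℚ.*_) (trans (Q.∑-∙ enum (λ _ → 1ℚ) (λ z → ℚ.- ⟨ z ≟ 0# ⟩))
                                                                   (cong₂ ℚ._+_ (Q.sumL-const-ℚ (Enum.elems enum) 1ℚ) (trans (sym (Q.∑-neg enum (λ z → ⟨ z ≟ 0# ⟩))) (cong ℚ.-_ (Q.∑-1 enum 0#))))) ⟩
    η (- 1#) ℚ.* (toℚ order ℚ.* 1ℚ ℚ.- 1ℚ)                      ∎
    where
    pointwise : ∀ z → η z ℚ.* η (0# - z) ≡ η (- 1#) ℚ.* (1ℚ ℚ.+ ℚ.- ⟨ z ≟ 0# ⟩)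
    pointwise z with z ≟ 0#
    ... | yes refl = trans (cong (ℚ._* η (0# - 0#)) η-0) (trans (ℚP.*-zeroˡ (η (0# - 0#))) (sym (ℚP.*-zeroʳ (η (- 1#)))))
    ... | no z≢0   = begin
      η z ℚ.* η (0# - z)                 ≡⟨ cong (λ u → η z ℚ.* η u) (solve 1 (λ z → :# 0 :- z := (:- :# 1) :* z) refl z) ⟩
      η z ℚ.* η ((- 1#) * z)             ≡⟨ cong (η z ℚ.*_) (η-* (- 1#) z) ⟩
      η z ℚ.* (η (- 1#) ℚ.* η z)         ≡⟨ Q.solve 2 (λ a b → a Q.:* (b Q.:* a) Q.:= b Q.:* (a Q.:* a)) refl (η z) (η (- 1#)) ⟩
      η (- 1#) ℚ.* (η z ℚ.* η z)         ≡⟨ cong (η (- 1#) ℚ.*_) (η²≡1 z≢0) ⟩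
      η (- 1#) ℚ.* 1ℚ                    ∎
  ... | no r≢0 = begin
    ∑ enum (λ z → η z ℚ.* η (r - z))                            ≡⟨ ∑-cong enum pointwise ⟩
    ∑ enum (λ z → η (r * z ⁻¹ - 1#) ℚ.+ ℚ.- (⟨ z ≟ 0# ⟩ ℚ.* η (- 1#))) ≡⟨ Q.∑-∙ enum (λ z → η (r * z ⁻¹ - 1#)) (λ z → ℚ.- (⟨ z ≟ 0# ⟩ ℚ.* η (- 1#))) ⟩
    ∑ enum (λ z → η (r * z ⁻¹ - 1#)) ℚ.+ ∑ enum (λ z → ℚ.- (⟨ z ≟ 0# ⟩ ℚ.* η (- 1#)))
      ≡⟨ cong₂ ℚ._+_ (trans (Q.∑-reindex enum enum (λ z → r * z ⁻¹ - 1#) (λ w → r * (w + 1#) ⁻¹) ψφ φψ η) ∑η≡0)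
           (trans (sym (Q.∑-neg enum (λ z → ⟨ z ≟ 0# ⟩ ℚ.* η (- 1#)))) (cong ℚ.-_ (Q.∑-δ enum (λ _ → η (- 1#)) 0#))) ⟩
    0ℚ ℚ.+ ℚ.- η (- 1#)                                          ≡⟨ Q.solve 2 (λ e q → Q.:# 0 Q.:+ (Q.:- e) Q.:= e Q.:* (q Q.:* Q.:# 0 Q.:- Q.:# 1)) refl (η (- 1#)) (toℚ order) ⟩
    η (- 1#) ℚ.* (toℚ order ℚ.* 0ℚ ℚ.- 1ℚ)                       ∎
    where
    -- The default value 0⁻¹ = 0 makes z ↦ r/z an involution of the whole field.
    involution : ∀ z → r * (r * z ⁻¹) ⁻¹ ≡ z
    involution z = go z (z ≟ 0#)
      where
      go : ∀ z → Dec (z ≡ 0#) → r * (r * z ⁻¹) ⁻¹ ≡ z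
      go _ (yes refl) = trans (cong (λ u → r * (r * u) ⁻¹) 0⁻¹) (trans (cong (λ u → r * u ⁻¹) (zeroʳ r)) (trans (cong (r *_) 0⁻¹) (zeroʳ r)))
      go z (no z≢0) = trans (cong (r *_) (trans (⁻¹-* r≢0 (⁻¹-nonzero z≢0)) (cong (r ⁻¹ *_) (⁻¹-involutive z≢0))))
        (trans (sym (*-assoc _ _ _)) (trans (cong (_* z) (inverseʳ r≢0)) (*-identityˡ z)))
    ψφ : ∀ z → r * ((r * z ⁻¹ - 1#) + 1#) ⁻¹ ≡ z
    ψφ z = trans (cong (λ u → r * u ⁻¹) (solve 2 (λ x o → (x :- o) :+ o := x) refl (r * z ⁻¹) 1#)) (involution z)
    φψ : ∀ w → r * (r * (w + 1#) ⁻¹) ⁻¹ - 1# ≡ w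
    φψ w = trans (cong (_- 1#) (involution (w + 1#))) (solve 2 (λ x o → (x :+ o) :- o := x) refl w 1#)
    pointwise : ∀ z → η z ℚ.* η (r - z) ≡ η (r * z ⁻¹ - 1#) ℚ.+ ℚ.- (⟨ z ≟ 0# ⟩ ℚ.* η (- 1#))
    pointwise z = go z (z ≟ 0#)
      where
      go : ∀ z (d : Dec (z ≡ 0#)) → η z ℚ.* η (r - z) ≡ η (r * z ⁻¹ - 1#) ℚ.+ ℚ.- (⟨ d ⟩ ℚ.* η (- 1#))
      go _ (yes refl) = trans (trans (cong (ℚ._* η (r - 0#)) η-0) (ℚP.*-zeroˡ (η (r - 0#))))
        (sym (trans (cong₂ (λ u v → η u ℚ.+ ℚ.- v) (trans (cong (λ u → r * u - 1#) 0⁻¹) (trans (cong (_- 1#) (zeroʳ r)) (+-identityˡ _))) (ℚP.*-identityˡ (η (- 1#)))) (ℚP.+-inverseʳ (η (- 1#)))))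
      go z (no z≢0) = begin
        η z ℚ.* η (r - z)                       ≡⟨ η-* z (r - z) ⟨
        η (z * (r - z))                         ≡⟨ cong (λ u → η (z * (r - u))) (sym (*-identityʳ z)) ⟩
        η (z * (r - z * 1#))                    ≡⟨ cong (λ u → η (z * (u - z * 1#))) (trans (sym (*-identityʳ r)) (trans (cong (r *_) (sym (inverseʳ z≢0))) (solve 3 (λ r z u → r :* (z :* u) := z :* (r :* u)) refl r z (z ⁻¹)))) ⟩
        η (z * (z * (r * z ⁻¹) - z * 1#))       ≡⟨ cong η (solve 3 (λ z x o → z :* (z :* x :- z :* o) := z :* z :* (x :- o)) refl z (r * z ⁻¹) 1#) ⟩
        η (z * z * (r * z ⁻¹ - 1#))             ≡⟨ η-*-square (r * z ⁻¹ - 1#) z≢0 ⟩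
        η (r * z ⁻¹ - 1#)                       ≡⟨ ℚP.+-identityʳ _ ⟨
        η (r * z ⁻¹ - 1#) ℚ.+ 0ℚ                ≡⟨ cong (λ u → η (r * z ⁻¹ - 1#) ℚ.+ ℚ.- u) (ℚP.*-zeroˡ (η (- 1#))) ⟨
        η (r * z ⁻¹ - 1#) ℚ.+ ℚ.- (0ℚ ℚ.* η (- 1#)) ∎

-- The quadratic extension K(√δ)

module QuadraticExtension (K : FiniteField) (δ : Field.Carrier K) (no-root : ∀ h → Field._*_ K h h ≢ δ) where
  open import Level using (0ℓ)
  open import Algebra.Bundles using (CommutativeRing)
  open import Data.Product using (_×_; _,_; proj₁)
  open import Relation.Nullary using (Dec; yes; no; contradiction)
  open import Relation.Binary.PropositionalEquality using (refl; sym; trans; cong; cong₂; isEquivalence; module ≡-Reasoning)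
  open Field K
  open Sums
  open ≡-Reasoning

  E : Set
  E = Carrier × Carrier

  _⊞_ _⊠_ : E → E → E
  (a , b) ⊞ (c , d) = a + c , b + d
  (a , b) ⊠ (c , d) = a * c + δ * (b * d) , a * d + b * c

  ⊟_ : E → E
  ⊟ (a , b) = - a , - b

  0ᴱ 1ᴱ : E
  0ᴱ = 0# , 0#
  1ᴱ = 1# , 0#

  norm : E → Carrier
  norm (a , b) = a * a - δ * (b * b)

  ringᴱ : CommutativeRing 0ℓ 0ℓ
  ringᴱ = record
    { Carrier = E ; _≈_ = _≡_ ; _+_ = _⊞_ ; _*_ = _⊠_ ; -_ = ⊟_ ; 0# = 0ᴱ ; 1# = 1ᴱ
    ; isCommutativeRing = record
      { isRing = record
        { +-isAbelianGroup = record
          { isGroup = record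
            { isMonoid = record
              { isSemigroup = record
                { isMagma = record { isEquivalence = isEquivalence ; ∙-cong = cong₂ _⊞_ }
                ; assoc = λ x y z → cong₂ _,_ (+-assoc _ _ _) (+-assoc _ _ _) }
              ; identity = (λ x → cong₂ _,_ (+-identityˡ _) (+-identityˡ _)) , (λ x → cong₂ _,_ (+-identityʳ _) (+-identityʳ _)) }
            ; inverse = (λ x → cong₂ _,_ (-‿inverseˡ _) (-‿inverseˡ _)) , (λ x → cong₂ _,_ (-‿inverseʳ _) (-‿inverseʳ _))
            ; ⁻¹-cong = cong (λ x → ⊟ x) }
          ; comm = λ x y → cong₂ _,_ (+-comm _ _) (+-comm _ _) }
        ; *-cong = cong₂ _⊠_
        ; *-assoc = λ { (a , b) (c , d) (e , f) → cong₂ _,_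
            (solve 7 (λ a b c d e f δ → (a :* c :+ δ :* (b :* d)) :* e :+ δ :* ((a :* d :+ b :* c) :* f)
               := a :* (c :* e :+ δ :* (d :* f)) :+ δ :* (b :* (c :* f :+ d :* e))) refl a b c d e f δ)
            (solve 7 (λ a b c d e f δ → (a :* c :+ δ :* (b :* d)) :* f :+ (a :* d :+ b :* c) :* e
               := a :* (c :* f :+ d :* e) :+ b :* (c :* e :+ δ :* (d :* f))) refl a b c d e f δ) }
        ; *-identity = (λ { (a , b) → cong₂ _,_
              (solve 3 (λ a b δ → :# 1 :* a :+ δ :* (:# 0 :* b) := a) refl a b δ)
              (solve 2 (λ a b → :# 1 :* b :+ :# 0 :* a := b) refl a b) })
            , (λ { (a , b) → cong₂ _,_
              (solve 3 (λ a b δ → a :* :# 1 :+ δ :* (b :* :# 0) := a) refl a b δ)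
              (solve 2 (λ a b → a :* :# 0 :+ b :* :# 1 := b) refl a b) })
        ; distrib = (λ { (a , b) (c , d) (e , f) → cong₂ _,_
              (solve 7 (λ a b c d e f δ → a :* (c :+ e) :+ δ :* (b :* (d :+ f)) := (a :* c :+ δ :* (b :* d)) :+ (a :* e :+ δ :* (b :* f))) refl a b c d e f δ)
              (solve 6 (λ a b c d e f → a :* (d :+ f) :+ b :* (c :+ e) := (a :* d :+ b :* c) :+ (a :* f :+ b :* e)) refl a b c d e f) })
            , (λ { (a , b) (c , d) (e , f) → cong₂ _,_
              (solve 7 (λ a b c d e f δ → (c :+ e) :* a :+ δ :* ((d :+ f) :* b) := (c :* a :+ δ :* (d :* b)) :+ (e :* a :+ δ :* (f :* b))) refl a b c d e f δ)
              (solve 6 (λ a b c d e f → (c :+ e) :* b :+ (d :+ f) :* a := (c :* b :+ d :* a) :+ (e :* b :+ f :* a)) refl a b c d e f) }) }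
      ; *-comm = λ { (a , b) (c , d) → cong₂ _,_
          (solve 5 (λ a b c d δ → a :* c :+ δ :* (b :* d) := c :* a :+ δ :* (d :* b)) refl a b c d δ)
          (solve 4 (λ a b c d → a :* d :+ b :* c := c :* b :+ d :* a) refl a b c d) } } }

  -- For b ≠ 0 a vanishing norm would make a/b a square root of δ.
  norm-zero : ∀ a b → norm (a , b) ≡ 0# → (a , b) ≡ 0ᴱ
  norm-zero a b p = go (b ≟ 0#)
    where
    go : Dec (b ≡ 0#) → (a , b) ≡ 0ᴱ
    go (yes b≡0) = cong₂ _,_ (square-zero (trans (solve 1 (λ a → a := a :- :# 0) refl (a * a))
                     (trans (cong (λ z → a * a - z) (sym (trans (cong (λ b → δ * (b * b)) b≡0) (trans (cong (δ *_) (zeroˡ 0#)) (zeroʳ δ))))) p))) b≡0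
      where
      square-zero : a * a ≡ 0# → a ≡ 0#
      square-zero q with a ≟ 0#
      ... | yes r = r
      ... | no r  = contradiction q (*-nonzero r r)
    go (no b≢0) = contradiction (begin
      a * b ⁻¹ * (a * b ⁻¹)                  ≡⟨ solve 2 (λ a u → a :* u :* (a :* u) := a :* a :* (u :* u)) refl a (b ⁻¹) ⟩
      a * a * (b ⁻¹ * b ⁻¹)                  ≡⟨ cong (_* (b ⁻¹ * b ⁻¹)) (-≡0⇒≡ p) ⟩
      δ * (b * b) * (b ⁻¹ * b ⁻¹)            ≡⟨ solve 3 (λ δ b u → δ :* (b :* b) :* (u :* u) := δ :* ((b :* u) :* (b :* u))) refl δ b (b ⁻¹) ⟩
      δ * (b * b ⁻¹ * (b * b ⁻¹))            ≡⟨ cong (λ u → δ * (u * u)) (inverseʳ b≢0) ⟩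
      δ * (1# * 1#)                          ≡⟨ trans (cong (δ *_) (*-identityˡ 1#)) (*-identityʳ δ) ⟩
      δ                                      ∎) (no-root (a * b ⁻¹))

  invᴱ : E → E
  invᴱ (a , b) = a * norm (a , b) ⁻¹ , - b * norm (a , b) ⁻¹

  invᴱ-inverse : ∀ x → norm x ≢ 0# → x ⊠ invᴱ x ≡ 1ᴱ
  invᴱ-inverse (a , b) n≢0 = cong₂ _,_
    (trans (solve 4 (λ a b u δ → a :* (a :* u) :+ δ :* (b :* ((:- b) :* u)) := (a :* a :- δ :* (b :* b)) :* u) refl a b (norm (a , b) ⁻¹) δ) (inverseʳ n≢0))
    (solve 3 (λ a b u → a :* ((:- b) :* u) :+ b :* (a :* u) := :# 0) refl a b (norm (a , b) ⁻¹))

  fieldᴱ : FiniteField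
  fieldᴱ = record
    { commRing       = ringᴱ
    ; ≈⇒≡            = λ p → p
    ; 1≢0            = λ p → 1≢0 (cong proj₁ p)
    ; inverse        = λ { (a , b) x≢0 → invᴱ (a , b) , invᴱ-inverse (a , b) (λ p → x≢0 (norm-zero a b p)) }
    ; _≟_            = Enum._≟_ (enum ⊗ enum)
    ; elems          = Enum.elems (enum ⊗ enum)
    ; elems-unique   = Enum.unique (enum ⊗ enum)
    ; elems-complete = Enum.complete (enum ⊗ enum)
    }

-- Additivity of the q-th power

module Frobenius (K : FiniteField) where
  open import Data.Nat as ℕ using (ℕ; zero; suc; s≤s)
  open import Data.List using (List; length)
  open import Data.List.Relation.Unary.Unique.Propositional using (Unique)
  open import Data.List.Relation.Unary.All as All using (All)
  open import Data.Product using (_×_; _,_; proj₁; proj₂)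
  open import Relation.Nullary using (Dec; yes; no)
  open import Relation.Binary.PropositionalEquality using (_≡_; refl; sym; trans; cong; cong₂; subst; module ≡-Reasoning)
  open Field K
  open Polynomials K
  open NonSquare K using (PolyTop; polyTop-mul)
  open ≡-Reasoning

  X+1-^ : ∀ n → PolyTop n (λ y → (y + 1#) ^ n) (λ _ → 1#)
  X+1-^ zero    = (λ _ → 0#) , (1# , λ _ → refl) , nil (λ _ → refl) , λ y → sym (trans (+-identityʳ _) (*-identityʳ _))
  X+1-^ (suc n) = subst (PolyTop (suc n) (λ y → (y + 1#) ^ suc n)) refl
    (top-cong (λ _ → *-identityˡ 1#) (polyTop-mul {P = 1} {f = _+ 1#} {t = λ _ → 1#}
      ((λ _ → 1#) , (1# , λ _ → refl) , poly-const 1# , λ y → solve 2 (λ y o → y :+ o := :# 1 :* (y :* :# 1) :+ o) refl y 1#) (X+1-^ n)))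
    where
    top-cong : ∀ {P f t s} → (∀ y → t y ≡ s y) → PolyTop P f t → PolyTop P f s
    top-cong {P} h (low , (a , p) , bl , q) = low , (a , λ y → trans (sym (h y)) (p y)) , bl , λ y → trans (q y) (cong (λ u → u * y ^ P + low y) (h y))

  -- (y + 1)^q - y^q - 1 has degree less than q but vanishes on all of Z.
  module _ {q : ℕ} (1≤q : 1 ℕ.≤ q) {Z : List Carrier} (uZ : Unique Z) (|Z| : q ℕ.≤ length Z)
           (fixed : All (λ z → z ^ q ≡ z × (z + 1#) ^ q ≡ z + 1#) Z) where

    frobenius-+1 : ∀ y → (y + 1#) ^ q ≡ y ^ q + 1#
    frobenius-+1 y = -≡0⇒≡ (poly-roots {f = λ y → (y + 1#) ^ q - (y ^ q + 1#)} pf uZ (All.map root fixed) |Z| y)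
      where
      T = X+1-^ q
      pf : IsPoly q (λ y → (y + 1#) ^ q - (y ^ q + 1#))
      pf = Blk-ext (λ y → trans (cong (_- (y ^ q + 1#)) (proj₂ (proj₂ (proj₂ T)) y))
          (solve 2 (λ p l → (:# 1 :* p :+ l) :- (p :+ :# 1) := l :- :# 1) refl (y ^ q) (proj₁ T y)))
        (Closed.subᶜ (poly-closed q) (proj₁ (proj₂ (proj₂ T))) (poly-weaken 1≤q (poly-const 1#)))
      root : ∀ {z} → z ^ q ≡ z × (z + 1#) ^ q ≡ z + 1# → (z + 1#) ^ q - (z ^ q + 1#) ≡ 0#
      root (p , p′) = ≡⇒-≡0 (trans p′ (cong (_+ 1#) (sym p)))

    -- Homogeneity reduces this to `frobenius-+1`: for y ≠ 0 apply it to x/y and multiply by y^q.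
    frobenius-+ : ∀ x y → (x + y) ^ q ≡ x ^ q + y ^ q
    frobenius-+ x y = go (y ≟ 0#)
      where
      0^q : ∀ {q} → 1 ℕ.≤ q → 0# ^ q ≡ 0#
      0^q (s≤s {n = n} _) = 0^ n
      go : Dec (y ≡ 0#) → (x + y) ^ q ≡ x ^ q + y ^ q
      go (yes refl) = trans (cong (_^ q) (+-identityʳ x)) (sym (trans (cong (x ^ q +_) (0^q 1≤q)) (+-identityʳ _)))
      go (no y≢0) = begin
        (x + y) ^ q                          ≡⟨ cong (λ u → (u + y) ^ q) x≡ ⟩
        (y * (x * y ⁻¹) + y) ^ q             ≡⟨ cong (_^ q) (solve 2 (λ y u → y :* u :+ y := y :* (u :+ :# 1)) refl y (x * y ⁻¹)) ⟩
        (y * (x * y ⁻¹ + 1#)) ^ q            ≡⟨ ^-distrib-* y _ q ⟩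
        y ^ q * (x * y ⁻¹ + 1#) ^ q          ≡⟨ cong (y ^ q *_) (frobenius-+1 (x * y ⁻¹)) ⟩
        y ^ q * ((x * y ⁻¹) ^ q + 1#)        ≡⟨ solve 2 (λ a b → a :* (b :+ :# 1) := a :* b :+ a) refl (y ^ q) ((x * y ⁻¹) ^ q) ⟩
        y ^ q * (x * y ⁻¹) ^ q + y ^ q       ≡⟨ cong (_+ y ^ q) (^-distrib-* y _ q) ⟨
        (y * (x * y ⁻¹)) ^ q + y ^ q         ≡⟨ cong (λ u → u ^ q + y ^ q) x≡ ⟨
        x ^ q + y ^ q                        ∎
        where
        x≡ : x ≡ y * (x * y ⁻¹)
        x≡ = sym (trans (solve 3 (λ y x u → y :* (x :* u) := x :* (y :* u)) refl y x (y ⁻¹)) (trans (cong (x *_) (inverseʳ y≢0)) (*-identityʳ x)))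

    frobenius-iterate : ∀ n x y → (x + y) ^ (q ℕ.^ n) ≡ x ^ (q ℕ.^ n) + y ^ (q ℕ.^ n)
    frobenius-iterate zero    x y = trans (*-identityʳ _) (sym (cong₂ _+_ (*-identityʳ x) (*-identityʳ y)))
    frobenius-iterate (suc n) x y = begin
      (x + y) ^ (q ℕ.* q ℕ.^ n)                         ≡⟨ ^-assocʳ (x + y) q (q ℕ.^ n) ⟨
      ((x + y) ^ q) ^ (q ℕ.^ n)                         ≡⟨ cong (_^ (q ℕ.^ n)) (frobenius-+ x y) ⟩
      (x ^ q + y ^ q) ^ (q ℕ.^ n)                       ≡⟨ frobenius-iterate n (x ^ q) (y ^ q) ⟩
      (x ^ q) ^ (q ℕ.^ n) + (y ^ q) ^ (q ℕ.^ n)         ≡⟨ cong₂ _+_ (^-assocʳ x q (q ℕ.^ n)) (^-assocʳ y q (q ℕ.^ n)) ⟩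
      x ^ (q ℕ.* q ℕ.^ n) + y ^ (q ℕ.* q ℕ.^ n)         ∎

-- The tower of quadratic extensions and its traces

module Tower (F : FiniteField) (k : ℕ) (q≡ : FiniteField.order F ≡ suc (k ℕ.+ k)) where
  import Data.Nat.Properties as ℕP
  open import Data.List using (List; map)
  open import Data.List.Properties using (length-map)
  open import Data.List.Relation.Unary.Unique.Propositional using (Unique)
  import Data.List.Relation.Unary.Unique.Propositional.Properties as Unique
  open import Data.List.Relation.Unary.All as All using (All)
  import Data.List.Relation.Unary.All.Properties as All
  open import Data.Product using (∃; _×_; _,_; proj₁; proj₂)
  open import Relation.Nullary using (yes; no; contradiction)
  open import Relation.Binary.PropositionalEquality using (_≢_; refl; sym; trans; cong; cong₂; subst; module ≡-Reasoning)
  open Sums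
  private module F = Field F
  open ≡-Reasoning

  q : ℕ
  q = F.order

  record Extension : Set₁ where
    field
      K : FiniteField
    open Field K
    field
      2≢0     : 2# ≢ 0#
      ι       : F.Carrier → Carrier
      ι-+     : ∀ x y → ι (x F.+ y) ≡ ι x + ι y
      ι-*     : ∀ x y → ι (x F.* y) ≡ ι x * ι y
      ι-1     : ι F.1# ≡ 1#

    ι-0 : ι F.0# ≡ 0#
    ι-0 = trans (solve 1 (λ x → x := (x :+ x) :- x) refl (ι F.0#)) (trans (cong (_- ι F.0#) (trans (sym (ι-+ F.0# F.0#)) (cong ι (F.+-identityˡ F.0#)))) (-‿inverseʳ _))

    ι-neg : ∀ x → ι (F.- x) ≡ - ι x
    ι-neg x = trans (solve 2 (λ a b → b := (a :+ b) :+ (:- a)) refl (ι x) (ι (F.- x)))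
      (trans (cong (_+ - ι x) (trans (sym (ι-+ x (F.- x))) (trans (cong ι (F.-‿inverseʳ x)) ι-0))) (+-identityˡ _))

    ι-nonzero : ∀ {x} → x ≢ F.0# → ι x ≢ 0#
    ι-nonzero {x} x≢0 p = 1≢0 (trans (sym ι-1) (trans (cong ι (sym (F.inverseʳ x≢0))) (trans (ι-* x (x F.⁻¹)) (trans (cong (_* ι (x F.⁻¹)) p) (zeroˡ _)))))

    ι-injective : ∀ {x y} → ι x ≡ ι y → x ≡ y
    ι-injective {x} {y} p = F.-≡0⇒≡ (zero-only (trans (ι-+ x (F.- y)) (trans (cong (ι x +_) (ι-neg y)) (≡⇒-≡0 p))))
      where
      zero-only : ∀ {z} → ι z ≡ 0# → z ≡ F.0#
      zero-only {z} h with z F.≟ F.0#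
      ... | yes r = r
      ... | no r  = contradiction h (ι-nonzero r)

    ι-^ : ∀ x n → ι (x F.^ n) ≡ ι x ^ n
    ι-^ x zero    = ι-1
    ι-^ x (suc n) = trans (ι-* x (x F.^ n)) (cong (ι x *_) (ι-^ x n))

    ι-frob : ∀ x → ι x ^ q ≡ ι x
    ι-frob x = trans (sym (ι-^ x q)) (cong ι (F.fermat x))

    private
      Z : List Carrier
      Z = map ι (Enum.elems F.enum)

      uZ : Unique Z
      uZ = Unique.map⁺ ι-injective (Enum.unique F.enum)

      1≤q : 1 ℕ.≤ q
      1≤q = subst (1 ℕ.≤_) (sym q≡) (ℕ.s≤s ℕ.z≤n)

      fixed : All (λ z → z ^ q ≡ z × (z + 1#) ^ q ≡ z + 1#) Z
      fixed = All.map⁺ (All.universal (λ x → ι-frob x , trans (cong (_^ q) (x+1 x)) (trans (ι-frob (x F.+ F.1#)) (sym (x+1 x)))) _)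
        where
        x+1 : ∀ x → ι x + 1# ≡ ι (x F.+ F.1#)
        x+1 x = trans (cong (ι x +_) (sym ι-1)) (sym (ι-+ x F.1#))

    -- The q elements ι x and their translates ι x + 1 = ι (x + 1) are fixed by the q-th power; they
    -- are the zeros that force additivity on all of K.
    frob-+ : ∀ x y → (x + y) ^ q ≡ x ^ q + y ^ q
    frob-+ = Frobenius.frobenius-+ K 1≤q uZ (ℕP.≤-reflexive (sym (length-map ι (Enum.elems F.enum)))) fixed

    frob-iterate : ∀ n x y → (x + y) ^ (q ℕ.^ n) ≡ x ^ (q ℕ.^ n) + y ^ (q ℕ.^ n)
    frob-iterate = Frobenius.frobenius-iterate K 1≤q uZ (ℕP.≤-reflexive (sym (length-map ι (Enum.elems F.enum)))) fixed

  -- The trace is kept abstract. Surjectivity makes the sum of χ ∘ tr vanish wherever the sum of χ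
  -- does, and invariance under the q-th power gives tr (y^q - y) = 0.
  record Level : Set₁ where
    field
      extension : Extension
    open Extension extension public
    open Field K
    field
      tr      : Carrier → F.Carrier
      tr-+    : ∀ x y → tr (x + y) ≡ tr x F.+ tr y
      tr-surj : ∀ c → ∃ λ x → tr x ≡ c
      tr-frob : ∀ x → tr (x ^ q) ≡ tr x

    tr-0 : tr 0# ≡ F.0#
    tr-0 = trans (F.solve 1 (λ x → x F.:= (x F.:+ x) F.:- x) refl (tr 0#)) (trans (cong (F._- tr 0#) (trans (sym (tr-+ 0# 0#)) (cong tr (+-identityˡ 0#)))) (F.-‿inverseʳ _))

    tr-neg : ∀ x → tr (- x) ≡ F.- tr x
    tr-neg x = trans (F.solve 2 (λ a b → b F.:= (a F.:+ b) F.:+ (F.:- a)) refl (tr x) (tr (- x)))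
      (trans (cong (F._+ (F.- tr x)) (trans (sym (tr-+ x (- x))) (trans (cong tr (-‿inverseʳ x)) tr-0))) (F.+-identityˡ _))

  base : Level
  base = record
    { extension = record
      { K = F ; 2≢0 = F.odd⇒2≢0 {k} q≡ ; ι = λ x → x ; ι-+ = λ _ _ → refl ; ι-* = λ _ _ → refl ; ι-1 = refl }
    ; tr = λ x → x ; tr-+ = λ _ _ → refl ; tr-surj = λ c → c , refl ; tr-frob = F.fermat }

  module Next (lev : Level) (δ : Field.Carrier (Level.K lev)) (δ-nonsquare : ∀ h → Field._*_ (Level.K lev) h h ≢ δ) where
    open Level lev
    open Field K

    module X = QuadraticExtension K δ δ-nonsquare
    module L = Field X.fieldᴱ

    embed : Carrier → L.Carrier
    embed x = x , 0#

    embed-+ : ∀ x y → embed (x + y) ≡ embed x L.+ embed y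
    embed-+ x y = cong (x + y ,_) (sym (+-identityˡ 0#))

    embed-* : ∀ x y → embed (x * y) ≡ embed x L.* embed y
    embed-* x y = cong₂ _,_ (solve 3 (λ x y δ → x :* y := x :* y :+ δ :* (:# 0 :* :# 0)) refl x y δ)
      (solve 2 (λ x y → :# 0 := x :* :# 0 :+ :# 0 :* y) refl x y)

    embed-neg : ∀ x → embed (- x) ≡ L.- embed x
    embed-neg x = cong (- x ,_) (sym -0#≈0#)

    embed-^ : ∀ x n → embed (x ^ n) ≡ embed x L.^ n
    embed-^ x zero    = refl
    embed-^ x (suc n) = trans (embed-* x (x ^ n)) (cong (embed x L.*_) (embed-^ x n))

    private
      √δ : L.Carrier
      √δ = 0# , 1#

      √δ-odd : ∀ n → √δ L.^ suc (n ℕ.+ n) ≡ (0# , δ ^ n)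
      √δ-odd zero = cong₂ _,_ (solve 1 (λ δ → :# 0 :* :# 1 :+ δ :* (:# 1 :* :# 0) := :# 0) refl δ)
        (solve 0 (:# 0 :* :# 0 :+ :# 1 :* :# 1 := :# 1) refl)
      √δ-odd (suc n) = trans (cong (λ m → √δ L.^ suc (suc m)) (ℕP.+-suc n n)) (trans (cong (λ u → √δ L.* (√δ L.* u)) (√δ-odd n)) (cong₂ _,_
        (solve 2 (λ δ d → :# 0 :* (:# 0 :* :# 0 :+ δ :* (:# 1 :* d)) :+ δ :* (:# 1 :* (:# 0 :* d :+ :# 1 :* :# 0)) := :# 0) refl δ (δ ^ n))
        (solve 2 (λ δ d → :# 0 :* (:# 0 :* d :+ :# 1 :* :# 0) :+ :# 1 :* (:# 0 :* :# 0 :+ δ :* (:# 1 :* d)) := δ :* d) refl δ (δ ^ n))))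

      split : ∀ m n → (m , n) ≡ embed m L.+ embed n L.* √δ
      split m n = cong₂ _,_ (solve 3 (λ m n δ → m := m :+ (n :* :# 0 :+ δ :* (:# 0 :* :# 1))) refl m n δ)
        (solve 1 (λ n → n := :# 0 :+ (n :* :# 1 :+ :# 0 :* :# 0)) refl n)

    -- m + m is the trace of m + n √δ over K, so the formula is transitivity of traces.
    trᴸ : L.Carrier → F.Carrier
    trᴸ (m , n) = tr (m + m)

    ιᴸ : F.Carrier → L.Carrier
    ιᴸ x = embed (ι x)

    private
      half : Carrier
      half = 2# ⁻¹

      half+half : ∀ x → half * x + half * x ≡ x
      half+half x = trans (solve 2 (λ h x → h :* x :+ h :* x := ((:# 1 :+ :# 1) :* h) :* x) refl half x)
        (trans (cong (_* x) (inverseʳ 2≢0)) (*-identityˡ x))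

    extᴸ : Extension
    extᴸ = record
      { K = X.fieldᴱ ; 2≢0 = λ p → 2≢0 (cong proj₁ p) ; ι = ιᴸ
      ; ι-+ = λ x y → trans (cong embed (ι-+ x y)) (embed-+ (ι x) (ι y))
      ; ι-* = λ x y → trans (cong embed (ι-* x y)) (embed-* (ι x) (ι y)) ; ι-1 = cong embed ι-1 }

    private
      -- As q = 2k + 1, (√δ)^q = δ^k √δ. Hence the q-th power acts on the first coordinate as it
      -- does in K, and `trᴸ` reads only this coordinate.
      frob-pair : ∀ m n → (m , n) L.^ q ≡ (m ^ q , n ^ q * δ ^ k)
      frob-pair m n = begin
        (m , n) L.^ q                                            ≡⟨ cong (L._^ q) (split m n) ⟩
        (embed m L.+ embed n L.* √δ) L.^ q                       ≡⟨ Extension.frob-+ extᴸ (embed m) (embed n L.* √δ) ⟩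
        embed m L.^ q L.+ (embed n L.* √δ) L.^ q                 ≡⟨ cong₂ L._+_ (sym (embed-^ m q)) (trans (L.^-distrib-* (embed n) √δ q) (cong₂ L._*_ (sym (embed-^ n q)) (trans (cong (√δ L.^_) q≡) (√δ-odd k)))) ⟩
        embed (m ^ q) L.+ embed (n ^ q) L.* (0# , δ ^ k)         ≡⟨ cong₂ _,_
          (solve 4 (λ m n d δ → m :+ (n :* :# 0 :+ δ :* (:# 0 :* d)) := m) refl (m ^ q) (n ^ q) (δ ^ k) δ)
          (solve 2 (λ n d → :# 0 :+ (n :* d :+ :# 0 :* :# 0) := n :* d) refl (n ^ q) (δ ^ k)) ⟩
        (m ^ q , n ^ q * δ ^ k)                                  ∎

    next : Level
    next = record
      { extension = extᴸ
      ; tr        = trᴸ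
      ; tr-+      = λ { (m , n) (m′ , n′) → trans (cong tr (solve 2 (λ m m′ → (m :+ m′) :+ (m :+ m′) := (m :+ m) :+ (m′ :+ m′)) refl m m′)) (tr-+ (m + m) (m′ + m′)) }
      ; tr-surj   = λ c → embed (half * proj₁ (tr-surj c)) , trans (cong tr (half+half (proj₁ (tr-surj c)))) (proj₂ (tr-surj c))
      ; tr-frob   = λ { (m , n) → trans (cong trᴸ (frob-pair m n)) (trans (tr-+ (m ^ q) (m ^ q))
          (trans (cong₂ F._+_ (tr-frob m) (tr-frob m)) (sym (tr-+ m m)))) }
      }

    order-next : L.order ≡ order ℕ.* order
    order-next = card-⊗ enum enum

  nonsquareᴷ : (lev : Level) → ∃ λ δ → ∀ h → Field._*_ (Level.K lev) h h ≢ δ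
  nonsquareᴷ lev = QuadraticCharacter.nonsquare-exists (Level.K lev) (Level.2≢0 lev)

  level : ℕ → Level
  level zero    = base
  level (suc j) = Next.next (level j) (proj₁ (nonsquareᴷ (level j))) (proj₂ (nonsquareᴷ (level j)))

  order-level : ∀ j → FiniteField.order (Level.K (level j)) ≡ q ℕ.^ (2 ℕ.^ j)
  order-level zero    = sym (ℕP.*-identityʳ q)
  order-level (suc j) = begin
    FiniteField.order (Level.K (level (suc j)))    ≡⟨ Next.order-next (level j) (proj₁ (nonsquareᴷ (level j))) (proj₂ (nonsquareᴷ (level j))) ⟩
    FiniteField.order (Level.K (level j)) ℕ.* FiniteField.order (Level.K (level j)) ≡⟨ cong₂ ℕ._*_ (order-level j) (order-level j) ⟩
    q ℕ.^ (2 ℕ.^ j) ℕ.* q ℕ.^ (2 ℕ.^ j)            ≡⟨ ℕP.^-distribˡ-+-* q (2 ℕ.^ j) (2 ℕ.^ j) ⟨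
    q ℕ.^ (2 ℕ.^ j ℕ.+ 2 ℕ.^ j)                    ≡⟨ cong (λ n → q ℕ.^ (2 ℕ.^ j ℕ.+ n)) (ℕP.+-identityʳ (2 ℕ.^ j)) ⟨
    q ℕ.^ (2 ℕ.^ suc j)                            ∎

-- Points on s + a/s = y^q - y + c

module PointCount (F : FiniteField) (k : ℕ) (q≡ : FiniteField.order F ≡ suc (k ℕ.+ k)) (3≤q : 3 ℕ.≤ FiniteField.order F)
                  (lev : Tower.Level F k q≡)
                  (δ : Field.Carrier (Tower.Level.K lev)) (δ-nonsquare : ∀ h → Field._*_ (Tower.Level.K lev) h h ≢ δ) (r R : ℕ) (R≡ : R ≡ FiniteField.order F ℕ.^ r)
                  (order≡R² : FiniteField.order (Tower.Level.K lev) ≡ R ℕ.* R)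
                  (q⁴≤R : FiniteField.order F ℕ.* FiniteField.order F ℕ.* (FiniteField.order F ℕ.* FiniteField.order F) ℕ.≤ R) where
  import Data.Nat.Properties as ℕP
  open import Data.List using (List; length; filter)
  open import Data.List.Properties using (length-map)
  import Data.List.Relation.Unary.Unique.Propositional.Properties as Unique
  open import Data.List.Relation.Unary.All as All using ()
  import Data.List.Relation.Unary.All.Properties as All
  open import Data.Product using (∃; _×_; _,_; proj₁; proj₂)
  open import Data.Rational as ℚ using (0ℚ; 1ℚ)
  import Data.Rational.Properties as ℚP
  open import Relation.Nullary using (Dec; yes; no; ¬?; contradiction)
  open import Relation.Binary.PropositionalEquality using (refl; sym; trans; cong; cong₂; subst; module ≡-Reasoning)
  open Sums
  open Tower F k q≡
  open Q using (⟨_⟩; ⟨yes⟩; ∑)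
  open ≡-Reasoning

  open Level lev using (K; 2≢0)
  open Field K
  open QuadraticCharacter K 2≢0
  open Next lev δ δ-nonsquare using (embed; embed-+; embed-*; embed-neg; embed-^; extᴸ; order-next)
  private
    -- Stepanov's argument takes place in this field with R⁴ elements, because the squares compared
    -- in it have degree bounds above |K| = R².
    module L = Field (Extension.K extᴸ)

  private
    2≤q : 2 ℕ.≤ q
    2≤q = ℕP.≤-trans (ℕ.s≤s (ℕ.s≤s ℕ.z≤n)) 3≤q

    oddR : ∃ λ M → R ≡ suc (M ℕ.+ M)
    oddR = proj₁ (StepanovParameters.odd-^ {q} {k} q≡ r) , trans R≡ (proj₂ (StepanovParameters.odd-^ {q} {k} q≡ r))

    module A = StepanovParameters.LargePower {q} {proj₁ oddR} {R} 3≤q (proj₂ oddR) q⁴≤R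

    M : ℕ
    M = A.l ℕ.+ q

    orderL : L.order ≡ R ℕ.* R ℕ.* R ℕ.* R
    orderL = trans order-next (trans (cong₂ ℕ._*_ order≡R² order≡R²) (sym (ℕP.*-assoc (R ℕ.* R) R R)))

    instance
      R-nonZero : ℕ.NonZero R
      R-nonZero = subst ℕ.NonZero (sym A.R≡′) _

    R³≤ : R ℕ.* R ℕ.* R ℕ.≤ L.order
    R³≤ = subst (R ℕ.* R ℕ.* R ℕ.≤_) (sym orderL) (ℕP.m≤m*n (R ℕ.* R ℕ.* R) R)

    -- h^{Q-1} = 1 in the form in which it is applied to D(y) = h².
    square-fixed : ∀ h → h ≢ 0# → ((h * h) ^ suc M) ^ R ≡ (h * h) ^ suc M
    square-fixed h h≢0 = begin
      ((h * h) ^ suc M) ^ R                       ≡⟨ ^-assocʳ (h * h) (suc M) R ⟩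
      (h * h) ^ (suc M ℕ.* R)                     ≡⟨ cong ((h * h) ^_) (trans (cong (suc M ℕ.*_) A.R≡′) (ℕS.solve 1 (λ M → (ℕS.con 1 ℕS.:+ M) ℕS.:* (ℕS.con 1 ℕS.:+ (M ℕS.:+ M)) ℕS.:= (ℕS.con 1 ℕS.:+ M) ℕS.:+ (ℕS.con 2 ℕS.:* M ℕS.:* (ℕS.con 1 ℕS.:+ M))) refl M)) ⟩
      (h * h) ^ (suc M ℕ.+ n)                     ≡⟨ ^-homo-* (h * h) (suc M) n ⟩
      (h * h) ^ suc M * (h * h) ^ n               ≡⟨ cong ((h * h) ^ suc M *_) one ⟩
      (h * h) ^ suc M * 1#                        ≡⟨ *-identityʳ _ ⟩
      (h * h) ^ suc M                             ∎
      where
      open import Data.Nat.Solver using (module +-*-Solver)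
      module ℕS = +-*-Solver
      n : ℕ
      n = 2 ℕ.* M ℕ.* suc M
      Q≡ : order ≡ suc (n ℕ.+ n)
      Q≡ = trans order≡R² (trans (cong (λ r → r ℕ.* r) A.R≡′) (ℕS.solve 1 (λ M → (ℕS.con 1 ℕS.:+ (M ℕS.:+ M)) ℕS.:* (ℕS.con 1 ℕS.:+ (M ℕS.:+ M))
             ℕS.:= ℕS.con 1 ℕS.:+ ((ℕS.con 2 ℕS.:* M ℕS.:* (ℕS.con 1 ℕS.:+ M)) ℕS.:+ (ℕS.con 2 ℕS.:* M ℕS.:* (ℕS.con 1 ℕS.:+ M)))) refl M))
      one : (h * h) ^ n ≡ 1#
      one = *-cancelˡ h≢0 (begin
        h * (h * h) ^ n            ≡⟨ cong (h *_) (^-distrib-* h h n) ⟩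
        h * (h ^ n * h ^ n)        ≡⟨ cong (h *_) (^-homo-* h n n) ⟨
        h ^ suc (n ℕ.+ n)          ≡⟨ cong (h ^_) Q≡ ⟨
        h ^ order                  ≡⟨ fermat h ⟩
        h                          ≡⟨ *-identityʳ h ⟨
        h * 1#                     ∎)

    4# : Carrier
    4# = 2# * 2#

  module _ (a : Carrier) (a≢0 : a ≢ 0#) (c : Carrier) where

    private
      e : Carrier
      e = 4# * a

      e≢0 : e ≢ 0#
      e≢0 = *-nonzero (*-nonzero 2≢0 2≢0) a≢0

      open NonSquare.ArtinSchreier K 2≤q c e using (L; D; D-top; D-nonzero)

      module St = NonSquare.ArtinSchreier (Extension.K extᴸ) 2≤q (embed c) (embed e)

      D-embed : ∀ y → St.D (embed y) ≡ embed (D y)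
      D-embed y = sym (trans (embed-+ (L y * L y) (- e)) (cong₂ L._+_ (trans (embed-* (L y) (L y)) (cong₂ L._*_ L-embed L-embed)) (embed-neg e)))
        where
        L-embed : embed (L y) ≡ St.L (embed y)
        L-embed = trans (embed-+ (y ^ q - y) c) (cong (L._+ embed c) (trans (embed-+ (y ^ q) (- y)) (cong₂ L._+_ (embed-^ y q) (embed-neg y))))

      good? : ∀ y → Dec (η (D y) ≡ 1ℚ)
      good? y = η (D y) ℚP.≟ 1ℚ

      Z Z₀ : List Carrier
      Z  = filter good? (Enum.elems enum)
      Z₀ = filter (λ y → D y ≟ 0#) (Enum.elems enum)

      good⇒fixed : ∀ {y} → η (D y) ≡ 1ℚ → (embed y L.^ R) L.^ R ≡ embed y × (St.D (embed y) L.^ suc M) L.^ R ≡ St.D (embed y) L.^ suc M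
      good⇒fixed {y} p = trans (L.^-assocʳ (embed y) R R) (trans (sym (embed-^ y (R ℕ.* R))) (cong embed (trans (cong (y ^_) (sym order≡R²)) (fermat y)))) ,
        trans (cong (λ u → (u L.^ suc M) L.^ R) (D-embed y)) (trans (trans (trans (cong (L._^ R) (sym (embed-^ (D y) (suc M)))) (sym (embed-^ (D y ^ suc M) R)))
          (trans (cong embed (go (squareView (D y)))) (embed-^ (D y) (suc M)))) (cong (L._^ suc M) (sym (D-embed y))))
        where
        go : SquareView (D y) → (D y ^ suc M) ^ R ≡ D y ^ suc M
        go (zeroˢ r) = contradiction (trans (sym p) (trans (cong η r) η-0)) (λ ())
        go (square {h} h≢0 r) = subst (λ d → (d ^ suc M) ^ R ≡ d ^ suc M) r (square-fixed h h≢0)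
        go (nonsquare r) = contradiction (trans (sym p) (η-nonsquare r)) (λ ())

      |Z|< : length Z ℕ.< A.m ℕ.* R ℕ.+ suc (suc M ℕ.* (q ℕ.+ q))
      |Z|< = subst (ℕ._< A.m ℕ.* R ℕ.+ suc (suc M ℕ.* (q ℕ.+ q))) (length-map embed Z)
        (Stepanov.stepanov (Extension.K extᴸ) (Extension.2≢0 extᴸ) q A.l M A.m R A.R≡′ 2≤q A.l≤R A.m≤R A.m≡ A.2l+D≡R
          (ℕP.≤-trans A.mR≤ R³≤) (ℕP.≤-trans A.2m≤ R³≤) (ℕP.≤-trans A.R≤R³ R³≤) (λ N<m → ℕP.≤-trans (A.blocks≤ N<m) R³≤) A.unknowns>
          -- The exponent R³ inverts the R-th power, since the extension has R⁴ elements.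
          (λ x y → subst (λ e → (x L.+ y) L.^ e ≡ x L.^ e L.+ y L.^ e) (sym R≡) (Extension.frob-iterate extᴸ r x y)) (R ℕ.* R ℕ.* R)
          (λ x → trans (L.^-assocʳ x (R ℕ.* R ℕ.* R) R) (trans (cong (x L.^_) (sym orderL)) (L.fermat x)))
          (embed c) (embed e) (λ p → e≢0 (cong proj₁ p))
          (Unique.map⁺ (cong proj₁) (Unique.filter⁺ good? (Enum.unique enum)))
          (All.map⁺ (All.map good⇒fixed (All.all-filter good? (Enum.elems enum)))))

      |Z₀|≤ : length Z₀ ℕ.≤ q ℕ.+ q
      |Z₀|≤ = ℕP.≮⇒≥ (λ l → D-nonzero (ℕP.<-≤-trans A.2q<R (subst (R ℕ.≤_) (sym order≡R²) (ℕP.m≤m*n R R)))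
        (Polynomials.poly-roots K (NonSquare.polyTop⇒poly K D-top) (Unique.filter⁺ (λ y → D y ≟ 0#) (Enum.unique enum)) (All.all-filter (λ y → D y ≟ 0#) (Enum.elems enum)) l))

      -- Completing the square: v = 2s - L y is a bijective substitution, and s + a/s = L y implies
      -- v² = L² - 4a = D y.
      fibre≤ : ∀ y → ∑ enum (λ s → ⟨ ¬? (s ≟ 0#) ⟩ ℚ.* ⟨ s + a * s ⁻¹ ≟ L y ⟩) ℚ.≤ roots (D y)
      fibre≤ y = ℚP.≤-trans (Q.sumL-mono (Enum.elems enum) (λ {s} _ → pointwise s (s ≟ 0#) (s + a * s ⁻¹ ≟ L y)))
        (ℚP.≤-reflexive (Q.∑-reindex enum enum (λ s → (s + s) - L y) (λ v → half * (v + L y)) ψφ φψ (λ v → ⟨ v * v ≟ D y ⟩)))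
        where
        half = 2# ⁻¹
        half-2 : ∀ x → half * (x + x) ≡ x
        half-2 x = trans (solve 2 (λ h x → h :* (x :+ x) := ((:# 1 :+ :# 1) :* h) :* x) refl half x) (trans (cong (_* x) (inverseʳ 2≢0)) (*-identityˡ x))
        ψφ : ∀ s → half * (((s + s) - L y) + L y) ≡ s
        ψφ s = trans (cong (half *_) (solve 2 (λ s l → ((s :+ s) :- l) :+ l := s :+ s) refl s (L y))) (half-2 s)
        φψ : ∀ v → (half * (v + L y) + half * (v + L y)) - L y ≡ v
        φψ v = trans (cong (_- L y) (trans (solve 2 (λ h x → h :* x :+ h :* x := h :* (x :+ x)) refl half (v + L y)) (half-2 (v + L y))))
          (solve 2 (λ v l → (v :+ l) :- l := v) refl v (L y))
        pointwise : ∀ s (d : Dec (s ≡ 0#)) (d′ : Dec (s + a * s ⁻¹ ≡ L y)) →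
          ⟨ ¬? d ⟩ ℚ.* ⟨ d′ ⟩ ℚ.≤ ⟨ ((s + s) - L y) * ((s + s) - L y) ≟ D y ⟩
        pointwise s (yes _) d′ = ℚP.≤-trans (ℚP.≤-reflexive (ℚP.*-zeroˡ ⟨ d′ ⟩)) (Q.0≤⟨⟩ (((s + s) - L y) * ((s + s) - L y) ≟ D y))
        pointwise s (no _) (no _) = Q.0≤⟨⟩ (((s + s) - L y) * ((s + s) - L y) ≟ D y)
        pointwise s (no s≢0) (yes p) = ℚP.≤-reflexive (sym (⟨yes⟩ (((s + s) - L y) * ((s + s) - L y) ≟ D y) (begin
          ((s + s) - L y) * ((s + s) - L y)                ≡⟨ solve 2 (λ s l → ((s :+ s) :- l) :* ((s :+ s) :- l) := l :* l :- ((:# 1 :+ :# 1) :* (:# 1 :+ :# 1)) :* (s :* (l :- s))) refl s (L y) ⟩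
          L y * L y - 4# * (s * (L y - s))                 ≡⟨ cong (λ u → L y * L y - 4# * (s * (u - s))) p ⟨
          L y * L y - 4# * (s * ((s + a * s ⁻¹) - s))      ≡⟨ cong (λ u → L y * L y - 4# * u) (solve 3 (λ s a u → s :* ((s :+ a :* u) :- s) := a :* (s :* u)) refl s a (s ⁻¹)) ⟩
          L y * L y - 4# * (a * (s * s ⁻¹))                ≡⟨ cong (λ u → L y * L y - 4# * u) (trans (cong (a *_) (inverseʳ s≢0)) (*-identityʳ a)) ⟩
          D y                                              ∎)))

      -- The number 1 + η (D y) is 2, 1 or 0 according to whether D y is a nonzero square, zero or a
      -- nonsquare.
      roots≤ : ∀ y → roots (D y) ℚ.≤ ⟨ good? y ⟩ ℚ.+ ⟨ good? y ⟩ ℚ.+ ⟨ D y ≟ 0# ⟩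
      roots≤ y = ℚP.≤-trans (ℚP.≤-reflexive (roots≡1+η (D y))) (go (squareView (D y)))
        where
        go : SquareView (D y) → 1ℚ ℚ.+ η (D y) ℚ.≤ ⟨ good? y ⟩ ℚ.+ ⟨ good? y ⟩ ℚ.+ ⟨ D y ≟ 0# ⟩
        go (zeroˢ r) = ℚP.≤-trans (ℚP.≤-reflexive (trans (cong (1ℚ ℚ.+_) (trans (cong η r) η-0)) (sym (trans (cong (0ℚ ℚ.+_) (⟨yes⟩ (D y ≟ 0#) r)) (ℚP.+-identityˡ 1ℚ)))))
          (ℚP.+-monoˡ-≤ ⟨ D y ≟ 0# ⟩ (Q.0≤+ (Q.0≤⟨⟩ (good? y)) (Q.0≤⟨⟩ (good? y))))
        go (square {h} h≢0 r) = ℚP.≤-trans (ℚP.≤-reflexive (trans (cong (1ℚ ℚ.+_) η≡1) (sym (trans (cong (λ u → u ℚ.+ u ℚ.+ 0ℚ) (⟨yes⟩ (good? y) η≡1)) refl))))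
          (ℚP.+-monoʳ-≤ (⟨ good? y ⟩ ℚ.+ ⟨ good? y ⟩) (Q.0≤⟨⟩ (D y ≟ 0#)))
          where
          η≡1 : η (D y) ≡ 1ℚ
          η≡1 = trans (cong η (sym r)) (η-square h≢0)
        go (nonsquare r) = ℚP.≤-trans (ℚP.≤-reflexive (cong (1ℚ ℚ.+_) (η-nonsquare r))) (Q.0≤+ (Q.0≤+ (Q.0≤⟨⟩ (good? y)) (Q.0≤⟨⟩ (good? y))) (Q.0≤⟨⟩ (D y ≟ 0#)))

    points≤ : ∑ enum (λ y → ∑ enum (λ s → ⟨ ¬? (s ≟ 0#) ⟩ ℚ.* ⟨ s + a * s ⁻¹ ≟ y ^ q - y + c ⟩)) ℚ.≤ toℚ (R ℕ.* R ℕ.+ (4 ℕ.* q ℕ.+ 6) ℕ.* R)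
    points≤ = ℚP.≤-trans (Q.sumL-mono (Enum.elems enum) (λ {y} _ → ℚP.≤-trans (fibre≤ y) (roots≤ y)))
      (ℚP.≤-trans (ℚP.≤-reflexive total) (Q.toℚ-mono (A.point-bound |Z|< |Z₀|≤)))
      where
      total : ∑ enum (λ y → ⟨ good? y ⟩ ℚ.+ ⟨ good? y ⟩ ℚ.+ ⟨ D y ≟ 0# ⟩) ≡ toℚ (length Z ℕ.+ length Z ℕ.+ length Z₀)
      total = trans (Q.∑-∙ enum (λ y → ⟨ good? y ⟩ ℚ.+ ⟨ good? y ⟩) (λ y → ⟨ D y ≟ 0# ⟩))
        (trans (cong₂ ℚ._+_ (trans (Q.∑-∙ enum (λ y → ⟨ good? y ⟩) (λ y → ⟨ good? y ⟩)) (trans (cong (λ u → u ℚ.+ u) (Q.sumL-count good? (Enum.elems enum))) (sym (Q.toℚ-+ (length Z) (length Z)))))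
          (Q.sumL-count (λ y → D y ≟ 0#) (Enum.elems enum))) (sym (Q.toℚ-+ (length Z ℕ.+ length Z) (length Z₀))))

-- Commutative rational algebras with involution and positive inner product

module StarAlgebras where
  open import Level using (0ℓ)
  open import Algebra.Bundles using (CommutativeRing)
  open import Data.List using (List)
  open import Data.Rational as ℚ using (ℚ; 0ℚ; 1ℚ)
  import Data.Rational.Properties as ℚP
  open import Relation.Binary.PropositionalEquality as ≡ using (_≡_)
  open Sums

  -- The part of the ℓ² structure of a group algebra that the spectral estimates use. Positivity of
  -- `⟪ f , f ⟫` is the only analytic ingredient, and norms stay squared because all scalars are
  -- rational.
  record StarAlgebra : Set₁ where
    field
      commRing : CommutativeRing 0ℓ 0ℓ
    open CommutativeRing commRing public
    field
      κ        : ℚ → Carrier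
      κ-+      : ∀ a b → κ (a ℚ.+ b) ≈ κ a + κ b
      κ-*      : ∀ a b → κ (a ℚ.* b) ≈ κ a * κ b
      κ-1      : κ 1ℚ ≈ 1#
      star     : Carrier → Carrier
      star-cong : ∀ {f g} → f ≈ g → star f ≈ star g
      star-+   : ∀ f g → star (f + g) ≈ star f + star g
      star-*   : ∀ f g → star (f * g) ≈ star f * star g
      star-κ   : ∀ c → star (κ c) ≈ κ c
      ⟪_,_⟫    : Carrier → Carrier → ℚ
      ⟪⟫-cong  : ∀ {f f′ g g′} → f ≈ f′ → g ≈ g′ → ⟪ f , g ⟫ ≡ ⟪ f′ , g′ ⟫
      ⟪⟫-sym   : ∀ f g → ⟪ f , g ⟫ ≡ ⟪ g , f ⟫
      ⟪⟫-+     : ∀ f f′ g → ⟪ f + f′ , g ⟫ ≡ ⟪ f , g ⟫ ℚ.+ ⟪ f′ , g ⟫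
      ⟪⟫-κ     : ∀ c f g → ⟪ κ c * f , g ⟫ ≡ c ℚ.* ⟪ f , g ⟫
      ⟪⟫-pos   : ∀ f → 0ℚ ℚ.≤ ⟪ f , f ⟫
      adjoint  : ∀ h f g → ⟪ h * f , g ⟫ ≡ ⟪ f , star h * g ⟫

  module Lemmas (Alg : StarAlgebra) where
    open StarAlgebra Alg
    open IntegerSolver commRing public using (solve; _:+_; _:*_; :-_; _:-_; _:=_; :#)
    open RingSum commRing public
    open import Algebra.Properties.Ring ring public using (-0#≈0#; -‿involutive)
    open import Relation.Binary.Reasoning.Setoid setoid public
    open import Algebra.Properties.Semiring.Mult semiring using () renaming (_×_ to _·_)

    ‖_‖² : Carrier → ℚ
    ‖ f ‖² = ⟪ f , f ⟫

    ‖‖²-cong : ∀ {f g} → f ≈ g → ‖ f ‖² ≡ ‖ g ‖²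
    ‖‖²-cong p = ⟪⟫-cong p p

    κ-cong : ∀ {a b} → a ≡ b → κ a ≈ κ b
    κ-cong p = reflexive (≡.cong κ p)

    κ-0 : κ 0ℚ ≈ 0#
    κ-0 = begin
      κ 0ℚ                   ≈⟨ solve 1 (λ x → x := (x :+ x) :- x) refl (κ 0ℚ) ⟩
      (κ 0ℚ + κ 0ℚ) - κ 0ℚ   ≈⟨ +-congʳ (sym (κ-+ 0ℚ 0ℚ)) ⟩
      κ 0ℚ - κ 0ℚ            ≈⟨ -‿inverseʳ _ ⟩
      0#                     ∎

    κ-0* : ∀ {c} f → c ≡ 0ℚ → κ c * f ≈ 0#
    κ-0* f p = trans (*-congʳ (trans (κ-cong p) κ-0)) (zeroˡ f)

    κ-1* : ∀ {c} f → c ≡ 1ℚ → κ c * f ≈ f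
    κ-1* f p = trans (*-congʳ (trans (κ-cong p) κ-1)) (*-identityˡ f)

    κ-neg : ∀ a → κ (ℚ.- a) ≈ - κ a
    κ-neg a = begin
      κ (ℚ.- a)                      ≈⟨ solve 2 (λ x y → y := (x :+ y) :+ (:- x)) refl (κ a) (κ (ℚ.- a)) ⟩
      (κ a + κ (ℚ.- a)) + - κ a      ≈⟨ +-congʳ (trans (sym (κ-+ a (ℚ.- a))) (trans (κ-cong (ℚP.+-inverseʳ a)) κ-0)) ⟩
      0# + - κ a                     ≈⟨ +-identityˡ _ ⟩
      - κ a                          ∎

    κ-∑ : ∀ {A} (e : Enum A) (c : A → ℚ) → κ (Q.∑ e c) ≈ ∑ e (λ x → κ (c x))
    κ-∑ e c = go (Enum.elems e)
      where
      go : ∀ xs → κ (Q.sumL xs c) ≈ sumL xs (λ x → κ (c x))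
      go List.[]       = κ-0
      go (x List.∷ xs) = trans (κ-+ _ _) (+-congˡ (go xs))

    ∑-const-κ : ∀ {A} (e : Enum A) f → ∑ e (λ _ → f) ≈ κ (toℚ (Enum.card e)) * f
    ∑-const-κ e f = trans (∑-const e f) (go (Enum.card e))
      where
      go : ∀ n → n · f ≈ κ (toℚ n) * f
      go zero    = sym (κ-0* {0ℚ} f ≡.refl)
      go (suc n) = begin
        f + n · f                         ≈⟨ +-congˡ (go n) ⟩
        f + κ (toℚ n) * f                 ≈⟨ solve 2 (λ f k → f :+ k :* f := (:# 1 :+ k) :* f) refl f (κ (toℚ n)) ⟩
        (1# + κ (toℚ n)) * f              ≈⟨ *-congʳ (+-congʳ κ-1) ⟨
        (κ 1ℚ + κ (toℚ n)) * f            ≈⟨ *-congʳ (trans (κ-cong (Q.toℚ-+ 1 n)) (κ-+ 1ℚ (toℚ n))) ⟨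
        κ (toℚ (suc n)) * f               ∎

    ∑-fibres : ∀ {A B} (e : Enum A) (e′ : Enum B) (g : A → B) (ψ : B → Carrier) →
      ∑ e (λ x → ψ (g x)) ≈ ∑ e′ (λ w → κ (Q.∑ e (λ x → Q.⟨ Enum._≟_ e′ w (g x) ⟩)) * ψ w)
    ∑-fibres e e′ g ψ = sym (begin
      ∑ e′ (λ w → κ (Q.∑ e (λ x → Q.⟨ Enum._≟_ e′ w (g x) ⟩)) * ψ w)
        ≈⟨ ∑-cong e′ (λ w → trans (*-congʳ (κ-∑ e (λ x → Q.⟨ Enum._≟_ e′ w (g x) ⟩))) (∑-*ʳ e (ψ w) _)) ⟩
      ∑ e′ (λ w → ∑ e (λ x → κ Q.⟨ Enum._≟_ e′ w (g x) ⟩ * ψ w))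
        ≈⟨ ∑-swap e′ e (λ w x → κ Q.⟨ Enum._≟_ e′ w (g x) ⟩ * ψ w) ⟩
      ∑ e (λ x → ∑ e′ (λ w → κ Q.⟨ Enum._≟_ e′ w (g x) ⟩ * ψ w))
        ≈⟨ ∑-cong e (λ x → ∑-κδ e′ ψ (g x)) ⟩
      ∑ e (λ x → ψ (g x)) ∎)
      where
      ∑-κδ : ∀ {B} (e′ : Enum B) (ψ : B → Carrier) b → ∑ e′ (λ w → κ Q.⟨ Enum._≟_ e′ w b ⟩ * ψ w) ≈ ψ b
      ∑-κδ e′ ψ b = trans (∑-only e′ b _ (λ w w≢b → κ-0* (ψ w) (Q.⟨no⟩ (Enum._≟_ e′ w b) w≢b))) (κ-1* (ψ b) (Q.⟨yes⟩ (Enum._≟_ e′ b b) ≡.refl))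

    star-0 : star 0# ≈ 0#
    star-0 = trans (star-cong (sym κ-0)) (trans (star-κ 0ℚ) κ-0)

    star-∑ : ∀ {A} (e : Enum A) f → star (∑ e f) ≈ ∑ e (λ x → star (f x))
    star-∑ e f = go (Enum.elems e)
      where
      go : ∀ xs → star (sumL xs f) ≈ sumL xs (λ x → star (f x))
      go List.[]       = star-0
      go (x List.∷ xs) = trans (star-+ _ _) (+-congˡ (go xs))

    ⟪0⟫ : ∀ g → ⟪ 0# , g ⟫ ≡ 0ℚ
    ⟪0⟫ g = ≡.trans (⟪⟫-cong (sym (κ-0* {0ℚ} 0# ≡.refl)) refl) (≡.trans (⟪⟫-κ 0ℚ 0# g) (ℚP.*-zeroˡ ⟪ 0# , g ⟫))

    ⟪∑⟫ : ∀ {A} (e : Enum A) f g → ⟪ ∑ e f , g ⟫ ≡ Q.∑ e (λ x → ⟪ f x , g ⟫)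
    ⟪∑⟫ e f g = go (Enum.elems e)
      where
      go : ∀ xs → ⟪ sumL xs f , g ⟫ ≡ Q.sumL xs (λ x → ⟪ f x , g ⟫)
      go List.[]       = ⟪0⟫ g
      go (x List.∷ xs) = ≡.trans (⟪⟫-+ (f x) (sumL xs f) g) (≡.cong (⟪ f x , g ⟫ ℚ.+_) (go xs))

    ⟪⟫-κʳ : ∀ c f g → ⟪ f , κ c * g ⟫ ≡ c ℚ.* ⟪ f , g ⟫
    ⟪⟫-κʳ c f g = ≡.trans (⟪⟫-sym f (κ c * g)) (≡.trans (⟪⟫-κ c g f) (≡.cong (c ℚ.*_) (⟪⟫-sym g f)))

    ⟪⟫-+ʳ : ∀ f g g′ → ⟪ f , g + g′ ⟫ ≡ ⟪ f , g ⟫ ℚ.+ ⟪ f , g′ ⟫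
    ⟪⟫-+ʳ f g g′ = ≡.trans (⟪⟫-sym f (g + g′)) (≡.trans (⟪⟫-+ g g′ f) (≡.cong₂ ℚ._+_ (⟪⟫-sym g f) (⟪⟫-sym g′ f)))

    ‖κ*‖² : ∀ c f → ‖ κ c * f ‖² ≡ c ℚ.* c ℚ.* ‖ f ‖²
    ‖κ*‖² c f = ≡.trans (⟪⟫-κ c f (κ c * f)) (≡.trans (≡.cong (c ℚ.*_) (⟪⟫-κʳ c f f)) (≡.sym (ℚP.*-assoc c c ‖ f ‖²)))

    -‖‖² : ∀ f → ‖ - f ‖² ≡ ‖ f ‖²
    -‖‖² f = ≡.trans (‖‖²-cong (trans (solve 1 (λ f → :- f := (:- :# 1) :* f) refl f) (*-congʳ (sym (trans (κ-neg 1ℚ) (-‿cong κ-1))))))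
      (≡.trans (‖κ*‖² (ℚ.- 1ℚ) f) (ℚP.*-identityˡ ‖ f ‖²))

    ‖+κ‖² : ∀ c f g → ‖ κ c * f + g ‖² ≡ c ℚ.* c ℚ.* ‖ f ‖² ℚ.+ (c ℚ.+ c) ℚ.* ⟪ f , g ⟫ ℚ.+ ‖ g ‖²
    ‖+κ‖² c f g = ≡.trans (⟪⟫-+ (κ c * f) g (κ c * f + g)) (≡.trans (≡.cong₂ ℚ._+_
        (≡.trans (⟪⟫-+ʳ (κ c * f) (κ c * f) g) (≡.cong₂ ℚ._+_ (‖κ*‖² c f) (⟪⟫-κ c f g)))
        (≡.trans (⟪⟫-+ʳ g (κ c * f) g) (≡.cong (ℚ._+ ‖ g ‖²) (≡.trans (⟪⟫-κʳ c g f) (≡.cong (c ℚ.*_) (⟪⟫-sym g f))))))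
      (Q.solve 4 (λ c F I G → (c Q.:* c Q.:* F Q.:+ c Q.:* I) Q.:+ (c Q.:* I Q.:+ G) Q.:= c Q.:* c Q.:* F Q.:+ (c Q.:+ c) Q.:* I Q.:+ G) ≡.refl c ‖ f ‖² ⟪ f , g ⟫ ‖ g ‖²))

    -- 0 ≤ ‖ s f + g ‖² gives -⟪ f , g ⟫ ≤ s ‖ f ‖² when ‖ g ‖² ≤ s² ‖ f ‖².
    -⟪⟫≤ : ∀ {s} f g → 0ℚ ℚ.< s → ‖ g ‖² ℚ.≤ s ℚ.* s ℚ.* ‖ f ‖² → ℚ.- ⟪ f , g ⟫ ℚ.≤ s ℚ.* ‖ f ‖²
    -⟪⟫≤ {s} f g 0<s h = Q.*-cancelˡ-≤ {z = s ℚ.+ s} (ℚP.+-mono-< 0<s 0<s)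
      (Q.≤-by (‖ κ s * f + g ‖² ℚ.+ (s ℚ.* s ℚ.* ‖ f ‖² ℚ.- ‖ g ‖²)) (Q.0≤+ (⟪⟫-pos _) (Q.≤⇒0≤- h))
        (≡.sym (≡.trans (≡.cong (ℚ._+ (s ℚ.* s ℚ.* ‖ f ‖² ℚ.- ‖ g ‖²)) (‖+κ‖² s f g))
          (Q.solve 4 (λ s F I G → (s Q.:* s Q.:* F Q.:+ (s Q.:+ s) Q.:* I Q.:+ G) Q.:+ (s Q.:* s Q.:* F Q.:- G)
              Q.:= (s Q.:+ s) Q.:* (s Q.:* F) Q.:- (s Q.:+ s) Q.:* (Q.:- I)) ≡.refl s ‖ f ‖² ⟪ f , g ⟫ ‖ g ‖²))))

    -- Cauchy-Schwarz for equal norms: `-⟪⟫≤` with s = 1, applied to f and - g.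
    ⟪⟫≤ : ∀ {N} f g → ‖ f ‖² ≡ N → ‖ g ‖² ≡ N → ⟪ f , g ⟫ ℚ.≤ N
    ⟪⟫≤ {N} f g p p′ = ≡.subst₂ ℚ._≤_ neg (≡.trans (ℚP.*-identityˡ ‖ f ‖²) p)
      (-⟪⟫≤ {1ℚ} f (- g) (ℚP.positive⁻¹ 1ℚ) (ℚP.≤-reflexive (≡.trans (-‖‖² g) (≡.trans p′ (≡.trans (≡.sym p) (≡.sym (ℚP.*-identityˡ ‖ f ‖²)))))))
      where
      neg : ℚ.- ⟪ f , - g ⟫ ≡ ⟪ f , g ⟫
      neg = ≡.trans (≡.cong ℚ.-_ (≡.trans (⟪⟫-cong refl (trans (solve 1 (λ f → :- f := (:- :# 1) :* f) refl g) (*-congʳ (sym (trans (κ-neg 1ℚ) (-‿cong κ-1)))))) (⟪⟫-κʳ (ℚ.- 1ℚ) f g)))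
        (Q.solve 1 (λ x → Q.:- ((Q.:- Q.:# 1) Q.:* x) Q.:= x) ≡.refl ⟪ f , g ⟫)

    -- The triangle inequality for nonnegative multiples of elements of equal norm. In squared form
    -- it is a termwise estimate of the expanded double sum and needs no square roots.
    ‖∑‖²≤ : ∀ {A} (e : Enum A) (w : A → ℚ) (x : A → Carrier) {N} → (∀ i → 0ℚ ℚ.≤ w i) → (∀ i → ‖ x i ‖² ≡ N) →
      ‖ ∑ e (λ i → κ (w i) * x i) ‖² ℚ.≤ Q.∑ e w ℚ.* Q.∑ e w ℚ.* N
    ‖∑‖²≤ e w x {N} w≥0 xN = ℚP.≤-trans (ℚP.≤-reflexive expand) (ℚP.≤-trans
      (Q.sumL-mono (Enum.elems e) (λ {i} _ → Q.sumL-mono (Enum.elems e) (λ {j} _ →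
        Q.*-monoˡ (w i ℚ.* w j) (Q.0≤* (w≥0 i) (w≥0 j)) (⟪⟫≤ (x i) (x j) (xN i) (xN j)))))
      (ℚP.≤-reflexive (≡.sym (≡.trans (≡.cong (ℚ._* N) (Q.∑-*∑ e e w w)) (≡.trans (Q.∑-*ʳ e N _) (Q.∑-cong e (λ i → Q.∑-*ʳ e N _)))))))
      where
      expand : ‖ ∑ e (λ i → κ (w i) * x i) ‖² ≡ Q.∑ e (λ i → Q.∑ e (λ j → w i ℚ.* w j ℚ.* ⟪ x i , x j ⟫))
      expand = ≡.trans (⟪∑⟫ e _ _) (Q.∑-cong e (λ i → ≡.trans (⟪⟫-sym (κ (w i) * x i) _) (≡.trans (⟪∑⟫ e _ _) (Q.∑-cong e (λ j →
        ≡.trans (⟪⟫-sym (κ (w j) * x j) (κ (w i) * x i)) (≡.trans (⟪⟫-κ (w i) (x i) (κ (w j) * x j)) (≡.trans (≡.cong (w i ℚ.*_) (⟪⟫-κʳ (w j) (x i) (x j))) (≡.sym (ℚP.*-assoc (w i) (w j) ⟪ x i , x j ⟫)))))))))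

open StarAlgebras using (StarAlgebra; module Lemmas)

-- Squares of Kloosterman sums and the quadratic extension

module KloostermanIdentities (Alg : StarAlgebra) (K : FiniteField) (2≢0 : Field.2# K ≢ Field.0# K)
  (ψ : Field.Carrier K → StarAlgebra.Carrier Alg)
  (ψ-0 : StarAlgebra._≈_ Alg (ψ (Field.0# K)) (StarAlgebra.1# Alg))
  (ψ-+ : ∀ x y → StarAlgebra._≈_ Alg (ψ (Field._+_ K x y)) (StarAlgebra._*_ Alg (ψ x) (ψ y))) where
  open import Data.Product using (_,_)
  open import Data.Rational as ℚ using (1ℚ)
  import Data.Rational.Properties as ℚP
  open import Relation.Nullary using (Dec; yes; no; ¬?; contradiction)
  open Sums
  open Q using (⟨_⟩; ⟨yes⟩; ⟨no⟩; ⟨⟩-cong)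
  private
    module k = Field K
    module Qd = QuadraticCharacter K 2≢0
  open StarAlgebra Alg
  open Lemmas Alg

  -- The bracket removes s = 0, which would contribute ψ 0 because of the convention 0⁻¹ = 0.
  term : k.Carrier → k.Carrier → Carrier
  term a s = κ ⟨ ¬? (s k.≟ k.0#) ⟩ * ψ (s k.+ a k.* s k.⁻¹)

  Kl : k.Carrier → Carrier
  Kl a = ∑ k.enum (term a)

  ψ-cong : ∀ {x y} → x ≡ y → ψ x ≈ ψ y
  ψ-cong p = reflexive (≡.cong ψ p)

  half : k.Carrier
  half = k.2# k.⁻¹

  half-2 : ∀ x → half k.* (x k.+ x) ≡ x
  half-2 x = ≡.trans (k.solve 2 (λ h x → h k.:* (x k.:+ x) k.:= ((k.:# 1 k.:+ k.:# 1) k.:* h) k.:* x) ≡.refl half x)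
    (≡.trans (≡.cong (k._* x) (k.inverseʳ 2≢0)) (k.*-identityˡ x))

  -- The substitution x = m + n, y = m - n is invertible as 2 ≠ 0. It is made one variable at a
  -- time: y = x - 2n for fixed x, then x = m + n for fixed n.
  ∑∑-rotate : ∀ (g : k.Carrier → k.Carrier → Carrier) →
    ∑ k.enum (λ x → ∑ k.enum (g x)) ≈ ∑ k.enum (λ m → ∑ k.enum (λ n → g (m k.+ n) (m k.- n)))
  ∑∑-rotate g = begin
    ∑ k.enum (λ x → ∑ k.enum (g x))
      ≈⟨ ∑-cong k.enum (λ x → ∑-reindex k.enum k.enum (λ n → x k.- (n k.+ n)) (λ y → half k.* (x k.- y))
           (λ n → ≡.trans (≡.cong (half k.*_) (k.solve 2 (λ x n → x k.:- (x k.:- n) k.:= n) ≡.refl x (n k.+ n))) (half-2 n))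
           (λ y → ≡.trans (≡.cong (λ z → x k.- z) (≡.trans (k.solve 2 (λ h z → h k.:* z k.:+ h k.:* z k.:= h k.:* (z k.:+ z)) ≡.refl half (x k.- y)) (half-2 (x k.- y))))
                    (k.solve 2 (λ x y → x k.:- (x k.:- y) k.:= y) ≡.refl x y)) (g x)) ⟨
    ∑ k.enum (λ x → ∑ k.enum (λ n → g x (x k.- (n k.+ n))))
      ≈⟨ ∑-swap k.enum k.enum (λ x n → g x (x k.- (n k.+ n))) ⟩
    ∑ k.enum (λ n → ∑ k.enum (λ x → g x (x k.- (n k.+ n))))
      ≈⟨ ∑-cong k.enum (λ n → ∑-reindex k.enum k.enum (k._+ n) (k._- n)
           (λ m → k.solve 2 (λ m n → (m k.:+ n) k.:- n k.:= m) ≡.refl m n) (λ m → k.solve 2 (λ m n → (m k.:- n) k.:+ n k.:= m) ≡.refl m n)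
           (λ x → g x (x k.- (n k.+ n)))) ⟨
    ∑ k.enum (λ n → ∑ k.enum (λ m → g (m k.+ n) ((m k.+ n) k.- (n k.+ n))))
      ≈⟨ ∑-swap k.enum k.enum (λ n m → g (m k.+ n) ((m k.+ n) k.- (n k.+ n))) ⟩
    ∑ k.enum (λ m → ∑ k.enum (λ n → g (m k.+ n) ((m k.+ n) k.- (n k.+ n))))
      ≈⟨ ∑-cong k.enum (λ m → ∑-cong k.enum (λ n → reflexive (≡.cong (g (m k.+ n)) (k.solve 2 (λ m n → (m k.:+ n) k.:- (n k.:+ n) k.:= m k.:- n) ≡.refl m n)))) ⟩
    ∑ k.enum (λ m → ∑ k.enum (λ n → g (m k.+ n) (m k.- n))) ∎

  -- the summand attached to elements of trace 2m and norm v
  Φ : k.Carrier → k.Carrier → k.Carrier → Carrier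
  Φ a m v = κ ⟨ ¬? (v k.≟ k.0#) ⟩ * ψ ((m k.+ m) k.* (k.1# k.+ a k.* v k.⁻¹))

  guard-cong : ∀ {x y u v} → (x ≢ k.0# → y ≢ k.0#) → (y ≢ k.0# → x ≢ k.0#) → (x ≢ k.0# → u ≡ v) →
    κ ⟨ ¬? (x k.≟ k.0#) ⟩ * ψ u ≈ κ ⟨ ¬? (y k.≟ k.0#) ⟩ * ψ v
  guard-cong {x} {y} {u} {v} xy yx uv = go (x k.≟ k.0#) (y k.≟ k.0#)
    where
    go : (d : Dec (x ≡ k.0#)) (d′ : Dec (y ≡ k.0#)) → κ ⟨ ¬? d ⟩ * ψ u ≈ κ ⟨ ¬? d′ ⟩ * ψ v
    go (yes p) (yes p′) = trans (κ-0* (ψ u) ≡.refl) (sym (κ-0* (ψ v) ≡.refl))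
    go (yes p) (no p′)  = contradiction p (yx p′)
    go (no p)  (yes p′) = contradiction p′ (xy p)
    go (no p)  (no p′)  = *-congˡ (ψ-cong (uv p))

  guard-∧ : ∀ x y → ⟨ ¬? (x k.≟ k.0#) ⟩ ℚ.* ⟨ ¬? (y k.≟ k.0#) ⟩ ≡ ⟨ ¬? (x k.* y k.≟ k.0#) ⟩
  guard-∧ x y = go (x k.≟ k.0#) (y k.≟ k.0#)
    where
    go : (d : Dec (x ≡ k.0#)) (d′ : Dec (y ≡ k.0#)) → ⟨ ¬? d ⟩ ℚ.* ⟨ ¬? d′ ⟩ ≡ ⟨ ¬? (x k.* y k.≟ k.0#) ⟩
    go (yes ≡.refl) d′ = ≡.trans (ℚP.*-zeroˡ ⟨ ¬? d′ ⟩) (≡.sym (⟨no⟩ (¬? (k.0# k.* y k.≟ k.0#)) (λ h → h (k.zeroˡ y))))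
    go (no p) (yes ≡.refl) = ≡.sym (⟨no⟩ (¬? (x k.* k.0# k.≟ k.0#)) (λ h → h (k.zeroʳ x)))
    go (no p) (no p′) = ≡.sym (⟨yes⟩ (¬? (x k.* y k.≟ k.0#)) (k.*-nonzero p p′))

  -- For x = m + n and y = m - n both x + y = 2m and 1/x + 1/y = 2m/(xy), so the product depends
  -- only on m and on xy = m² - n².
  term-pair : ∀ a m n → term a (m k.+ n) * term a (m k.- n) ≈ Φ a m (m k.* m k.- n k.* n)
  term-pair a m n = begin
    κ ⟨ ¬? (x k.≟ k.0#) ⟩ * ψ (x k.+ a k.* x k.⁻¹) * (κ ⟨ ¬? (y k.≟ k.0#) ⟩ * ψ (y k.+ a k.* y k.⁻¹))
      ≈⟨ solve 4 (λ u p v r → u :* p :* (v :* r) := u :* v :* (p :* r)) refl (κ ⟨ ¬? (x k.≟ k.0#) ⟩) _ (κ ⟨ ¬? (y k.≟ k.0#) ⟩) _ ⟩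
    κ ⟨ ¬? (x k.≟ k.0#) ⟩ * κ ⟨ ¬? (y k.≟ k.0#) ⟩ * (ψ (x k.+ a k.* x k.⁻¹) * ψ (y k.+ a k.* y k.⁻¹))
      ≈⟨ *-cong (trans (sym (κ-* _ _)) (κ-cong (guard-∧ x y))) (sym (ψ-+ _ _)) ⟩
    κ ⟨ ¬? (x k.* y k.≟ k.0#) ⟩ * ψ ((x k.+ a k.* x k.⁻¹) k.+ (y k.+ a k.* y k.⁻¹))
      ≈⟨ guard-cong (λ h p → h (≡.trans xy p)) (λ h p → h (≡.trans (≡.sym xy) p)) arg ⟩
    Φ a m (m k.* m k.- n k.* n) ∎
    where
    x = m k.+ n
    y = m k.- n
    xy : x k.* y ≡ m k.* m k.- n k.* n
    xy = k.solve 2 (λ m n → (m k.:+ n) k.:* (m k.:- n) k.:= m k.:* m k.:- n k.:* n) ≡.refl m n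
    arg : x k.* y ≢ k.0# → (x k.+ a k.* x k.⁻¹) k.+ (y k.+ a k.* y k.⁻¹) ≡ (m k.+ m) k.* (k.1# k.+ a k.* (m k.* m k.- n k.* n) k.⁻¹)
    arg h = ≡.trans (k.solve 5 (λ x y a u v → (x k.:+ a k.:* u) k.:+ (y k.:+ a k.:* v) k.:= (x k.:+ y) k.:+ a k.:* (u k.:+ v)) ≡.refl x y a (x k.⁻¹) (y k.⁻¹))
      (≡.trans (≡.cong₂ (λ s t → s k.+ a k.* t) (k.solve 2 (λ m n → (m k.:+ n) k.:+ (m k.:- n) k.:= m k.:+ m) ≡.refl m n) inv-sum)
        (k.solve 3 (λ s a t → s k.:+ a k.:* (s k.:* t) k.:= s k.:* (k.:# 1 k.:+ a k.:* t)) ≡.refl (m k.+ m) a ((m k.* m k.- n k.* n) k.⁻¹)))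
      where
      x≢0 : x ≢ k.0#
      x≢0 p = h (≡.trans (≡.cong (k._* y) p) (k.zeroˡ y))
      y≢0 : y ≢ k.0#
      y≢0 p = h (≡.trans (≡.cong (x k.*_) p) (k.zeroʳ x))
      inv-sum : x k.⁻¹ k.+ y k.⁻¹ ≡ (m k.+ m) k.* (m k.* m k.- n k.* n) k.⁻¹
      inv-sum = ≡.sym (≡.trans (≡.cong₂ k._*_ (k.solve 2 (λ m n → m k.:+ m k.:= (m k.:+ n) k.:+ (m k.:- n)) ≡.refl m n)
          (≡.trans (≡.cong k._⁻¹ (≡.sym xy)) (k.⁻¹-* x≢0 y≢0)))
        (≡.trans (k.solve 4 (λ x y u v → (x k.:+ y) k.:* (u k.:* v) k.:= (x k.:* u) k.:* v k.:+ (y k.:* v) k.:* u) ≡.refl x y (x k.⁻¹) (y k.⁻¹))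
          (≡.trans (≡.cong₂ (λ s t → s k.* y k.⁻¹ k.+ t k.* x k.⁻¹) (k.inverseʳ x≢0) (k.inverseʳ y≢0))
            (≡.trans (≡.cong₂ k._+_ (k.*-identityˡ _) (k.*-identityˡ _)) (k.+-comm _ _)))))

  Kl² : ∀ a → Kl a * Kl a ≈ ∑ k.enum (λ m → ∑ k.enum (λ n → Φ a m (m k.* m k.- n k.* n)))
  Kl² a = trans (∑-*∑ k.enum k.enum (term a) (term a)) (trans (∑∑-rotate (λ x y → term a x * term a y))
    (∑-cong k.enum (λ m → ∑-cong k.enum (λ n → term-pair a m n))))

  module _ {δ : k.Carrier} (δ-nonsquare : ∀ h → h k.* h ≢ δ) where

    private
      δ≢0 : δ ≢ k.0#
      δ≢0 p = δ-nonsquare k.0# (≡.trans (k.zeroˡ k.0#) (≡.sym p))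

      count-squares : ∀ w → Q.∑ k.enum (λ n → ⟨ w k.≟ n k.* n ⟩) ≡ 1ℚ ℚ.+ Qd.η w
      count-squares w = ≡.trans (Q.∑-cong k.enum (λ n → ⟨⟩-cong (w k.≟ n k.* n) (n k.* n k.≟ w) ≡.sym ≡.sym)) (Qd.roots≡1+η w)

      count-δsquares : ∀ w → Q.∑ k.enum (λ n → ⟨ w k.≟ δ k.* (n k.* n) ⟩) ≡ 1ℚ ℚ.+ ℚ.- Qd.η w
      count-δsquares w = ≡.trans (Q.∑-cong k.enum (λ n → ⟨⟩-cong (w k.≟ δ k.* (n k.* n)) (δ k.⁻¹ k.* w k.≟ n k.* n)
          (λ p → ≡.trans (≡.cong (δ k.⁻¹ k.*_) p) (cancel (n k.* n))) (λ p → ≡.trans (≡.sym (cancel′ w)) (≡.cong (δ k.*_) p))))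
        (≡.trans (count-squares (δ k.⁻¹ k.* w)) (≡.cong (1ℚ ℚ.+_) (≡.trans
          (Q.solve 1 (λ x → x Q.:= Q.:- (Q.:- x)) ≡.refl (Qd.η (δ k.⁻¹ k.* w)))
          (≡.cong ℚ.-_ (≡.trans (≡.sym (Qd.η-*-nonsquare δ-nonsquare (δ k.⁻¹ k.* w))) (≡.cong Qd.η (cancel′ w)))))))
        where
        cancel : ∀ x → δ k.⁻¹ k.* (δ k.* x) ≡ x
        cancel x = ≡.trans (≡.sym (k.*-assoc _ _ _)) (≡.trans (≡.cong (k._* x) (k.inverseˡ δ≢0)) (k.*-identityˡ x))
        cancel′ : ∀ x → δ k.* (δ k.⁻¹ k.* x) ≡ x
        cancel′ x = ≡.trans (≡.sym (k.*-assoc _ _ _)) (≡.trans (≡.cong (k._* x) (k.inverseʳ δ≢0)) (k.*-identityˡ x))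

    -- An element w has 1 + η w representations as n² and 1 - η w as δ n², exactly two in all.
    squares+δsquares : ∀ (g : k.Carrier → Carrier) →
      ∑ k.enum (λ n → g (n k.* n)) + ∑ k.enum (λ n → g (δ k.* (n k.* n))) ≈ ∑ k.enum g + ∑ k.enum g
    squares+δsquares g = begin
      ∑ k.enum (λ n → g (n k.* n)) + ∑ k.enum (λ n → g (δ k.* (n k.* n)))
        ≈⟨ +-cong (∑-fibres k.enum k.enum (λ n → n k.* n) g) (∑-fibres k.enum k.enum (λ n → δ k.* (n k.* n)) g) ⟩
      ∑ k.enum (λ w → κ (Q.∑ k.enum (λ n → ⟨ w k.≟ n k.* n ⟩)) * g w) + ∑ k.enum (λ w → κ (Q.∑ k.enum (λ n → ⟨ w k.≟ δ k.* (n k.* n) ⟩)) * g w)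
        ≈⟨ ∑-∙ k.enum _ _ ⟨
      ∑ k.enum (λ w → κ (Q.∑ k.enum (λ n → ⟨ w k.≟ n k.* n ⟩)) * g w + κ (Q.∑ k.enum (λ n → ⟨ w k.≟ δ k.* (n k.* n) ⟩)) * g w)
        ≈⟨ ∑-cong k.enum (λ w → begin
             κ (Q.∑ k.enum (λ n → ⟨ w k.≟ n k.* n ⟩)) * g w + κ (Q.∑ k.enum (λ n → ⟨ w k.≟ δ k.* (n k.* n) ⟩)) * g w
               ≈⟨ +-cong (*-congʳ (κ-cong (count-squares w))) (*-congʳ (κ-cong (count-δsquares w))) ⟩
             κ (1ℚ ℚ.+ Qd.η w) * g w + κ (1ℚ ℚ.+ ℚ.- Qd.η w) * g w
               ≈⟨ +-cong (*-congʳ (κ-+ 1ℚ (Qd.η w))) (*-congʳ (trans (κ-+ 1ℚ (ℚ.- Qd.η w)) (+-congˡ (κ-neg (Qd.η w))))) ⟩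
             (κ 1ℚ + κ (Qd.η w)) * g w + (κ 1ℚ - κ (Qd.η w)) * g w
               ≈⟨ solve 3 (λ o e g → (o :+ e) :* g :+ (o :- e) :* g := o :* g :+ o :* g) refl (κ 1ℚ) (κ (Qd.η w)) (g w) ⟩
             κ 1ℚ * g w + κ 1ℚ * g w
               ≈⟨ +-cong (κ-1* (g w) ≡.refl) (κ-1* (g w) ≡.refl) ⟩
             g w + g w ∎) ⟩
      ∑ k.enum (λ w → g w + g w)
        ≈⟨ ∑-∙ k.enum g g ⟩
      ∑ k.enum g + ∑ k.enum g ∎

  module _ {a : k.Carrier} (a≢0 : a ≢ k.0#) {f : Carrier} (vanish : ∑ k.enum ψ * f ≈ 0#) where

    -- The inner sum over m is a full sum over K unless 1 + a / v = 0.
    ∑Φ : ∑ k.enum (λ m → ∑ k.enum (λ w → Φ a m (m k.* m k.- w))) * f ≈ κ (toℚ k.order) * f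
    ∑Φ = begin
      ∑ k.enum (λ m → ∑ k.enum (λ w → Φ a m (m k.* m k.- w))) * f
        ≈⟨ *-congʳ (∑-cong k.enum (λ m → ∑-reindex k.enum k.enum (λ w → m k.* m k.- w) (λ v → m k.* m k.- v) (flip m) (flip m) (Φ a m))) ⟩
      ∑ k.enum (λ m → ∑ k.enum (Φ a m)) * f
        ≈⟨ *-congʳ (∑-swap k.enum k.enum (Φ a)) ⟩
      ∑ k.enum (λ v → ∑ k.enum (λ m → Φ a m v)) * f
        ≈⟨ ∑-*ʳ k.enum f _ ⟩
      ∑ k.enum (λ v → ∑ k.enum (λ m → Φ a m v) * f)
        ≈⟨ ∑-only k.enum (k.- a) _ others ⟩
      ∑ k.enum (λ m → Φ a m (k.- a)) * f
        ≈⟨ *-congʳ (∑-cong k.enum (λ m → trans (κ-1* _ (⟨yes⟩ (¬? (k.- a k.≟ k.0#)) (k.neg-nonzero a≢0))) (trans (ψ-cong (arg0 m)) ψ-0))) ⟩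
      ∑ k.enum (λ m → 1#) * f
        ≈⟨ trans (*-congʳ (trans (∑-const-κ k.enum 1#) (*-identityʳ _))) refl ⟩
      κ (toℚ k.order) * f ∎
      where
      flip : ∀ m w → m k.* m k.- (m k.* m k.- w) ≡ w
      flip m w = k.solve 2 (λ x w → x k.:- (x k.:- w) k.:= w) ≡.refl (m k.* m) w
      arg0 : ∀ m → (m k.+ m) k.* (k.1# k.+ a k.* (k.- a) k.⁻¹) ≡ k.0#
      arg0 m = ≡.trans (≡.cong ((m k.+ m) k.*_) (≡.trans (≡.cong (λ z → k.1# k.+ a k.* z) (k.⁻¹-neg a≢0))
        (≡.trans (k.solve 2 (λ a u → k.:# 1 k.:+ a k.:* (k.:- u) k.:= k.:# 1 k.:- a k.:* u) ≡.refl a (a k.⁻¹)) (k.≡⇒-≡0 (≡.sym (k.inverseʳ a≢0)))))) (k.zeroʳ _)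
      others : ∀ v → v ≢ k.- a → ∑ k.enum (λ m → Φ a m v) * f ≈ 0#
      others v v≢-a = go (v k.≟ k.0#)
        where
        go : Dec (v ≡ k.0#) → ∑ k.enum (λ m → Φ a m v) * f ≈ 0#
        go (yes p) = trans (*-congʳ (∑-ε k.enum (λ m → κ-0* _ (⟨no⟩ (¬? (v k.≟ k.0#)) (λ h → h p))))) (zeroˡ f)
        go (no v≢0) = trans (*-congʳ (trans (∑-cong k.enum (λ m → trans (κ-1* _ (⟨yes⟩ (¬? (v k.≟ k.0#)) v≢0))
              (ψ-cong (k.solve 2 (λ m b → (m k.:+ m) k.:* b k.:= (b k.:+ b) k.:* m) ≡.refl m b))))
            (∑-reindex k.enum k.enum ((b k.+ b) k.*_) ((b k.+ b) k.⁻¹ k.*_) (cancel (k.inverseˡ 2b≢0)) (cancel (k.inverseʳ 2b≢0)) ψ))) vanish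
          where
          b = k.1# k.+ a k.* v k.⁻¹
          b≢0 : b ≢ k.0#
          b≢0 p = v≢-a (≡.sym (k.-≡0⇒≡ (≡.trans (k.solve 2 (λ a v → (k.:- a) k.:- v k.:= k.:- (v k.:+ a)) ≡.refl a v) (≡.trans (≡.cong (λ z → k.- z) v+a≡0) k.-0#≈0#))))
            where
            v+a≡0 : v k.+ a ≡ k.0#
            v+a≡0 = ≡.trans (≡.sym (≡.trans (k.solve 3 (λ v a u → v k.:* (k.:# 1 k.:+ a k.:* u) k.:= v k.:+ a k.:* (v k.:* u)) ≡.refl v a (v k.⁻¹))
              (≡.cong (v k.+_) (≡.trans (≡.cong (a k.*_) (k.inverseʳ v≢0)) (k.*-identityʳ a))))) (≡.trans (≡.cong (v k.*_) p) (k.zeroʳ v))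
          2b≢0 : b k.+ b ≢ k.0#
          2b≢0 p = b≢0 (Qd.2*-zero p)
          cancel : ∀ {x y} → x k.* y ≡ k.1# → ∀ z → x k.* (y k.* z) ≡ z
          cancel p z = ≡.trans (≡.sym (k.*-assoc _ _ _)) (≡.trans (≡.cong (k._* z) p) (k.*-identityˡ z))

    module _ {δ : k.Carrier} (δ-nonsquare : ∀ h → h k.* h ≢ δ) where

      -- The square `Kl a * Kl a` collects the norms m² - n² of pairs, the other sum the norms m² -
      -- δ n² of elements m + n √δ. By `squares+δsquares` the two together run twice over all
      -- values, and there `∑Φ` evaluates the sum.
      Kl²+Φδ : (Kl a * Kl a + ∑ k.enum (λ m → ∑ k.enum (λ n → Φ a m (m k.* m k.- δ k.* (n k.* n))))) * f
        ≈ κ (toℚ k.order) * f + κ (toℚ k.order) * f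
      Kl²+Φδ = begin
        (Kl a * Kl a + ∑ k.enum (λ m → ∑ k.enum (λ n → Φ a m (m k.* m k.- δ k.* (n k.* n))))) * f
          ≈⟨ *-congʳ (+-congʳ (Kl² a)) ⟩
        (∑ k.enum (λ m → ∑ k.enum (λ n → Φ a m (m k.* m k.- n k.* n))) + ∑ k.enum (λ m → ∑ k.enum (λ n → Φ a m (m k.* m k.- δ k.* (n k.* n))))) * f
          ≈⟨ *-congʳ (∑-∙ k.enum _ _) ⟨
        ∑ k.enum (λ m → ∑ k.enum (λ n → Φ a m (m k.* m k.- n k.* n)) + ∑ k.enum (λ n → Φ a m (m k.* m k.- δ k.* (n k.* n)))) * f
          ≈⟨ *-congʳ (trans (∑-cong k.enum (λ m → squares+δsquares δ-nonsquare (λ w → Φ a m (m k.* m k.- w)))) (∑-∙ k.enum _ _)) ⟩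
        (∑ k.enum (λ m → ∑ k.enum (λ w → Φ a m (m k.* m k.- w))) + ∑ k.enum (λ m → ∑ k.enum (λ w → Φ a m (m k.* m k.- w)))) * f
          ≈⟨ distribʳ f _ _ ⟩
        ∑ k.enum (λ m → ∑ k.enum (λ w → Φ a m (m k.* m k.- w))) * f + ∑ k.enum (λ m → ∑ k.enum (λ w → Φ a m (m k.* m k.- w))) * f
          ≈⟨ +-cong ∑Φ ∑Φ ⟩
        κ (toℚ k.order) * f + κ (toℚ k.order) * f ∎

  module Extension {δ : k.Carrier} (δ-nonsquare : ∀ h → h k.* h ≢ δ) where
    private
      module X = QuadraticExtension K δ δ-nonsquare
      module L = Field X.fieldᴱ

    ψᴸ : L.Carrier → Carrier
    ψᴸ (m , n) = ψ (m k.+ m)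

    termᴸ : k.Carrier → L.Carrier → Carrier
    termᴸ a s = κ ⟨ ¬? (s L.≟ L.0#) ⟩ * ψᴸ (s L.+ (a , k.0#) L.* s L.⁻¹)

    private
      norm-0 : ∀ {m n} → (m , n) ≡ L.0# → m k.* m k.- δ k.* (n k.* n) ≡ k.0#
      norm-0 ≡.refl = k.solve 1 (λ d → k.:# 0 k.:* k.:# 0 k.:- d k.:* (k.:# 0 k.:* k.:# 0) k.:= k.:# 0) ≡.refl δ

      first : ∀ a m v y → m k.+ (a k.* (m k.* v) k.+ δ k.* (k.0# k.* y)) ≡ m k.* (k.1# k.+ a k.* v)
      first a m v y = k.solve 5 (λ m a v y d → m k.:+ (a k.:* (m k.:* v) k.:+ d k.:* (k.:# 0 k.:* y)) k.:= m k.:* (k.:# 1 k.:+ a k.:* v)) ≡.refl m a v y δ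

    -- m + n √δ has trace 2m and norm N = m² - δ n², and its inverse has trace 2m/N; so s + a/s has
    -- trace 2m (1 + a/N).
    termᴸ≈Φ : ∀ a m n → termᴸ a (m , n) ≈ Φ a m (m k.* m k.- δ k.* (n k.* n))
    termᴸ≈Φ a m n = go ((m , n) L.≟ L.0#) (nm k.≟ k.0#)
      where
      nm = m k.* m k.- δ k.* (n k.* n)
      go : (d : Dec ((m , n) ≡ L.0#)) (d′ : Dec (nm ≡ k.0#)) →
        κ ⟨ ¬? d ⟩ * ψᴸ ((m , n) L.+ (a , k.0#) L.* (m , n) L.⁻¹) ≈ κ ⟨ ¬? d′ ⟩ * ψ ((m k.+ m) k.* (k.1# k.+ a k.* nm k.⁻¹))
      go (yes p) (yes p′) = trans (κ-0* _ ≡.refl) (sym (κ-0* _ ≡.refl))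
      go (yes p) (no p′)  = contradiction (norm-0 p) p′
      go (no p)  (yes p′) = contradiction (X.norm-zero m n p′) p
      go (no p)  (no p′)  = *-congˡ (begin
        ψᴸ ((m , n) L.+ (a , k.0#) L.* (m , n) L.⁻¹)          ≈⟨ reflexive (≡.cong (λ z → ψᴸ ((m , n) L.+ (a , k.0#) L.* z)) (≡.sym (L.⁻¹-unique {m , n} {X.invᴱ (m , n)} (X.invᴱ-inverse (m , n) p′)))) ⟩
        ψᴸ ((m , n) L.+ (a , k.0#) L.* X.invᴱ (m , n))        ≈⟨ ψ-cong (≡.cong (λ z → z k.+ z) (first a m (nm k.⁻¹) (k.- n k.* nm k.⁻¹))) ⟩
        ψ (m k.* b k.+ m k.* b)                               ≈⟨ ψ-cong (≡.sym (k.distribʳ b m m)) ⟩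
        ψ ((m k.+ m) k.* b)                                   ∎)
        where b = k.1# k.+ a k.* nm k.⁻¹

-- Descent of the Kloosterman bound through the tower

module KloostermanBound (F : FiniteField) (k : ℕ) (q≡ : FiniteField.order F ≡ suc (k ℕ.+ k)) (3≤q : 3 ℕ.≤ FiniteField.order F)
  (Alg : StarAlgebra) (χ : Field.Carrier F → StarAlgebra.Carrier Alg)
  (χ-0 : StarAlgebra._≈_ Alg (χ (Field.0# F)) (StarAlgebra.1# Alg))
  (χ-+ : ∀ x y → StarAlgebra._≈_ Alg (χ (Field._+_ F x y)) (StarAlgebra._*_ Alg (χ x) (χ y)))
  (χ-star : ∀ x → StarAlgebra._≈_ Alg (StarAlgebra.star Alg (χ x)) (χ (Field.-_ F x))) where
  import Data.Nat.Properties as ℕP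
  open import Data.Product using (proj₁; proj₂)
  open import Data.Rational as ℚ using (ℚ; 0ℚ; 1ℚ)
  import Data.Rational.Properties as ℚP
  open import Relation.Nullary using (Dec; yes; no; ¬?)
  open Sums
  open Q using (⟨_⟩; ⟨yes⟩; ⟨no⟩)
  open Tower F k q≡
  private module F = Field F
  open StarAlgebra Alg
  open Lemmas Alg

  u : Carrier
  u = ∑ F.enum χ

  ord : Level → ℕ
  ord lev = FiniteField.order (Level.K lev)

  toℚ-pos : ∀ {n} → 1 ℕ.≤ n → 0ℚ ℚ.< toℚ n
  toℚ-pos 1≤n = ℚP.<-≤-trans (ℚP.positive⁻¹ 1ℚ) (Q.toℚ-mono 1≤n)

  κ-cancel : ∀ {c x} → 0ℚ ℚ.< c → κ c * x ≈ 0# → x ≈ 0#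
  κ-cancel {c} {x} 0<c h = begin
    x                            ≈⟨ κ-1* x (ℚP.*-inverseˡ c {{nz}}) ⟨
    κ (ℚ.1/_ c {{nz}} ℚ.* c) * x ≈⟨ *-congʳ (κ-* _ c) ⟩
    κ (ℚ.1/_ c {{nz}}) * κ c * x ≈⟨ *-assoc _ _ _ ⟩
    κ (ℚ.1/_ c {{nz}}) * (κ c * x) ≈⟨ *-congˡ h ⟩
    κ (ℚ.1/_ c {{nz}}) * 0#      ≈⟨ zeroʳ _ ⟩
    0#                           ∎
    where
    nz : ℚ.NonZero c
    nz = ℚP.pos⇒nonZero c {{ℚ.positive 0<c}}

  module AtLevel (lev : Level) where
    open Level lev
    module k = Field K

    ψ : k.Carrier → Carrier
    ψ x = χ (tr x)

    ψ-0 : ψ k.0# ≈ 1#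
    ψ-0 = trans (reflexive (≡.cong χ tr-0)) χ-0

    ψ-+ : ∀ x y → ψ (x k.+ y) ≈ ψ x * ψ y
    ψ-+ x y = trans (reflexive (≡.cong χ (tr-+ x y))) (χ-+ (tr x) (tr y))

    module Kl = KloostermanIdentities Alg K 2≢0 ψ ψ-0 ψ-+

    S : F.Carrier → Carrier
    S a = Kl.Kl (ι a)

    order-pos : 1 ℕ.≤ k.order
    order-pos = positive (FiniteField.order-nonZero K)
      where
      positive : ∀ {n} → ℕ.NonZero n → 1 ℕ.≤ n
      positive {suc n} _ = ℕ.s≤s ℕ.z≤n

    -- Every χ c equals ψ x for some x of trace c, so it is absorbed by the sum Z of all ψ. Hence u
    -- Z = q Z and q Z f = Z u f = 0.
    vanish : ∀ {f} → u * f ≈ 0# → ∑ k.enum ψ * f ≈ 0#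
    vanish {f} uf = κ-cancel (toℚ-pos (ℕP.≤-trans (ℕ.s≤s ℕ.z≤n) 3≤q)) (begin
      κ (toℚ q) * (Z * f)                ≈⟨ ∑-const-κ F.enum (Z * f) ⟨
      ∑ F.enum (λ _ → Z * f)             ≈⟨ ∑-cong F.enum (λ c → trans (*-congʳ (sym (shift c))) (solve 3 (λ c z f → c :* z :* f := c :* (z :* f)) refl (χ c) Z f)) ⟩
      ∑ F.enum (λ c → χ c * (Z * f))     ≈⟨ ∑-*ʳ F.enum (Z * f) χ ⟨
      u * (Z * f)                        ≈⟨ solve 3 (λ u z f → u :* (z :* f) := z :* (u :* f)) refl u Z f ⟩
      Z * (u * f)                        ≈⟨ *-congˡ uf ⟩
      Z * 0#                             ≈⟨ zeroʳ Z ⟩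
      0#                                 ∎)
      where
      Z = ∑ k.enum ψ
      shift : ∀ c → χ c * Z ≈ Z
      shift c = begin
        χ c * Z                                    ≈⟨ *-congʳ (reflexive (≡.cong χ (proj₂ (tr-surj c)))) ⟨
        ψ x * Z                                    ≈⟨ ∑-*ˡ k.enum (ψ x) ψ ⟩
        ∑ k.enum (λ m → ψ x * ψ m)                 ≈⟨ ∑-cong k.enum (λ m → sym (ψ-+ x m)) ⟩
        ∑ k.enum (λ m → ψ (x k.+ m))               ≈⟨ ∑-reindex k.enum k.enum (x k.+_) (λ y → y k.- x)
                                                        (λ m → k.solve 2 (λ x m → (x k.:+ m) k.:- x k.:= m) ≡.refl x m) (λ m → k.solve 2 (λ x m → x k.:+ (m k.:- x) k.:= m) ≡.refl x m) ψ ⟩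
        Z                                          ∎
        where x = proj₁ (tr-surj c)

    -- The involution negates s + a/s, and so does s ↦ - s. Self-adjointness is what turns ‖S f‖²
    -- into ⟪ f , S² f ⟫.
    S-star : ∀ a → star (S a) ≈ S a
    S-star a = begin
      star (S a)                                   ≈⟨ star-∑ k.enum (Kl.term (ι a)) ⟩
      ∑ k.enum (λ s → star (Kl.term (ι a) s))      ≈⟨ ∑-cong k.enum pointwise ⟩
      ∑ k.enum (λ s → Kl.term (ι a) (k.- s))       ≈⟨ ∑-reindex k.enum k.enum (λ s → k.- s) (λ s → k.- s) k.-‿involutive k.-‿involutive (Kl.term (ι a)) ⟩
      S a                                          ∎
      where
      pointwise : ∀ s → star (Kl.term (ι a) s) ≈ Kl.term (ι a) (k.- s)
      pointwise s = begin
        star (Kl.term (ι a) s)                                             ≈⟨ trans (star-* _ _) (*-cong (star-κ _) (χ-star _)) ⟩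
        κ ⟨ ¬? (s k.≟ k.0#) ⟩ * χ (F.- tr (s k.+ ι a k.* s k.⁻¹))         ≈⟨ *-congˡ (reflexive (≡.cong χ (≡.sym (tr-neg _)))) ⟩
        κ ⟨ ¬? (s k.≟ k.0#) ⟩ * ψ (k.- (s k.+ ι a k.* s k.⁻¹))            ≈⟨ Kl.guard-cong k.neg-nonzero (λ h p → h (≡.trans (≡.cong (λ z → k.- z) p) k.-0#≈0#))
                                                                                (λ s≢0 → ≡.trans (k.solve 3 (λ s a v → k.:- (s k.:+ a k.:* v) k.:= (k.:- s) k.:+ a k.:* (k.:- v)) ≡.refl s (ι a) (s k.⁻¹))
                                                                                   (≡.cong (λ z → (k.- s) k.+ ι a k.* z) (≡.sym (k.⁻¹-neg s≢0)))) ⟩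
        Kl.term (ι a) (k.- s)                                              ∎

  module _ (lev : Level) (δ : Field.Carrier (Level.K lev)) (δ-nonsquare : ∀ h → Field._*_ (Level.K lev) h h ≢ δ) where
    private
      module A = AtLevel lev
      module N = Next lev δ δ-nonsquare
      module B = AtLevel N.next
      open Level lev
      module k = A.k

    -- Elements of the next field are pairs (m , n), and in these coordinates its Kloosterman sum is
    -- the second double sum of `Kl²+Φδ`.
    S²+Snext : ∀ {a f} → a ≢ F.0# → u * f ≈ 0# → (A.S a * A.S a + B.S a) * f ≈ κ (toℚ (ord lev)) * f + κ (toℚ (ord lev)) * f
    S²+Snext {a} {f} a≢0 uf = trans (*-congʳ (+-congˡ (trans (∑-⊗ k.enum k.enum (B.Kl.term (N.ιᴸ a))) (∑-cong k.enum (λ m → ∑-cong k.enum (λ n → A.Kl.Extension.termᴸ≈Φ δ-nonsquare (ι a) m n))))))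
      (A.Kl.Kl²+Φδ (ι-nonzero a≢0) (A.vanish uf) δ-nonsquare)

    -- ‖S f‖² = ⟪ f , S² f ⟫ = 2Q ‖f‖² - ⟪ f , S_next f ⟫
    step : ∀ {a f s} → a ≢ F.0# → u * f ≈ 0# → 0ℚ ℚ.< s →
      ‖ B.S a * f ‖² ℚ.≤ s ℚ.* s ℚ.* toℚ (ord N.next) ℚ.* ‖ f ‖² → ‖ A.S a * f ‖² ℚ.≤ (1ℚ ℚ.+ 1ℚ ℚ.+ s) ℚ.* toℚ (ord lev) ℚ.* ‖ f ‖²
    step {a} {f} {s} a≢0 uf 0<s h = ℚP.≤-trans (ℚP.≤-reflexive norm²)
      (Q.≤-by (s ℚ.* Qo ℚ.* ‖ f ‖² ℚ.- ℚ.- ⟪ f , B.S a * f ⟫) (Q.≤⇒0≤- cs)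
        (Q.solve 4 (λ s Qo N I → (Q.:# 1 Q.:+ Q.:# 1 Q.:+ s) Q.:* Qo Q.:* N Q.:- (Qo Q.:* N Q.:+ Qo Q.:* N Q.:- I) Q.:= s Q.:* Qo Q.:* N Q.:- (Q.:- I)) ≡.refl s Qo ‖ f ‖² ⟪ f , B.S a * f ⟫))
      where
      Qo = toℚ (ord lev)
      S²f : star (A.S a) * (A.S a * f) ≈ (κ Qo * f + κ Qo * f) - B.S a * f
      S²f = begin
        star (A.S a) * (A.S a * f)               ≈⟨ *-congʳ (A.S-star a) ⟩
        A.S a * (A.S a * f)                      ≈⟨ solve 3 (λ s b f → s :* (s :* f) := (s :* s :+ b) :* f :- b :* f) refl (A.S a) (B.S a) f ⟩
        (A.S a * A.S a + B.S a) * f - B.S a * f  ≈⟨ +-congʳ (S²+Snext a≢0 uf) ⟩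
        (κ Qo * f + κ Qo * f) - B.S a * f        ∎
      inner-neg : ∀ g h → ⟪ g , - h ⟫ ≡ ℚ.- ⟪ g , h ⟫
      inner-neg g h = ≡.trans (Q.solve 2 (λ x y → y Q.:= (x Q.:+ y) Q.:- x) ≡.refl ⟪ g , h ⟫ ⟪ g , - h ⟫)
        (≡.trans (≡.cong (ℚ._- ⟪ g , h ⟫) (≡.trans (≡.sym (⟪⟫-+ʳ g h (- h))) (≡.trans (⟪⟫-cong refl (-‿inverseʳ h)) (≡.trans (⟪⟫-sym g 0#) (⟪0⟫ g))))) (ℚP.+-identityˡ _))
      norm² : ‖ A.S a * f ‖² ≡ Qo ℚ.* ‖ f ‖² ℚ.+ Qo ℚ.* ‖ f ‖² ℚ.- ⟪ f , B.S a * f ⟫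
      norm² = ≡.trans (adjoint (A.S a) f (A.S a * f)) (≡.trans (⟪⟫-cong refl S²f) (≡.trans (⟪⟫-+ʳ f (κ Qo * f + κ Qo * f) (- (B.S a * f)))
        (≡.cong₂ ℚ._+_ (≡.trans (⟪⟫-+ʳ f (κ Qo * f) (κ Qo * f)) (≡.cong (λ z → z ℚ.+ z) (⟪⟫-κʳ Qo f f))) (inner-neg f (B.S a * f)))))
      cs : ℚ.- ⟪ f , B.S a * f ⟫ ℚ.≤ s ℚ.* Qo ℚ.* ‖ f ‖²
      cs = -⟪⟫≤ f (B.S a * f) (Q.0<* 0<s (toℚ-pos A.order-pos)) (ℚP.≤-trans h (ℚP.≤-reflexive
        (≡.trans (≡.cong (λ z → s ℚ.* s ℚ.* z ℚ.* ‖ f ‖²) (≡.trans (≡.cong toℚ N.order-next) (Q.toℚ-* (ord lev) (ord lev))))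
          (Q.solve 3 (λ s Qo N → s Q.:* s Q.:* (Qo Q.:* Qo) Q.:* N Q.:= s Q.:* Qo Q.:* (s Q.:* Qo) Q.:* N) ≡.refl s Qo ‖ f ‖²))))

  module Terminal (lev : Level) (r R : ℕ) (R≡ : R ≡ q ℕ.^ r) (order≡R² : ord lev ≡ R ℕ.* R)
                  (q⁴≤R : q ℕ.* q ℕ.* (q ℕ.* q) ℕ.≤ R) where
    private
      module A = AtLevel lev
      open Level lev
      module k = A.k
      module PC = PointCount F k q≡ 3≤q lev (proj₁ (nonsquareᴷ lev)) (proj₂ (nonsquareᴷ lev)) r R R≡ order≡R² q⁴≤R

      C₁ : ℕ
      C₁ = 4 ℕ.* q ℕ.+ 6

      Qo = toℚ k.order

    module _ {a : F.Carrier} (a≢0 : a ≢ F.0#) {f : Carrier} (uf : u * f ≈ 0#) where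
      private
        b = ι a

        g : k.Carrier → k.Carrier
        g s = s k.+ b k.* s k.⁻¹

        ℘ : k.Carrier → k.Carrier
        ℘ y = y k.^ q k.- y

        nz : k.Carrier → ℚ
        nz s = ⟨ ¬? (s k.≟ k.0#) ⟩

        N : k.Carrier → ℚ
        N c = Q.∑ k.enum (λ y → Q.∑ k.enum (λ s → nz s ℚ.* ⟨ g s k.≟ ℘ y k.+ c ⟩))

        B : ℚ
        B = toℚ (R ℕ.* R ℕ.+ C₁ ℕ.* R)

        -- The shortfall of the count from Stepanov's upper bound. The total of the counts being
        -- known, these nonnegative weights have a small sum, so a one-sided estimate controls the
        -- deviation on both sides.
        w : k.Carrier → ℚ
        w c = B ℚ.- N c

        w≥0 : ∀ c → 0ℚ ℚ.≤ w c
        w≥0 c = Q.≤⇒0≤- (PC.points≤ b (ι-nonzero a≢0) c)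

        solve-c : ∀ {x y c} → x ≡ y k.+ c → c ≡ x k.- y
        solve-c {x} {y} {c} p = ≡.trans (k.solve 2 (λ y c → c k.:= (y k.:+ c) k.:- y) ≡.refl y c) (≡.cong (k._- y) (≡.sym p))

        solve-c′ : ∀ {x y c} → c ≡ x k.- y → x ≡ y k.+ c
        solve-c′ {x} {y} p = ≡.trans (k.solve 2 (λ x y → x k.:= y k.:+ (x k.:- y)) ≡.refl x y) (≡.cong (y k.+_) (≡.sym p))

        ∑nz : Q.∑ k.enum nz ≡ Qo ℚ.- 1ℚ
        ∑nz = ≡.trans (Q.∑-cong k.enum (λ s → complement (s k.≟ k.0#))) (≡.trans (Q.∑-∙ k.enum (λ _ → 1ℚ) (λ s → ℚ.- ⟨ s k.≟ k.0# ⟩))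
          (≡.cong₂ ℚ._+_ (≡.trans (Q.sumL-const-ℚ (Enum.elems k.enum) 1ℚ) (ℚP.*-identityʳ Qo)) (≡.trans (≡.sym (Q.∑-neg k.enum (λ s → ⟨ s k.≟ k.0# ⟩))) (≡.cong ℚ.-_ (Q.∑-1 k.enum k.0#)))))
          where
          complement : ∀ {P : Set} (d : Dec P) → ⟨ ¬? d ⟩ ≡ 1ℚ ℚ.+ ℚ.- ⟨ d ⟩
          complement (yes _) = ≡.refl
          complement (no _)  = ≡.refl

        -- For every y and every s ≠ 0 exactly one c solves the equation.
        ∑N : Q.∑ k.enum N ≡ Qo ℚ.* (Qo ℚ.- 1ℚ)
        ∑N = ≡.trans (Q.∑-swap k.enum k.enum (λ c y → Q.∑ k.enum (λ s → nz s ℚ.* ⟨ g s k.≟ ℘ y k.+ c ⟩)))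
          (≡.trans (Q.∑-cong k.enum (λ y → ≡.trans (Q.∑-swap k.enum k.enum (λ c s → nz s ℚ.* ⟨ g s k.≟ ℘ y k.+ c ⟩))
            (≡.trans (Q.∑-cong k.enum (λ s → ≡.trans (≡.sym (Q.∑-*ˡ k.enum (nz s) (λ c → ⟨ g s k.≟ ℘ y k.+ c ⟩)))
                (≡.trans (≡.cong (nz s ℚ.*_) (≡.trans (Q.∑-cong k.enum (λ c → Q.⟨⟩-cong (g s k.≟ ℘ y k.+ c) (c k.≟ g s k.- ℘ y) solve-c solve-c′)) (Q.∑-1 k.enum (g s k.- ℘ y)))) (ℚP.*-identityʳ (nz s)))))
              ∑nz)))
            (Q.sumL-const-ℚ (Enum.elems k.enum) (Qo ℚ.- 1ℚ)))

        -- The main terms cancel: for every c the bound is |K| + C₁ R, against an average count of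
        -- |K| - 1.
        ∑w : Q.∑ k.enum w ≡ Qo ℚ.* (toℚ (C₁ ℕ.* R) ℚ.+ 1ℚ)
        ∑w = ≡.trans (Q.∑-∙ k.enum (λ _ → B) (λ c → ℚ.- N c)) (≡.trans (≡.cong₂ ℚ._+_ (Q.sumL-const-ℚ (Enum.elems k.enum) B) (≡.trans (≡.sym (Q.∑-neg k.enum N)) (≡.cong ℚ.-_ ∑N)))
          (≡.trans (≡.cong (λ z → Qo ℚ.* z ℚ.- Qo ℚ.* (Qo ℚ.- 1ℚ)) (≡.trans (Q.toℚ-+ (R ℕ.* R) (C₁ ℕ.* R)) (≡.cong (λ z → toℚ z ℚ.+ toℚ (C₁ ℕ.* R)) (≡.sym order≡R²))))
            (Q.solve 2 (λ Qo C → Qo Q.:* (Qo Q.:+ C) Q.:- Qo Q.:* (Qo Q.:- Q.:# 1) Q.:= Qo Q.:* (C Q.:+ Q.:# 1)) ≡.refl Qo (toℚ (C₁ ℕ.* R)))))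

        ψ-℘ : ∀ s y → A.ψ (g s k.- ℘ y) ≈ A.ψ (g s)
        ψ-℘ s y = reflexive (≡.cong χ (≡.trans (tr-+ (g s) (k.- ℘ y)) (≡.trans (≡.cong (tr (g s) F.+_) (≡.trans (tr-neg (℘ y)) (≡.trans (≡.cong (λ z → F.- z) tr℘) F.-0#≈0#))) (F.+-identityʳ _))))
          where
          tr℘ : tr (℘ y) ≡ F.0#
          tr℘ = ≡.trans (tr-+ (y k.^ q) (k.- y)) (≡.trans (≡.cong₂ F._+_ (tr-frob y) (tr-neg y)) (F.-‿inverseʳ _))

        -- Every y contributes a copy of S a, because the trace vanishes on y^q - y.
        average : ∑ k.enum (λ c → κ (N c) * A.ψ c) ≈ κ Qo * A.S a
        average = begin
          ∑ k.enum (λ c → κ (N c) * A.ψ c)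
            ≈⟨ ∑-cong k.enum (λ c → trans (*-congʳ (trans (κ-∑ k.enum _) (∑-cong k.enum (λ y → κ-∑ k.enum _)))) (trans (∑-*ʳ k.enum (A.ψ c) _) (∑-cong k.enum (λ y → ∑-*ʳ k.enum (A.ψ c) _)))) ⟩
          ∑ k.enum (λ c → ∑ k.enum (λ y → ∑ k.enum (λ s → κ (nz s ℚ.* ⟨ g s k.≟ ℘ y k.+ c ⟩) * A.ψ c)))
            ≈⟨ ∑-swap k.enum k.enum _ ⟩
          ∑ k.enum (λ y → ∑ k.enum (λ c → ∑ k.enum (λ s → κ (nz s ℚ.* ⟨ g s k.≟ ℘ y k.+ c ⟩) * A.ψ c)))
            ≈⟨ ∑-cong k.enum (λ y → trans (∑-swap k.enum k.enum _) (∑-cong k.enum (λ s → inner y s))) ⟩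
          ∑ k.enum (λ y → A.S a)
            ≈⟨ ∑-const-κ k.enum (A.S a) ⟩
          κ Qo * A.S a ∎
          where
          inner : ∀ y s → ∑ k.enum (λ c → κ (nz s ℚ.* ⟨ g s k.≟ ℘ y k.+ c ⟩) * A.ψ c) ≈ κ (nz s) * A.ψ (g s)
          inner y s = trans (∑-only k.enum (g s k.- ℘ y) _ (λ c c≢ → κ-0* (A.ψ c) (≡.trans (≡.cong (nz s ℚ.*_) (⟨no⟩ (g s k.≟ ℘ y k.+ c) (λ p → c≢ (solve-c p)))) (ℚP.*-zeroʳ (nz s)))))
            (*-cong (κ-cong (≡.trans (≡.cong (nz s ℚ.*_) (⟨yes⟩ (g s k.≟ ℘ y k.+ (g s k.- ℘ y)) (solve-c′ ≡.refl))) (ℚP.*-identityʳ (nz s)))) (ψ-℘ s y))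

        -- N c = B - w c, and the constant B contributes nothing because the sum of all ψ
        -- annihilates f.
        weighted : κ Qo * (A.S a * f) ≈ - ∑ k.enum (λ c → κ (w c) * (A.ψ c * f))
        weighted = begin
          κ Qo * (A.S a * f)                                     ≈⟨ *-assoc _ _ _ ⟨
          κ Qo * A.S a * f                                       ≈⟨ *-congʳ average ⟨
          ∑ k.enum (λ c → κ (N c) * A.ψ c) * f                   ≈⟨ ∑-*ʳ k.enum f _ ⟩
          ∑ k.enum (λ c → κ (N c) * A.ψ c * f)                   ≈⟨ ∑-cong k.enum (λ c → split c) ⟩
          ∑ k.enum (λ c → κ B * (A.ψ c * f) + - (κ (w c) * (A.ψ c * f))) ≈⟨ ∑-∙ k.enum _ _ ⟩
          ∑ k.enum (λ c → κ B * (A.ψ c * f)) + ∑ k.enum (λ c → - (κ (w c) * (A.ψ c * f)))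
            ≈⟨ +-cong (trans (sym (∑-*ˡ k.enum (κ B) _)) (trans (*-congˡ (trans (sym (∑-*ʳ k.enum f A.ψ)) (A.vanish uf))) (zeroʳ _))) (sym (∑-neg k.enum _)) ⟩
          0# + - ∑ k.enum (λ c → κ (w c) * (A.ψ c * f))          ≈⟨ +-identityˡ _ ⟩
          - ∑ k.enum (λ c → κ (w c) * (A.ψ c * f))               ∎
          where
          split : ∀ c → κ (N c) * A.ψ c * f ≈ κ B * (A.ψ c * f) + - (κ (w c) * (A.ψ c * f))
          split c = trans (*-assoc _ _ _) (trans (*-congʳ (trans (κ-cong (Q.solve 2 (λ B N → N Q.:= B Q.:+ (Q.:- (B Q.:- N))) ≡.refl B (N c))) (trans (κ-+ B (ℚ.- w c)) (+-congˡ (κ-neg (w c))))))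
            (solve 3 (λ B w x → (B :+ (:- w)) :* x := B :* x :+ (:- (w :* x))) refl (κ B) (κ (w c)) (A.ψ c * f)))

        ‖ψf‖ : ∀ c → ‖ A.ψ c * f ‖² ≡ ‖ f ‖²
        ‖ψf‖ c = ≡.trans (adjoint (A.ψ c) f (A.ψ c * f)) (⟪⟫-cong refl (begin
          star (A.ψ c) * (A.ψ c * f)          ≈⟨ *-assoc _ _ _ ⟨
          star (A.ψ c) * A.ψ c * f            ≈⟨ *-congʳ (*-congʳ (χ-star (tr c))) ⟩
          χ (F.- tr c) * χ (tr c) * f         ≈⟨ *-congʳ (χ-+ _ _) ⟨
          χ ((F.- tr c) F.+ tr c) * f         ≈⟨ *-congʳ (trans (reflexive (≡.cong χ (F.-‿inverseˡ (tr c)))) χ-0) ⟩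
          1# * f                              ≈⟨ *-identityˡ f ⟩
          f                                   ∎))

      -- The triangle inequality for the elements ψ c f, all of the norm of f, with total weight |K|
      -- (C₁ R + 1), where C₁ R + 1 ≤ (4q + 7) R.
      terminal : ‖ A.S a * f ‖² ℚ.≤ toℚ (4 ℕ.* q ℕ.+ 7) ℚ.* toℚ (4 ℕ.* q ℕ.+ 7) ℚ.* toℚ (ord lev) ℚ.* ‖ f ‖²
      terminal = Q.*-cancelˡ-≤ {z = Qo ℚ.* Qo} (Q.0<* Q>0 Q>0) (ℚP.≤-trans (ℚP.≤-reflexive (≡.trans (≡.sym (‖κ*‖² Qo (A.S a * f))) (≡.trans (‖‖²-cong weighted) (-‖‖² _))))
        (ℚP.≤-trans (‖∑‖²≤ k.enum w (λ c → A.ψ c * f) w≥0 ‖ψf‖) (ℚP.≤-trans (ℚP.≤-reflexive (≡.trans (≡.cong (λ z → z ℚ.* z ℚ.* ‖ f ‖²) ∑w)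
          (Q.solve 3 (λ Qo C N → Qo Q.:* C Q.:* (Qo Q.:* C) Q.:* N Q.:= Qo Q.:* Qo Q.:* (C Q.:* C Q.:* N)) ≡.refl Qo T ‖ f ‖²)))
          (Q.*-monoˡ (Qo ℚ.* Qo) (Q.0≤* (Q.0≤toℚ k.order) (Q.0≤toℚ k.order)) (ℚP.≤-trans
            (ℚP.*-monoʳ-≤-nonNeg ‖ f ‖² {{ℚ.nonNegative (⟪⟫-pos f)}} (Q.*-mono 0≤T 0≤V T≤V T≤V))
            (ℚP.≤-reflexive (≡.cong (ℚ._* ‖ f ‖²) V²)))))))
        where
        Q>0 : 0ℚ ℚ.< Qo
        Q>0 = toℚ-pos A.order-pos
        T = toℚ (C₁ ℕ.* R) ℚ.+ 1ℚ
        C₂ = 4 ℕ.* q ℕ.+ 7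
        V = toℚ (C₂ ℕ.* R)
        1≤R : 1 ℕ.≤ R
        1≤R = ℕP.≤-trans (ℕP.*-mono-≤ (ℕP.*-mono-≤ 1≤q 1≤q) (ℕP.*-mono-≤ 1≤q 1≤q)) q⁴≤R
          where
          1≤q : 1 ℕ.≤ q
          1≤q = ℕP.≤-trans (ℕ.s≤s ℕ.z≤n) 3≤q
        0≤T : 0ℚ ℚ.≤ T
        0≤T = Q.0≤+ (Q.0≤toℚ (C₁ ℕ.* R)) (ℚP.nonNegative⁻¹ 1ℚ)
        0≤V : 0ℚ ℚ.≤ V
        0≤V = Q.0≤toℚ (C₂ ℕ.* R)
        T≤V : T ℚ.≤ V
        T≤V = ℚP.≤-trans (ℚP.≤-reflexive (≡.sym (Q.toℚ-+ (C₁ ℕ.* R) 1))) (Q.toℚ-mono (ℕP.≤-trans (ℕP.+-monoʳ-≤ (C₁ ℕ.* R) 1≤R)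
          (ℕP.≤-reflexive (≡.trans (ℕP.+-comm (C₁ ℕ.* R) R) (≡.cong (ℕ._* R) (≡.sym (ℕP.+-suc (4 ℕ.* q) 6)))))))
        V² : V ℚ.* V ≡ toℚ C₂ ℚ.* toℚ C₂ ℚ.* toℚ (ord lev)
        V² = ≡.trans (≡.cong (λ z → z ℚ.* z) (Q.toℚ-* C₂ R)) (≡.trans (Q.solve 2 (λ C R → C Q.:* R Q.:* (C Q.:* R) Q.:= C Q.:* C Q.:* (R Q.:* R)) ≡.refl (toℚ C₂) (toℚ R))
          (≡.cong (toℚ C₂ ℚ.* toℚ C₂ ℚ.*_) (≡.trans (≡.sym (Q.toℚ-* R R)) (≡.cong toℚ (≡.sym order≡R²)))))

  private
    -- Chosen so that 3 + J = 4q + 7, the constant of `terminal`.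
    J : ℕ
    J = suc (4 ℕ.* q ℕ.+ 3)

    1≤q : 1 ℕ.≤ q
    1≤q = ℕP.≤-trans (ℕ.s≤s ℕ.z≤n) 3≤q

  module _ {a : F.Carrier} (a≢0 : a ≢ F.0#) {f : Carrier} (uf : u * f ≈ 0#) where

    -- A constant linear in the level survives the descent: from 4 + j at level j + 1 the step
    -- yields 6 + j at level j, and 6 + j ≤ (3 + j)².
    LevelBound : ℕ → Set
    LevelBound j = ‖ AtLevel.S (level j) a * f ‖² ℚ.≤ toℚ (3 ℕ.+ j) ℚ.* toℚ (3 ℕ.+ j) ℚ.* toℚ (ord (level j)) ℚ.* ‖ f ‖²

    top-level : LevelBound J
    top-level = ≡.subst (λ n → ‖ AtLevel.S (level J) a * f ‖² ℚ.≤ toℚ n ℚ.* toℚ n ℚ.* toℚ (ord (level J)) ℚ.* ‖ f ‖²) 4q+7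
      (Terminal.terminal (level J) (2 ℕ.^ i) (q ℕ.^ (2 ℕ.^ i)) ≡.refl
        (≡.trans (order-level J) (≡.trans (≡.cong (λ n → q ℕ.^ (2 ℕ.^ i ℕ.+ n)) (ℕP.+-identityʳ (2 ℕ.^ i))) (ℕP.^-distribˡ-+-* q (2 ℕ.^ i) (2 ℕ.^ i))))
        q⁴≤ a≢0 uf)
      where
      i = 4 ℕ.* q ℕ.+ 3
      4q+7 : 4 ℕ.* q ℕ.+ 7 ≡ 3 ℕ.+ J
      4q+7 = ≡.trans (≡.sym (ℕP.+-assoc (4 ℕ.* q) 3 4)) (ℕP.+-comm i 4)
      q⁴≤ : q ℕ.* q ℕ.* (q ℕ.* q) ℕ.≤ q ℕ.^ (2 ℕ.^ i)
      q⁴≤ = ≡.subst (ℕ._≤ q ℕ.^ (2 ℕ.^ i)) q^4 (ℕP.^-monoʳ-≤ q {{ℕ.>-nonZero 1≤q}} (ℕP.^-monoʳ-≤ 2 {2} {i} (ℕP.≤-trans (ℕ.s≤s (ℕ.s≤s ℕ.z≤n)) (ℕP.m≤n+m 3 (4 ℕ.* q)))))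
        where
        q^4 : q ℕ.^ 4 ≡ q ℕ.* q ℕ.* (q ℕ.* q)
        q^4 = ≡.trans (≡.cong (λ n → q ℕ.* (q ℕ.* (q ℕ.* n))) (ℕP.*-identityʳ q)) (≡.sym (ℕP.*-assoc q q (q ℕ.* q)))

    step-level : ∀ j → LevelBound (suc j) → ‖ AtLevel.S (level j) a * f ‖² ℚ.≤ toℚ (6 ℕ.+ j) ℚ.* toℚ (ord (level j)) ℚ.* ‖ f ‖²
    step-level j h = ≡.subst (λ c → ‖ AtLevel.S (level j) a * f ‖² ℚ.≤ c ℚ.* toℚ (ord (level j)) ℚ.* ‖ f ‖²) (≡.sym (Q.toℚ-+ 2 (4 ℕ.+ j)))
      (step (level j) (proj₁ (nonsquareᴷ (level j))) (proj₂ (nonsquareᴷ (level j))) {s = toℚ (4 ℕ.+ j)} a≢0 uf (toℚ-pos {4 ℕ.+ j} (ℕ.s≤s ℕ.z≤n)) h)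

    descend : ∀ n j → j ℕ.+ n ≡ J → LevelBound j
    descend zero    j p = ≡.subst LevelBound (≡.trans (≡.sym p) (ℕP.+-identityʳ j)) top-level
    descend (suc n) j p = ℚP.≤-trans (step-level j (descend n (suc j) (≡.trans (≡.sym (ℕP.+-suc j n)) p)))
      (ℚP.*-monoʳ-≤-nonNeg ‖ f ‖² {{ℚ.nonNegative (⟪⟫-pos f)}} (ℚP.*-monoʳ-≤-nonNeg (toℚ (ord (level j))) {{ℚ.nonNegative (Q.0≤toℚ (ord (level j)))}}
        (≡.subst (toℚ (6 ℕ.+ j) ℚ.≤_) (Q.toℚ-* (3 ℕ.+ j) (3 ℕ.+ j)) (Q.toℚ-mono 6+j≤))))
      where
      6+j≤ : 6 ℕ.+ j ℕ.≤ (3 ℕ.+ j) ℕ.* (3 ℕ.+ j)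
      6+j≤ = ℕP.≤-trans (ℕP.m≤m+n (6 ℕ.+ j) (3 ℕ.+ 5 ℕ.* j ℕ.+ j ℕ.* j))
        (ℕP.≤-reflexive (ℕS.solve 1 (λ j → ℕS.con 6 ℕS.:+ j ℕS.:+ (ℕS.con 3 ℕS.:+ ℕS.con 5 ℕS.:* j ℕS.:+ j ℕS.:* j) ℕS.:= (ℕS.con 3 ℕS.:+ j) ℕS.:* (ℕS.con 3 ℕS.:+ j)) ≡.refl j))
        where
        open import Data.Nat.Solver using (module +-*-Solver)
        module ℕS = +-*-Solver

    -- The last step is not weakened to (3 + 0)² = 9, which keeps the constant 6.
    kloosterman-bound≢0 : ‖ AtLevel.S base a * f ‖² ℚ.≤ toℚ 6 ℚ.* toℚ q ℚ.* ‖ f ‖²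
    kloosterman-bound≢0 = step-level 0 (descend (4 ℕ.* q ℕ.+ 3) 1 ≡.refl)

  term₀ : F.Carrier → F.Carrier → Carrier
  term₀ a c = κ ⟨ ¬? (c F.≟ F.0#) ⟩ * χ (c F.+ a F.* c F.⁻¹)

  -- For a = 0 the sum degenerates to u - 1, which acts as -1 on f.
  kloosterman-bound : ∀ a {f} → u * f ≈ 0# → ‖ ∑ F.enum (term₀ a) * f ‖² ℚ.≤ toℚ 6 ℚ.* toℚ q ℚ.* ‖ f ‖²
  kloosterman-bound a {f} uf = go (a F.≟ F.0#)
    where
    go : Dec (a ≡ F.0#) → ‖ ∑ F.enum (term₀ a) * f ‖² ℚ.≤ toℚ 6 ℚ.* toℚ q ℚ.* ‖ f ‖²
    go (no a≢0) = kloosterman-bound≢0 a≢0 uf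
    go (yes ≡.refl) = ℚP.≤-trans (ℚP.≤-reflexive (≡.trans (‖‖²-cong S₀) (-‖‖² f)))
      (ℚP.≤-trans (ℚP.≤-reflexive (≡.sym (ℚP.*-identityˡ ‖ f ‖²))) (ℚP.*-monoʳ-≤-nonNeg ‖ f ‖² {{ℚ.nonNegative (⟪⟫-pos f)}}
        (ℚP.≤-trans (Q.toℚ-mono {1} {6 ℕ.* q} (ℕP.*-mono-≤ {1} {6} (ℕ.s≤s ℕ.z≤n) 1≤q)) (ℚP.≤-reflexive (Q.toℚ-* 6 q)))))
      where
      S₀ : ∑ F.enum (term₀ F.0#) * f ≈ - f
      S₀ = begin
        ∑ F.enum (term₀ F.0#) * f                              ≈⟨ *-congʳ (∑-cong F.enum (λ c → pointwise c (c F.≟ F.0#))) ⟩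
        ∑ F.enum (λ c → χ c + - (κ ⟨ c F.≟ F.0# ⟩ * 1#)) * f   ≈⟨ *-congʳ (trans (∑-∙ F.enum _ _) (+-congˡ (sym (∑-neg F.enum _)))) ⟩
        (u - ∑ F.enum (λ c → κ ⟨ c F.≟ F.0# ⟩ * 1#)) * f       ≈⟨ *-congʳ (+-congˡ (-‿cong (trans (∑-only F.enum F.0# _ (λ c c≢0 → κ-0* 1# (⟨no⟩ (c F.≟ F.0#) c≢0))) (κ-1* 1# (⟨yes⟩ (F.0# F.≟ F.0#) ≡.refl))))) ⟩
        (u - 1#) * f                                           ≈⟨ solve 2 (λ u f → (u :- :# 1) :* f := u :* f :- f) refl u f ⟩
        u * f - f                                              ≈⟨ +-congʳ uf ⟩
        0# - f                                                 ≈⟨ +-identityˡ _ ⟩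
        - f                                                    ∎
        where
        pointwise : ∀ c (d : Dec (c ≡ F.0#)) → κ ⟨ ¬? d ⟩ * χ (c F.+ F.0# F.* c F.⁻¹) ≈ χ c + - (κ ⟨ d ⟩ * 1#)
        pointwise c (yes ≡.refl) = trans (κ-0* _ ≡.refl) (sym (trans (+-cong χ-0 (-‿cong (κ-1* 1# ≡.refl))) (-‿inverseʳ 1#)))
        pointwise c (no c≢0) = trans (κ-1* _ ≡.refl) (trans (reflexive (≡.cong χ (≡.trans (≡.cong (c F.+_) (F.zeroˡ _)) (F.+-identityʳ c))))
          (sym (trans (+-congˡ (trans (-‿cong (κ-0* 1# ≡.refl)) -0#≈0#)) (+-identityʳ _))))

-- Gauss and Salié sums

module SalieBound (F : FiniteField) (2≢0 : Field.2# F ≢ Field.0# F)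
  (Alg : StarAlgebra) (χ : Field.Carrier F → StarAlgebra.Carrier Alg)
  (χ-0 : StarAlgebra._≈_ Alg (χ (Field.0# F)) (StarAlgebra.1# Alg))
  (χ-+ : ∀ x y → StarAlgebra._≈_ Alg (χ (Field._+_ F x y)) (StarAlgebra._*_ Alg (χ x) (χ y)))
  (χ-star : ∀ x → StarAlgebra._≈_ Alg (StarAlgebra.star Alg (χ x)) (χ (Field.-_ F x))) where
  open import Data.Rational as ℚ using (ℚ; 0ℚ; 1ℚ)
  import Data.Rational.Properties as ℚP
  open import Relation.Nullary using (Dec; yes; no)
  open Sums
  open Q using (⟨_⟩; ⟨yes⟩; ⟨no⟩; ⟨⟩-cong)
  open QuadraticCharacter F 2≢0
  private module F = Field F
  open StarAlgebra Alg
  open Lemmas Alg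

  u γ : Carrier
  u = ∑ F.enum χ
  γ = ∑ F.enum (λ z → κ (η z) * χ z)

  χ-cong : ∀ {x y} → x ≡ y → χ x ≈ χ y
  χ-cong p = reflexive (≡.cong χ p)

  η₋₁ : ℚ
  η₋₁ = η (F.- F.1#)

  η-neg : ∀ x → η (F.- x) ≡ η₋₁ ℚ.* η x
  η-neg x = ≡.trans (≡.cong η (F.solve 1 (λ x → F.:- x F.:= (F.:- F.:# 1) F.:* x) ≡.refl x)) (η-* (F.- F.1#) x)

  -1≢0 : F.- F.1# ≢ F.0#
  -1≢0 = F.neg-nonzero F.1≢0

  χ-inverse : ∀ x → χ (F.- x) * χ x ≈ 1#
  χ-inverse x = trans (sym (χ-+ (F.- x) x)) (trans (χ-cong (F.-‿inverseˡ x)) χ-0)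

  -- The coefficient of χ r is the convolution of η with itself at r, which `η-⋆-η` evaluates.
  γ² : γ * γ ≈ κ η₋₁ * (κ (toℚ F.order) - u)
  γ² = begin
    γ * γ
      ≈⟨ ∑-*∑ F.enum F.enum _ _ ⟩
    ∑ F.enum (λ z → ∑ F.enum (λ w → κ (η z) * χ z * (κ (η w) * χ w)))
      ≈⟨ ∑-cong F.enum (λ z → sym (∑-reindex F.enum F.enum (λ r → r F.- z) (F._+ z)
           (λ r → F.solve 2 (λ r z → (r F.:- z) F.:+ z F.:= r) ≡.refl r z) (λ w → F.solve 2 (λ r z → (r F.:+ z) F.:- z F.:= r) ≡.refl w z) (λ w → κ (η z) * χ z * (κ (η w) * χ w)))) ⟩
    ∑ F.enum (λ z → ∑ F.enum (λ r → κ (η z) * χ z * (κ (η (r F.- z)) * χ (r F.- z))))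
      ≈⟨ ∑-cong F.enum (λ z → ∑-cong F.enum (λ r → pointwise z r)) ⟩
    ∑ F.enum (λ z → ∑ F.enum (λ r → κ (η z ℚ.* η (r F.- z)) * χ r))
      ≈⟨ ∑-swap F.enum F.enum _ ⟩
    ∑ F.enum (λ r → ∑ F.enum (λ z → κ (η z ℚ.* η (r F.- z)) * χ r))
      ≈⟨ ∑-cong F.enum (λ r → trans (sym (∑-*ʳ F.enum (χ r) _)) (*-congʳ (trans (sym (κ-∑ F.enum _)) (trans (κ-cong (η-⋆-η r)) (κ-* η₋₁ _))))) ⟩
    ∑ F.enum (λ r → κ η₋₁ * κ (toℚ F.order ℚ.* ⟨ r F.≟ F.0# ⟩ ℚ.- 1ℚ) * χ r)
      ≈⟨ ∑-cong F.enum (λ r → trans (*-assoc _ _ _) (*-congˡ (trans (*-congʳ (κ-+ _ _)) (trans (distribʳ (χ r) _ _) (+-cong (trans (*-congʳ (κ-* _ _)) (*-assoc _ _ _)) (trans (*-congʳ (trans (κ-neg 1ℚ) (-‿cong κ-1))) (solve 1 (λ x → (:- :# 1) :* x := :- x) refl (χ r)))))))) ⟩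
    ∑ F.enum (λ r → κ η₋₁ * (κ (toℚ F.order) * (κ ⟨ r F.≟ F.0# ⟩ * χ r) + - χ r))
      ≈⟨ ∑-*ˡ F.enum (κ η₋₁) _ ⟨
    κ η₋₁ * ∑ F.enum (λ r → κ (toℚ F.order) * (κ ⟨ r F.≟ F.0# ⟩ * χ r) + - χ r)
      ≈⟨ *-congˡ (trans (∑-∙ F.enum _ _) (+-cong (trans (sym (∑-*ˡ F.enum (κ (toℚ F.order)) _)) (trans (*-congˡ single) (*-identityʳ _))) (sym (∑-neg F.enum χ)))) ⟩
    κ η₋₁ * (κ (toℚ F.order) - u) ∎
    where
    pointwise : ∀ z r → κ (η z) * χ z * (κ (η (r F.- z)) * χ (r F.- z)) ≈ κ (η z ℚ.* η (r F.- z)) * χ r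
    pointwise z r = trans (solve 4 (λ a b c d → a :* b :* (c :* d) := a :* c :* (b :* d)) refl (κ (η z)) (χ z) (κ (η (r F.- z))) (χ (r F.- z)))
      (*-cong (sym (κ-* _ _)) (trans (sym (χ-+ _ _)) (χ-cong (F.solve 2 (λ z r → z F.:+ (r F.:- z) F.:= r) ≡.refl z r))))
    single : ∑ F.enum (λ r → κ ⟨ r F.≟ F.0# ⟩ * χ r) ≈ 1#
    single = trans (∑-only F.enum F.0# _ (λ r r≢0 → κ-0* (χ r) (⟨no⟩ (r F.≟ F.0#) r≢0))) (trans (κ-1* (χ F.0#) (⟨yes⟩ (F.0# F.≟ F.0#) ≡.refl)) χ-0)

  γ-star : star γ ≈ κ η₋₁ * γ
  γ-star = begin
    star γ                                         ≈⟨ star-∑ F.enum _ ⟩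
    ∑ F.enum (λ z → star (κ (η z) * χ z))          ≈⟨ ∑-cong F.enum (λ z → trans (star-* _ _) (*-cong (star-κ (η z)) (χ-star z))) ⟩
    ∑ F.enum (λ z → κ (η z) * χ (F.- z))           ≈⟨ ∑-cong F.enum (λ z → trans (*-congʳ (trans (κ-cong (η≡ z)) (κ-* _ _))) (*-assoc _ _ _)) ⟩
    ∑ F.enum (λ z → κ η₋₁ * (κ (η (F.- z)) * χ (F.- z))) ≈⟨ ∑-*ˡ F.enum (κ η₋₁) _ ⟨
    κ η₋₁ * ∑ F.enum (λ z → κ (η (F.- z)) * χ (F.- z))   ≈⟨ *-congˡ (∑-reindex F.enum F.enum (λ z → F.- z) (λ z → F.- z) F.-‿involutive F.-‿involutive (λ z → κ (η z) * χ z)) ⟩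
    κ η₋₁ * γ                                      ∎
    where
    η≡ : ∀ z → η z ≡ η₋₁ ℚ.* η (F.- z)
    η≡ z = ≡.trans (≡.cong η (≡.sym (F.-‿involutive z))) (η-neg (F.- z))

  γ*γ : star γ * γ ≈ κ (toℚ F.order) - u
  γ*γ = begin
    star γ * γ                                     ≈⟨ *-congʳ γ-star ⟩
    κ η₋₁ * γ * γ                                  ≈⟨ trans (*-assoc _ _ _) (*-congˡ γ²) ⟩
    κ η₋₁ * (κ η₋₁ * (κ (toℚ F.order) - u))        ≈⟨ *-assoc _ _ _ ⟨
    κ η₋₁ * κ η₋₁ * (κ (toℚ F.order) - u)          ≈⟨ *-congʳ (sym (κ-* _ _)) ⟩
    κ (η₋₁ ℚ.* η₋₁) * (κ (toℚ F.order) - u)        ≈⟨ κ-1* _ (η²≡1 -1≢0) ⟩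
    κ (toℚ F.order) - u                            ∎

  ‖γ*‖² : ∀ {f} → u * f ≈ 0# → ‖ γ * f ‖² ≡ toℚ F.order ℚ.* ‖ f ‖²
  ‖γ*‖² {f} uf = ≡.trans (adjoint γ f (γ * f)) (≡.trans (⟪⟫-cong refl (begin
    star γ * (γ * f)                       ≈⟨ *-assoc _ _ _ ⟨
    star γ * γ * f                         ≈⟨ *-congʳ γ*γ ⟩
    (κ (toℚ F.order) - u) * f              ≈⟨ solve 3 (λ k u f → (k :- u) :* f := k :* f :- u :* f) refl (κ (toℚ F.order)) u f ⟩
    κ (toℚ F.order) * f - u * f            ≈⟨ +-congˡ (trans (-‿cong uf) -0#≈0#) ⟩
    κ (toℚ F.order) * f + 0#               ≈⟨ +-identityʳ _ ⟩
    κ (toℚ F.order) * f                    ∎)) (⟪⟫-κʳ (toℚ F.order) f f))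

  ‖χ*‖² : ∀ c f → ‖ χ c * f ‖² ≡ ‖ f ‖²
  ‖χ*‖² c f = ≡.trans (adjoint (χ c) f (χ c * f)) (⟪⟫-cong refl
    (trans (sym (*-assoc _ _ _)) (trans (*-congʳ (trans (*-congʳ (χ-star c)) (χ-inverse c))) (*-identityˡ f))))

  salie-term : F.Carrier → F.Carrier → Carrier
  salie-term a c = κ (η c) * χ (c F.+ a F.* c F.⁻¹)

  Sal : F.Carrier → Carrier
  Sal a = ∑ F.enum (salie-term a)

  0≤q : 0ℚ ℚ.≤ toℚ F.order
  0≤q = Q.0≤toℚ F.order

  -- c ↦ a / c fixes c + a / c and changes the sign of η c.
  Sal-nonsquare : ∀ {a} → (∀ h → h F.* h ≢ a) → Sal a ≈ 0#
  Sal-nonsquare {a} no-root = begin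
    Sal a                                            ≈⟨ halves (Sal a) ⟨
    κ ℚ.½ * (Sal a + Sal a)                          ≈⟨ *-congˡ (trans (+-congʳ flip) (-‿inverseˡ _)) ⟩
    κ ℚ.½ * 0#                                       ≈⟨ zeroʳ _ ⟩
    0#                                               ∎
    where
    halves : ∀ x → κ ℚ.½ * (x + x) ≈ x
    halves x = trans (solve 2 (λ h x → h :* (x :+ x) := (h :+ h) :* x) refl (κ ℚ.½) x) (trans (*-congʳ (sym (κ-+ ℚ.½ ℚ.½))) (κ-1* x ≡.refl))
    a≢0 : a ≢ F.0#
    a≢0 p = no-root F.0# (≡.trans (F.zeroˡ F.0#) (≡.sym p))
    τ : F.Carrier → F.Carrier
    τ c = a F.* c F.⁻¹
    ττ : ∀ c → τ (τ c) ≡ c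
    ττ c = go c (c F.≟ F.0#)
      where
      go : ∀ c → Dec (c ≡ F.0#) → τ (τ c) ≡ c
      go _ (yes ≡.refl) = ≡.trans (≡.cong (λ z → a F.* (a F.* z) F.⁻¹) F.0⁻¹) (≡.trans (≡.cong (λ z → a F.* z F.⁻¹) (F.zeroʳ a)) (≡.trans (≡.cong (a F.*_) F.0⁻¹) (F.zeroʳ a)))
      go c (no c≢0) = ≡.trans (≡.cong (a F.*_) (≡.trans (F.⁻¹-* a≢0 (F.⁻¹-nonzero c≢0)) (≡.cong (a F.⁻¹ F.*_) (F.⁻¹-involutive c≢0))))
        (≡.trans (≡.sym (F.*-assoc _ _ _)) (≡.trans (≡.cong (F._* c) (F.inverseʳ a≢0)) (F.*-identityˡ c)))
    η-τ : ∀ c → η (τ c) ≡ ℚ.- η c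
    η-τ c = ≡.trans (η-*-nonsquare no-root (c F.⁻¹)) (≡.cong ℚ.-_ (go c (c F.≟ F.0#)))
      where
      go : ∀ c → Dec (c ≡ F.0#) → η (c F.⁻¹) ≡ η c
      go _ (yes ≡.refl) = ≡.cong η F.0⁻¹
      go c (no c≢0) = η-⁻¹ c≢0
    flip : Sal a ≈ - Sal a
    flip = begin
      Sal a                                          ≈⟨ ∑-reindex F.enum F.enum τ τ ττ ττ (salie-term a) ⟨
      ∑ F.enum (λ c → κ (η (τ c)) * χ (τ c F.+ τ (τ c))) ≈⟨ ∑-cong F.enum (λ c → trans (*-cong (trans (κ-cong (η-τ c)) (κ-neg (η c))) (χ-cong (≡.trans (≡.cong (τ c F.+_) (ττ c)) (F.+-comm _ _))))
                                                            (solve 2 (λ x y → (:- x) :* y := :- (x :* y)) refl (κ (η c)) (χ (c F.+ τ c)))) ⟩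
      ∑ F.enum (λ c → - salie-term a c)              ≈⟨ ∑-neg F.enum (salie-term a) ⟨
      - Sal a                                        ∎

  Sal-0 : Sal F.0# ≈ γ
  Sal-0 = ∑-cong F.enum (λ c → *-congˡ (χ-cong (≡.trans (≡.cong (c F.+_) (F.zeroˡ _)) (F.+-identityʳ c))))

  -- For a root c of c + b²/c = r one has (c + b)² = c (r + 2b) and (c - b)² = c (r - 2b), which determines η c.
  module _ {b : F.Carrier} (b≢0 : b ≢ F.0#) where
    private
      2b = b F.+ b

      -- The coefficient of χ r in `Sal (b * b)`.
      T : F.Carrier → ℚ
      T r = Q.∑ F.enum (λ c → η c ℚ.* ⟨ r F.≟ c F.+ b F.* b F.* c F.⁻¹ ⟩)

      half = F.2# F.⁻¹

      half-2 : ∀ x → half F.* (x F.+ x) ≡ x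
      half-2 x = ≡.trans (F.solve 2 (λ h x → h F.:* (x F.:+ x) F.:= ((F.:# 1 F.:+ F.:# 1) F.:* h) F.:* x) ≡.refl half x)
        (≡.trans (≡.cong (F._* x) (F.inverseʳ 2≢0)) (F.*-identityˡ x))

      Root : F.Carrier → F.Carrier → Set
      Root r c = c F.* c F.+ b F.* b ≡ r F.* c

      root? : ∀ r c → Dec (Root r c)
      root? r c = c F.* c F.+ b F.* b F.≟ r F.* c

      root≢0 : ∀ {r c} → Root r c → c ≢ F.0#
      root≢0 {r} {c} p ≡.refl = F.*-nonzero b≢0 b≢0 (≡.trans (≡.sym (≡.trans (≡.cong (F._+ b F.* b) (F.zeroˡ F.0#)) (F.+-identityˡ _))) (≡.trans p (F.zeroʳ r)))

      to-root : ∀ {r c} → c ≢ F.0# → r ≡ c F.+ b F.* b F.* c F.⁻¹ → Root r c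
      to-root {r} {c} c≢0 p = ≡.sym (≡.trans (≡.cong (F._* c) p) (≡.trans (F.solve 3 (λ c B v → (c F.:+ B F.:* v) F.:* c F.:= c F.:* c F.:+ B F.:* (c F.:* v)) ≡.refl c (b F.* b) (c F.⁻¹))
        (≡.cong (c F.* c F.+_) (≡.trans (≡.cong (b F.* b F.*_) (F.inverseʳ c≢0)) (F.*-identityʳ _)))))

      from-root : ∀ {r c} → c ≢ F.0# → Root r c → r ≡ c F.+ b F.* b F.* c F.⁻¹
      from-root {r} {c} c≢0 p = F.*-cancelˡ c≢0 (≡.trans (F.*-comm c r) (≡.trans (≡.sym p) (≡.sym
        (≡.trans (F.solve 3 (λ c B v → c F.:* (c F.:+ B F.:* v) F.:= c F.:* c F.:+ B F.:* (c F.:* v)) ≡.refl c (b F.* b) (c F.⁻¹))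
        (≡.cong (c F.* c F.+_) (≡.trans (≡.cong (b F.* b F.*_) (F.inverseʳ c≢0)) (F.*-identityʳ _)))))))

      -- The discriminant of c² - r c + b² is (r + 2b)(r - 2b).
      root-count : ∀ r → Q.∑ F.enum (λ c → ⟨ root? r c ⟩) ≡ 1ℚ ℚ.+ η (r F.+ 2b) ℚ.* η (r F.- 2b)
      root-count r = ≡.trans (Q.∑-cong F.enum (λ c → ⟨⟩-cong (root? r c) (v c F.* v c F.≟ D) to from))
        (≡.trans (Q.∑-reindex F.enum F.enum v (λ v → half F.* (v F.+ r)) ψφ φψ (λ v → ⟨ v F.* v F.≟ D ⟩)) (≡.trans (roots≡1+η D) (≡.cong (1ℚ ℚ.+_) (η-* (r F.+ 2b) (r F.- 2b)))))
        where
        v : F.Carrier → F.Carrier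
        v c = (c F.+ c) F.- r
        D = (r F.+ 2b) F.* (r F.- 2b)
        4# = F.2# F.* F.2#
        diff : ∀ c → v c F.* v c F.- D ≡ 4# F.* ((c F.* c F.+ b F.* b) F.- r F.* c)
        diff c = F.solve 3 (λ c r b → ((c F.:+ c) F.:- r) F.:* ((c F.:+ c) F.:- r) F.:- (r F.:+ (b F.:+ b)) F.:* (r F.:- (b F.:+ b))
          F.:= ((F.:# 1 F.:+ F.:# 1) F.:* (F.:# 1 F.:+ F.:# 1)) F.:* ((c F.:* c F.:+ b F.:* b) F.:- r F.:* c)) ≡.refl c r b
        to : ∀ {c} → Root r c → v c F.* v c ≡ D
        to {c} p = F.-≡0⇒≡ (≡.trans (diff c) (≡.trans (≡.cong (4# F.*_) (F.≡⇒-≡0 p)) (F.zeroʳ 4#)))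
        from : ∀ {c} → v c F.* v c ≡ D → Root r c
        from {c} p = F.-≡0⇒≡ (F.*-cancelˡ (F.*-nonzero 2≢0 2≢0) (≡.trans (≡.sym (diff c)) (≡.trans (F.≡⇒-≡0 p) (≡.sym (F.zeroʳ 4#)))))
        ψφ : ∀ s → half F.* (((s F.+ s) F.- r) F.+ r) ≡ s
        ψφ s = ≡.trans (≡.cong (half F.*_) (F.solve 2 (λ s l → (s F.:- l) F.:+ l F.:= s) ≡.refl (s F.+ s) r)) (half-2 s)
        φψ : ∀ v → (half F.* (v F.+ r) F.+ half F.* (v F.+ r)) F.- r ≡ v
        φψ v = ≡.trans (≡.cong (F._- r) (≡.trans (F.solve 2 (λ h x → h F.:* x F.:+ h F.:* x F.:= h F.:* (x F.:+ x)) ≡.refl half (v F.+ r)) (half-2 (v F.+ r))))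
          (F.solve 2 (λ v l → (v F.:+ l) F.:- l F.:= v) ≡.refl v r)

      η-root : ∀ {r c} s → s F.* s ≡ b F.* b → r F.+ (s F.+ s) ≢ F.0# → Root r c → η c ≡ η (r F.+ (s F.+ s))
      η-root {r} {c} s s² P≢0 p = ≡.trans (≡.sym (≡.trans (≡.cong (η c ℚ.*_) (η²≡1 P≢0)) (ℚP.*-identityʳ (η c))))
        (≡.trans (≡.sym (ℚP.*-assoc (η c) (η P) (η P))) (≡.trans (≡.cong (ℚ._* η P) (≡.trans (≡.sym (η-* c P)) (≡.trans (≡.cong η (≡.sym sq)) (η-square c+s≢0)))) (ℚP.*-identityˡ (η P))))
        where
        P = r F.+ (s F.+ s)
        sq : (c F.+ s) F.* (c F.+ s) ≡ c F.* P
        sq = ≡.trans (F.solve 2 (λ c s → (c F.:+ s) F.:* (c F.:+ s) F.:= (c F.:* c F.:+ s F.:* s) F.:+ c F.:* (s F.:+ s)) ≡.refl c s)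
          (≡.trans (≡.cong (F._+ c F.* (s F.+ s)) (≡.trans (≡.cong (c F.* c F.+_) s²) p)) (F.solve 3 (λ r c t → r F.:* c F.:+ c F.:* t F.:= c F.:* (r F.:+ t)) ≡.refl r c (s F.+ s)))
        c+s≢0 : c F.+ s ≢ F.0#
        c+s≢0 q = F.*-nonzero (root≢0 p) P≢0 (≡.trans (≡.sym sq) (≡.trans (≡.cong (F._* (c F.+ s)) q) (F.zeroˡ _)))

      -- Put p = η (r + 2b) and m = η (r - 2b). If r + 2b ≠ 0, all 1 + p m roots have η c = p, and p
      -- (1 + p m) = p + m by p² = 1. If r = - 2b, then r - 2b = - 4b ≠ 0 and the same argument
      -- works with - b.
      T≡ : ∀ r → T r ≡ η (r F.+ 2b) ℚ.+ η (r F.- 2b)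
      T≡ r = ≡.trans (Q.∑-cong F.enum pointwise) (go (r F.+ 2b F.≟ F.0#))
        where
        pointwise : ∀ c → η c ℚ.* ⟨ r F.≟ c F.+ b F.* b F.* c F.⁻¹ ⟩ ≡ η c ℚ.* ⟨ root? r c ⟩
        pointwise c = case (c F.≟ F.0#)
          where
          case : Dec (c ≡ F.0#) → η c ℚ.* ⟨ r F.≟ c F.+ b F.* b F.* c F.⁻¹ ⟩ ≡ η c ℚ.* ⟨ root? r c ⟩
          case (yes p) = ≡.trans (zero* ⟨ r F.≟ c F.+ b F.* b F.* c F.⁻¹ ⟩) (≡.sym (zero* ⟨ root? r c ⟩))
            where
            zero* : ∀ x → η c ℚ.* x ≡ 0ℚ
            zero* x = ≡.trans (≡.cong (ℚ._* x) (≡.trans (≡.cong η p) η-0)) (ℚP.*-zeroˡ x)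
          case (no c≢0) = ≡.cong (η c ℚ.*_) (⟨⟩-cong (r F.≟ c F.+ b F.* b F.* c F.⁻¹) (root? r c) (to-root c≢0) (from-root c≢0))
        replace : ∀ {e} → (∀ {c} → Root r c → η c ≡ e) → Q.∑ F.enum (λ c → η c ℚ.* ⟨ root? r c ⟩) ≡ e ℚ.* (1ℚ ℚ.+ η (r F.+ 2b) ℚ.* η (r F.- 2b))
        replace {e} h = ≡.trans (Q.∑-cong F.enum (λ c → const c (root? r c))) (≡.trans (≡.sym (Q.∑-*ˡ F.enum e (λ c → ⟨ root? r c ⟩))) (≡.cong (e ℚ.*_) (root-count r)))
          where
          const : ∀ c (d : Dec (Root r c)) → η c ℚ.* ⟨ d ⟩ ≡ e ℚ.* ⟨ d ⟩
          const c (yes p) = ≡.cong (ℚ._* 1ℚ) (h p)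
          const c (no p)  = ≡.trans (ℚP.*-zeroʳ (η c)) (≡.sym (ℚP.*-zeroʳ e))
        go : Dec (r F.+ 2b ≡ F.0#) → Q.∑ F.enum (λ c → η c ℚ.* ⟨ root? r c ⟩) ≡ η (r F.+ 2b) ℚ.+ η (r F.- 2b)
        go (no P≢0) = ≡.trans (replace (η-root b ≡.refl P≢0)) (≡.trans (Q.solve 2 (λ p m → p Q.:* (Q.:# 1 Q.:+ p Q.:* m) Q.:= p Q.:+ (p Q.:* p) Q.:* m) ≡.refl (η (r F.+ 2b)) (η (r F.- 2b)))
          (≡.cong (η (r F.+ 2b) ℚ.+_) (≡.trans (≡.cong (ℚ._* η (r F.- 2b)) (η²≡1 P≢0)) (ℚP.*-identityˡ (η (r F.- 2b))))))
        go (yes P≡0) = ≡.trans (replace {η (r F.- 2b)} (λ {c} p → ≡.trans (η-root (F.- b) (F.solve 1 (λ b → (F.:- b) F.:* (F.:- b) F.:= b F.:* b) ≡.refl b) M≢0′ p) (≡.cong η M≡)))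
          (≡.trans (Q.solve 2 (λ p m → m Q.:* (Q.:# 1 Q.:+ p Q.:* m) Q.:= p Q.:* (m Q.:* m) Q.:+ m) ≡.refl (η (r F.+ 2b)) (η (r F.- 2b)))
            (≡.cong (ℚ._+ η (r F.- 2b)) (≡.trans (≡.cong (η (r F.+ 2b) ℚ.*_) (η²≡1 (λ q → M≢0′ (≡.trans M≡ q)))) (ℚP.*-identityʳ (η (r F.+ 2b))))))
          where
          M≡ : r F.+ (F.- b F.+ F.- b) ≡ r F.- 2b
          M≡ = F.solve 2 (λ r b → r F.:+ ((F.:- b) F.:+ (F.:- b)) F.:= r F.:- (b F.:+ b)) ≡.refl r b
          M≢0′ : r F.+ (F.- b F.+ F.- b) ≢ F.0#
          M≢0′ q = b≢0 (2*-zero (2*-zero (≡.trans (F.solve 2 (λ r b → (b F.:+ b) F.:+ (b F.:+ b) F.:= (r F.:+ (b F.:+ b)) F.:- (r F.:+ ((F.:- b) F.:+ (F.:- b)))) ≡.refl r b)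
            (≡.trans (≡.cong₂ F._-_ P≡0 q) (F.-‿inverseʳ F.0#)))))

      shift-γ : ∀ s → ∑ F.enum (λ r → κ (η (r F.+ s)) * χ r) ≈ χ (F.- s) * γ
      shift-γ s = sym (begin
        χ (F.- s) * γ                                          ≈⟨ ∑-*ˡ F.enum (χ (F.- s)) _ ⟩
        ∑ F.enum (λ z → χ (F.- s) * (κ (η z) * χ z))           ≈⟨ ∑-reindex F.enum F.enum (F._+ s) (F._- s) (λ r → F.solve 2 (λ r s → (r F.:+ s) F.:- s F.:= r) ≡.refl r s) (λ r → F.solve 2 (λ r s → (r F.:- s) F.:+ s F.:= r) ≡.refl r s) _ ⟨
        ∑ F.enum (λ r → χ (F.- s) * (κ (η (r F.+ s)) * χ (r F.+ s))) ≈⟨ ∑-cong F.enum (λ r → trans (solve 3 (λ a b c → a :* (b :* c) := b :* (a :* c)) refl (χ (F.- s)) (κ (η (r F.+ s))) (χ (r F.+ s)))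
                                                                     (*-congˡ (trans (sym (χ-+ _ _)) (χ-cong (F.solve 2 (λ r s → (F.:- s) F.:+ (r F.:+ s) F.:= r) ≡.refl r s))))) ⟩
        ∑ F.enum (λ r → κ (η (r F.+ s)) * χ r)                 ∎)

    Sal-square : Sal (b F.* b) ≈ χ (F.- (b F.+ b)) * γ + χ (b F.+ b) * γ
    Sal-square = begin
      ∑ F.enum (λ c → κ (η c) * χ (c F.+ b F.* b F.* c F.⁻¹))
        ≈⟨ ∑-cong F.enum (λ c → sym (trans (∑-only F.enum (c F.+ b F.* b F.* c F.⁻¹) _ (λ r r≢ → κ-0* (χ r) (≡.trans (≡.cong (η c ℚ.*_) (⟨no⟩ (r F.≟ _) r≢)) (ℚP.*-zeroʳ (η c)))))
             (*-congʳ (κ-cong (≡.trans (≡.cong (η c ℚ.*_) (⟨yes⟩ (_ F.≟ _) ≡.refl)) (ℚP.*-identityʳ (η c))))))) ⟩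
      ∑ F.enum (λ c → ∑ F.enum (λ r → κ (η c ℚ.* ⟨ r F.≟ c F.+ b F.* b F.* c F.⁻¹ ⟩) * χ r))
        ≈⟨ ∑-swap F.enum F.enum _ ⟩
      ∑ F.enum (λ r → ∑ F.enum (λ c → κ (η c ℚ.* ⟨ r F.≟ c F.+ b F.* b F.* c F.⁻¹ ⟩) * χ r))
        ≈⟨ ∑-cong F.enum (λ r → trans (sym (∑-*ʳ F.enum (χ r) _)) (*-congʳ (trans (sym (κ-∑ F.enum _)) (trans (κ-cong (T≡ r)) (κ-+ _ _))))) ⟩
      ∑ F.enum (λ r → (κ (η (r F.+ 2b)) + κ (η (r F.- 2b))) * χ r)
        ≈⟨ trans (∑-cong F.enum (λ r → distribʳ (χ r) _ _)) (∑-∙ F.enum _ _) ⟩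
      ∑ F.enum (λ r → κ (η (r F.+ 2b)) * χ r) + ∑ F.enum (λ r → κ (η (r F.- 2b)) * χ r)
        ≈⟨ +-cong (shift-γ 2b) (trans (shift-γ (F.- 2b)) (*-congʳ (χ-cong (F.-‿involutive 2b)))) ⟩
      χ (F.- 2b) * γ + χ 2b * γ ∎

  -- The three cases give the constants 1, 0 and 4; all are relaxed to 6 in order to agree with the
  -- Kloosterman bound.
  salie-bound : ∀ a {f} → u * f ≈ 0# → ‖ Sal a * f ‖² ℚ.≤ toℚ 6 ℚ.* toℚ F.order ℚ.* ‖ f ‖²
  salie-bound a {f} uf = go (squareView a)
    where
    N = toℚ F.order ℚ.* ‖ f ‖²
    0≤N : 0ℚ ℚ.≤ N
    0≤N = Q.0≤* 0≤q (⟪⟫-pos f)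
    scale : ∀ {x} (c : ℚ) (d : ℚ) → 0ℚ ℚ.≤ d → toℚ 6 ≡ c ℚ.+ d → x ℚ.≤ c ℚ.* N → x ℚ.≤ toℚ 6 ℚ.* toℚ F.order ℚ.* ‖ f ‖²
    scale c d 0≤d p h = ℚP.≤-trans h (Q.≤-by (d ℚ.* N) (Q.0≤* 0≤d 0≤N) (≡.trans (≡.cong (λ z → z ℚ.* toℚ F.order ℚ.* ‖ f ‖² ℚ.- c ℚ.* N) p)
      (Q.solve 4 (λ c d q n → (c Q.:+ d) Q.:* q Q.:* n Q.:- c Q.:* (q Q.:* n) Q.:= d Q.:* (q Q.:* n)) ≡.refl c d (toℚ F.order) ‖ f ‖²)))
    go : SquareView a → ‖ Sal a * f ‖² ℚ.≤ toℚ 6 ℚ.* toℚ F.order ℚ.* ‖ f ‖²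
    go (zeroˢ ≡.refl) = scale 1ℚ (toℚ 5) (Q.0≤toℚ 5) ≡.refl (ℚP.≤-reflexive (≡.trans (‖‖²-cong (*-congʳ Sal-0)) (≡.trans (‖γ*‖² uf) (≡.sym (ℚP.*-identityˡ N)))))
    go (nonsquare n) = scale 0ℚ (toℚ 6) (Q.0≤toℚ 6) ≡.refl (ℚP.≤-reflexive (≡.trans (‖‖²-cong (trans (*-congʳ (Sal-nonsquare n)) (zeroˡ f))) (≡.trans (⟪0⟫ 0#) (≡.sym (ℚP.*-zeroˡ N)))))
    go (square {b} b≢0 ≡.refl) = scale (toℚ 4) (toℚ 2) (Q.0≤toℚ 2) ≡.refl (ℚP.≤-trans (ℚP.≤-reflexive (≡.trans (‖‖²-cong eq) (‖+κ‖² 1ℚ X Y)))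
        (Q.≤-by (N ℚ.+ N ℚ.- (⟪ X , Y ⟫ ℚ.+ ⟪ X , Y ⟫)) (Q.≤⇒0≤- (ℚP.+-mono-≤ X·Y X·Y)) (≡.trans (≡.cong₂ (λ x y → toℚ 4 ℚ.* N ℚ.- (1ℚ ℚ.* 1ℚ ℚ.* x ℚ.+ (1ℚ ℚ.+ 1ℚ) ℚ.* ⟪ X , Y ⟫ ℚ.+ y)) ‖X‖ ‖Y‖)
          (Q.solve 2 (λ N I → Q.:# 4 Q.:* N Q.:- (Q.:# 1 Q.:* Q.:# 1 Q.:* N Q.:+ (Q.:# 1 Q.:+ Q.:# 1) Q.:* I Q.:+ N) Q.:= N Q.:+ N Q.:- (I Q.:+ I)) ≡.refl N ⟪ X , Y ⟫))))
      where
      X = χ (F.- (b F.+ b)) * (γ * f)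
      Y = χ (b F.+ b) * (γ * f)
      ‖X‖ : ‖ X ‖² ≡ N
      ‖X‖ = ≡.trans (‖χ*‖² _ _) (‖γ*‖² uf)
      ‖Y‖ : ‖ Y ‖² ≡ N
      ‖Y‖ = ≡.trans (‖χ*‖² _ _) (‖γ*‖² uf)
      X·Y : ⟪ X , Y ⟫ ℚ.≤ N
      X·Y = ⟪⟫≤ X Y ‖X‖ ‖Y‖
      eq : Sal (b F.* b) * f ≈ κ 1ℚ * X + Y
      eq = trans (*-congʳ (Sal-square b≢0)) (trans (solve 4 (λ x y g f → (x :* g :+ y :* g) :* f := x :* (g :* f) :+ y :* (g :* f)) refl (χ (F.- (b F.+ b))) (χ (b F.+ b)) γ f) (+-congʳ (sym (κ-1* X ≡.refl))))

-- The rational group algebra of a finite abelian group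

module GroupRing where
  open import Level using (0ℓ)
  open import Algebra.Bundles using (CommutativeRing)
  open import Data.Product using (_,_)
  open import Data.Rational using (ℚ; 0ℚ; _+_; _*_; -_)
  open import Data.Rational.Properties as ℚP hiding (_≟_)
  open import Relation.Binary.PropositionalEquality using (_≡_; refl; sym; trans; cong; cong₂)
  open Sums
  open StarAlgebras
  open Q using (solve; _:*_; _:=_)
  open Q using (⟨_⟩; ⟨⟩-cong; ∑; ∑-cong)

  record FiniteAbelianGroup : Set₁ where
    infixl 6 _⊕_
    field
      A         : Set
      enum      : Enum A
      _⊕_       : A → A → A
      ⊖_        : A → A
      𝟘         : A
      ⊕-assoc   : ∀ x y z → (x ⊕ y) ⊕ z ≡ x ⊕ (y ⊕ z)
      ⊕-comm    : ∀ x y → x ⊕ y ≡ y ⊕ x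
      ⊕-identity : ∀ x → 𝟘 ⊕ x ≡ x
      ⊕-inverse : ∀ x → (⊖ x) ⊕ x ≡ 𝟘

  module _ (G : FiniteAbelianGroup) where
    open FiniteAbelianGroup G
    open Enum enum using (_≟_)

    private
      ⊕-identityʳ : ∀ x → x ⊕ 𝟘 ≡ x
      ⊕-identityʳ x = trans (⊕-comm x 𝟘) (⊕-identity x)

      ⊕-inverseʳ : ∀ x → x ⊕ (⊖ x) ≡ 𝟘
      ⊕-inverseʳ x = trans (⊕-comm x (⊖ x)) (⊕-inverse x)

      cancelʳ : ∀ x y → (x ⊕ y) ⊕ (⊖ y) ≡ x
      cancelʳ x y = trans (⊕-assoc x y (⊖ y)) (trans (cong (x ⊕_) (⊕-inverseʳ y)) (⊕-identityʳ x))

      cancelʳ′ : ∀ x y → (x ⊕ (⊖ y)) ⊕ y ≡ x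
      cancelʳ′ x y = trans (⊕-assoc x (⊖ y) y) (trans (cong (x ⊕_) (⊕-inverse y)) (⊕-identityʳ x))

      ⊖-unique : ∀ {x y} → x ⊕ y ≡ 𝟘 → x ≡ ⊖ y
      ⊖-unique {x} {y} p = trans (sym (cancelʳ x y)) (trans (cong (_⊕ (⊖ y)) p) (⊕-identity (⊖ y)))

      ⊖-⊕ : ∀ x y → ⊖ (x ⊕ y) ≡ (⊖ x) ⊕ (⊖ y)
      ⊖-⊕ x y = sym (⊖-unique (trans (⊕-assoc (⊖ x) (⊖ y) (x ⊕ y)) (trans (cong ((⊖ x) ⊕_)
        (trans (cong ((⊖ y) ⊕_) (⊕-comm x y)) (trans (sym (⊕-assoc (⊖ y) y x)) (trans (cong (_⊕ x) (⊕-inverse y)) (⊕-identity x))))) (⊕-inverse x))))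

      ⊖-involutive : ∀ x → ⊖ (⊖ x) ≡ x
      ⊖-involutive x = sym (⊖-unique (⊕-inverseʳ x))

      ⊖-𝟘 : ⊖ 𝟘 ≡ 𝟘
      ⊖-𝟘 = sym (⊖-unique (⊕-identity 𝟘))

      sub-sub : ∀ x y → x ⊕ (⊖ (x ⊕ (⊖ y))) ≡ y
      sub-sub x y = trans (cong (x ⊕_) (trans (⊖-⊕ x (⊖ y)) (cong ((⊖ x) ⊕_) (⊖-involutive y))))
        (trans (sym (⊕-assoc x (⊖ x) y)) (trans (cong (_⊕ y) (⊕-inverseʳ x)) (⊕-identity y)))

    Fun : Set
    Fun = A → ℚ

    _⋆_ : Fun → Fun → Fun
    (f ⋆ g) x = ∑ enum (λ y → f y * g (x ⊕ (⊖ y)))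

    [_] : A → Fun
    [ a ] x = ⟨ x ≟ a ⟩

    κᴳ : ℚ → Fun
    κᴳ c x = ⟨ x ≟ 𝟘 ⟩ * c

    []-⋆ : ∀ a f x → ([ a ] ⋆ f) x ≡ f (x ⊕ (⊖ a))
    []-⋆ a f x = Q.∑-δ enum (λ y → f (x ⊕ (⊖ y))) a

    private
      ⋆-comm : ∀ f g x → (f ⋆ g) x ≡ (g ⋆ f) x
      ⋆-comm f g x = trans (sym (Q.∑-reindex enum enum (λ y → x ⊕ (⊖ y)) (λ y → x ⊕ (⊖ y)) (sub-sub x) (sub-sub x) (λ y → f y * g (x ⊕ (⊖ y)))))
        (∑-cong enum (λ y → trans (cong (f (x ⊕ (⊖ y)) *_) (cong g (sub-sub x y))) (ℚP.*-comm (f (x ⊕ (⊖ y))) (g y))))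

      ⋆-cong : ∀ {f f′ g g′} → (∀ x → f x ≡ f′ x) → (∀ x → g x ≡ g′ x) → ∀ x → (f ⋆ g) x ≡ (f′ ⋆ g′) x
      ⋆-cong p p′ x = ∑-cong enum (λ y → cong₂ _*_ (p y) (p′ _))

      ⋆-assoc : ∀ f g h x → ((f ⋆ g) ⋆ h) x ≡ (f ⋆ (g ⋆ h)) x
      ⋆-assoc f g h x = begin
        ∑ enum (λ y → ∑ enum (λ z → f z * g (y ⊕ (⊖ z))) * h (x ⊕ (⊖ y)))
          ≡⟨ ∑-cong enum (λ y → Q.∑-*ʳ enum (h (x ⊕ (⊖ y))) _) ⟩
        ∑ enum (λ y → ∑ enum (λ z → f z * g (y ⊕ (⊖ z)) * h (x ⊕ (⊖ y))))
          ≡⟨ Q.∑-swap enum enum _ ⟩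
        ∑ enum (λ z → ∑ enum (λ y → f z * g (y ⊕ (⊖ z)) * h (x ⊕ (⊖ y))))
          ≡⟨ ∑-cong enum (λ z → sym (Q.∑-reindex enum enum (_⊕ z) (_⊕ (⊖ z)) (λ y → cancelʳ y z) (λ y → cancelʳ′ y z) (λ y → f z * g (y ⊕ (⊖ z)) * h (x ⊕ (⊖ y))))) ⟩
        ∑ enum (λ z → ∑ enum (λ y → f z * g ((y ⊕ z) ⊕ (⊖ z)) * h (x ⊕ (⊖ (y ⊕ z)))))
          ≡⟨ ∑-cong enum (λ z → trans (∑-cong enum (λ y → trans (cong₂ (λ a b → f z * g a * h b) (cancelʳ y z) (arg y z)) (ℚP.*-assoc (f z) (g y) _)))
               (sym (Q.∑-*ˡ enum (f z) (λ y → g y * h ((x ⊕ (⊖ z)) ⊕ (⊖ y)))))) ⟩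
        ∑ enum (λ z → f z * ∑ enum (λ y → g y * h ((x ⊕ (⊖ z)) ⊕ (⊖ y)))) ∎
        where
        open import Relation.Binary.PropositionalEquality using (module ≡-Reasoning)
        open ≡-Reasoning
        arg : ∀ y z → x ⊕ (⊖ (y ⊕ z)) ≡ (x ⊕ (⊖ z)) ⊕ (⊖ y)
        arg y z = trans (cong (x ⊕_) (trans (⊖-⊕ y z) (⊕-comm (⊖ y) (⊖ z)))) (sym (⊕-assoc x (⊖ z) (⊖ y)))

      ⋆-identity : ∀ f x → ([ 𝟘 ] ⋆ f) x ≡ f x
      ⋆-identity f x = trans ([]-⋆ 𝟘 f x) (cong f (trans (cong (x ⊕_) ⊖-𝟘) (⊕-identityʳ x)))

      ⋆-distribˡ : ∀ f g h x → (f ⋆ (λ y → g y + h y)) x ≡ (f ⋆ g) x + (f ⋆ h) x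
      ⋆-distribˡ f g h x = trans (∑-cong enum (λ y → ℚP.*-distribˡ-+ (f y) _ _)) (Q.∑-∙ enum _ _)

    groupRing : CommutativeRing 0ℓ 0ℓ
    groupRing = record
      { Carrier = Fun ; _≈_ = λ f g → ∀ x → f x ≡ g x ; _+_ = λ f g x → f x + g x ; _*_ = _⋆_ ; -_ = λ f x → - f x ; 0# = λ _ → 0ℚ ; 1# = [ 𝟘 ]
      ; isCommutativeRing = record
        { isRing = record
          { +-isAbelianGroup = record
            { isGroup = record
              { isMonoid = record
                { isSemigroup = record
                  { isMagma = record
                    { isEquivalence = record { refl = λ x → refl ; sym = λ p x → sym (p x) ; trans = λ p p′ x → trans (p x) (p′ x) }
                    ; ∙-cong = λ p p′ x → cong₂ _+_ (p x) (p′ x) }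
                  ; assoc = λ f g h x → ℚP.+-assoc (f x) (g x) (h x) }
                ; identity = (λ f x → ℚP.+-identityˡ (f x)) , (λ f x → ℚP.+-identityʳ (f x)) }
              ; inverse = (λ f x → ℚP.+-inverseˡ (f x)) , (λ f x → ℚP.+-inverseʳ (f x))
              ; ⁻¹-cong = λ p x → cong -_ (p x) }
            ; comm = λ f g x → ℚP.+-comm (f x) (g x) }
          ; *-cong = λ p p′ → ⋆-cong p p′
          ; *-assoc = ⋆-assoc
          ; *-identity = ⋆-identity , (λ f x → trans (⋆-comm f [ 𝟘 ] x) (⋆-identity f x))
          ; distrib = ⋆-distribˡ , (λ f g h x → trans (⋆-comm (λ y → g y + h y) f x) (trans (⋆-distribˡ f g h x) (cong₂ _+_ (⋆-comm f g x) (⋆-comm f h x)))) }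
        ; *-comm = ⋆-comm } }

    κᴳ-⋆ : ∀ c f x → (κᴳ c ⋆ f) x ≡ c * f x
    κᴳ-⋆ c f x = trans (∑-cong enum (λ y → ℚP.*-assoc ⟨ y ≟ 𝟘 ⟩ c (f (x ⊕ (⊖ y)))))
      (trans (Q.∑-δ enum (λ y → c * f (x ⊕ (⊖ y))) 𝟘) (cong (λ z → c * f z) (trans (cong (x ⊕_) ⊖-𝟘) (⊕-identityʳ x))))

    private
      ⋆-star : ∀ f g x → (f ⋆ g) (⊖ x) ≡ ((λ y → f (⊖ y)) ⋆ (λ y → g (⊖ y))) x
      ⋆-star f g x = trans (sym (Q.∑-reindex enum enum ⊖_ ⊖_ ⊖-involutive ⊖-involutive (λ y → f y * g ((⊖ x) ⊕ (⊖ y)))))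
        (∑-cong enum (λ y → cong (λ z → f (⊖ y) * g z) (sym (⊖-⊕ x (⊖ y)))))

      κᴳ-star : ∀ c x → κᴳ c (⊖ x) ≡ κᴳ c x
      κᴳ-star c x = cong (_* c) (⟨⟩-cong ((⊖ x) ≟ 𝟘) (x ≟ 𝟘) (λ p → trans (sym (⊖-involutive x)) (trans (cong ⊖_ p) ⊖-𝟘)) (λ p → trans (cong ⊖_ p) ⊖-𝟘))

      ⋆-adjoint : ∀ h f g → ∑ enum (λ x → (h ⋆ f) x * g x) ≡ ∑ enum (λ x → f x * ((λ y → h (⊖ y)) ⋆ g) x)
      ⋆-adjoint h f g = begin
        ∑ enum (λ x → ∑ enum (λ y → h y * f (x ⊕ (⊖ y))) * g x)
          ≡⟨ ∑-cong enum (λ x → Q.∑-*ʳ enum (g x) _) ⟩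
        ∑ enum (λ x → ∑ enum (λ y → h y * f (x ⊕ (⊖ y)) * g x))
          ≡⟨ Q.∑-swap enum enum _ ⟩
        ∑ enum (λ y → ∑ enum (λ x → h y * f (x ⊕ (⊖ y)) * g x))
          ≡⟨ ∑-cong enum (λ y → sym (Q.∑-reindex enum enum (_⊕ y) (_⊕ (⊖ y)) (λ x → cancelʳ x y) (λ x → cancelʳ′ x y) (λ x → h y * f (x ⊕ (⊖ y)) * g x))) ⟩
        ∑ enum (λ y → ∑ enum (λ x → h y * f ((x ⊕ y) ⊕ (⊖ y)) * g (x ⊕ y)))
          ≡⟨ ∑-cong enum (λ y → ∑-cong enum (λ x → trans (cong (λ z → h y * f z * g (x ⊕ y)) (cancelʳ x y))
               (solve 3 (λ a b c → a :* b :* c := b :* (a :* c)) refl (h y) (f x) (g (x ⊕ y))))) ⟩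
        ∑ enum (λ y → ∑ enum (λ x → f x * (h y * g (x ⊕ y))))
          ≡⟨ Q.∑-swap enum enum _ ⟩
        ∑ enum (λ x → ∑ enum (λ y → f x * (h y * g (x ⊕ y))))
          ≡⟨ ∑-cong enum (λ x → trans (sym (Q.∑-*ˡ enum (f x) _)) (cong (f x *_) (trans (sym (Q.∑-reindex enum enum ⊖_ ⊖_ ⊖-involutive ⊖-involutive (λ y → h y * g (x ⊕ y)))) refl))) ⟩
        ∑ enum (λ x → f x * ∑ enum (λ y → h (⊖ y) * g (x ⊕ (⊖ y)))) ∎
        where
        open import Relation.Binary.PropositionalEquality using (module ≡-Reasoning)
        open ≡-Reasoning

    -- Convolution algebra with reflection as involution and the ℓ² product of coefficient
    -- functions. Adjointness is the invariance of that product under translations.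
    groupAlgebra : StarAlgebra
    groupAlgebra = record
      { commRing  = groupRing
      ; κ         = κᴳ
      ; κ-+       = λ a b x → ℚP.*-distribˡ-+ ⟨ x ≟ 𝟘 ⟩ a b
      ; κ-*       = λ a b x → trans (solve 3 (λ d a b → d :* (a :* b) := a :* (d :* b)) refl ⟨ x ≟ 𝟘 ⟩ a b) (sym (κᴳ-⋆ a (κᴳ b) x))
      ; κ-1       = λ x → ℚP.*-identityʳ ⟨ x ≟ 𝟘 ⟩
      ; star      = λ f x → f (⊖ x)
      ; star-cong = λ p x → p (⊖ x)
      ; star-+    = λ f g x → refl
      ; star-*    = ⋆-star
      ; star-κ    = κᴳ-star
      ; ⟪_,_⟫     = λ f g → ∑ enum (λ x → f x * g x)
      ; ⟪⟫-cong   = λ p p′ → ∑-cong enum (λ x → cong₂ _*_ (p x) (p′ x))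
      ; ⟪⟫-sym    = λ f g → ∑-cong enum (λ x → ℚP.*-comm (f x) (g x))
      ; ⟪⟫-+      = λ f f′ g → trans (∑-cong enum (λ x → ℚP.*-distribʳ-+ (g x) (f x) (f′ x))) (Q.∑-∙ enum _ _)
      ; ⟪⟫-κ      = λ c f g → trans (∑-cong enum (λ x → trans (cong (_* g x) (κᴳ-⋆ c f x)) (ℚP.*-assoc c (f x) (g x)))) (sym (Q.∑-*ˡ enum c _))
      ; ⟪⟫-pos    = λ f → Q.sumL-nonneg (Enum.elems enum) (λ x → Q.square-nonneg (f x))
      ; adjoint   = ⋆-adjoint
      }

    []-⊕ : ∀ a b x → [ a ⊕ b ] x ≡ ([ a ] ⋆ [ b ]) x
    []-⊕ a b x = sym (trans ([]-⋆ a [ b ] x) (⟨⟩-cong ((x ⊕ (⊖ a)) ≟ b) (x ≟ (a ⊕ b))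
      (λ p → trans (sym (cancelʳ′ x a)) (trans (cong (_⊕ a) p) (⊕-comm b a))) (λ p → trans (cong (_⊕ (⊖ a)) (trans p (⊕-comm a b))) (cancelʳ b a))))

    []-star : ∀ a x → [ a ] (⊖ x) ≡ [ ⊖ a ] x
    []-star a x = ⟨⟩-cong ((⊖ x) ≟ a) (x ≟ (⊖ a)) (λ p → trans (sym (⊖-involutive x)) (cong ⊖_ p)) (λ p → trans (cong ⊖_ p) (⊖-involutive a))

-- Vectors over the field and completing the square

module Points (F : FiniteField) where
  open import Data.Vec using ([]; _∷_)
  open import Relation.Binary.PropositionalEquality using (_≡_; _≢_; refl; sym; trans; cong; cong₂)
  open Field F
  open FiniteField F public using (Point; ‖_‖)

  infixl 6 _⊞_ _⊟_
  _⊞_ _⊟_ : ∀ {d} → Point d → Point d → Point d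
  []      ⊞ []      = []
  (a ∷ x) ⊞ (b ∷ y) = a + b ∷ x ⊞ y
  []      ⊟ []      = []
  (a ∷ x) ⊟ (b ∷ y) = a - b ∷ x ⊟ y

  ⊟ᵥ_ : ∀ {d} → Point d → Point d
  ⊟ᵥ []      = []
  ⊟ᵥ (a ∷ x) = - a ∷ ⊟ᵥ x

  0ᵥ : ∀ {d} → Point d
  0ᵥ {zero}  = []
  0ᵥ {suc d} = 0# ∷ 0ᵥ

  infixr 7 _*ᵥ_
  _*ᵥ_ : ∀ {d} → Carrier → Point d → Point d
  k *ᵥ []      = []
  k *ᵥ (a ∷ x) = k * a ∷ k *ᵥ x

  ⊞-assoc : ∀ {d} (x y z : Point d) → (x ⊞ y) ⊞ z ≡ x ⊞ (y ⊞ z)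
  ⊞-assoc []      []      []      = refl
  ⊞-assoc (a ∷ x) (b ∷ y) (c ∷ z) = cong₂ _∷_ (+-assoc a b c) (⊞-assoc x y z)

  ⊞-comm : ∀ {d} (x y : Point d) → x ⊞ y ≡ y ⊞ x
  ⊞-comm []      []      = refl
  ⊞-comm (a ∷ x) (b ∷ y) = cong₂ _∷_ (+-comm a b) (⊞-comm x y)

  ⊞-identity : ∀ {d} (x : Point d) → 0ᵥ ⊞ x ≡ x
  ⊞-identity []      = refl
  ⊞-identity (a ∷ x) = cong₂ _∷_ (+-identityˡ a) (⊞-identity x)

  ⊞-inverse : ∀ {d} (x : Point d) → (⊟ᵥ x) ⊞ x ≡ 0ᵥ
  ⊞-inverse []      = refl
  ⊞-inverse (a ∷ x) = cong₂ _∷_ (-‿inverseˡ a) (⊞-inverse x)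

  ⊟≡⊞⊟ᵥ : ∀ {d} (x y : Point d) → x ⊟ y ≡ x ⊞ (⊟ᵥ y)
  ⊟≡⊞⊟ᵥ []      []      = refl
  ⊟≡⊞⊟ᵥ (a ∷ x) (b ∷ y) = cong (a - b ∷_) (⊟≡⊞⊟ᵥ x y)

  ⊖≡⊟ : ∀ {d} (x y : Point d) → FiniteField._⊖_ F x y ≡ x ⊟ y
  ⊖≡⊟ []      []      = refl
  ⊖≡⊟ (a ∷ x) (b ∷ y) = cong (a - b ∷_) (⊖≡⊟ x y)

  ⊞⊟ : ∀ {d} (x y : Point d) → (x ⊞ y) ⊟ y ≡ x
  ⊞⊟ []      []      = refl
  ⊞⊟ (a ∷ x) (b ∷ y) = cong₂ _∷_ (solve 2 (λ a b → (a :+ b) :- b := a) refl a b) (⊞⊟ x y)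

  ⊟⊞ : ∀ {d} (x y : Point d) → (x ⊟ y) ⊞ y ≡ x
  ⊟⊞ []      []      = refl
  ⊟⊞ (a ∷ x) (b ∷ y) = cong₂ _∷_ (solve 2 (λ a b → (a :- b) :+ b := a) refl a b) (⊟⊞ x y)

  ⊟⊟ : ∀ {d} (x y : Point d) → x ⊟ (x ⊟ y) ≡ y
  ⊟⊟ []      []      = refl
  ⊟⊟ (a ∷ x) (b ∷ y) = cong₂ _∷_ (solve 2 (λ a b → a :- (a :- b) := b) refl a b) (⊟⊟ x y)

  ⊟ᵥ-involutive : ∀ {d} (x : Point d) → ⊟ᵥ (⊟ᵥ x) ≡ x
  ⊟ᵥ-involutive []      = refl
  ⊟ᵥ-involutive (a ∷ x) = cong₂ _∷_ (-‿involutive a) (⊟ᵥ-involutive x)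

  ‖⊟ᵥ‖ : ∀ {d} (x : Point d) → ‖ ⊟ᵥ x ‖ ≡ ‖ x ‖
  ‖⊟ᵥ‖ []      = refl
  ‖⊟ᵥ‖ (a ∷ x) = cong₂ _+_ (solve 1 (λ a → (:- a) :* (:- a) := a :* a) refl a) (‖⊟ᵥ‖ x)

  -- The minimum of c y² + c′ (x - y)² over y is attained at k x.
  complete-square : ∀ {d} {c c′ k m} → c + c′ ≢ 0# → k ≡ c′ * (c + c′) ⁻¹ → m ≡ c * c′ * (c + c′) ⁻¹ → ∀ (x y : Point d) →
    c * ‖ y ⊞ k *ᵥ x ‖ + c′ * ‖ x ⊟ (y ⊞ k *ᵥ x) ‖ ≡ (c + c′) * ‖ y ‖ + m * ‖ x ‖
  complete-square {c = c} {c′} {k} {m} s≢0 _ _ [] [] = solve 3 (λ c c′ m → c :* :# 0 :+ c′ :* :# 0 := (c :+ c′) :* :# 0 :+ m :* :# 0) refl c c′ m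
  complete-square {c = c} {c′} {k} {m} s≢0 k≡ m≡ (a ∷ x) (b ∷ y) =
    trans (solve 6 (λ c c′ u v U V → c :* (u :+ U) :+ c′ :* (v :+ V) := (c :* u :+ c′ :* v) :+ (c :* U :+ c′ :* V)) refl c c′ ((b + k * a) * (b + k * a)) ((a - (b + k * a)) * (a - (b + k * a))) _ _)
    (trans (cong₂ _+_ coordinate (complete-square s≢0 k≡ m≡ x y))
      (solve 6 (λ s m u v U V → (s :* u :+ m :* v) :+ (s :* U :+ m :* V) := s :* (u :+ U) :+ m :* (v :+ V)) refl (c + c′) m (b * b) (a * a) (‖ y ‖) (‖ x ‖)))
    where
    s = c + c′
    sk≡c′ : s * k ≡ c′
    sk≡c′ = trans (cong (s *_) k≡) (trans (solve 3 (λ s c v → s :* (c :* v) := c :* (s :* v)) refl s c′ (s ⁻¹)) (trans (cong (c′ *_) (inverseʳ s≢0)) (*-identityʳ c′)))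
    ck≡m : c * k ≡ m
    ck≡m = trans (cong (c *_) k≡) (trans (sym (*-assoc c c′ _)) (sym m≡))
    coordinate : c * ((b + k * a) * (b + k * a)) + c′ * ((a - (b + k * a)) * (a - (b + k * a))) ≡ s * (b * b) + m * (a * a)
    coordinate = trans (expand b (k * a))
      (trans (cong₂ (λ u v → s * (b * b) + (u + u) * b + v) lin quad) (solve 3 (λ X b m → X :+ (:# 0 :+ :# 0) :* b :+ m := X :+ m) refl (s * (b * b)) b (m * (a * a))))
      where
      expand : ∀ b t → c * ((b + t) * (b + t)) + c′ * ((a - (b + t)) * (a - (b + t))) ≡ s * (b * b) + ((s * t - c′ * a) + (s * t - c′ * a)) * b + (c * (t * t) + c′ * ((a - t) * (a - t)))
      expand b t = solve 5 (λ c c′ a b t → c :* ((b :+ t) :* (b :+ t)) :+ c′ :* ((a :- (b :+ t)) :* (a :- (b :+ t)))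
        := (c :+ c′) :* (b :* b) :+ (((c :+ c′) :* t :- c′ :* a) :+ ((c :+ c′) :* t :- c′ :* a)) :* b :+ (c :* (t :* t) :+ c′ :* ((a :- t) :* (a :- t)))) refl c c′ a b t
      lin : s * (k * a) - c′ * a ≡ 0#
      lin = ≡⇒-≡0 (trans (sym (*-assoc s k a)) (cong (_* a) sk≡c′))
      quad : c * (k * a * (k * a)) + c′ * ((a - k * a) * (a - k * a)) ≡ m * (a * a)
      quad = trans (solve 4 (λ c c′ k a → c :* (k :* a :* (k :* a)) :+ c′ :* ((a :- k :* a) :* (a :- k :* a)) := (((c :+ c′) :* k) :* k :+ c′ :- (c′ :* k :+ c′ :* k)) :* (a :* a)) refl c c′ k a)
        (cong (_* (a * a)) (trans (cong (λ z → z * k + c′ - (c′ * k + c′ * k)) sk≡c′) (trans (solve 2 (λ c′ k → c′ :* k :+ c′ :- (c′ :* k :+ c′ :* k) := c′ :- c′ :* k) refl c′ k)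
          (trans (cong (_- c′ * k) (sym sk≡c′)) (trans (solve 3 (λ c c′ k → (c :+ c′) :* k :- c′ :* k := c :* k) refl c c′ k) ck≡m)))))

-- Gaussian kernels and the spectral bound for the sphere operator

module SphereOperator (F : FiniteField) (k : ℕ) (q≡ : FiniteField.order F ≡ suc (k ℕ.+ k)) (3≤q : 3 ℕ.≤ FiniteField.order F)
  (d : ℕ) (Alg : StarAlgebra) (E : FiniteField.Point F d → Field.Carrier F → StarAlgebra.Carrier Alg)
  (E-0 : StarAlgebra._≈_ Alg (E (Points.0ᵥ F) (Field.0# F)) (StarAlgebra.1# Alg))
  (E-+ : ∀ x r y s → StarAlgebra._≈_ Alg (E (Points._⊞_ F x y) (Field._+_ F r s)) (StarAlgebra._*_ Alg (E x r) (E y s)))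
  (E-star : ∀ x r → StarAlgebra._≈_ Alg (StarAlgebra.star Alg (E x r)) (E (Points.⊟ᵥ_ F x) (Field.-_ F r))) where
  open import Data.Rational as ℚ using (ℚ; 0ℚ; 1ℚ)
  import Data.Nat.Properties as ℕP
  import Data.Rational.Properties as ℚP
  open import Data.Product using (∃; _,_)
  open import Data.Sum using (_⊎_; inj₁; inj₂)
  open import Data.Vec using ([]; _∷_)
  open import Relation.Nullary using (Dec; yes; no; ¬?; contradiction)
  open Sums
  open Q using (⟨_⟩; ⟨⟩-cong)
  private module F = Field F
  open Points F
  open StarAlgebra Alg
  open Lemmas Alg
  open import Algebra.Properties.CommutativeSemiring.Exp commutativeSemiring using (_^_; ^-congˡ; ^-distrib-*)

  2≢0 : F.2# ≢ F.0#
  2≢0 = F.odd⇒2≢0 {k} q≡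

  open QuadraticCharacter F 2≢0

  qℚ : ℚ
  qℚ = toℚ F.order

  0<q : 0ℚ ℚ.< qℚ
  0<q = ℚP.<-≤-trans (ℚP.positive⁻¹ 1ℚ) (Q.toℚ-mono (ℕP.≤-trans (ℕ.s≤s ℕ.z≤n) 3≤q))

  instance
    q-nonZero : ℚ.NonZero qℚ
    q-nonZero = ℚP.pos⇒nonZero qℚ {{ℚ.positive 0<q}}

  points : ∀ n → Enum (Point n)
  points n = vecEnum F.enum n

  τ : F.Carrier → Carrier
  τ r = E 0ᵥ r

  τ-+ : ∀ r s → τ (r F.+ s) ≈ τ r * τ s
  τ-+ r s = trans (reflexive (≡.cong (λ z → E z (r F.+ s)) (≡.sym (⊞-identity 0ᵥ)))) (E-+ 0ᵥ r 0ᵥ s)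

  ⊟ᵥ-0 : ∀ {n} → ⊟ᵥ (0ᵥ {n}) ≡ 0ᵥ
  ⊟ᵥ-0 {zero}  = ≡.refl
  ⊟ᵥ-0 {suc n} = ≡.cong₂ _∷_ F.-0#≈0# ⊟ᵥ-0

  τ-star : ∀ r → star (τ r) ≈ τ (F.- r)
  τ-star r = trans (E-star 0ᵥ r) (reflexive (≡.cong (λ z → E z (F.- r)) ⊟ᵥ-0))

  open SalieBound F 2≢0 Alg τ E-0 τ-+ τ-star using (u; γ; γ²; γ-star; ‖γ*‖²; η₋₁; η-neg; -1≢0) renaming (χ-cong to τ-cong)

  E-τ : ∀ x r → E x r ≈ E x F.0# * τ r
  E-τ x r = trans (reflexive (≡.cong₂ E (≡.trans (≡.sym (⊞-identity x)) (⊞-comm 0ᵥ x)) (≡.sym (F.+-identityˡ r)))) (E-+ x F.0# 0ᵥ r)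

  -- Elements without a component in the trivial representation of the second factor. On them γ is
  -- invertible, with square η(-1) q.
  Killed : Carrier → Set
  Killed f = u * f ≈ 0#

  killed-* : ∀ {f} x → Killed f → Killed (x * f)
  killed-* {f} x uf = trans (solve 3 (λ u x f → u :* (x :* f) := x :* (u :* f)) refl u x f) (trans (*-congˡ uf) (zeroʳ x))

  scale-bij : ∀ {c} → c ≢ F.0# → (g : F.Carrier → Carrier) → ∑ F.enum (λ z → g (c F.* z)) ≈ ∑ F.enum g
  scale-bij {c} c≢0 g = ∑-reindex F.enum F.enum (c F.*_) (c F.⁻¹ F.*_) (cancel (F.inverseˡ c≢0)) (cancel (F.inverseʳ c≢0)) g
    where
    cancel : ∀ {x y} → x F.* y ≡ F.1# → ∀ z → x F.* (y F.* z) ≡ z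
    cancel p z = ≡.trans (≡.sym (F.*-assoc _ _ _)) (≡.trans (≡.cong (F._* z) p) (F.*-identityˡ z))

  κ-^ : ∀ a n → κ a ^ n ≈ κ (a Q.^ n)
  κ-^ a zero    = sym κ-1
  κ-^ a (suc n) = trans (*-congˡ (κ-^ a n)) (sym (κ-* a (a Q.^ n)))

  γ²* : ∀ {f} → Killed f → γ * (γ * f) ≈ κ (η₋₁ ℚ.* qℚ) * f
  γ²* {f} uf = begin
    γ * (γ * f)                               ≈⟨ *-assoc _ _ _ ⟨
    γ * γ * f                                 ≈⟨ *-congʳ γ² ⟩
    κ η₋₁ * (κ qℚ - u) * f                    ≈⟨ solve 4 (λ e q u f → e :* (q :- u) :* f := e :* q :* f :- e :* (u :* f)) refl (κ η₋₁) (κ qℚ) u f ⟩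
    κ η₋₁ * κ qℚ * f - κ η₋₁ * (u * f)        ≈⟨ +-cong (*-congʳ (sym (κ-* η₋₁ qℚ))) (trans (-‿cong (trans (*-congˡ uf) (zeroʳ _))) -0#≈0#) ⟩
    κ (η₋₁ ℚ.* qℚ) * f + 0#                   ≈⟨ +-identityʳ _ ⟩
    κ (η₋₁ ℚ.* qℚ) * f                        ∎

  γ^γ^* : ∀ n {f} → Killed f → γ ^ n * (γ ^ n * f) ≈ κ ((η₋₁ ℚ.* qℚ) Q.^ n) * f
  γ^γ^* zero    {f} uf = trans (*-identityˡ _) (trans (*-identityˡ f) (sym (κ-1* f ≡.refl)))
  γ^γ^* (suc n) {f} uf = begin
    γ * γ ^ n * (γ * γ ^ n * f)               ≈⟨ solve 3 (λ g h f → g :* h :* (g :* h :* f) := g :* (g :* (h :* (h :* f)))) refl γ (γ ^ n) f ⟩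
    γ * (γ * (γ ^ n * (γ ^ n * f)))           ≈⟨ *-congˡ (*-congˡ (γ^γ^* n uf)) ⟩
    γ * (γ * (κ (e Q.^ n) * f))               ≈⟨ γ²* (killed-* _ uf) ⟩
    κ e * (κ (e Q.^ n) * f)                   ≈⟨ trans (sym (*-assoc _ _ _)) (*-congʳ (sym (κ-* e (e Q.^ n)))) ⟩
    κ (e Q.^ suc n) * f                       ∎
    where e = η₋₁ ℚ.* qℚ

  ‖γ^*‖² : ∀ n {f} → Killed f → ‖ γ ^ n * f ‖² ≡ qℚ Q.^ n ℚ.* ‖ f ‖²
  ‖γ^*‖² zero    {f} uf = ≡.trans (‖‖²-cong (*-identityˡ f)) (≡.sym (ℚP.*-identityˡ ‖ f ‖²))
  ‖γ^*‖² (suc n) {f} uf = ≡.trans (‖‖²-cong (*-assoc γ (γ ^ n) f)) (≡.trans (‖γ*‖² (killed-* (γ ^ n) uf)) (≡.trans (≡.cong (qℚ ℚ.*_) (‖γ^*‖² n uf)) (≡.sym (ℚP.*-assoc qℚ (qℚ Q.^ n) ‖ f ‖²))))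

  Γ : ∀ n → F.Carrier → Carrier
  Γ n c = ∑ (points n) (λ y → τ (c F.* ‖ y ‖))

  private
    gauss : ∀ {c} → c ≢ F.0# → ∑ F.enum (λ a → τ (c F.* (a F.* a))) ≈ u + κ (η c) * γ
    gauss {c} c≢0 = begin
      ∑ F.enum (λ a → τ (c F.* (a F.* a)))
        ≈⟨ ∑-fibres F.enum F.enum (λ a → a F.* a) (λ w → τ (c F.* w)) ⟩
      ∑ F.enum (λ w → κ (Q.∑ F.enum (λ a → ⟨ w F.≟ a F.* a ⟩)) * τ (c F.* w))
        ≈⟨ ∑-cong F.enum (λ w → trans (*-congʳ (trans (κ-cong (≡.trans (Q.∑-cong F.enum (λ a → ⟨⟩-cong (w F.≟ a F.* a) (a F.* a F.≟ w) ≡.sym ≡.sym)) (roots≡1+η w))) (trans (κ-+ 1ℚ (η w)) (+-congʳ κ-1))))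
             (trans (distribʳ _ _ _) (+-cong (*-identityˡ _) (trans (*-congʳ (trans (κ-cong (ηc w)) (κ-* _ _))) (*-assoc _ _ _))))) ⟩
      ∑ F.enum (λ w → τ (c F.* w) + κ (η c) * (κ (η (c F.* w)) * τ (c F.* w)))
        ≈⟨ trans (∑-∙ F.enum _ _) (+-cong (scale-bij c≢0 τ) (trans (sym (∑-*ˡ F.enum (κ (η c)) _)) (*-congˡ (scale-bij c≢0 (λ z → κ (η z) * τ z))))) ⟩
      u + κ (η c) * γ ∎
      where
      ηc : ∀ w → η w ≡ η c ℚ.* η (c F.* w)
      ηc w = ≡.sym (≡.trans (≡.cong (η c ℚ.*_) (η-* c w)) (≡.trans (≡.sym (ℚP.*-assoc (η c) (η c) (η w))) (≡.trans (≡.cong (ℚ._* η w) (η²≡1 c≢0)) (ℚP.*-identityˡ (η w)))))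

  -- `Γ n c` is a product over the coordinates of Gauss sums u + η(c) γ, and u drops out on f.
  Γ* : ∀ n {c f} → c ≢ F.0# → Killed f → Γ n c * f ≈ κ (η c Q.^ n) * (γ ^ n * f)
  Γ* zero {c} {f} c≢0 uf = trans (*-congʳ (trans (+-identityʳ _) (trans (τ-cong (F.zeroʳ c)) E-0))) (trans (*-identityˡ f) (sym (trans (κ-1* _ ≡.refl) (*-identityˡ f))))
  Γ* (suc n) {c} {f} c≢0 uf = begin
    Γ (suc n) c * f
      ≈⟨ *-congʳ (trans (∑-vec F.enum n _) (trans (∑-cong F.enum (λ a → ∑-cong (points n) (λ y → trans (τ-cong (F.distribˡ c (a F.* a) ‖ y ‖)) (τ-+ _ _)))) (sym (∑-*∑ F.enum (points n) _ _)))) ⟩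
    ∑ F.enum (λ a → τ (c F.* (a F.* a))) * Γ n c * f
      ≈⟨ trans (*-assoc _ _ _) (*-cong (gauss c≢0) (Γ* n c≢0 uf)) ⟩
    (u + κ (η c) * γ) * (κ (η c Q.^ n) * (γ ^ n * f))
      ≈⟨ solve 6 (λ u e g e′ h f → (u :+ e :* g) :* (e′ :* (h :* f)) := e′ :* h :* (u :* f) :+ e :* e′ :* (g :* h :* f)) refl u (κ (η c)) γ (κ (η c Q.^ n)) (γ ^ n) f ⟩
    κ (η c Q.^ n) * γ ^ n * (u * f) + κ (η c) * κ (η c Q.^ n) * (γ * γ ^ n * f)
      ≈⟨ +-cong (trans (*-congˡ uf) (zeroʳ _)) (*-congʳ (sym (κ-* _ _))) ⟩
    0# + κ (η c Q.^ suc n) * (γ ^ suc n * f)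
      ≈⟨ +-identityˡ _ ⟩
    κ (η c Q.^ suc n) * (γ ^ suc n * f) ∎

  p : F.Carrier → Carrier
  p c = ∑ (points d) (λ y → E y (c F.* ‖ y ‖))

  private
    p*p : ∀ c c′ → p c * p c′ ≈ ∑ (points d) (λ x → E x F.0# * ∑ (points d) (λ y → τ (c F.* ‖ y ‖ F.+ c′ F.* ‖ x ⊟ y ‖)))
    p*p c c′ = begin
      p c * p c′
        ≈⟨ ∑-*∑ (points d) (points d) _ _ ⟩
      ∑ (points d) (λ y → ∑ (points d) (λ z → E y (c F.* ‖ y ‖) * E z (c′ F.* ‖ z ‖)))
        ≈⟨ ∑-cong (points d) (λ y → ∑-cong (points d) (λ z → sym (E-+ _ _ _ _))) ⟩
      ∑ (points d) (λ y → ∑ (points d) (λ z → E (y ⊞ z) (c F.* ‖ y ‖ F.+ c′ F.* ‖ z ‖)))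
        ≈⟨ ∑-cong (points d) (λ y → sym (∑-reindex (points d) (points d) (λ x → x ⊟ y) (λ z → z ⊞ y) (λ x → ⊟⊞ x y) (λ z → ⊞⊟ z y) (λ z → E (y ⊞ z) (c F.* ‖ y ‖ F.+ c′ F.* ‖ z ‖)))) ⟩
      ∑ (points d) (λ y → ∑ (points d) (λ x → E (y ⊞ (x ⊟ y)) (c F.* ‖ y ‖ F.+ c′ F.* ‖ x ⊟ y ‖)))
        ≈⟨ ∑-swap (points d) (points d) _ ⟩
      ∑ (points d) (λ x → ∑ (points d) (λ y → E (y ⊞ (x ⊟ y)) (c F.* ‖ y ‖ F.+ c′ F.* ‖ x ⊟ y ‖)))
        ≈⟨ ∑-cong (points d) (λ x → trans (∑-cong (points d) (λ y → trans (reflexive (≡.cong (λ z → E z (c F.* ‖ y ‖ F.+ c′ F.* ‖ x ⊟ y ‖)) (≡.trans (⊞-comm y (x ⊟ y)) (⊟⊞ x y)))) (E-τ x _))) (sym (∑-*ˡ (points d) (E x F.0#) _))) ⟩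
      ∑ (points d) (λ x → E x F.0# * ∑ (points d) (λ y → τ (c F.* ‖ y ‖ F.+ c′ F.* ‖ x ⊟ y ‖))) ∎

  -- The square in y is completed at (c′/(c + c′)) x. What remains is m ‖x‖ and a Gauss sum
  -- independent of x; for nonzero c and c′ the formula for m reads 1/m = 1/c + 1/c′.
  p*p-nonzero : ∀ {c c′ m} → c F.+ c′ ≢ F.0# → m ≡ c F.* c′ F.* (c F.+ c′) F.⁻¹ → p c * p c′ ≈ p m * Γ d (c F.+ c′)
  p*p-nonzero {c} {c′} {m} s≢0 m≡ = begin
    p c * p c′
      ≈⟨ p*p c c′ ⟩
    ∑ (points d) (λ x → E x F.0# * ∑ (points d) (λ y → τ (c F.* ‖ y ‖ F.+ c′ F.* ‖ x ⊟ y ‖)))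
      ≈⟨ ∑-cong (points d) (λ x → trans (*-congˡ (inner x)) (trans (sym (*-assoc _ _ _)) (*-congʳ (sym (E-τ x (m F.* ‖ x ‖)))))) ⟩
    ∑ (points d) (λ x → E x (m F.* ‖ x ‖) * Γ d (c F.+ c′))
      ≈⟨ ∑-*ʳ (points d) (Γ d (c F.+ c′)) _ ⟨
    p m * Γ d (c F.+ c′) ∎
    where
    h = c′ F.* (c F.+ c′) F.⁻¹
    inner : ∀ x → ∑ (points d) (λ y → τ (c F.* ‖ y ‖ F.+ c′ F.* ‖ x ⊟ y ‖)) ≈ τ (m F.* ‖ x ‖) * Γ d (c F.+ c′)
    inner x = begin
      ∑ (points d) (λ y → τ (c F.* ‖ y ‖ F.+ c′ F.* ‖ x ⊟ y ‖))
        ≈⟨ ∑-reindex (points d) (points d) (_⊞ h *ᵥ x) (_⊟ h *ᵥ x) (λ y → ⊞⊟ y (h *ᵥ x)) (λ y → ⊟⊞ y (h *ᵥ x)) _ ⟨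
      ∑ (points d) (λ y → τ (c F.* ‖ y ⊞ h *ᵥ x ‖ F.+ c′ F.* ‖ x ⊟ (y ⊞ h *ᵥ x) ‖))
        ≈⟨ ∑-cong (points d) (λ y → trans (τ-cong (≡.trans (complete-square s≢0 ≡.refl m≡ x y) (F.+-comm _ _))) (τ-+ _ _)) ⟩
      ∑ (points d) (λ y → τ (m F.* ‖ x ‖) * τ ((c F.+ c′) F.* ‖ y ‖))
        ≈⟨ ∑-*ˡ (points d) (τ (m F.* ‖ x ‖)) _ ⟨
      τ (m F.* ‖ x ‖) * Γ d (c F.+ c′) ∎

  private
    W : ∀ n → F.Carrier → Point n → Carrier
    W n c x = ∑ (points n) (λ y → τ (c F.* ‖ y ‖ F.+ (F.- c) F.* ‖ x ⊟ y ‖))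

    W-step : ∀ n c a (x : Point n) → W (suc n) c (a ∷ x) ≈ ∑ F.enum (λ b → τ (c F.* (b F.* b) F.+ (F.- c) F.* ((a F.- b) F.* (a F.- b)))) * W n c x
    W-step n c a x = trans (∑-vec F.enum n _) (trans (∑-cong F.enum (λ b → ∑-cong (points n) (λ y → trans (τ-cong
      (F.solve 6 (λ c c′ u U v V → c F.:* (u F.:+ U) F.:+ c′ F.:* (v F.:+ V) F.:= (c F.:* u F.:+ c′ F.:* v) F.:+ (c F.:* U F.:+ c′ F.:* V)) ≡.refl c (F.- c) (b F.* b) (‖ y ‖) ((a F.- b) F.* (a F.- b)) (‖ x ⊟ y ‖))) (τ-+ _ _))))
      (sym (∑-*∑ F.enum (points n) _ _)))

    W-0 : ∀ n c → W n c 0ᵥ ≈ κ (qℚ Q.^ n)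
    W-0 zero c = trans (+-identityʳ _) (trans (τ-cong (F.solve 1 (λ c → c F.:* F.:# 0 F.:+ (F.:- c) F.:* F.:# 0 F.:= F.:# 0) ≡.refl c)) (trans E-0 (sym κ-1)))
    W-0 (suc n) c = trans (W-step n c F.0# 0ᵥ) (trans (*-cong (trans (∑-cong F.enum (λ b → trans (τ-cong
      (F.solve 2 (λ c b → c F.:* (b F.:* b) F.:+ (F.:- c) F.:* ((F.:# 0 F.:- b) F.:* (F.:# 0 F.:- b)) F.:= F.:# 0) ≡.refl c b)) E-0)) (trans (∑-const-κ F.enum 1#) (*-identityʳ _))) (W-0 n c)) (sym (κ-* qℚ (qℚ Q.^ n))))

    -- c b² - c (a - b)² = - c a² + 2 c a b is linear in b. A coordinate a ≠ 0 of x therefore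
    -- contributes a full sum of translations, that is, a multiple of u.
    W-≢0 : ∀ n {c f} (x : Point n) → c ≢ F.0# → x ≢ 0ᵥ → Killed f → W n c x * f ≈ 0#
    W-≢0 zero [] c≢0 x≢0 uf = contradiction ≡.refl x≢0
    W-≢0 (suc n) {c} {f} (a ∷ x) c≢0 x≢0 uf = trans (*-congʳ (W-step n c a x)) (go (a F.≟ F.0#))
      where
      go : Dec (a ≡ F.0#) → ∑ F.enum (λ b → τ (c F.* (b F.* b) F.+ (F.- c) F.* ((a F.- b) F.* (a F.- b)))) * W n c x * f ≈ 0#
      go (yes a≡0) = trans (*-assoc _ _ _) (trans (*-congˡ (W-≢0 n x c≢0 (λ x≡0 → x≢0 (≡.cong₂ _∷_ a≡0 x≡0)) uf)) (zeroʳ _))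
      go (no a≢0) = trans (*-congʳ (*-congʳ (trans (∑-cong F.enum (λ b → trans (τ-cong
          (F.solve 3 (λ c a b → c F.:* (b F.:* b) F.:+ (F.:- c) F.:* ((a F.:- b) F.:* (a F.:- b)) F.:= (F.:- (c F.:* (a F.:* a))) F.:+ (c F.:* (a F.:+ a)) F.:* b) ≡.refl c a b)) (τ-+ _ _)))
          (trans (sym (∑-*ˡ F.enum _ _)) (*-congˡ (scale-bij (F.*-nonzero c≢0 (λ q → a≢0 (2*-zero q))) τ))))))
        (trans (solve 4 (λ t u w f → t :* u :* w :* f := t :* w :* (u :* f)) refl (τ (F.- (c F.* (a F.* a)))) u (W n c x) f) (trans (*-congˡ uf) (zeroʳ _)))

  -- Completing the square degenerates for c + c′ = 0: the exponent is linear in y, so only x = 0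
  -- survives, with q^d equal terms.
  p*p-zero : ∀ {c f} → c ≢ F.0# → Killed f → p c * (p (F.- c) * f) ≈ κ (qℚ Q.^ d) * f
  p*p-zero {c} {f} c≢0 uf = begin
    p c * (p (F.- c) * f)                                      ≈⟨ *-assoc _ _ _ ⟨
    p c * p (F.- c) * f                                        ≈⟨ *-congʳ (p*p c (F.- c)) ⟩
    ∑ (points d) (λ x → E x F.0# * W d c x) * f                ≈⟨ trans (∑-*ʳ (points d) f _) (∑-cong (points d) (λ x → *-assoc _ _ _)) ⟩
    ∑ (points d) (λ x → E x F.0# * (W d c x * f))              ≈⟨ ∑-only (points d) 0ᵥ _ (λ x x≢0 → trans (*-congˡ (W-≢0 d x c≢0 x≢0 uf)) (zeroʳ _)) ⟩
    E 0ᵥ F.0# * (W d c 0ᵥ * f)                                 ≈⟨ trans (*-congʳ E-0) (*-identityˡ _) ⟩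
    W d c 0ᵥ * f                                               ≈⟨ *-congʳ (W-0 d c) ⟩
    κ (qℚ Q.^ d) * f                                           ∎

  p-star : ∀ c → star (p c) ≈ p (F.- c)
  p-star c = trans (star-∑ (points d) _) (trans (∑-cong (points d) (λ y → trans (E-star y _) (reflexive (≡.cong (E (⊟ᵥ y))
      (≡.trans (F.solve 2 (λ c n → F.:- (c F.:* n) F.:= (F.:- c) F.:* n) ≡.refl c ‖ y ‖) (≡.cong ((F.- c) F.*_) (≡.sym (‖⊟ᵥ‖ y))))))))
    (∑-reindex (points d) (points d) ⊟ᵥ_ ⊟ᵥ_ ⊟ᵥ-involutive ⊟ᵥ-involutive (λ y → E y ((F.- c) F.* ‖ y ‖))))

  -- normalises γ² = η(-1) q on the elements annihilated by u
  s : ℚ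
  s = η₋₁ ℚ.* ℚ.1/ qℚ

  s*ηq : s ℚ.* (η₋₁ ℚ.* qℚ) ≡ 1ℚ
  s*ηq = ≡.trans (Q.solve 3 (λ e v q → e Q.:* v Q.:* (e Q.:* q) Q.:= (e Q.:* e) Q.:* (v Q.:* q)) ≡.refl η₋₁ (ℚ.1/ qℚ) qℚ)
    (≡.cong₂ ℚ._*_ (η²≡1 -1≢0) (ℚP.*-inverseˡ qℚ))

  coef : F.Carrier → ℚ
  coef α = (s ℚ.* η α) Q.^ d

  gᵈ : ∀ α → Dec (α ≡ F.0#) → Carrier
  gᵈ α (yes _) = 1#
  gᵈ α (no _)  = κ (coef α) * (γ ^ d * p (α F.⁻¹))

  -- Kernels are indexed by α = 1/c because their products add these parameters. `coef` removes the
  -- powers of the Gauss sum, and α = 0 stands for the identity, which is what c + c′ = 0 leaves.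
  g : F.Carrier → Carrier
  g α = gᵈ α (α F.≟ F.0#)

  g-0 : g F.0# ≈ 1#
  g-0 = go (F.0# F.≟ F.0#)
    where
    go : (δ : Dec (F.0# ≡ F.0#)) → gᵈ F.0# δ ≈ 1#
    go (yes _) = refl
    go (no n)  = contradiction ≡.refl n

  g-≢0 : ∀ {α} → α ≢ F.0# → g α ≈ κ (coef α) * (γ ^ d * p (α F.⁻¹))
  g-≢0 {α} α≢0 = go (α F.≟ F.0#)
    where
    go : (δ : Dec (α ≡ F.0#)) → gᵈ α δ ≈ κ (coef α) * (γ ^ d * p (α F.⁻¹))
    go (yes e) = contradiction e α≢0
    go (no _)  = refl

  private
    ^-1 : ∀ {x} n → x ≡ 1ℚ → x Q.^ n ≡ 1ℚ
    ^-1 n ≡.refl = Q.1^ n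

    ^-merge : ∀ {x y z} n → x ℚ.* y ≡ z → x Q.^ n ℚ.* y Q.^ n ≡ z Q.^ n
    ^-merge {x} {y} n ≡.refl = ≡.sym (Q.^-*-dist x y n)

  -- Undoes the normalisation: γ^d applied twice is the scalar (η(-1) q)^d on elements annihilated
  -- by u, and `coef` cancels it.
  p≈g : ∀ {c f} → c ≢ F.0# → Killed f → p c * f ≈ κ (η c Q.^ d) * (γ ^ d * (g (c F.⁻¹) * f))
  p≈g {c} {f} c≢0 uf = sym (begin
    κ (η c Q.^ d) * (γ ^ d * (g (c F.⁻¹) * f))
      ≈⟨ *-congˡ (*-congˡ (*-congʳ (trans (g-≢0 (F.⁻¹-nonzero c≢0)) (*-congˡ (*-congˡ (reflexive (≡.cong p (F.⁻¹-involutive c≢0)))))))) ⟩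
    κ (η c Q.^ d) * (γ ^ d * (κ (coef (c F.⁻¹)) * (γ ^ d * p c) * f))
      ≈⟨ solve 5 (λ a h b P f → a :* (h :* (b :* (h :* P) :* f)) := a :* b :* (h :* (h :* (P :* f)))) refl (κ (η c Q.^ d)) (γ ^ d) (κ (coef (c F.⁻¹))) (p c) f ⟩
    κ (η c Q.^ d) * κ (coef (c F.⁻¹)) * (γ ^ d * (γ ^ d * (p c * f)))
      ≈⟨ *-cong (sym (κ-* _ _)) (γ^γ^* d (killed-* (p c) uf)) ⟩
    κ (η c Q.^ d ℚ.* coef (c F.⁻¹)) * (κ ((η₋₁ ℚ.* qℚ) Q.^ d) * (p c * f))
      ≈⟨ trans (sym (*-assoc _ _ _)) (*-congʳ (sym (κ-* _ _))) ⟩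
    κ (η c Q.^ d ℚ.* coef (c F.⁻¹) ℚ.* (η₋₁ ℚ.* qℚ) Q.^ d) * (p c * f)
      ≈⟨ κ-1* (p c * f) (≡.trans (≡.cong (ℚ._* (η₋₁ ℚ.* qℚ) Q.^ d) (^-merge d ≡.refl)) (≡.trans (^-merge d ≡.refl) (^-1 d scalar))) ⟩
    p c * f ∎)
    where
    scalar : η c ℚ.* (s ℚ.* η (c F.⁻¹)) ℚ.* (η₋₁ ℚ.* qℚ) ≡ 1ℚ
    scalar = ≡.trans (≡.cong (λ z → η c ℚ.* (s ℚ.* z) ℚ.* (η₋₁ ℚ.* qℚ)) (η-⁻¹ c≢0)) (≡.trans (Q.solve 3 (λ e s r → e Q.:* (s Q.:* e) Q.:* r Q.:= (e Q.:* e) Q.:* (s Q.:* r)) ≡.refl (η c) s (η₋₁ ℚ.* qℚ)) (≡.cong₂ ℚ._*_ (η²≡1 c≢0) s*ηq))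

  -- For c = 1/α and c′ = 1/β the product has the parameter cc′/(c + c′) = 1/(α + β), and the
  -- scalars match by η(1/α + 1/β) = η(α + β) η(α) η(β). For β = - α the two kernels are inverse to
  -- each other up to q^d.
  g-+ : ∀ α β {f} → Killed f → g α * (g β * f) ≈ g (α F.+ β) * f
  g-+ α β {f} uf = go (α F.≟ F.0#) (β F.≟ F.0#) (α F.+ β F.≟ F.0#)
    where
    e = η₋₁ ℚ.* qℚ
    product : α ≢ F.0# → β ≢ F.0# → g α * (g β * f) ≈ κ (coef α ℚ.* coef β) * (γ ^ d * (γ ^ d * (p (α F.⁻¹) * (p (β F.⁻¹) * f))))
    product α≢0 β≢0 = trans (*-cong (g-≢0 α≢0) (*-congʳ (g-≢0 β≢0)))
      (trans (solve 6 (λ a h P b P′ f → a :* (h :* P) :* (b :* (h :* P′) :* f) := a :* b :* (h :* (h :* (P :* (P′ :* f))))) refl (κ (coef α)) (γ ^ d) (p (α F.⁻¹)) (κ (coef β)) (p (β F.⁻¹)) f)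
        (*-congʳ (sym (κ-* _ _))))
    go : Dec (α ≡ F.0#) → Dec (β ≡ F.0#) → Dec (α F.+ β ≡ F.0#) → g α * (g β * f) ≈ g (α F.+ β) * f
    go (yes ≡.refl) _ _ = trans (*-congʳ g-0) (trans (*-identityˡ _) (*-congʳ (reflexive (≡.cong g (≡.sym (F.+-identityˡ β))))))
    go (no _) (yes ≡.refl) _ = *-cong (reflexive (≡.cong g (≡.sym (F.+-identityʳ α)))) (trans (*-congʳ g-0) (*-identityˡ f))
    go (no α≢0) (no β≢0) (yes s≡0) = begin
      g α * (g β * f)
        ≈⟨ product α≢0 β≢0 ⟩
      κ (coef α ℚ.* coef β) * (γ ^ d * (γ ^ d * (p (α F.⁻¹) * (p (β F.⁻¹) * f))))
        ≈⟨ *-congˡ (trans (γ^γ^* d (killed-* _ (killed-* _ uf))) (*-congˡ (trans (*-congˡ (*-congʳ (reflexive (≡.cong p β⁻¹)))) (p*p-zero (F.⁻¹-nonzero α≢0) uf)))) ⟩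
      κ (coef α ℚ.* coef β) * (κ (e Q.^ d) * (κ (qℚ Q.^ d) * f))
        ≈⟨ trans (sym (*-assoc _ _ _)) (trans (*-congʳ (sym (κ-* _ _))) (trans (sym (*-assoc _ _ _)) (*-congʳ (sym (κ-* _ _))))) ⟩
      κ (coef α ℚ.* coef β ℚ.* e Q.^ d ℚ.* qℚ Q.^ d) * f
        ≈⟨ *-congʳ (κ-cong (≡.trans (≡.cong (ℚ._* qℚ Q.^ d) (≡.trans (≡.cong (ℚ._* e Q.^ d) (^-merge d ≡.refl)) (^-merge d ≡.refl))) (≡.trans (^-merge d ≡.refl) (^-1 d scalar)))) ⟩
      κ 1ℚ * f
        ≈⟨ trans (*-congʳ κ-1) (*-congʳ (trans (sym g-0) (reflexive (≡.cong g (≡.sym s≡0))))) ⟩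
      g (α F.+ β) * f ∎
      where
      β≡ : β ≡ F.- α
      β≡ = ≡.trans (F.solve 2 (λ a b → b F.:= (a F.:+ b) F.:- a) ≡.refl α β) (≡.trans (≡.cong (F._- α) s≡0) (F.+-identityˡ _))
      β⁻¹ : β F.⁻¹ ≡ F.- α F.⁻¹
      β⁻¹ = ≡.trans (≡.cong F._⁻¹ β≡) (F.⁻¹-neg α≢0)
      scalar : s ℚ.* η α ℚ.* (s ℚ.* η β) ℚ.* e ℚ.* qℚ ≡ 1ℚ
      scalar = ≡.trans (≡.cong (λ z → s ℚ.* η α ℚ.* (s ℚ.* z) ℚ.* e ℚ.* qℚ) (≡.trans (≡.cong η β≡) (η-neg α)))
        (≡.trans (Q.solve 4 (λ s a m q → s Q.:* a Q.:* (s Q.:* (m Q.:* a)) Q.:* (m Q.:* q) Q.:* q Q.:= (a Q.:* a) Q.:* ((s Q.:* (m Q.:* q)) Q.:* (s Q.:* (m Q.:* q)))) ≡.refl s (η α) η₋₁ qℚ)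
          (≡.cong₂ (λ x y → x ℚ.* (y ℚ.* y)) (η²≡1 α≢0) s*ηq))
    go (no α≢0) (no β≢0) (no s≢0) = begin
      g α * (g β * f)
        ≈⟨ product α≢0 β≢0 ⟩
      κ (coef α ℚ.* coef β) * (γ ^ d * (γ ^ d * (p (α F.⁻¹) * (p (β F.⁻¹) * f))))
        ≈⟨ *-congˡ (trans (γ^γ^* d (killed-* _ (killed-* _ uf))) (*-congˡ (trans (sym (*-assoc _ _ _)) (trans (*-congʳ (p*p-nonzero c≢0 m≡)) (trans (*-assoc _ _ _) (*-congˡ (Γ* d c≢0 uf))))))) ⟩
      κ (coef α ℚ.* coef β) * (κ (e Q.^ d) * (P * (κ (η c Q.^ d) * (γ ^ d * f))))
        ≈⟨ solve 6 (λ a b P r h f → a :* (b :* (P :* (r :* (h :* f)))) := (a :* b :* r) :* (h :* P) :* f) refl (κ (coef α ℚ.* coef β)) (κ (e Q.^ d)) P (κ (η c Q.^ d)) (γ ^ d) f ⟩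
      κ (coef α ℚ.* coef β) * κ (e Q.^ d) * κ (η c Q.^ d) * (γ ^ d * P) * f
        ≈⟨ *-congʳ (*-congʳ (trans (*-congʳ (sym (κ-* _ _))) (trans (sym (κ-* _ _)) (κ-cong (≡.trans (≡.cong (ℚ._* η c Q.^ d) (≡.trans (≡.cong (ℚ._* e Q.^ d) (^-merge d ≡.refl)) (^-merge d ≡.refl))) (^-merge d scalar)))))) ⟩
      κ (coef (α F.+ β)) * (γ ^ d * P) * f
        ≈⟨ *-congʳ (sym (g-≢0 s≢0)) ⟩
      g (α F.+ β) * f ∎
      where
      c = α F.⁻¹ F.+ β F.⁻¹
      P = p ((α F.+ β) F.⁻¹)
      c≡ : c ≡ (α F.+ β) F.* (α F.⁻¹ F.* β F.⁻¹)
      c≡ = ≡.sym (≡.trans (F.solve 4 (λ a b u v → (a F.:+ b) F.:* (u F.:* v) F.:= (a F.:* u) F.:* v F.:+ (b F.:* v) F.:* u) ≡.refl α β (α F.⁻¹) (β F.⁻¹))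
        (≡.trans (≡.cong₂ (λ x y → x F.* β F.⁻¹ F.+ y F.* α F.⁻¹) (F.inverseʳ α≢0) (F.inverseʳ β≢0)) (≡.trans (≡.cong₂ F._+_ (F.*-identityˡ _) (F.*-identityˡ _)) (F.+-comm _ _))))
      uv≢0 : α F.⁻¹ F.* β F.⁻¹ ≢ F.0#
      uv≢0 = F.*-nonzero (F.⁻¹-nonzero α≢0) (F.⁻¹-nonzero β≢0)
      c≢0 : c ≢ F.0#
      c≢0 q = F.*-nonzero s≢0 uv≢0 (≡.trans (≡.sym c≡) q)
      m≡ : (α F.+ β) F.⁻¹ ≡ α F.⁻¹ F.* β F.⁻¹ F.* c F.⁻¹
      m≡ = ≡.sym (F.⁻¹-unique (≡.trans (≡.sym (F.*-assoc _ _ _)) (≡.trans (≡.cong (F._* c F.⁻¹) (≡.sym c≡)) (F.inverseʳ c≢0))))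
      ηc : η c ≡ η (α F.+ β) ℚ.* (η α ℚ.* η β)
      ηc = ≡.trans (≡.cong η c≡) (≡.trans (η-* (α F.+ β) _) (≡.cong (η (α F.+ β) ℚ.*_) (≡.trans (η-* (α F.⁻¹) (β F.⁻¹)) (≡.cong₂ ℚ._*_ (η-⁻¹ α≢0) (η-⁻¹ β≢0)))))
      scalar : s ℚ.* η α ℚ.* (s ℚ.* η β) ℚ.* e ℚ.* η c ≡ s ℚ.* η (α F.+ β)
      scalar = ≡.trans (≡.cong (s ℚ.* η α ℚ.* (s ℚ.* η β) ℚ.* e ℚ.*_) ηc)
        (≡.trans (Q.solve 5 (λ s a b e t → s Q.:* a Q.:* (s Q.:* b) Q.:* e Q.:* (t Q.:* (a Q.:* b)) Q.:= (s Q.:* e) Q.:* ((a Q.:* a) Q.:* (b Q.:* b)) Q.:* (s Q.:* t)) ≡.refl s (η α) (η β) e (η (α F.+ β)))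
          (≡.trans (≡.cong (ℚ._* (s ℚ.* η (α F.+ β))) (≡.cong₂ ℚ._*_ s*ηq (≡.cong₂ ℚ._*_ (η²≡1 α≢0) (η²≡1 β≢0)))) (ℚP.*-identityˡ _)))

  star-^ : ∀ x n → star (x ^ n) ≈ star x ^ n
  star-^ x zero    = trans (star-cong (sym κ-1)) (trans (star-κ 1ℚ) κ-1)
  star-^ x (suc n) = trans (star-* x (x ^ n)) (*-congˡ (star-^ x n))

  g-star : ∀ α → star (g α) ≈ g (F.- α)
  g-star α = go (α F.≟ F.0#)
    where
    go : Dec (α ≡ F.0#) → star (g α) ≈ g (F.- α)
    go (yes ≡.refl) = trans (star-cong g-0) (trans (star-^ 1# 0) (trans (sym g-0) (reflexive (≡.cong g (≡.sym F.-0#≈0#)))))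
    go (no α≢0) = begin
      star (g α)                                                     ≈⟨ star-cong (g-≢0 α≢0) ⟩
      star (κ (coef α) * (γ ^ d * p (α F.⁻¹)))                       ≈⟨ trans (star-* _ _) (*-cong (star-κ _) (trans (star-* _ _) (*-cong (trans (star-^ γ d) (trans (^-congˡ d γ-star) (trans (^-distrib-* (κ η₋₁) γ d) (*-congʳ (κ-^ η₋₁ d))))) (p-star (α F.⁻¹))))) ⟩
      κ (coef α) * (κ (η₋₁ Q.^ d) * γ ^ d * p (F.- α F.⁻¹))          ≈⟨ solve 4 (λ a b h P → a :* (b :* h :* P) := a :* b :* (h :* P)) refl (κ (coef α)) (κ (η₋₁ Q.^ d)) (γ ^ d) (p (F.- α F.⁻¹)) ⟩
      κ (coef α) * κ (η₋₁ Q.^ d) * (γ ^ d * p (F.- α F.⁻¹))          ≈⟨ *-cong (trans (sym (κ-* _ _)) (κ-cong (^-merge d (≡.trans (Q.solve 3 (λ s a m → s Q.:* a Q.:* m Q.:= s Q.:* (m Q.:* a)) ≡.refl s (η α) η₋₁) (≡.cong (s ℚ.*_) (≡.sym (η-neg α)))))))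
                                                                          (*-congˡ (reflexive (≡.cong p (≡.sym (F.⁻¹-neg α≢0))))) ⟩
      κ (coef (F.- α)) * (γ ^ d * p ((F.- α) F.⁻¹))                  ≈⟨ g-≢0 (F.neg-nonzero α≢0) ⟨
      g (F.- α)                                                      ∎

  module Decompose (t : F.Carrier) (t≢0 : t ≢ F.0#) where

    -- Up to the factor q, the projection onto the part on which g α acts as τ (- t a α). The
    -- translations τ take the place of complex roots of unity, so the eigenvalues are themselves
    -- group elements.
    X : F.Carrier → Carrier
    X a = ∑ F.enum (λ w → g w * τ (t F.* a F.* w))

    g*X : ∀ α a {f} → Killed f → g α * (X a * f) ≈ τ (F.- (t F.* a F.* α)) * (X a * f)
    g*X α a {f} uf = begin
      g α * (X a * f)
        ≈⟨ *-congˡ (trans (∑-*ʳ F.enum f _) (∑-cong F.enum (λ w → trans (*-assoc _ _ _) refl))) ⟩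
      g α * ∑ F.enum (λ w → g w * (τ (t F.* a F.* w) * f))
        ≈⟨ trans (∑-*ˡ F.enum (g α) _) (∑-cong F.enum (λ w → g-+ α w (killed-* _ uf))) ⟩
      ∑ F.enum (λ w → g (α F.+ w) * (τ (t F.* a F.* w) * f))
        ≈⟨ ∑-cong F.enum (λ w → trans (*-congˡ (*-congʳ (trans (τ-cong (F.solve 3 (λ b α w → b F.:* w F.:= (F.:- (b F.:* α)) F.:+ b F.:* (α F.:+ w)) ≡.refl (t F.* a) α w)) (τ-+ _ _))))
             (solve 4 (λ g x y f → g :* (x :* y :* f) := x :* (g :* y :* f)) refl (g (α F.+ w)) (τ (F.- (t F.* a F.* α))) (τ (t F.* a F.* (α F.+ w))) f)) ⟩
      ∑ F.enum (λ w → τ (F.- (t F.* a F.* α)) * (g (α F.+ w) * τ (t F.* a F.* (α F.+ w)) * f))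
        ≈⟨ ∑-*ˡ F.enum _ _ ⟨
      τ (F.- (t F.* a F.* α)) * ∑ F.enum (λ w → g (α F.+ w) * τ (t F.* a F.* (α F.+ w)) * f)
        ≈⟨ *-congˡ (trans (∑-reindex F.enum F.enum (α F.+_) (λ w → w F.- α) (λ w → F.solve 2 (λ a w → (a F.:+ w) F.:- a F.:= w) ≡.refl α w) (λ w → F.solve 2 (λ a w → a F.:+ (w F.:- a) F.:= w) ≡.refl α w)
             (λ w → g w * τ (t F.* a F.* w) * f)) (sym (∑-*ʳ F.enum f _))) ⟩
      τ (F.- (t F.* a F.* α)) * (X a * f) ∎

    X*X : ∀ a {f} → Killed f → X a * (X a * f) ≈ κ qℚ * (X a * f)
    X*X a {f} uf = begin
      X a * (X a * f)
        ≈⟨ trans (∑-*ʳ F.enum (X a * f) _) (∑-cong F.enum (λ w → trans (solve 3 (λ g t x → g :* t :* x := t :* (g :* x)) refl (g w) (τ (t F.* a F.* w)) (X a * f)) (*-congˡ (g*X w a uf)))) ⟩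
      ∑ F.enum (λ w → τ (t F.* a F.* w) * (τ (F.- (t F.* a F.* w)) * (X a * f)))
        ≈⟨ ∑-cong F.enum (λ w → trans (sym (*-assoc _ _ _)) (trans (*-congʳ (trans (sym (τ-+ _ _)) (trans (τ-cong (F.-‿inverseʳ _)) E-0))) (*-identityˡ _))) ⟩
      ∑ F.enum (λ w → X a * f)
        ≈⟨ ∑-const-κ F.enum (X a * f) ⟩
      κ qℚ * (X a * f) ∎

    X-star : ∀ a → star (X a) ≈ X a
    X-star a = trans (star-∑ F.enum _) (trans (∑-cong F.enum (λ w → trans (star-* _ _) (*-cong (g-star w) (trans (τ-star _) (τ-cong (F.solve 2 (λ b w → F.:- (b F.:* w) F.:= b F.:* (F.:- w)) ≡.refl (t F.* a) w))))))
      (∑-reindex F.enum F.enum (λ w → F.- w) (λ w → F.- w) F.-‿involutive F.-‿involutive (λ w → g w * τ (t F.* a F.* w))))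

    -- Summing over a first produces a multiple of u for every w ≠ 0, which annihilates f; w = 0
    -- contributes q.
    ∑X : ∀ {f} → Killed f → ∑ F.enum (λ a → X a * f) ≈ κ qℚ * f
    ∑X {f} uf = begin
      ∑ F.enum (λ a → X a * f)
        ≈⟨ ∑-cong F.enum (λ a → trans (∑-*ʳ F.enum f _) (∑-cong F.enum (λ w → trans (*-assoc _ _ _) (*-congˡ (*-congʳ (τ-cong (F.solve 3 (λ t a w → t F.:* a F.:* w F.:= t F.:* w F.:* a) ≡.refl t a w))))))) ⟩
      ∑ F.enum (λ a → ∑ F.enum (λ w → g w * (τ (t F.* w F.* a) * f)))
        ≈⟨ trans (∑-swap F.enum F.enum _) (∑-cong F.enum (λ w → trans (sym (∑-*ˡ F.enum (g w) _)) (*-congˡ (sym (∑-*ʳ F.enum f _))))) ⟩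
      ∑ F.enum (λ w → g w * (∑ F.enum (λ a → τ (t F.* w F.* a)) * f))
        ≈⟨ ∑-only F.enum F.0# _ (λ w w≢0 → trans (*-congˡ (trans (*-congʳ (scale-bij (F.*-nonzero t≢0 w≢0) τ)) uf)) (zeroʳ _)) ⟩
      g F.0# * (∑ F.enum (λ a → τ (t F.* F.0# F.* a)) * f)
        ≈⟨ trans (*-congʳ g-0) (trans (*-identityˡ _) (*-congʳ (trans (∑-cong F.enum (λ a → trans (τ-cong (≡.trans (≡.cong (F._* a) (F.zeroʳ t)) (F.zeroˡ a))) E-0)) (trans (∑-const-κ F.enum 1#) (*-identityʳ _))))) ⟩
      κ qℚ * f ∎

    -- X a is self-adjoint and its square is q X a, so ‖X a f‖² = q ⟪ X a f , f ⟫; then `∑X` adds up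
    -- the right-hand sides.
    parseval : ∀ {f} → Killed f → Q.∑ F.enum (λ a → ‖ X a * f ‖²) ≡ qℚ ℚ.* qℚ ℚ.* ‖ f ‖²
    parseval {f} uf = ≡.trans (Q.∑-cong F.enum (λ a → ≡.trans (adjoint (X a) f (X a * f)) (≡.trans (⟪⟫-cong refl (trans (*-congʳ (X-star a)) (X*X a uf))) (≡.trans (⟪⟫-κʳ qℚ f (X a * f)) (≡.cong (qℚ ℚ.*_) (⟪⟫-sym f (X a * f)))))))
      (≡.trans (≡.sym (Q.∑-*ˡ F.enum qℚ _)) (≡.trans (≡.cong (qℚ ℚ.*_) (≡.trans (≡.sym (⟪∑⟫ F.enum _ f)) (≡.trans (⟪⟫-cong (∑X uf) refl) (⟪⟫-κ qℚ f f)))) (≡.sym (ℚP.*-assoc qℚ qℚ ‖ f ‖²))))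

    χ : F.Carrier → Carrier
    χ z = τ (F.- (t F.* z))

    χ-0 : χ F.0# ≈ 1#
    χ-0 = trans (τ-cong (≡.trans (≡.cong (λ z → F.- z) (F.zeroʳ t)) F.-0#≈0#)) E-0

    χ-+ : ∀ x y → χ (x F.+ y) ≈ χ x * χ y
    χ-+ x y = trans (τ-cong (F.solve 3 (λ t x y → F.:- (t F.:* (x F.:+ y)) F.:= (F.:- (t F.:* x)) F.:+ (F.:- (t F.:* y))) ≡.refl t x y)) (τ-+ _ _)

    χ-star : ∀ x → star (χ x) ≈ χ (F.- x)
    χ-star x = trans (τ-star _) (τ-cong (F.solve 2 (λ t x → F.:- (F.:- (t F.:* x)) F.:= F.:- (t F.:* (F.:- x))) ≡.refl t x))

    ∑χ : ∑ F.enum χ ≈ u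
    ∑χ = trans (∑-cong F.enum (λ z → τ-cong (F.solve 2 (λ t z → F.:- (t F.:* z) F.:= (F.:- t) F.:* z) ≡.refl t z))) (scale-bij (F.neg-nonzero t≢0) τ)

    Kd : F.Carrier → Carrier
    Kd a = ∑ F.enum (λ c → κ (⟨ ¬? (c F.≟ F.0#) ⟩ ℚ.* η c Q.^ d) * χ (c F.+ a F.* c F.⁻¹))

    private
      η^-even : ∀ n {c} → c ≢ F.0# → η c Q.^ (n ℕ.+ n) ≡ 1ℚ
      η^-even n {c} c≢0 = ≡.trans (Q.^-+ (η c) n n) (≡.trans (^-merge n ≡.refl) (^-1 n (η²≡1 c≢0)))

    Kd-bound : ∀ a {f} → Killed f → ‖ Kd a * f ‖² ℚ.≤ toℚ 6 ℚ.* qℚ ℚ.* ‖ f ‖²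
    Kd-bound a {f} uf = go (parity d)
      where
      uf′ : ∑ F.enum χ * f ≈ 0#
      uf′ = trans (*-congʳ ∑χ) uf
      parity : ∀ d → (∃ λ n → d ≡ n ℕ.+ n) ⊎ (∃ λ n → d ≡ suc (n ℕ.+ n))
      parity zero = inj₁ (0 , ≡.refl)
      parity (suc d) with parity d
      ... | inj₁ (n , p) = inj₂ (n , ≡.cong suc p)
      ... | inj₂ (n , p) = inj₁ (suc n , ≡.trans (≡.cong suc p) (≡.cong suc (≡.sym (ℕP.+-suc n n))))
      go : (∃ λ n → d ≡ n ℕ.+ n) ⊎ (∃ λ n → d ≡ suc (n ℕ.+ n)) → ‖ Kd a * f ‖² ℚ.≤ toℚ 6 ℚ.* qℚ ℚ.* ‖ f ‖²
      go (inj₁ (n , d≡)) = ℚP.≤-trans (ℚP.≤-reflexive (‖‖²-cong (*-congʳ (∑-cong F.enum (λ c → *-congʳ (κ-cong (even c (c F.≟ F.0#))))))))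
          (KloostermanBound.kloosterman-bound F k q≡ 3≤q Alg χ χ-0 χ-+ χ-star a uf′)
        where
        even : ∀ c (δ : Dec (c ≡ F.0#)) → ⟨ ¬? δ ⟩ ℚ.* η c Q.^ d ≡ ⟨ ¬? δ ⟩
        even c (yes _) = ℚP.*-zeroˡ (η c Q.^ d)
        even c (no c≢0) = ≡.trans (ℚP.*-identityˡ (η c Q.^ d)) (≡.trans (≡.cong (η c Q.^_) d≡) (η^-even n c≢0))
      go (inj₂ (n , d≡)) = ℚP.≤-trans (ℚP.≤-reflexive (‖‖²-cong (*-congʳ (∑-cong F.enum (λ c → *-congʳ (κ-cong (odd c (c F.≟ F.0#))))))))
          (SalieBound.salie-bound F 2≢0 Alg χ χ-0 χ-+ χ-star a uf′)
        where
        odd : ∀ c (δ : Dec (c ≡ F.0#)) → ⟨ ¬? δ ⟩ ℚ.* η c Q.^ d ≡ η c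
        odd c (yes c≡0) = ≡.trans (ℚP.*-zeroˡ (η c Q.^ d)) (≡.sym (≡.trans (≡.cong η c≡0) η-0))
        odd c (no c≢0) = ≡.trans (ℚP.*-identityˡ (η c Q.^ d)) (≡.trans (≡.cong (η c Q.^_) d≡) (≡.trans (≡.cong (η c ℚ.*_) (η^-even n c≢0)) (ℚP.*-identityʳ (η c))))

    K₀ : Carrier
    K₀ = ∑ F.enum (λ c → κ ⟨ ¬? (c F.≟ F.0#) ⟩ * (p c * τ (F.- (c F.* t))))

    -- On X a the kernel p c acts as η(c)^d γ^d τ(- t a/c). Together with the twist τ(- c t) this is
    -- χ (c + a/c), which is why t appears in the definition of `X`.
    K₀*X : ∀ a {f} → Killed f → K₀ * (X a * f) ≈ γ ^ d * (Kd a * (X a * f))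
    K₀*X a {f} uf = begin
      K₀ * (X a * f)
        ≈⟨ ∑-*ʳ F.enum (X a * f) _ ⟩
      ∑ F.enum (λ c → κ ⟨ ¬? (c F.≟ F.0#) ⟩ * (p c * τ (F.- (c F.* t))) * (X a * f))
        ≈⟨ ∑-cong F.enum (λ c → pointwise c (c F.≟ F.0#)) ⟩
      ∑ F.enum (λ c → γ ^ d * (κ (⟨ ¬? (c F.≟ F.0#) ⟩ ℚ.* η c Q.^ d) * χ (c F.+ a F.* c F.⁻¹) * (X a * f)))
        ≈⟨ ∑-*ˡ F.enum (γ ^ d) _ ⟨
      γ ^ d * ∑ F.enum (λ c → κ (⟨ ¬? (c F.≟ F.0#) ⟩ ℚ.* η c Q.^ d) * χ (c F.+ a F.* c F.⁻¹) * (X a * f))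
        ≈⟨ *-congˡ (∑-*ʳ F.enum (X a * f) _) ⟨
      γ ^ d * (Kd a * (X a * f)) ∎
      where
      h = X a * f
      pointwise : ∀ c (δ : Dec (c ≡ F.0#)) → κ ⟨ ¬? δ ⟩ * (p c * τ (F.- (c F.* t))) * h ≈ γ ^ d * (κ (⟨ ¬? δ ⟩ ℚ.* η c Q.^ d) * χ (c F.+ a F.* c F.⁻¹) * h)
      pointwise c (yes _) = trans (*-congʳ (κ-0* _ ≡.refl)) (trans (zeroˡ h) (sym (trans (*-congˡ (trans (*-congʳ (κ-0* _ (ℚP.*-zeroˡ (η c Q.^ d)))) (zeroˡ h))) (zeroʳ _))))
      pointwise c (no c≢0) = begin
        κ 1ℚ * (p c * τ (F.- (c F.* t))) * h
          ≈⟨ trans (*-congʳ (κ-1* _ ≡.refl)) (solve 3 (λ P t h → P :* t :* h := t :* (P :* h)) refl (p c) (τ (F.- (c F.* t))) h) ⟩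
        τ (F.- (c F.* t)) * (p c * h)
          ≈⟨ *-congˡ (trans (p≈g c≢0 (killed-* (X a) uf)) (*-congˡ (*-congˡ (g*X (c F.⁻¹) a uf)))) ⟩
        τ (F.- (c F.* t)) * (κ (η c Q.^ d) * (γ ^ d * (τ (F.- (t F.* a F.* c F.⁻¹)) * h)))
          ≈⟨ solve 5 (λ x e g y h → x :* (e :* (g :* (y :* h))) := g :* (e :* (x :* y) :* h)) refl (τ (F.- (c F.* t))) (κ (η c Q.^ d)) (γ ^ d) (τ (F.- (t F.* a F.* c F.⁻¹))) h ⟩
        γ ^ d * (κ (η c Q.^ d) * (τ (F.- (c F.* t)) * τ (F.- (t F.* a F.* c F.⁻¹))) * h)
          ≈⟨ *-congˡ (*-congʳ (*-cong (κ-cong (≡.sym (ℚP.*-identityˡ (η c Q.^ d)))) (trans (sym (τ-+ _ _)) (τ-cong (F.solve 4 (λ c t a v → (F.:- (c F.:* t)) F.:+ (F.:- (t F.:* a F.:* v)) F.:= F.:- (t F.:* (c F.:+ a F.:* v))) ≡.refl c t a (c F.⁻¹)))))) ⟩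
        γ ^ d * (κ (1ℚ ℚ.* η c Q.^ d) * χ (c F.+ a F.* c F.⁻¹) * h) ∎

    -- In each component γ^d contributes q^d and `Kd-bound` the factor 6 q; `parseval` for f and for
    -- K₀ f reassembles the components.
    K₀-bound : ∀ {f} → Killed f → ‖ K₀ * f ‖² ℚ.≤ toℚ 6 ℚ.* qℚ Q.^ suc d ℚ.* ‖ f ‖²
    K₀-bound {f} uf = Q.*-cancelˡ-≤ {z = qℚ ℚ.* qℚ} (Q.0<* 0<q 0<q) (ℚP.≤-trans (ℚP.≤-reflexive (≡.sym (parseval (killed-* K₀ uf))))
      (ℚP.≤-trans (Q.sumL-mono (Enum.elems F.enum) (λ {a} _ → each a)) (ℚP.≤-reflexive (≡.trans (≡.sym (Q.∑-*ˡ F.enum B _)) (≡.trans (≡.cong (B ℚ.*_) (parseval uf)) swap)))))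
      where
      B = qℚ Q.^ d ℚ.* (toℚ 6 ℚ.* qℚ)
      swap : B ℚ.* (qℚ ℚ.* qℚ ℚ.* ‖ f ‖²) ≡ qℚ ℚ.* qℚ ℚ.* (toℚ 6 ℚ.* qℚ Q.^ suc d ℚ.* ‖ f ‖²)
      swap = Q.solve 4 (λ qd x q n → qd Q.:* (x Q.:* q) Q.:* (q Q.:* q Q.:* n) Q.:= q Q.:* q Q.:* (x Q.:* (q Q.:* qd) Q.:* n)) ≡.refl (qℚ Q.^ d) (toℚ 6) qℚ ‖ f ‖²
      each : ∀ a → ‖ X a * (K₀ * f) ‖² ℚ.≤ B ℚ.* ‖ X a * f ‖²
      each a = ℚP.≤-trans (ℚP.≤-reflexive (≡.trans (‖‖²-cong (trans (solve 3 (λ x k f → x :* (k :* f) := k :* (x :* f)) refl (X a) K₀ f) (K₀*X a uf))) (‖γ^*‖² d (killed-* (Kd a) (killed-* (X a) uf)))))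
        (ℚP.≤-trans (Q.*-monoˡ (qℚ Q.^ d) (Q.0≤^ d (Q.0≤toℚ F.order)) (Kd-bound a (killed-* (X a) uf))) (ℚP.≤-reflexive (≡.sym (ℚP.*-assoc (qℚ Q.^ d) (toℚ 6 ℚ.* qℚ) ‖ X a * f ‖²))))

-- From the group algebra to functions on F_q^d

module SphereSums (F : FiniteField) (k : ℕ) (q≡ : FiniteField.order F ≡ suc (k ℕ.+ k)) (3≤q : 3 ℕ.≤ FiniteField.order F) (d : ℕ) where
  open import Data.Integer as ℤ using ()
  open import Data.List using ([]; _∷_)
  open import Data.Product using (_×_; _,_)
  import Data.Vec
  open import Data.Rational as ℚ using (ℚ; 0ℚ; 1ℚ; _+_; _*_; -_; _-_; _≤_; _<_)
  open import Data.Rational.Properties hiding (_≟_)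
  open import Relation.Nullary using (Dec; yes; no; ¬?)
  open import Relation.Binary.PropositionalEquality using (refl; sym; trans; cong; cong₂; subst; subst₂; module ≡-Reasoning)
  open Sums
  open StarAlgebras
  open GroupRing
  open Q using (solve; _:+_; _:*_; :-_; _:-_; _:=_; :#)
  open Q using (⟨_⟩; ⟨⟩-cong; ∑; ∑-cong)
  private module F = Field F
  open Points F
  open ≡-Reasoning

  points : Enum (Point d)
  points = vecEnum F.enum d

  G : FiniteAbelianGroup
  G = record
    { A = Point d × F.Carrier ; enum = points ⊗ F.enum
    ; _⊕_ = λ { (x , r) (y , s) → x ⊞ y , r F.+ s } ; ⊖_ = λ { (x , r) → ⊟ᵥ x , F.- r } ; 𝟘 = 0ᵥ , F.0#
    ; ⊕-assoc = λ { (x , r) (y , s) (z , t) → cong₂ _,_ (⊞-assoc x y z) (F.+-assoc r s t) }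
    ; ⊕-comm = λ { (x , r) (y , s) → cong₂ _,_ (⊞-comm x y) (F.+-comm r s) }
    ; ⊕-identity = λ { (x , r) → cong₂ _,_ (⊞-identity x) (F.+-identityˡ r) }
    ; ⊕-inverse = λ { (x , r) → cong₂ _,_ (⊞-inverse x) (F.-‿inverseˡ r) }
    }

  Alg : StarAlgebra
  Alg = groupAlgebra G

  module Alg = StarAlgebra Alg
  module L = Lemmas Alg

  E : Point d → F.Carrier → Alg.Carrier
  E x r = [_] G (x , r)

  module T = SphereOperator F k q≡ 3≤q d Alg E (λ _ → refl)
    (λ x r y s → []-⊕ G (x , r) (y , s)) (λ x r → []-star G (x , r))

  qℚ : ℚ
  qℚ = toℚ F.order

  ∑-pointwise : ∀ {B} (e : Enum B) (φ : B → Alg.Carrier) x → L.∑ e φ x ≡ ∑ e (λ b → φ b x)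
  ∑-pointwise e φ x = go (Enum.elems e)
    where
    go : ∀ bs → L.sumL bs φ x ≡ Q.sumL bs (λ b → φ b x)
    go []       = refl
    go (b ∷ bs) = cong (φ b x +_) (go bs)

  ∑*-pointwise : ∀ {B} (e : Enum B) (φ : B → Alg.Carrier) f x → (L.∑ e φ Alg.* f) x ≡ ∑ e (λ b → (φ b Alg.* f) x)
  ∑*-pointwise e φ f x = trans (L.∑-*ʳ e f φ x) (∑-pointwise e (λ b → φ b Alg.* f) x)

  E* : ∀ y s f x r → (E y s Alg.* f) (x , r) ≡ f (x ⊟ y , r F.- s)
  E* y s f x r = trans ([]-⋆ G (y , s) f (x , r)) (cong (λ z → f (z , r F.- s)) (sym (⊟≡⊞⊟ᵥ x y)))

  ⊟-0 : ∀ {n} (x : Point n) → x ⊟ 0ᵥ ≡ x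
  ⊟-0 Data.Vec.[] = refl
  ⊟-0 (a Data.Vec.∷ x) = cong₂ Data.Vec._∷_ (F.solve 1 (λ a → a F.:- F.:# 0 F.:= a) refl a) (⊟-0 x)

  -- The sum of all nontrivial additive characters. Its sum is 0, so f ⊗ ε is annihilated by u; it
  -- is not zero, so norms of functions of x can be read off from their products with it.
  ε : F.Carrier → ℚ
  ε r = qℚ * ⟨ r F.≟ F.0# ⟩ - 1ℚ

  ∑1 : ∑ F.enum (λ _ → 1ℚ) ≡ qℚ
  ∑1 = trans (Q.sumL-const-ℚ (Enum.elems F.enum) 1ℚ) (*-identityʳ qℚ)

  ∑ε : ∑ F.enum ε ≡ 0ℚ
  ∑ε = trans (Q.∑-∙ F.enum (λ r → qℚ * ⟨ r F.≟ F.0# ⟩) (λ _ → - 1ℚ)) (trans (cong₂ _+_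
    (trans (sym (Q.∑-*ˡ F.enum qℚ _)) (trans (cong (qℚ *_) (Q.∑-1 F.enum F.0#)) (*-identityʳ qℚ))) (trans (sym (Q.∑-neg F.enum (λ _ → 1ℚ))) (cong -_ ∑1))) (+-inverseʳ qℚ))

  ∑ε² : ∑ F.enum (λ r → ε r * ε r) ≡ qℚ * (qℚ - 1ℚ)
  ∑ε² = begin
    ∑ F.enum (λ r → ε r * ε r)                                      ≡⟨ ∑-cong F.enum (λ r → square (r F.≟ F.0#)) ⟩
    ∑ F.enum (λ r → (qℚ * qℚ - qℚ - qℚ) * ⟨ r F.≟ F.0# ⟩ + 1ℚ)      ≡⟨ Q.∑-∙ F.enum _ _ ⟩
    ∑ F.enum (λ r → (qℚ * qℚ - qℚ - qℚ) * ⟨ r F.≟ F.0# ⟩) + ∑ F.enum (λ _ → 1ℚ)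
                                                                     ≡⟨ cong₂ _+_ (trans (sym (Q.∑-*ˡ F.enum (qℚ * qℚ - qℚ - qℚ) _)) (cong ((qℚ * qℚ - qℚ - qℚ) *_) (Q.∑-1 F.enum F.0#))) ∑1 ⟩
    (qℚ * qℚ - qℚ - qℚ) * 1ℚ + qℚ                                    ≡⟨ solve 1 (λ q → (q :* q :- q :- q) :* :# 1 :+ q := q :* (q :- :# 1)) refl qℚ ⟩
    qℚ * (qℚ - 1ℚ)                                                   ∎
    where
    square : ∀ {P : Set} (δ : Dec P) → (qℚ * ⟨ δ ⟩ - 1ℚ) * (qℚ * ⟨ δ ⟩ - 1ℚ) ≡ (qℚ * qℚ - qℚ - qℚ) * ⟨ δ ⟩ + 1ℚ
    square (yes _) = solve 1 (λ q → (q :* :# 1 :- :# 1) :* (q :* :# 1 :- :# 1) := (q :* q :- q :- q) :* :# 1 :+ :# 1) refl qℚ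
    square (no _)  = solve 1 (λ q → (q :* :# 0 :- :# 1) :* (q :* :# 0 :- :# 1) := (q :* q :- q :- q) :* :# 0 :+ :# 1) refl qℚ

  0<∑ε² : 0ℚ < qℚ * (qℚ - 1ℚ)
  0<∑ε² = Q.0<* T.0<q (subst (_< qℚ - 1ℚ) (+-inverseʳ 1ℚ) (+-monoˡ-< (- 1ℚ) (<-≤-trans 1<3 (Q.toℚ-mono 3≤q))))
    where
    1<3 : 1ℚ < toℚ 3
    1<3 = ℚ.*<* (ℤ.+<+ (ℕ.s≤s (ℕ.s≤s ℕ.z≤n)))

  module _ (t : F.Carrier) (t≢0 : t ≢ F.0#) where
    open T.Decompose t t≢0 using (K₀; K₀-bound)

    -- f * S in the notation of the paper
    sphereSum : (Point d → ℚ) → Point d → ℚ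
    sphereSum f x = ∑ points (λ y → ⟨ ‖ y ‖ F.≟ t ⟩ * f (x ⊟ y))

    module _ (f : Point d → ℚ) (∑f : ∑ points f ≡ 0ℚ) where
      private
        Φ : Alg.Carrier
        Φ (x , r) = f x * ε r

        sub-reindex : ∀ r (φ : F.Carrier → ℚ) → ∑ F.enum (λ s → φ (r F.- s)) ≡ ∑ F.enum φ
        sub-reindex r φ = Q.∑-reindex F.enum F.enum (λ s → r F.- s) (λ s → r F.- s) flip flip φ
          where
          flip : ∀ s → r F.- (r F.- s) ≡ s
          flip s = F.solve 2 (λ r s → r F.:- (r F.:- s) F.:= s) refl r s

        killed : T.Killed Φ
        killed (x , r) = begin
          (L.∑ F.enum T.τ Alg.* Φ) (x , r)                ≡⟨ ∑*-pointwise F.enum T.τ Φ (x , r) ⟩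
          ∑ F.enum (λ s → (E 0ᵥ s Alg.* Φ) (x , r))       ≡⟨ ∑-cong F.enum (λ s → trans (E* 0ᵥ s Φ x r) (cong (λ z → f z * ε (r F.- s)) (⊟-0 x))) ⟩
          ∑ F.enum (λ s → f x * ε (r F.- s))              ≡⟨ Q.∑-*ˡ F.enum (f x) _ ⟨
          f x * ∑ F.enum (λ s → ε (r F.- s))              ≡⟨ cong (f x *_) (trans (sub-reindex r ε) ∑ε) ⟩
          f x * 0ℚ                                        ≡⟨ *-zeroʳ (f x) ⟩
          0ℚ                                              ∎

        ∑-translate : ∀ x → ∑ points (λ y → f (x ⊟ y)) ≡ 0ℚ
        ∑-translate x = trans (Q.∑-reindex points points (x ⊟_) (x ⊟_) (⊟⊟ x) (⊟⊟ x) f) ∑f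

        -- For w ≠ 0 the points r + c w run through the field and contribute ∑ ε = 0; for w = 0 they
        -- contribute q equal terms. The excluded c = 0 accounts for - ε r.
        line-sum : ∀ r w → ∑ F.enum (λ c → ⟨ ¬? (c F.≟ F.0#) ⟩ * ε (r F.+ c F.* w)) ≡ qℚ * ⟨ w F.≟ F.0# ⟩ * ε r - ε r
        line-sum r w = begin
          ∑ F.enum (λ c → ⟨ ¬? (c F.≟ F.0#) ⟩ * ε (r F.+ c F.* w))
            ≡⟨ ∑-cong F.enum (λ c → split c (c F.≟ F.0#)) ⟩
          ∑ F.enum (λ c → ε (r F.+ c F.* w) + - (⟨ c F.≟ F.0# ⟩ * ε (r F.+ c F.* w)))
            ≡⟨ Q.∑-∙ F.enum _ _ ⟩
          ∑ F.enum (λ c → ε (r F.+ c F.* w)) + ∑ F.enum (λ c → - (⟨ c F.≟ F.0# ⟩ * ε (r F.+ c F.* w)))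
            ≡⟨ cong₂ _+_ (full (w F.≟ F.0#)) (trans (sym (Q.∑-neg F.enum _)) (cong -_ (trans (Q.∑-δ F.enum (λ c → ε (r F.+ c F.* w)) F.0#) (cong ε (trans (cong (r F.+_) (F.zeroˡ w)) (F.+-identityʳ r)))))) ⟩
          qℚ * ⟨ w F.≟ F.0# ⟩ * ε r - ε r ∎
          where
          split : ∀ c (δ : Dec (c ≡ F.0#)) → ⟨ ¬? δ ⟩ * ε (r F.+ c F.* w) ≡ ε (r F.+ c F.* w) + - (⟨ δ ⟩ * ε (r F.+ c F.* w))
          split c (yes _) = solve 1 (λ e → :# 0 :* e := e :+ (:- (:# 1 :* e))) refl (ε (r F.+ c F.* w))
          split c (no _)  = solve 1 (λ e → :# 1 :* e := e :+ (:- (:# 0 :* e))) refl (ε (r F.+ c F.* w))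
          full : (δ : Dec (w ≡ F.0#)) → ∑ F.enum (λ c → ε (r F.+ c F.* w)) ≡ qℚ * ⟨ δ ⟩ * ε r
          full (yes refl) = trans (∑-cong F.enum (λ c → cong ε (trans (cong (r F.+_) (F.zeroʳ c)) (F.+-identityʳ r)))) (trans (Q.sumL-const-ℚ (Enum.elems F.enum) (ε r)) (cong (_* ε r) (sym (*-identityʳ qℚ))))
          full (no w≢0) = trans (Q.∑-reindex F.enum F.enum (λ c → r F.+ c F.* w) (λ z → (z F.- r) F.* w F.⁻¹) ψφ φψ ε)
            (trans ∑ε (sym (trans (cong (_* ε r) (*-zeroʳ qℚ)) (*-zeroˡ (ε r)))))
            where
            ψφ : ∀ c → ((r F.+ c F.* w) F.- r) F.* w F.⁻¹ ≡ c
            ψφ c = trans (F.solve 4 (λ r c w v → ((r F.:+ c F.:* w) F.:- r) F.:* v F.:= c F.:* (w F.:* v)) refl r c w (w F.⁻¹)) (trans (cong (c F.*_) (F.inverseʳ w≢0)) (F.*-identityʳ c))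
            φψ : ∀ z → r F.+ (z F.- r) F.* w F.⁻¹ F.* w ≡ z
            φψ z = trans (cong (r F.+_) (trans (F.*-assoc _ _ _) (trans (cong ((z F.- r) F.*_) (F.inverseˡ w≢0)) (F.*-identityʳ _)))) (F.solve 2 (λ r z → r F.:+ (z F.:- r) F.:= z) refl r z)

        -- `line-sum` at w = t - ‖y‖ detects the sphere. Its second term does not depend on y, so it
        -- is summed against f and vanishes.
        K₀Φ : ∀ x r → (K₀ Alg.* Φ) (x , r) ≡ qℚ * sphereSum f x * ε r
        K₀Φ x r = begin
          (K₀ Alg.* Φ) (x , r)
            ≡⟨ ∑*-pointwise F.enum _ Φ (x , r) ⟩
          ∑ F.enum (λ c → (Alg.κ ⟨ ¬? (c F.≟ F.0#) ⟩ Alg.* (T.p c Alg.* T.τ (F.- (c F.* t))) Alg.* Φ) (x , r))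
            ≡⟨ ∑-cong F.enum (λ c → term c) ⟩
          ∑ F.enum (λ c → ∑ points (λ y → ⟨ ¬? (c F.≟ F.0#) ⟩ * (f (x ⊟ y) * ε (r F.+ c F.* (t F.- ‖ y ‖)))))
            ≡⟨ Q.∑-swap F.enum points _ ⟩
          ∑ points (λ y → ∑ F.enum (λ c → ⟨ ¬? (c F.≟ F.0#) ⟩ * (f (x ⊟ y) * ε (r F.+ c F.* (t F.- ‖ y ‖)))))
            ≡⟨ ∑-cong points (λ y → trans (∑-cong F.enum (λ c → solve 3 (λ a b c → a :* (b :* c) := b :* (a :* c)) refl ⟨ ¬? (c F.≟ F.0#) ⟩ (f (x ⊟ y)) (ε (r F.+ c F.* (t F.- ‖ y ‖)))))
                 (trans (sym (Q.∑-*ˡ F.enum (f (x ⊟ y)) _)) (trans (cong (f (x ⊟ y) *_) (line-sum r (t F.- ‖ y ‖))) (regroup y)))) ⟩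
          ∑ points (λ y → qℚ * ε r * (⟨ ‖ y ‖ F.≟ t ⟩ * f (x ⊟ y)) + - (ε r * f (x ⊟ y)))
            ≡⟨ trans (Q.∑-∙ points _ _) (cong₂ _+_ (sym (Q.∑-*ˡ points (qℚ * ε r) _)) (trans (sym (Q.∑-neg points _)) (cong -_ (trans (sym (Q.∑-*ˡ points (ε r) _)) (cong (ε r *_) (∑-translate x)))))) ⟩
          qℚ * ε r * sphereSum f x + - (ε r * 0ℚ)
            ≡⟨ solve 3 (λ q e s → q :* e :* s :+ (:- (e :* :# 0)) := q :* s :* e) refl qℚ (ε r) (sphereSum f x) ⟩
          qℚ * sphereSum f x * ε r ∎
          where
          regroup : ∀ y → f (x ⊟ y) * (qℚ * ⟨ (t F.- ‖ y ‖) F.≟ F.0# ⟩ * ε r - ε r) ≡ qℚ * ε r * (⟨ ‖ y ‖ F.≟ t ⟩ * f (x ⊟ y)) + - (ε r * f (x ⊟ y))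
          regroup y = trans (cong (λ z → f (x ⊟ y) * (qℚ * z * ε r - ε r)) (⟨⟩-cong ((t F.- ‖ y ‖) F.≟ F.0#) (‖ y ‖ F.≟ t) (λ e → sym (F.-≡0⇒≡ e)) (λ e → F.≡⇒-≡0 (sym e))))
            (solve 4 (λ f q i e → f :* (q :* i :* e :- e) := q :* e :* (i :* f) :+ (:- (e :* f))) refl (f (x ⊟ y)) qℚ ⟨ ‖ y ‖ F.≟ t ⟩ (ε r))
          term : ∀ c → (Alg.κ ⟨ ¬? (c F.≟ F.0#) ⟩ Alg.* (T.p c Alg.* T.τ (F.- (c F.* t))) Alg.* Φ) (x , r)
            ≡ ∑ points (λ y → ⟨ ¬? (c F.≟ F.0#) ⟩ * (f (x ⊟ y) * ε (r F.+ c F.* (t F.- ‖ y ‖))))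
          term c = begin
            (Alg.κ i Alg.* (T.p c Alg.* T.τ (F.- (c F.* t))) Alg.* Φ) (x , r)
              ≡⟨ Alg.trans (Alg.*-assoc (Alg.κ i) (T.p c Alg.* T.τ (F.- (c F.* t))) Φ) (Alg.*-congˡ {Alg.κ i} (Alg.*-assoc (T.p c) (T.τ (F.- (c F.* t))) Φ)) (x , r) ⟩
            (Alg.κ i Alg.* (T.p c Alg.* (T.τ (F.- (c F.* t)) Alg.* Φ))) (x , r)
              ≡⟨ κᴳ-⋆ G i (T.p c Alg.* (T.τ (F.- (c F.* t)) Alg.* Φ)) (x , r) ⟩
            i * (T.p c Alg.* (T.τ (F.- (c F.* t)) Alg.* Φ)) (x , r)
              ≡⟨ cong (i *_) (trans (∑*-pointwise points (λ y → E y (c F.* ‖ y ‖)) (T.τ (F.- (c F.* t)) Alg.* Φ) (x , r)) (∑-cong points (λ y → trans (E* y (c F.* ‖ y ‖) (T.τ (F.- (c F.* t)) Alg.* Φ) x r) (trans (E* 0ᵥ (F.- (c F.* t)) Φ (x ⊟ y) (r F.- c F.* ‖ y ‖))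
                   (cong₂ (λ z w → f z * ε w) (⊟-0 (x ⊟ y)) (F.solve 4 (λ r c n t → (r F.:- c F.:* n) F.:- (F.:- (c F.:* t)) F.:= r F.:+ c F.:* (t F.:- n)) refl r c ‖ y ‖ t)))))) ⟩
            i * ∑ points (λ y → f (x ⊟ y) * ε (r F.+ c F.* (t F.- ‖ y ‖)))
              ≡⟨ Q.∑-*ˡ points i _ ⟩
            ∑ points (λ y → i * (f (x ⊟ y) * ε (r F.+ c F.* (t F.- ‖ y ‖)))) ∎
            where i = ⟨ ¬? (c F.≟ F.0#) ⟩

        tensor-norm : ∀ (h : Point d → ℚ) → ∑ (points ⊗ F.enum) (λ { (x , r) → h x * ε r * (h x * ε r) }) ≡ qℚ * (qℚ - 1ℚ) * ∑ points (λ x → h x * h x)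
        tensor-norm h = trans (Q.∑-⊗ points F.enum _) (trans (∑-cong points (λ x → trans (∑-cong F.enum (λ r → solve 2 (λ h e → h :* e :* (h :* e) := h :* h :* (e :* e)) refl (h x) (ε r)))
          (trans (sym (Q.∑-*ˡ F.enum (h x * h x) _)) (trans (cong (h x * h x *_) ∑ε²) (*-comm (h x * h x) (qℚ * (qℚ - 1ℚ))))))) (sym (Q.∑-*ˡ points (qℚ * (qℚ - 1ℚ)) _)))

      -- The hypothesis ∑ f = 0 removes the trivial eigenvalue |S|.
      sphereSum-bound : qℚ * qℚ * ∑ points (λ x → sphereSum f x * sphereSum f x) ≤ toℚ 6 * qℚ Q.^ suc d * ∑ points (λ x → f x * f x)
      sphereSum-bound = Q.*-cancelˡ-≤ {z = qℚ * (qℚ - 1ℚ)} 0<∑ε² (subst₂ _≤_ lhs rhs (K₀-bound {Φ} killed))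
        where
        lhs : L.‖ K₀ Alg.* Φ ‖² ≡ qℚ * (qℚ - 1ℚ) * (qℚ * qℚ * ∑ points (λ x → sphereSum f x * sphereSum f x))
        lhs = trans (∑-cong (points ⊗ F.enum) (λ { (x , r) → cong₂ _*_ (K₀Φ x r) (K₀Φ x r) })) (trans (tensor-norm (λ x → qℚ * sphereSum f x))
          (cong (qℚ * (qℚ - 1ℚ) *_) (trans (∑-cong points (λ x → solve 2 (λ q s → q :* s :* (q :* s) := q :* q :* (s :* s)) refl qℚ (sphereSum f x))) (sym (Q.∑-*ˡ points (qℚ * qℚ) _)))))
        rhs : toℚ 6 * qℚ Q.^ suc d * L.‖ Φ ‖² ≡ qℚ * (qℚ - 1ℚ) * (toℚ 6 * qℚ Q.^ suc d * ∑ points (λ x → f x * f x))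
        rhs = trans (cong (toℚ 6 * qℚ Q.^ suc d *_) (tensor-norm f)) (solve 3 (λ a b c → a :* (b :* c) := b :* (a :* c)) refl (toℚ 6 * qℚ Q.^ suc d) (qℚ * (qℚ - 1ℚ)) (∑ points (λ x → f x * f x)))

-- The number of points on a sphere

module SphereSize (F : FiniteField) (2≢0 : Field.2# F ≢ Field.0# F) where
  open import Data.Product using (∃; _,_)
  open import Data.Rational as ℚ using (ℚ; 0ℚ; 1ℚ; _+_; _*_; -_; _-_; _≤_)
  import Data.Nat.Properties as ℕP
  open import Data.Rational.Properties as ℚP hiding (_≟_)
  open import Data.Sum using (_⊎_; inj₁; inj₂)
  open import Relation.Binary.PropositionalEquality using (refl; sym; trans; cong; cong₂; subst; subst₂; module ≡-Reasoning)
  open Sums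
  open Q using (solve; _:+_; _:*_; :-_; _:-_; _:=_; :#)
  open Q using (⟨_⟩; ⟨no⟩; ⟨⟩-cong; ∑; ∑-cong)
  open QuadraticCharacter F 2≢0
  private module F = Field F
  open FiniteField F using (‖_‖)
  open ≡-Reasoning

  private
    qℚ : ℚ
    qℚ = toℚ F.order

    ε : F.Carrier → ℚ
    ε r = qℚ * ⟨ r F.≟ F.0# ⟩ - 1ℚ

  sphereSize : ∀ n → F.Carrier → ℚ
  sphereSize n r = ∑ (vecEnum F.enum n) (λ y → ⟨ ‖ y ‖ F.≟ r ⟩)

  ∑-squares : ∀ (φ : F.Carrier → ℚ) → ∑ F.enum (λ a → φ (a F.* a)) ≡ ∑ F.enum φ + ∑ F.enum (λ w → η w * φ w)
  ∑-squares φ = begin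
    ∑ F.enum (λ a → φ (a F.* a))
      ≡⟨ ∑-cong F.enum (λ a → sym (Q.∑-δ F.enum φ (a F.* a))) ⟩
    ∑ F.enum (λ a → ∑ F.enum (λ w → ⟨ w F.≟ a F.* a ⟩ * φ w))
      ≡⟨ Q.∑-swap F.enum F.enum _ ⟩
    ∑ F.enum (λ w → ∑ F.enum (λ a → ⟨ w F.≟ a F.* a ⟩ * φ w))
      ≡⟨ ∑-cong F.enum (λ w → trans (sym (Q.∑-*ʳ F.enum (φ w) _)) (trans (cong (_* φ w) (trans (∑-cong F.enum (λ a → ⟨⟩-cong (w F.≟ a F.* a) (a F.* a F.≟ w) sym sym)) (roots≡1+η w)))
           (solve 2 (λ e f → (:# 1 :+ e) :* f := f :+ e :* f) refl (η w) (φ w)))) ⟩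
    ∑ F.enum (λ w → φ w + η w * φ w)
      ≡⟨ Q.∑-∙ F.enum _ _ ⟩
    ∑ F.enum φ + ∑ F.enum (λ w → η w * φ w) ∎

  private
    ∑-flip : ∀ r (φ : F.Carrier → ℚ) → ∑ F.enum (λ s → φ (r F.- s)) ≡ ∑ F.enum φ
    ∑-flip r φ = Q.∑-reindex F.enum F.enum (λ s → r F.- s) (λ s → r F.- s) flip flip φ
      where
      flip : ∀ s → r F.- (r F.- s) ≡ s
      flip s = F.solve 2 (λ r s → r F.:- (r F.:- s) F.:= s) refl r s

    ∑const : ∀ c → ∑ F.enum (λ _ → c) ≡ qℚ * c
    ∑const c = Q.sumL-const-ℚ (Enum.elems F.enum) c

    ∑ε≡0 : ∑ F.enum ε ≡ 0ℚ
    ∑ε≡0 = trans (Q.∑-∙ F.enum (λ r → qℚ * ⟨ r F.≟ F.0# ⟩) (λ _ → - 1ℚ)) (trans (cong₂ _+_ (trans (sym (Q.∑-*ˡ F.enum qℚ _)) (cong (qℚ *_) (Q.∑-1 F.enum F.0#))) (∑const (- 1ℚ)))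
      (solve 1 (λ q → q :* :# 1 :+ q :* (:- :# 1) := :# 0) refl qℚ))

    ∑ηε : ∀ r → ∑ F.enum (λ w → η w * ε (r F.- w)) ≡ qℚ * η r
    ∑ηε r = begin
      ∑ F.enum (λ w → η w * ε (r F.- w))
        ≡⟨ ∑-cong F.enum (λ w → trans (solve 3 (λ e q i → e :* (q :* i :- :# 1) := q :* (i :* e) :+ (:- e)) refl (η w) qℚ ⟨ (r F.- w) F.≟ F.0# ⟩)
             (cong (λ z → qℚ * (z * η w) + - η w) (⟨⟩-cong ((r F.- w) F.≟ F.0#) (w F.≟ r) (λ p → sym (F.-≡0⇒≡ p)) (λ p → F.≡⇒-≡0 (sym p))))) ⟩
      ∑ F.enum (λ w → qℚ * (⟨ w F.≟ r ⟩ * η w) + - η w)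
        ≡⟨ trans (Q.∑-∙ F.enum _ _) (cong₂ _+_ (trans (sym (Q.∑-*ˡ F.enum qℚ _)) (cong (qℚ *_) (Q.∑-δ F.enum η r))) (trans (sym (Q.∑-neg F.enum η)) (cong -_ ∑η≡0))) ⟩
      qℚ * η r + - 0ℚ
        ≡⟨ +-identityʳ (qℚ * η r) ⟩
      qℚ * η r ∎

    η₋₁ : ℚ
    η₋₁ = η (F.- F.1#)

    A : ℕ → ℚ
    A n = (η₋₁ * qℚ) Q.^ n

    size-suc : ∀ n r → sphereSize (suc n) r ≡ ∑ F.enum (λ w → sphereSize n (r F.- w)) + ∑ F.enum (λ w → η w * sphereSize n (r F.- w))
    size-suc n r = trans (Q.∑-vec F.enum n _) (trans (∑-cong F.enum (λ a → ∑-cong (vecEnum F.enum n) (λ y → ⟨⟩-cong (a F.* a F.+ ‖ y ‖ F.≟ r) (‖ y ‖ F.≟ r F.- a F.* a)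
        (λ p → trans (F.solve 2 (λ x n → n F.:= (x F.:+ n) F.:- x) refl (a F.* a) (‖ y ‖)) (cong (F._- a F.* a) p))
        (λ p → trans (cong (a F.* a F.+_) p) (F.solve 2 (λ x r → x F.:+ (r F.:- x) F.:= r) refl (a F.* a) r)))))
      (∑-squares (λ w → sphereSize n (r F.- w))))

    -- The square of one more coordinate takes the value w with multiplicity 1 + η w. So B is
    -- multiplied by q and ρ is replaced by ∑ ρ + η ⋆ ρ, which alternates between multiples of ε and
    -- η: η ⋆ ε = q η and η ⋆ η = η(-1) ε.
    step : ∀ n (a B : ℚ) (ρ : F.Carrier → ℚ) c → (∀ r → c * sphereSize n r ≡ B + a * ρ r) → ∀ r →
      c * sphereSize (suc n) r ≡ qℚ * B + a * (∑ F.enum ρ + ∑ F.enum (λ w → η w * ρ (r F.- w)))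
    step n a B ρ c h r = begin
      c * sphereSize (suc n) r
        ≡⟨ cong (c *_) (size-suc n r) ⟩
      c * (∑ F.enum (λ w → sphereSize n (r F.- w)) + ∑ F.enum (λ w → η w * sphereSize n (r F.- w)))
        ≡⟨ trans (*-distribˡ-+ c _ _) (cong₂ _+_ (Q.∑-*ˡ F.enum c _) (Q.∑-*ˡ F.enum c _)) ⟩
      ∑ F.enum (λ w → c * sphereSize n (r F.- w)) + ∑ F.enum (λ w → c * (η w * sphereSize n (r F.- w)))
        ≡⟨ cong₂ _+_ (∑-cong F.enum (λ w → h (r F.- w))) (∑-cong F.enum (λ w → trans (solve 3 (λ c e s → c :* (e :* s) := e :* (c :* s)) refl c (η w) (sphereSize n (r F.- w)))
             (trans (cong (η w *_) (h (r F.- w))) (solve 4 (λ e B a p → e :* (B :+ a :* p) := B :* e :+ a :* (e :* p)) refl (η w) B (a) (ρ (r F.- w)))))) ⟩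
      ∑ F.enum (λ w → B + a * ρ (r F.- w)) + ∑ F.enum (λ w → B * η w + a * (η w * ρ (r F.- w)))
        ≡⟨ cong₂ _+_ (trans (Q.∑-∙ F.enum _ _) (cong₂ _+_ (∑const B) (trans (sym (Q.∑-*ˡ F.enum (a) _)) (cong (a *_) (∑-flip r ρ)))))
             (trans (Q.∑-∙ F.enum _ _) (cong₂ _+_ (trans (sym (Q.∑-*ˡ F.enum B _)) (cong (B *_) ∑η≡0)) (sym (Q.∑-*ˡ F.enum (a) _)))) ⟩
      (qℚ * B + a * ∑ F.enum ρ) + (B * 0ℚ + a * ∑ F.enum (λ w → η w * ρ (r F.- w)))
        ≡⟨ solve 5 (λ q B a x y → (q :* B :+ a :* x) :+ (B :* :# 0 :+ a :* y) := q :* B :+ a :* (x :+ y)) refl qℚ B (a) (∑ F.enum ρ) (∑ F.enum (λ w → η w * ρ (r F.- w))) ⟩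
      qℚ * B + a * (∑ F.enum ρ + ∑ F.enum (λ w → η w * ρ (r F.- w))) ∎

  mutual
    sphereSize-even : ∀ n r → qℚ * sphereSize (n ℕ.+ n) r ≡ qℚ Q.^ (n ℕ.+ n) + A n * ε r
    sphereSize-even zero r = trans (cong (λ z → qℚ * (z + 0ℚ)) (⟨⟩-cong (F.0# F.≟ r) (r F.≟ F.0#) sym sym))
      (solve 2 (λ q i → q :* (i :+ :# 0) := :# 1 :+ :# 1 :* (q :* i :- :# 1)) refl qℚ ⟨ r F.≟ F.0# ⟩)
    sphereSize-even (suc n) r = subst (λ m → qℚ * sphereSize (suc m) r ≡ qℚ Q.^ suc m + A (suc n) * ε r) (sym (ℕP.+-suc n n)) (begin
      qℚ * sphereSize (suc (suc (n ℕ.+ n))) r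
        ≡⟨ cong (qℚ *_) (trans (sym (*-identityˡ (sphereSize (suc (suc (n ℕ.+ n))) r))) (step (suc (n ℕ.+ n)) (A n) (qℚ Q.^ (n ℕ.+ n)) η 1ℚ (λ r → trans (*-identityˡ (sphereSize (suc (n ℕ.+ n)) r)) (sphereSize-odd n r)) r)) ⟩
      qℚ * (qℚ * qℚ Q.^ (n ℕ.+ n) + A n * (∑ F.enum η + ∑ F.enum (λ w → η w * η (r F.- w))))
        ≡⟨ cong (λ z → qℚ * (qℚ * qℚ Q.^ (n ℕ.+ n) + A n * z)) (trans (cong₂ _+_ ∑η≡0 (η-⋆-η r)) (+-identityˡ (η₋₁ * ε r))) ⟩
      qℚ * (qℚ * qℚ Q.^ (n ℕ.+ n) + A n * (η₋₁ * ε r))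
        ≡⟨ solve 5 (λ q B a m e → q :* (q :* B :+ a :* (m :* e)) := q :* (q :* B) :+ m :* q :* a :* e) refl qℚ (qℚ Q.^ (n ℕ.+ n)) (A n) η₋₁ (ε r) ⟩
      qℚ Q.^ suc (suc (n ℕ.+ n)) + A (suc n) * ε r ∎)

    sphereSize-odd : ∀ n r → sphereSize (suc (n ℕ.+ n)) r ≡ qℚ Q.^ (n ℕ.+ n) + A n * η r
    sphereSize-odd n r = *-cancelˡ-pos (trans (step (n ℕ.+ n) (A n) (qℚ Q.^ (n ℕ.+ n)) ε qℚ (sphereSize-even n) r)
      (trans (cong (λ z → qℚ * qℚ Q.^ (n ℕ.+ n) + A n * z) (trans (cong₂ _+_ ∑ε≡0 (∑ηε r)) (+-identityˡ (qℚ * η r))))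
        (solve 4 (λ q B a e → q :* B :+ a :* (q :* e) := q :* (B :+ a :* e)) refl qℚ (qℚ Q.^ (n ℕ.+ n)) (A n) (η r))))
      where
      0<q : 0ℚ ℚ.< qℚ
      0<q = <-≤-trans (ℚP.positive⁻¹ 1ℚ) (Q.toℚ-mono (positive (FiniteField.order-nonZero F)))
        where
        positive : ∀ {n} → ℕ.NonZero n → 1 ℕ.≤ n
        positive {suc n} _ = ℕ.s≤s ℕ.z≤n
      *-cancelˡ-pos : ∀ {x y} → qℚ * x ≡ qℚ * y → x ≡ y
      *-cancelˡ-pos p = ≤-antisym (Q.*-cancelˡ-≤ 0<q (≤-reflexive p)) (Q.*-cancelˡ-≤ 0<q (≤-reflexive (sym p)))

  private
    A² : ∀ n → A n * A n ≡ qℚ Q.^ (n ℕ.+ n)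
    A² n = trans (sym (Q.^-*-dist (η₋₁ * qℚ) (η₋₁ * qℚ) n)) (trans (cong (Q._^ n) (trans (solve 2 (λ e q → e :* q :* (e :* q) := (e :* e) :* (q :* q)) refl η₋₁ qℚ)
      (trans (cong (_* (qℚ * qℚ)) (η²≡1 (F.neg-nonzero F.1≢0))) (*-identityˡ (qℚ * qℚ))))) (trans (Q.^-*-dist qℚ qℚ n) (sym (Q.^-+ qℚ n n))))

    ^-mono : ∀ {m n} → m ℕ.≤ n → qℚ Q.^ m ≤ qℚ Q.^ n
    ^-mono {m} {n} l = subst₂ _≤_ (Q.toℚ-^ F.order m) (Q.toℚ-^ F.order n) (Q.toℚ-mono (ℕP.^-monoʳ-≤ F.order {{FiniteField.order-nonZero F}} l))

  parity : ∀ d → (∃ λ n → d ≡ n ℕ.+ n) ⊎ (∃ λ n → d ≡ suc (n ℕ.+ n))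
  parity zero = inj₁ (0 , refl)
  parity (suc d) with parity d
  ... | inj₁ (n , p) = inj₂ (n , cong suc p)
  ... | inj₂ (n , p) = inj₁ (suc n , trans (cong suc p) (cong suc (sym (ℕP.+-suc n n))))

  -- In dimension n = d + 2 the deviation is ± q^(n/2) for even n and ± q^((n+1)/2) for odd n. Both
  -- exponents are at most n - 1, as an odd n is at least 3.
  sphereSize-deviation : ∀ d {t} → t ≢ F.0# →
    (qℚ * sphereSize (suc (suc d)) t - qℚ Q.^ suc (suc d)) * (qℚ * sphereSize (suc (suc d)) t - qℚ Q.^ suc (suc d)) ≤ qℚ Q.^ suc d * qℚ Q.^ suc d
  sphereSize-deviation d {t} t≢0 = go (parity d)
    where
    εt : ε t ≡ - 1ℚ
    εt = trans (cong (λ z → qℚ * z - 1ℚ) (⟨no⟩ (t F.≟ F.0#) t≢0)) (solve 1 (λ q → q :* :# 0 :- :# 1 := :- :# 1) refl qℚ)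
    go : (∃ λ n → d ≡ n ℕ.+ n) ⊎ (∃ λ n → d ≡ suc (n ℕ.+ n)) → _
    go (inj₁ (n , refl)) = ≤-trans (≤-reflexive (trans (cong (λ z → z * z) dev) (trans (solve 1 (λ a → (:- a) :* (:- a) := a :* a) refl (A (suc n))) (A² (suc n)))))
        (≤-trans (^-mono {suc n ℕ.+ suc n} {suc (n ℕ.+ n) ℕ.+ suc (n ℕ.+ n)} (ℕP.+-mono-≤ (ℕ.s≤s (ℕP.m≤m+n n n)) (ℕ.s≤s (ℕP.m≤m+n n n)))) (≤-reflexive (Q.^-+ qℚ (suc (n ℕ.+ n)) (suc (n ℕ.+ n)))))
      where
      dev : qℚ * sphereSize (suc (suc (n ℕ.+ n))) t - qℚ Q.^ suc (suc (n ℕ.+ n)) ≡ - A (suc n)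
      dev = trans (cong (_- qℚ Q.^ suc (suc (n ℕ.+ n))) (subst (λ m → qℚ * sphereSize (suc m) t ≡ qℚ Q.^ suc m + A (suc n) * ε t) (ℕP.+-suc n n) (sphereSize-even (suc n) t)))
        (trans (cong (λ z → qℚ Q.^ suc (suc (n ℕ.+ n)) + A (suc n) * z - qℚ Q.^ suc (suc (n ℕ.+ n))) εt)
          (solve 2 (λ B a → B :+ a :* (:- :# 1) :- B := :- a) refl (qℚ Q.^ suc (suc (n ℕ.+ n))) (A (suc n))))
    go (inj₂ (n , refl)) = ≤-trans (≤-reflexive (trans (cong (λ z → z * z) dev) (trans (solve 3 (λ q a e → q :* (a :* e) :* (q :* (a :* e)) := q :* q :* (a :* a) :* (e :* e)) refl qℚ (A (suc n)) (η t))
          (trans (cong₂ (λ x y → qℚ * qℚ * x * y) (A² (suc n)) (η²≡1 t≢0)) (solve 2 (λ q X → q :* q :* X :* :# 1 := q :* (q :* X)) refl qℚ (qℚ Q.^ (suc n ℕ.+ suc n)))))))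
        (≤-trans (^-mono {suc (suc (suc n ℕ.+ suc n))} {suc (suc (n ℕ.+ n)) ℕ.+ suc (suc (n ℕ.+ n))} len) (≤-reflexive (Q.^-+ qℚ (suc (suc (n ℕ.+ n))) (suc (suc (n ℕ.+ n))))))
      where
      len : suc (suc (suc n ℕ.+ suc n)) ℕ.≤ suc (suc (n ℕ.+ n)) ℕ.+ suc (suc (n ℕ.+ n))
      len = ℕP.≤-trans (ℕP.≤-reflexive (cong (λ m → suc (suc (suc m))) (ℕP.+-suc n n))) (ℕP.≤-trans (ℕP.≤-reflexive (ℕP.+-comm 2 (suc (suc (n ℕ.+ n))))) (ℕP.+-monoʳ-≤ (suc (suc (n ℕ.+ n))) (ℕ.s≤s (ℕ.s≤s ℕ.z≤n))))
      dev : qℚ * sphereSize (suc (suc (suc (n ℕ.+ n)))) t - qℚ Q.^ suc (suc (suc (n ℕ.+ n))) ≡ qℚ * (A (suc n) * η t)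
      dev = trans (cong (λ z → qℚ * z - qℚ Q.^ suc (suc (suc (n ℕ.+ n)))) (subst (λ m → sphereSize (suc (suc m)) t ≡ qℚ Q.^ suc m + A (suc n) * η t) (ℕP.+-suc n n) (sphereSize-odd (suc n) t)))
        (solve 3 (λ q B a → q :* (B :+ a) :- q :* B := q :* a) refl qℚ (qℚ Q.^ suc (suc (n ℕ.+ n))) (A (suc n) * η t))

-- The second moment of the sphere counts over E

module SecondMoment where
  open import Data.Nat as ℕ using (ℕ; zero; suc; _≤_; _^_)
  open import Data.Nat.Divisibility using (_∣_; divides)
  open import Data.Integer as ℤ using ()
  open import Data.List using (List; []; _∷_; length)
  open import Data.List.Relation.Unary.Unique.Propositional using (Unique)
  open import Data.List.Relation.Unary.All using ([]; _∷_)
  open import Data.List.Membership.Propositional using (_∈_)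
  open import Data.Product using (∃; _,_)
  open import Data.Rational as ℚ using (ℚ; 1ℚ; 0ℚ)
  open import Relation.Nullary using (¬_; Dec; yes; no; contradiction)
  open import Relation.Binary.PropositionalEquality using (_≡_; _≢_; refl; sym; trans; cong; cong₂; subst; subst₂)
  import Data.Nat.Properties as ℕP
  import Data.Integer.Properties as ℤP
  import Data.Rational.Properties as ℚP
  open import Data.Rational.Unnormalised as ℚᵘ using (mkℚᵘ; *≡*)
  import Data.Rational.Unnormalised.Properties as ℚᵘP
  open import Data.List.Membership.DecPropositional using (_∈?_)
  open import Data.List.Relation.Unary.Any using (here)
  open import Data.Sum using (_⊎_; inj₁; inj₂)
  open Sums
  open Q using (solve; _:+_; _:*_; :-_; _:-_; _:=_; :#)
  open Q using (⟨_⟩; ⟨yes⟩; ⟨no⟩; sumL)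

  /-* : ∀ n m {{_ : ℕ.NonZero m}} → (ℤ.+ n ℚ./ m) ℚ.* toℚ m ≡ toℚ n
  /-* n (suc m) = ℚP.toℚᵘ-injective (begin
    ℚ.toℚᵘ ((ℤ.+ n ℚ./ suc m) ℚ.* toℚ (suc m))                 ≈⟨ ℚP.toℚᵘ-homo-* (ℤ.+ n ℚ./ suc m) (toℚ (suc m)) ⟩
    ℚ.toℚᵘ (ℤ.+ n ℚ./ suc m) ℚᵘ.* ℚ.toℚᵘ (toℚ (suc m))         ≈⟨ ℚᵘP.*-cong (ℚP.toℚᵘ-fromℚᵘ (mkℚᵘ (ℤ.+ n) m)) (ℚP.toℚᵘ-fromℚᵘ (mkℚᵘ (ℤ.+ suc m) 0)) ⟩
    mkℚᵘ (ℤ.+ n) m ℚᵘ.* mkℚᵘ (ℤ.+ suc m) 0                     ≈⟨ *≡* (trans (ℤP.*-assoc (ℤ.+ n) (ℤ.+ suc m) (ℤ.+ 1)) (cong (ℤ.+ n ℤ.*_) (trans (ℤP.*-identityʳ (ℤ.+ suc m)) (cong (λ k → ℤ.+ k) (sym (ℕP.*-identityʳ (suc m))))))) ⟩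
    mkℚᵘ (ℤ.+ n) 0                                             ≈⟨ ℚP.toℚᵘ-fromℚᵘ (mkℚᵘ (ℤ.+ n) 0) ⟨
    ℚ.toℚᵘ (toℚ n)                                             ∎)
    where open import Relation.Binary.Reasoning.Setoid ℚᵘP.≃-setoid

  module _ (F : FiniteField) where
    private module F = Field F

    odd-order : ¬ (2 ∣ F.order) → ∃ λ k → F.order ≡ suc (k ℕ.+ k)
    odd-order h = go F.order h
      where
      go : ∀ n → ¬ (2 ∣ n) → ∃ λ k → n ≡ suc (k ℕ.+ k)
      go zero    h = contradiction (divides 0 refl) h
      go (suc zero) h = 0 , refl
      go (suc (suc n)) h with go n (λ { (divides k p) → h (divides (suc k) (cong (λ m → suc (suc m)) p)) })
      ... | k , p = suc k , cong (λ m → suc (suc m)) (trans p (sym (ℕP.+-suc k k)))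

    order≥3 : ∀ {k} → F.order ≡ suc (k ℕ.+ k) → 3 ≤ F.order
    order≥3 {zero} p = contradiction (singleton (FiniteField.elems F) p (FiniteField.elems-complete F F.1#) (FiniteField.elems-complete F F.0#)) F.1≢0
      where
      singleton : ∀ (xs : List F.Carrier) → length xs ≡ 1 → ∀ {x y} → x ∈ xs → y ∈ xs → x ≡ y
      singleton (x ∷ []) _ (here refl) (here refl) = refl
    order≥3 {suc k} p = subst (3 ≤_) (sym p) (ℕ.s≤s (ℕ.s≤s (subst (1 ≤_) (sym (ℕP.+-suc k k)) (ℕ.s≤s ℕ.z≤n))))

  module Moment (F : FiniteField) (k : ℕ) (q≡ : FiniteField.order F ≡ suc (k ℕ.+ k)) (3≤q : 3 ≤ FiniteField.order F)
                (d′ : ℕ) (t : Field.Carrier F) (t≢0 : t ≢ Field.0# F)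
                (E : List (FiniteField.Point F (suc (suc d′)))) (uE : Unique E) where
    private
      module F = Field F
      d = suc (suc d′)
      module D = SphereSums F k q≡ 3≤q d
      module S = SphereSize F (F.odd⇒2≢0 {k} q≡)
    open Points F
    open FiniteField F using (sphereCount; _/q)
    open Q using (∑; ∑-cong)
    private
      points = D.points
      _≟ᵖ_ = Enum._≟_ points

      qℚ Nℚ Qd : ℚ
      qℚ = toℚ F.order
      Nℚ = toℚ (length E)
      Qd = qℚ Q.^ d

      0<q : 0ℚ ℚ.< qℚ
      0<q = D.T.0<q

      0<Qd : 0ℚ ℚ.< Qd
      0<Qd = Q.0<^ d 0<q

      instance
        Qd-nonZero : ℚ.NonZero Qd
        Qd-nonZero = ℚP.pos⇒nonZero Qd {{ℚ.positive 0<Qd}}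

      m : ℚ
      m = Nℚ ℚ.* ℚ.1/ Qd

      m*Qd : m ℚ.* Qd ≡ Nℚ
      m*Qd = trans (ℚP.*-assoc Nℚ (ℚ.1/ Qd) Qd) (trans (cong (Nℚ ℚ.*_) (ℚP.*-inverseˡ Qd)) (ℚP.*-identityʳ Nℚ))

      -- Built from point masses, so that sums against it are sums over the list; uniqueness of the
      -- list makes it an indicator function.
      e : Point d → ℚ
      e x = sumL E (λ y → ⟨ x ≟ᵖ y ⟩)

      ∑e* : ∀ (h : Point d → ℚ) → ∑ points (λ x → e x ℚ.* h x) ≡ sumL E h
      ∑e* h = trans (∑-cong points (λ x → trans (ℚP.*-comm (e x) (h x)) (trans (Q.sumL-*ˡ E (h x) _) (Q.sumL-cong E (λ y → ℚP.*-comm (h x) ⟨ x ≟ᵖ y ⟩)))))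
        (trans (Q.sumL-swap (Enum.elems points) E (λ x y → ⟨ x ≟ᵖ y ⟩ ℚ.* h x)) (Q.sumL-cong E (λ y → Q.∑-δ points h y)))

      e-∈ : ∀ {x} → x ∈ E → e x ≡ 1ℚ
      e-∈ {x} x∈E = trans (Q.sumL-only (λ y → ⟨ x ≟ᵖ y ⟩) uE x∈E (λ y y≢x → ⟨no⟩ (x ≟ᵖ y) (λ p → y≢x (sym p)))) (⟨yes⟩ (x ≟ᵖ x) refl)

      e-∉ : ∀ {x} → ¬ (x ∈ E) → e x ≡ 0ℚ
      e-∉ {x} x∉E = trans (Q.sumL-cong∈ E (λ {y} y∈E → ⟨no⟩ (x ≟ᵖ y) (λ { refl → x∉E y∈E }))) (Q.sumL-ε E)

      e≤1 : ∀ x → e x ℚ.≤ 1ℚ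
      e≤1 x = go (_∈?_ _≟ᵖ_ x E)
        where
        go : Dec (x ∈ E) → e x ℚ.≤ 1ℚ
        go (yes p) = ℚP.≤-reflexive (e-∈ p)
        go (no p)  = ℚP.≤-trans (ℚP.≤-reflexive (e-∉ p)) (ℚP.nonNegative⁻¹ 1ℚ)

      ∑e : ∑ points e ≡ Nℚ
      ∑e = trans (∑-cong points (λ x → sym (ℚP.*-identityʳ (e x)))) (trans (∑e* (λ _ → 1ℚ)) (trans (Q.sumL-const-ℚ E 1ℚ) (ℚP.*-identityʳ Nℚ)))

      ∑-const-points : ∀ c → ∑ points (λ _ → c) ≡ Qd ℚ.* c
      ∑-const-points c = trans (Q.sumL-const-ℚ (Enum.elems points) c) (cong (ℚ._* c) (trans (cong toℚ (card-vecEnum F.enum d)) (Q.toℚ-^ F.order d)))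

      -- E minus its density m = |E|/q^d, which gives the sum 0 that `sphereSum-bound` requires.
      f : Point d → ℚ
      f x = e x ℚ.+ ℚ.- m

      ∑f : ∑ points f ≡ 0ℚ
      ∑f = trans (Q.∑-∙ points e (λ _ → ℚ.- m)) (trans (cong₂ ℚ._+_ (trans ∑e (sym m*Qd)) (∑-const-points (ℚ.- m)))
        (solve 2 (λ m Q → m :* Q :+ Q :* (:- m) := :# 0) refl m Qd))

      ∑f²≤ : ∑ points (λ x → f x ℚ.* f x) ℚ.≤ Nℚ
      ∑f²≤ = Q.≤-by (m ℚ.* m ℚ.* Qd) (Q.0≤* (Q.square-nonneg m) (ℚP.<⇒≤ 0<Qd)) (trans (cong (λ z → Nℚ ℚ.- z) expand)
          (trans (cong (λ z → z ℚ.- (z ℚ.+ (ℚ.- (m ℚ.+ m)) ℚ.* z ℚ.+ Qd ℚ.* (m ℚ.* m))) (sym m*Qd))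
            (solve 2 (λ m Q → m :* Q :- (m :* Q :+ (:- (m :+ m)) :* (m :* Q) :+ Q :* (m :* m)) := m :* m :* Q) refl m Qd)))
        where
        expand : ∑ points (λ x → f x ℚ.* f x) ≡ Nℚ ℚ.+ (ℚ.- (m ℚ.+ m)) ℚ.* Nℚ ℚ.+ Qd ℚ.* (m ℚ.* m)
        expand = trans (∑-cong points (λ x → solve 2 (λ e m → (e :+ (:- m)) :* (e :+ (:- m)) := e :* e :+ (:- (m :+ m)) :* e :+ m :* m) refl (e x) m))
          (trans (Q.∑-∙ points _ _) (cong₂ ℚ._+_ (trans (Q.∑-∙ points _ _) (cong₂ ℚ._+_
            (trans (∑e* e) (trans (Q.sumL-cong∈ E e-∈) (trans (Q.sumL-const-ℚ E 1ℚ) (ℚP.*-identityʳ Nℚ))))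
            (trans (sym (Q.∑-*ˡ points (ℚ.- (m ℚ.+ m)) e)) (cong ((ℚ.- (m ℚ.+ m)) ℚ.*_) ∑e)))) (∑-const-points (m ℚ.* m))))

    ν : Point d → ℚ
    ν x = toℚ (sphereCount t E x)

    μ : ℚ
    μ = m ℚ.* S.sphereSize d t

    private
      sphereSum-e : ∀ x → D.sphereSum t t≢0 e x ≡ ν x
      sphereSum-e x = trans (sym (Q.∑-reindex points points (x ⊟_) (x ⊟_) (⊟⊟ x) (⊟⊟ x) (λ y → ⟨ ‖ y ‖ F.≟ t ⟩ ℚ.* e (x ⊟ y))))
        (trans (∑-cong points (λ y → trans (cong (λ z → ⟨ ‖ x ⊟ y ‖ F.≟ t ⟩ ℚ.* e z) (⊟⊟ x y)) (ℚP.*-comm ⟨ ‖ x ⊟ y ‖ F.≟ t ⟩ (e y))))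
          (trans (∑e* (λ y → ⟨ ‖ x ⊟ y ‖ F.≟ t ⟩)) (trans (Q.sumL-cong E (λ y → cong (λ z → ⟨ ‖ z ‖ F.≟ t ⟩) (sym (⊖≡⊟ x y)))) (Q.sumL-count _ E))))

      sphereSum-f : ∀ x → D.sphereSum t t≢0 f x ≡ ν x ℚ.- μ
      sphereSum-f x = trans (∑-cong points (λ y → solve 3 (λ i e m → i :* (e :+ (:- m)) := i :* e :+ (:- (m :* i))) refl ⟨ ‖ y ‖ F.≟ t ⟩ (e (x ⊟ y)) m))
        (trans (Q.∑-∙ points _ _) (cong₂ ℚ._+_ (sphereSum-e x) (trans (sym (Q.∑-neg points _)) (cong ℚ.-_ (sym (Q.∑-*ˡ points m _))))))

    -- `sphereSum-bound` controls the squared deviation over the whole space; its terms are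
    -- nonnegative, so those outside E may be dropped.
    moment : qℚ ℚ.* qℚ ℚ.* sumL E (λ x → (ν x ℚ.- μ) ℚ.* (ν x ℚ.- μ)) ℚ.≤ toℚ 6 ℚ.* toℚ (F.order ^ suc d) ℚ.* Nℚ
    moment = ℚP.≤-trans (Q.*-monoˡ (qℚ ℚ.* qℚ) (Q.square-nonneg qℚ) restrict)
      (ℚP.≤-trans (ℚP.≤-trans (ℚP.≤-reflexive (cong (qℚ ℚ.* qℚ ℚ.*_) (∑-cong points (λ x → cong (λ z → z ℚ.* z) (sym (sphereSum-f x)))))) (D.sphereSum-bound t t≢0 f ∑f))
        (ℚP.≤-trans (Q.*-monoˡ (toℚ 6 ℚ.* qℚ Q.^ suc d) (Q.0≤* (Q.0≤toℚ 6) (Q.0≤^ (suc d) (Q.0≤toℚ F.order))) ∑f²≤)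
          (ℚP.≤-reflexive (cong (λ z → toℚ 6 ℚ.* z ℚ.* Nℚ) (sym (Q.toℚ-^ F.order (suc d)))))))
      where
      restrict : sumL E (λ x → (ν x ℚ.- μ) ℚ.* (ν x ℚ.- μ)) ℚ.≤ ∑ points (λ x → (ν x ℚ.- μ) ℚ.* (ν x ℚ.- μ))
      restrict = ℚP.≤-trans (ℚP.≤-reflexive (sym (∑e* _))) (Q.sumL-mono (Enum.elems points) (λ {x} _ → ℚP.≤-trans
        (ℚP.*-monoʳ-≤-nonNeg ((ν x ℚ.- μ) ℚ.* (ν x ℚ.- μ)) {{ℚ.nonNegative (Q.square-nonneg (ν x ℚ.- μ))}} (e≤1 x)) (ℚP.≤-reflexive (ℚP.*-identityˡ ((ν x ℚ.- μ) ℚ.* (ν x ℚ.- μ))))))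

    α : ℚ
    α = length E /q

    α*q : α ℚ.* qℚ ≡ Nℚ
    α*q = /-* (length E) F.order {{FiniteField.order-nonZero F}}

    0≤α : 0ℚ ℚ.≤ α
    0≤α = Q.*-cancelˡ-≤ {z = qℚ} 0<q (subst₂ ℚ._≤_ (sym (ℚP.*-zeroʳ qℚ)) (trans (sym α*q) (ℚP.*-comm α qℚ)) (Q.0≤toℚ (length E)))

    private
      q′ : ℚ
      q′ = qℚ Q.^ suc d′

      m*q′ : m ℚ.* q′ ≡ α
      m*q′ = cancel (trans (solve 3 (λ q m x → q :* (m :* x) := m :* (q :* x)) refl qℚ m q′) (trans m*Qd (trans (sym α*q) (ℚP.*-comm α qℚ))))
        where
        cancel : ∀ {x y} → qℚ ℚ.* x ≡ qℚ ℚ.* y → x ≡ y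
        cancel p = ℚP.≤-antisym (Q.*-cancelˡ-≤ 0<q (ℚP.≤-reflexive p)) (Q.*-cancelˡ-≤ 0<q (ℚP.≤-reflexive (sym p)))

      0≤m : 0ℚ ℚ.≤ m
      0≤m = Q.*-cancelˡ-≤ {z = Qd} 0<Qd (subst₂ ℚ._≤_ (sym (ℚP.*-zeroʳ Qd)) (trans (sym m*Qd) (ℚP.*-comm m Qd)) (Q.0≤toℚ (length E)))

      dev : ℚ
      dev = qℚ ℚ.* S.sphereSize d t ℚ.- Qd

      3≤qℚ : toℚ 3 ℚ.≤ qℚ
      3≤qℚ = Q.toℚ-mono 3≤q

      -- q (μ - α) = m dev, and |m dev| ≤ m q^{d-1} = α
      q*dev : qℚ ℚ.* (μ ℚ.- α) ≡ m ℚ.* dev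
      q*dev = trans (solve 4 (λ q m n a → q :* (m :* n :- a) := m :* (q :* n) :- a :* q) refl qℚ m (S.sphereSize d t) α)
        (trans (cong (λ z → m ℚ.* (qℚ ℚ.* S.sphereSize d t) ℚ.- z) (trans α*q (sym m*Qd))) (solve 3 (λ m x y → m :* x :- m :* y := m :* (x :- y)) refl m (qℚ ℚ.* S.sphereSize d t) Qd))

      -- This is where q ≥ 3 enters; a negative x is covered by 0 ≤ α instead.
      third : ∀ {x} → qℚ ℚ.* x ℚ.≤ α → toℚ 3 ℚ.* x ℚ.≤ α
      third {x} h = go (ℚP.≤-total 0ℚ x)
        where
        go : 0ℚ ℚ.≤ x ⊎ x ℚ.≤ 0ℚ → toℚ 3 ℚ.* x ℚ.≤ α
        go (inj₁ 0≤x) = ℚP.≤-trans (ℚP.*-monoʳ-≤-nonNeg x {{ℚ.nonNegative 0≤x}} 3≤qℚ) h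
        go (inj₂ x≤0) = ℚP.≤-trans (Q.*-monoˡ (toℚ 3) (Q.0≤toℚ 3) x≤0) 0≤α

    μ-upper : toℚ 3 ℚ.* (μ ℚ.- α) ℚ.≤ α
    μ-upper = third (ℚP.≤-trans (ℚP.≤-reflexive q*dev) (ℚP.≤-trans (Q.*-monoˡ m 0≤m (Q.square-≤⇒≤ (Q.0≤^ (suc d′) (Q.0≤toℚ F.order)) (S.sphereSize-deviation d′ t≢0))) (ℚP.≤-reflexive m*q′)))

    μ-lower : toℚ 3 ℚ.* (α ℚ.- μ) ℚ.≤ α
    μ-lower = third (ℚP.≤-trans (ℚP.≤-reflexive (trans (solve 3 (λ q a b → q :* (a :- b) := :- (q :* (b :- a))) refl qℚ α μ) (trans (cong ℚ.-_ q*dev) (solve 2 (λ m x → :- (m :* x) := m :* (:- x)) refl m dev))))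
      (ℚP.≤-trans (Q.*-monoˡ m 0≤m (Q.square-≤⇒≤ (Q.0≤^ (suc d′) (Q.0≤toℚ F.order)) (ℚP.≤-trans (ℚP.≤-reflexive (solve 1 (λ x → (:- x) :* (:- x) := x :* x) refl dev)) (S.sphereSize-deviation d′ t≢0)))) (ℚP.≤-reflexive m*q′)))

-- Chebyshev's inequality with explicit constants

module ChebyshevBound where
  open import Data.Integer as ℤ using ()
  open import Data.Rational as ℚ using (ℚ; 1ℚ; 0ℚ)
  import Data.Rational.Properties as ℚP
  open import Relation.Binary.PropositionalEquality using (_≡_; refl; sym; trans; cong; cong₂; subst; subst₂)
  open Q using (solve; _:+_; _:*_; _:-_; _:=_; :#)

  -- A bad point deviates from μ by at least (2/3 - 1/λ) |E|/q,
  -- and C (2 - 3/λ) ≥ 8.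
  module Chebyshev {N q X C lam u α : ℚ} (0<N : 0ℚ ℚ.< N) (α*q : α ℚ.* q ≡ N) (0≤α : 0ℚ ℚ.≤ α)
                   (4<C : toℚ 4 ℚ.< C) (size : C ℚ.* C ℚ.* X ℚ.≤ N ℚ.* N)
                   (0<u : 0ℚ ℚ.< u) (lam*u : lam ℚ.* u ≡ 1ℚ) (2Cu≤ : toℚ 2 ℚ.* C ℚ.* u ℚ.≤ C ℚ.- toℚ 4) where

    -- A lower bound for three times the deviation of a bad point from μ; the factor 3 clears the
    -- denominator in |μ - α| ≤ α/3.
    T : ℚ
    T = (toℚ 2 ℚ.- toℚ 3 ℚ.* u) ℚ.* α

    private
      0<C : 0ℚ ℚ.< C
      0<C = ℚP.≤-<-trans (Q.0≤toℚ 4) 4<C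

      -- 2 C u ≤ C - 4 gives (2 - 3u) C ≥ 2C - (3/2)(C - 4) = C/2 + 6, and C > 4.
      8≤ : toℚ 8 ℚ.≤ (toℚ 2 ℚ.- toℚ 3 ℚ.* u) ℚ.* C
      8≤ = Q.*-cancelˡ-≤ {z = toℚ 2} (ℚP.positive⁻¹ (toℚ 2)) (Q.≤-by (toℚ 3 ℚ.* ((C ℚ.- toℚ 4) ℚ.- toℚ 2 ℚ.* C ℚ.* u) ℚ.+ (C ℚ.- toℚ 4))
        (Q.0≤+ (Q.0≤* (Q.0≤toℚ 3) (Q.≤⇒0≤- 2Cu≤)) (Q.≤⇒0≤- (ℚP.<⇒≤ 4<C)))
        (solve 2 (λ C u → :# 2 :* ((:# 2 :- :# 3 :* u) :* C) :- :# 2 :* :# 8 := :# 3 :* ((C :- :# 4) :- :# 2 :* C :* u) :+ (C :- :# 4)) refl C u))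

      0≤2-3u : 0ℚ ℚ.≤ toℚ 2 ℚ.- toℚ 3 ℚ.* u
      0≤2-3u = Q.*-cancelˡ-≤ {z = C} 0<C (subst₂ ℚ._≤_ (sym (ℚP.*-zeroʳ C)) (ℚP.*-comm (toℚ 2 ℚ.- toℚ 3 ℚ.* u) C) (ℚP.≤-trans (Q.0≤toℚ 8) 8≤))

    0≤T : 0ℚ ℚ.≤ T
    0≤T = Q.0≤* 0≤2-3u 0≤α

    module _ {μ : ℚ} (upper : toℚ 3 ℚ.* (μ ℚ.- α) ℚ.≤ α) (lower : toℚ 3 ℚ.* (α ℚ.- μ) ℚ.≤ α) where

      low-deviation : ∀ {ν} → ν ℚ.≤ u ℚ.* α → T ℚ.≤ toℚ 3 ℚ.* (μ ℚ.- ν)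
      low-deviation {ν} h = Q.≤-by ((α ℚ.- toℚ 3 ℚ.* (α ℚ.- μ)) ℚ.+ toℚ 3 ℚ.* (u ℚ.* α ℚ.- ν)) (Q.0≤+ (Q.≤⇒0≤- lower) (Q.0≤* (Q.0≤toℚ 3) (Q.≤⇒0≤- h)))
        (solve 4 (λ m v u a → :# 3 :* (m :- v) :- (:# 2 :- :# 3 :* u) :* a := (a :- :# 3 :* (a :- m)) :+ :# 3 :* (u :* a :- v)) refl μ ν u α)

      -- A point above lam α is at least as far from α as one below u α, because lam - 1 ≥ 1 - u,
      -- that is, lam + 1/lam ≥ 2.
      high-deviation : ∀ {ν} → lam ℚ.* α ℚ.≤ ν → T ℚ.≤ toℚ 3 ℚ.* (ν ℚ.- μ)
      high-deviation {ν} h = Q.≤-by ((α ℚ.- toℚ 3 ℚ.* (μ ℚ.- α)) ℚ.+ toℚ 3 ℚ.* (ν ℚ.- lam ℚ.* α) ℚ.+ toℚ 3 ℚ.* ((lam ℚ.+ u ℚ.- toℚ 2) ℚ.* α))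
        (Q.0≤+ (Q.0≤+ (Q.≤⇒0≤- upper) (Q.0≤* (Q.0≤toℚ 3) (Q.≤⇒0≤- h))) (Q.0≤* (Q.0≤toℚ 3) (Q.0≤* am-gm 0≤α)))
        (solve 5 (λ m v u l a → :# 3 :* (v :- m) :- (:# 2 :- :# 3 :* u) :* a := (a :- :# 3 :* (m :- a)) :+ :# 3 :* (v :- l :* a) :+ :# 3 :* ((l :+ u :- :# 2) :* a)) refl μ ν u lam α)
        where
        am-gm : 0ℚ ℚ.≤ lam ℚ.+ u ℚ.- toℚ 2
        am-gm = subst (0ℚ ℚ.≤_) (trans (solve 2 (λ l u → (l :- :# 1) :* (l :- :# 1) :* u := (l :* u) :* l :- :# 2 :* (l :* u) :+ u) refl lam u)
          (trans (cong (λ z → z ℚ.* lam ℚ.- toℚ 2 ℚ.* z ℚ.+ u) lam*u) (solve 2 (λ l u → :# 1 :* l :- :# 2 :* :# 1 :+ u := l :+ u :- :# 2) refl lam u)))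
          (Q.0≤* (Q.square-nonneg (lam ℚ.- 1ℚ)) (ℚP.<⇒≤ 0<u))

    -- Here b counts the bad points and V sums the squared deviations. Multiply by N² = α² q² and
    -- replace 8 by (2 - 3u) C on the left; the hypotheses then bound this by 54 C² X N, and C² X ≤
    -- N².
    bad-bound : ∀ {b V} → 0ℚ ℚ.≤ b → b ℚ.* (T ℚ.* T) ℚ.≤ toℚ 9 ℚ.* V → q ℚ.* q ℚ.* V ℚ.≤ toℚ 6 ℚ.* X ℚ.* N → toℚ 8 ℚ.* toℚ 8 ℚ.* b ℚ.≤ toℚ 9 ℚ.* toℚ 6 ℚ.* N
    bad-bound {b} {V} 0≤b h h′ = Q.*-cancelˡ-≤ {z = N ℚ.* N} (Q.0<* 0<N 0<N) (ℚP.≤-trans (ℚP.≤-trans (ℚP.≤-reflexive (solve 2 (λ N b → N :* N :* (:# 8 :* :# 8 :* b) := N :* N :* b :* (:# 8 :* :# 8)) refl N b))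
        (Q.*-monoˡ (N ℚ.* N ℚ.* b) (Q.0≤* (Q.square-nonneg N) 0≤b) (Q.*-mono (Q.0≤toℚ 8) (ℚP.≤-trans (Q.0≤toℚ 8) 8≤) 8≤ 8≤)))
      (ℚP.≤-trans (ℚP.≤-reflexive (trans (cong (λ z → z ℚ.* z ℚ.* b ℚ.* (w ℚ.* C ℚ.* (w ℚ.* C))) (sym α*q))
          (trans (cong₂ (λ x y → x ℚ.* b ℚ.* y) (squares α q) (squares w C))
            (trans (solve 5 (λ A Q b W C → A :* Q :* b :* (W :* C) := C :* (Q :* (b :* (W :* A)))) refl (α ℚ.* α) (q ℚ.* q) b (w ℚ.* w) (C ℚ.* C))
              (cong (λ z → C ℚ.* C ℚ.* (q ℚ.* q ℚ.* (b ℚ.* z))) (sym (squares w α)))))))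
      (ℚP.≤-trans (Q.*-monoˡ (C ℚ.* C) (Q.square-nonneg C) (ℚP.≤-trans (Q.*-monoˡ (q ℚ.* q) (Q.square-nonneg q) h)
          (ℚP.≤-trans (ℚP.≤-reflexive (solve 2 (λ q V → q :* q :* (:# 9 :* V) := :# 9 :* (q :* q :* V)) refl q V)) (Q.*-monoˡ (toℚ 9) (Q.0≤toℚ 9) h′))))
      (ℚP.≤-trans (ℚP.≤-reflexive (solve 3 (λ C X N → C :* C :* (:# 9 :* (:# 6 :* X :* N)) := :# 9 :* :# 6 :* N :* (C :* C :* X)) refl C X N))
      (ℚP.≤-trans (Q.*-monoˡ (toℚ 9 ℚ.* toℚ 6 ℚ.* N) (Q.0≤* (Q.0≤* (Q.0≤toℚ 9) (Q.0≤toℚ 6)) (ℚP.<⇒≤ 0<N)) size) (ℚP.≤-reflexive (solve 1 (λ N → :# 9 :* :# 6 :* N :* (N :* N) := N :* N :* (:# 9 :* :# 6 :* N)) refl N)))))))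
      where
      w = toℚ 2 ℚ.- toℚ 3 ℚ.* u
      squares : ∀ x y → x ℚ.* y ℚ.* (x ℚ.* y) ≡ x ℚ.* x ℚ.* (y ℚ.* y)
      squares x y = solve 2 (λ x y → x :* y :* (x :* y) := x :* x :* (y :* y)) refl x y

    -- At most 27/32 of N is bad, so at least 5/32 is good, while u (1 - 2u)/2 ≤ 1/16 with equality
    -- at u = 1/4; hence the square of 4u - 1.
    good-bound : ∀ {b g} → toℚ 8 ℚ.* toℚ 8 ℚ.* b ℚ.≤ toℚ 9 ℚ.* toℚ 6 ℚ.* N → g ℚ.+ b ≡ N → (1ℚ ℚ.- toℚ 2 ℚ.* u) ℚ.* (ℤ.+ 1 ℚ./ 2) ℚ.* u ℚ.* N ℚ.≤ g
    good-bound {b} {g} h g+b = Q.*-cancelˡ-≤ {z = toℚ 8 ℚ.* toℚ 8} (ℚP.positive⁻¹ (toℚ 8 ℚ.* toℚ 8)) (Q.≤-by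
      ((toℚ 9 ℚ.* toℚ 6 ℚ.* N ℚ.- toℚ 8 ℚ.* toℚ 8 ℚ.* b) ℚ.+ toℚ 6 ℚ.* N ℚ.+ toℚ 4 ℚ.* ((toℚ 4 ℚ.* u ℚ.- 1ℚ) ℚ.* (toℚ 4 ℚ.* u ℚ.- 1ℚ)) ℚ.* N)
      (Q.0≤+ (Q.0≤+ (Q.≤⇒0≤- h) (Q.0≤* (Q.0≤toℚ 6) (ℚP.<⇒≤ 0<N))) (Q.0≤* (Q.0≤* (Q.0≤toℚ 4) (Q.square-nonneg (toℚ 4 ℚ.* u ℚ.- 1ℚ))) (ℚP.<⇒≤ 0<N)))
      (subst (λ M → toℚ 8 ℚ.* toℚ 8 ℚ.* g ℚ.- toℚ 8 ℚ.* toℚ 8 ℚ.* ((1ℚ ℚ.- toℚ 2 ℚ.* u) ℚ.* (ℤ.+ 1 ℚ./ 2) ℚ.* u ℚ.* M) ≡ (toℚ 9 ℚ.* toℚ 6 ℚ.* M ℚ.- toℚ 8 ℚ.* toℚ 8 ℚ.* b) ℚ.+ toℚ 6 ℚ.* M ℚ.+ toℚ 4 ℚ.* ((toℚ 4 ℚ.* u ℚ.- 1ℚ) ℚ.* (toℚ 4 ℚ.* u ℚ.- 1ℚ)) ℚ.* M) g+b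
        (trans (solve 4 (λ g b u h → :# 8 :* :# 8 :* g :- :# 8 :* :# 8 :* ((:# 1 :- :# 2 :* u) :* h :* u :* (g :+ b)) := :# 8 :* :# 8 :* g :- (:# 2 :* h) :* (:# 8 :* :# 4 :* ((:# 1 :- :# 2 :* u) :* u :* (g :+ b)))) refl g b u (ℤ.+ 1 ℚ./ 2))
          (solve 3 (λ g b u → :# 8 :* :# 8 :* g :- :# 1 :* (:# 8 :* :# 4 :* ((:# 1 :- :# 2 :* u) :* u :* (g :+ b)))
            := (:# 9 :* :# 6 :* (g :+ b) :- :# 8 :* :# 8 :* b) :+ :# 6 :* (g :+ b) :+ :# 4 :* ((:# 4 :* u :- :# 1) :* (:# 4 :* u :- :# 1)) :* (g :+ b)) refl g b u))))

-- Selection of the good points of E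

open import Data.Nat as ℕ using (ℕ; _≤_; _^_; suc)
open import Data.Nat.Divisibility using (_∣_)
open import Data.Integer as ℤ using ()
open import Data.List using (List; length; filter; []; _∷_)
open import Data.List.Relation.Unary.Unique.Propositional using (Unique; []; _∷_)
open import Data.List.Relation.Unary.All as All using (All; []; _∷_)
open import Data.List.Membership.Propositional using (_∈_)
open import Data.Product using (∃; _×_; _,_; proj₁; proj₂)
open import Data.Rational as ℚ using (ℚ; Positive; 1ℚ; 0ℚ)
open import Relation.Nullary using (¬_; Dec; yes; no; ¬?; contradiction)
open import Relation.Binary.PropositionalEquality using (_≡_; refl; sym; trans; cong; subst₂)
import Data.Nat.Properties as ℕP
import Data.Rational.Properties as ℚP
import Data.List.Relation.Unary.All.Properties as AllP
import Data.List.Relation.Unary.Unique.Propositional.Properties as UniqueP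
open import Data.List.Membership.Propositional.Properties using (∈-filter⁻)
open import Relation.Nullary.Decidable using (_×-dec_)
open Q using (solve; _:*_; _:-_; _:=_; :#)
open Q using (⟨_⟩; sumL)
open SecondMoment
open ChebyshevBound

inv-* : ∀ p (pos : Positive p) → p ℚ.* inv p pos ≡ 1ℚ
inv-* p pos = ℚP.*-inverseʳ p {{ℚP.pos⇒nonZero p {{pos}}}}

inv-pos : ∀ p (pos : Positive p) → 0ℚ ℚ.< inv p pos
inv-pos p pos = ℚP.positive⁻¹ (inv p pos) {{ℚP.1/pos⇒pos p {{pos}}}}

-- Multiplying lam > 2C/(C - 4) by C - 4 and dividing by lam puts the hypothesis into the form
-- linear in 1/lam that the Chebyshev estimate uses.
lamBound-inv : ∀ {C lam} (C>4 : toℚ 4 ℚ.< C) (lam>0 : Positive lam) → lamBound C C>4 ℚ.< lam →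
  toℚ 2 ℚ.* C ℚ.* inv lam lam>0 ℚ.≤ C ℚ.- toℚ 4
lamBound-inv {C} {lam} C>4 lam>0 h = Q.*-cancelˡ-≤ {z = lam} (ℚP.positive⁻¹ lam {{lam>0}})
  (subst₂ ℚ._≤_ lhs refl (ℚP.≤-trans (ℚP.≤-reflexive (sym lhs₁)) (ℚP.*-monoʳ-≤-nonNeg D {{ℚ.nonNegative (ℚP.<⇒≤ 0<D)}} (ℚP.<⇒≤ h))))
  where
  D = C ℚ.- toℚ 4
  0<D : 0ℚ ℚ.< D
  0<D = ℚP.positive⁻¹ D {{sub-pos C>4}}
  lhs₁ : lamBound C C>4 ℚ.* D ≡ toℚ 2 ℚ.* C
  lhs₁ = trans (ℚP.*-assoc (toℚ 2 ℚ.* C) (inv D (sub-pos C>4)) D) (trans (cong (toℚ 2 ℚ.* C ℚ.*_) (trans (ℚP.*-comm (inv D (sub-pos C>4)) D) (inv-* D (sub-pos C>4)))) (ℚP.*-identityʳ (toℚ 2 ℚ.* C)))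
  lhs : toℚ 2 ℚ.* C ≡ lam ℚ.* (toℚ 2 ℚ.* C ℚ.* inv lam lam>0)
  lhs = sym (trans (solve 3 (λ l x u → l :* (x :* u) := x :* (l :* u)) refl lam (toℚ 2 ℚ.* C) (inv lam lam>0)) (trans (cong (toℚ 2 ℚ.* C ℚ.*_) (inv-* lam lam>0)) (ℚP.*-identityʳ (toℚ 2 ℚ.* C))))

module Selection {A : Set} (E : List A) (uE : Unique E) (ν : A → ℚ) {q X C lam u α μ : ℚ}
                 (0<N : 0ℚ ℚ.< toℚ (length E)) (α*q : α ℚ.* q ≡ toℚ (length E)) (0≤α : 0ℚ ℚ.≤ α)
                 (4<C : toℚ 4 ℚ.< C) (size : C ℚ.* C ℚ.* X ℚ.≤ toℚ (length E) ℚ.* toℚ (length E))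
                 (0<u : 0ℚ ℚ.< u) (lam*u : lam ℚ.* u ≡ 1ℚ) (2Cu≤ : toℚ 2 ℚ.* C ℚ.* u ℚ.≤ C ℚ.- toℚ 4)
                 (upper : toℚ 3 ℚ.* (μ ℚ.- α) ℚ.≤ α) (lower : toℚ 3 ℚ.* (α ℚ.- μ) ℚ.≤ α)
                 (moment : q ℚ.* q ℚ.* sumL E (λ x → (ν x ℚ.- μ) ℚ.* (ν x ℚ.- μ)) ℚ.≤ toℚ 6 ℚ.* X ℚ.* toℚ (length E)) where
  private
    module Ch = Chebyshev {lam = lam} 0<N α*q 0≤α 4<C size 0<u lam*u 2Cu≤

    N : ℚ
    N = toℚ (length E)

    TT : ℚ
    TT = Ch.T ℚ.* Ch.T

    dev² : A → ℚ
    dev² x = (ν x ℚ.- μ) ℚ.* (ν x ℚ.- μ)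

  Good : A → Set
  Good x = (u ℚ.* α ℚ.≤ ν x) × (ν x ℚ.≤ lam ℚ.* α)

  private
    good? : ∀ x → Dec (Good x)
    good? x = (u ℚ.* α ℚP.≤? ν x) ×-dec (ν x ℚP.≤? lam ℚ.* α)

    bad : A → ℚ
    bad x = ⟨ ¬? (good? x) ⟩

    total : toℚ (length (filter good? E)) ℚ.+ sumL E bad ≡ N
    total = trans (cong (ℚ._+ sumL E bad) (sym (Q.sumL-count good? E))) (trans (sym (Q.sumL-∙ E (λ x → ⟨ good? x ⟩) bad))
      (trans (Q.sumL-cong E (λ x → complement (good? x))) (trans (Q.sumL-const-ℚ E 1ℚ) (ℚP.*-identityʳ N))))
      where
      complement : ∀ {P : Set} (δ : Dec P) → ⟨ δ ⟩ ℚ.+ ⟨ ¬? δ ⟩ ≡ 1ℚ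
      complement (yes _) = refl
      complement (no _)  = refl

    TT≤9* : ∀ y → Ch.T ℚ.≤ toℚ 3 ℚ.* y → TT ℚ.≤ toℚ 9 ℚ.* (y ℚ.* y)
    TT≤9* y h = ℚP.≤-trans (Q.*-mono Ch.0≤T (ℚP.≤-trans Ch.0≤T h) h h)
      (ℚP.≤-reflexive (solve 1 (λ y → :# 3 :* y :* (:# 3 :* y) := :# 9 :* (y :* y)) refl y))

    far : ∀ x → Dec (u ℚ.* α ℚ.≤ ν x) → Dec (ν x ℚ.≤ lam ℚ.* α) → ¬ Good x → TT ℚ.≤ toℚ 9 ℚ.* dev² x
    far x (yes p) (yes p′) ¬good = contradiction (p , p′) ¬good
    far x (no low) _ _ = ℚP.≤-trans (TT≤9* (μ ℚ.- ν x) (Ch.low-deviation upper lower (ℚP.<⇒≤ (ℚP.≰⇒> low))))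
      (ℚP.≤-reflexive (cong (toℚ 9 ℚ.*_) (solve 2 (λ m v → (m :- v) :* (m :- v) := (v :- m) :* (v :- m)) refl μ (ν x))))
    far x (yes _) (no high) _ = TT≤9* (ν x ℚ.- μ) (Ch.high-deviation upper lower (ℚP.<⇒≤ (ℚP.≰⇒> high)))

    pointwise : ∀ x (δ : Dec (Good x)) → TT ℚ.* ⟨ ¬? δ ⟩ ℚ.≤ toℚ 9 ℚ.* dev² x
    pointwise x (yes _) = ℚP.≤-trans (ℚP.≤-reflexive (ℚP.*-zeroʳ TT)) (Q.0≤* (Q.0≤toℚ 9) (Q.square-nonneg (ν x ℚ.- μ)))
    pointwise x (no p)  = ℚP.≤-trans (ℚP.≤-reflexive (ℚP.*-identityʳ TT)) (far x (u ℚ.* α ℚP.≤? ν x) (ν x ℚP.≤? lam ℚ.* α) p)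

    deviations : sumL E bad ℚ.* TT ℚ.≤ toℚ 9 ℚ.* sumL E dev²
    deviations = subst₂ ℚ._≤_ (trans (sym (Q.sumL-*ˡ E TT bad)) (ℚP.*-comm TT (sumL E bad))) (sym (Q.sumL-*ˡ E (toℚ 9) dev²))
      (Q.sumL-mono E (λ {x} _ → pointwise x (good? x)))

  selection : ∃ λ Estar → Unique Estar × All (_∈ E) Estar ×
    (1ℚ ℚ.- toℚ 2 ℚ.* u) ℚ.* (ℤ.+ 1 ℚ./ 2) ℚ.* u ℚ.* toℚ (length E) ℚ.≤ toℚ (length Estar) × All Good Estar
  selection = filter good? E , UniqueP.filter⁺ good? uE , All.tabulate (λ x∈ → proj₁ (∈-filter⁻ good? x∈)) ,
    Ch.good-bound (Ch.bad-bound (Q.sumL-nonneg E (λ x → Q.0≤⟨⟩ (¬? (good? x)))) deviations moment) total ,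
    AllP.all-filter good? E

mainTheorem4 : (F : FiniteField) → let open FiniteField F in
    ¬ (2 ∣ order) →
    (d : ℕ) → 2 ≤ d →
    (t : Carrier) → ¬ (t ≡ 0#) →
    (E : List (Point d)) → Unique E →
    (C : ℚ) → (C>4 : toℚ 4 ℚ.< C) →
    (C ℚ.* C) ℚ.* toℚ (order ^ ℕ.suc d) ℚ.≤ toℚ (length E ^ 2) →
    (lam : ℚ) → (lam>0 : Positive lam) → lamBound C C>4 ℚ.< lam →
    ∃ λ (Estar : List (Point d)) →
    Unique Estar × All (_∈ E) Estar ×
    ((1ℚ ℚ.- toℚ 2 ℚ.* inv lam lam>0) ℚ.* (ℤ.+ 1 ℚ./ 2) ℚ.* inv lam lam>0) ℚ.* toℚ (length E)
    ℚ.≤ toℚ (length Estar) ×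
    All (λ x → (inv lam lam>0 ℚ.* (length E /q) ℚ.≤ toℚ (sphereCount t E x))
    × (toℚ (sphereCount t E x) ℚ.≤ lam ℚ.* (length E /q))) Estar
-- For empty E the positivity of |E|, by which |E|² is cancelled later, fails; the empty list itself
-- qualifies.
mainTheorem4 F odd d 2≤d t t≢0 [] uE C C>4 size lam lam>0 lam> =
  [] , [] , [] , ℚP.≤-reflexive (ℚP.*-zeroʳ ((1ℚ ℚ.- toℚ 2 ℚ.* inv lam lam>0) ℚ.* (ℤ.+ 1 ℚ./ 2) ℚ.* inv lam lam>0)) , []
mainTheorem4 F odd (suc (suc d′)) (ℕ.s≤s (ℕ.s≤s _)) t t≢0 E@(x₀ ∷ E′) uE C C>4 size lam lam>0 lam> =
  Selection.selection E uE Mo.ν {lam = lam} {μ = Mo.μ} 0<N Mo.α*q Mo.0≤α C>4 size′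
    (inv-pos lam lam>0) (inv-* lam lam>0) (lamBound-inv C>4 lam>0 lam>) Mo.μ-upper Mo.μ-lower Mo.moment
  where
  open FiniteField F using (order)
  k = odd-order F odd
  q≡ = proj₂ k
  module Mo = Moment F (proj₁ k) q≡ (order≥3 F {proj₁ k} q≡) d′ t t≢0 E uE
  N : ℚ
  N = toℚ (length E)
  0<N : 0ℚ ℚ.< N
  0<N = ℚP.<-≤-trans (ℚP.positive⁻¹ 1ℚ) (Q.toℚ-mono {1} {length E} (ℕ.s≤s ℕ.z≤n))
  size′ : C ℚ.* C ℚ.* toℚ (order ^ suc (suc (suc d′))) ℚ.≤ N ℚ.* N
  size′ = ℚP.≤-trans size (ℚP.≤-reflexive (trans (cong toℚ (cong (length E ℕ.*_) (ℕP.*-identityʳ (length E)))) (Q.toℚ-* (length E) (length E))))
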